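{- For every connected graph $G$ and every $x\in V(G)$, the pair $(G,h_x)$ is not choosable if and only if $(G,h_x)$ is not AT. Moreover, $(G,h_x)$ is not paintable if and only if $(G,h_x)$ is not AT.
   Context: For an orientation $D$ of a graph, a spanning Eulerian subgraph is a spanning subgraph in which every vertex has indegree equal to outdegree; $EE(D)$ (resp. $EO(D)$) is the number of spanning Eulerian subgraphs with an even (resp. odd) number of edges. $D$ is AT if $EE(D)\ne EO(D)$. $h_x(x)=1$ and $h_x(v)=0$ for $v\ne x$; $(G,h_x)$ is AT if $G$ has an AT orientation in which every vertex $v$ has outdegree at most $d_G(v)-h_x(v)-1$. The pair $(G,h_x)$ is choosable if $G$ has a proper coloring $\varphi$ with $\varphi(v)\in L(v)$ for all $v$ whenever $L$ is a list assignment with $|L(x)|=d(x)-1$ and $|L(v)|=d(v)$ for all $v\ne x$. For $f:V(G)\to\mathbb{Z}$, $G$ is $f$-paintable if either $G$ is empty, or $f(v)\ge1$ for all $v$ and for every $S\subseteq V(G)$ there is an independent set $I\subseteq S$ such that $G-I$ is $f'$-paintable, where $f'(v)=f(v)$ for $v\in V(G)\setminus S$ and $f'(v)=f(v)-1$ for $v\in S\setminus I$. The pair $(G,h_x)$ is paintable if $G$ is $(d_G-h_x)$-paintable.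
   Formalization: When G is a single vertex, the impossible list size d(x)−1 = −1 is read as 0 (literally the pair would be vacuously choosable yet not AT), and in the definition of paintable S ranges over nonempty sets, since S = ∅ makes the recursion circular. -}

module Defs where

open import Data.Bool using (Bool; true; false; not; _∧_; _∨_; if_then_else_)
open import Data.Nat using (ℕ; zero; suc; _+_; _∸_; _≤_; _%_; _≡ᵇ_)
open import Data.Fin using (Fin)
open import Data.List using (List; []; _∷_; map; concatMap; allFin; filterᵇ; length)
open import Data.Nat.ListAction using (sum)
open import Data.Bool.ListAction using (and)
open import Data.List.Membership.Propositional using (_∈_)
open import Data.List.Relation.Unary.Unique.Propositional using (Unique)
open import Data.Product using (Σ; _×_; ∃; ∃-syntax)
open import Relation.Binary.PropositionalEquality using (_≡_; _≢_)
open import Relation.Nullary using (¬_)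
import Data.Vec.Functional as VF

record Graph : Set where
  field
    n      : ℕ
    adj    : Fin n → Fin n → Bool
    sym    : ∀ u v → adj u v ≡ adj v u
    irrefl : ∀ v → adj v v ≡ false
open Graph public

countᵇ : ∀ {m} → (Fin m → Bool) → ℕ
countᵇ {m} p = sum (map (λ i → if p i then 1 else 0) (allFin m))

deg : (G : Graph) → Fin (n G) → ℕ
deg G v = countᵇ (adj G v)

data Reach (G : Graph) : Fin (n G) → Fin (n G) → Set where
  here : ∀ {v} → Reach G v v
  step : ∀ {u w v} → adj G u w ≡ true → Reach G w v → Reach G u v

Connected : Graph → Set
Connected G = ∀ u v → Reach G u v

h : ∀ {m} → Fin m → Fin m → ℕ
h x v with x Data.Fin.≟ v
... | Relation.Nullary.yes _ = 1
... | Relation.Nullary.no _ = 0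

Arcs : ℕ → Set
Arcs m = Fin m → Fin m → Bool

outdeg : ∀ {m} → Arcs m → Fin m → ℕ
outdeg D v = countᵇ (D v)

indeg : ∀ {m} → Arcs m → Fin m → ℕ
indeg D v = countᵇ (λ u → D u v)

size : ∀ {m} → Arcs m → ℕ
size {m} D = sum (map (outdeg D) (allFin m))

IsOrientation : (G : Graph) → Arcs (n G) → Set
IsOrientation G D =
  (∀ u v → adj G u v ≡ (D u v ∨ D v u)) × (∀ u v → ¬ (D u v ≡ true × D v u ≡ true))

allFuns : ∀ {A : Set} → List A → (m : ℕ) → List (Fin m → A)
allFuns xs zero    = VF.[] ∷ []
allFuns xs (suc m) = concatMap (λ a → map (λ f → a VF.∷ f) (allFuns xs m)) xs

allArcs : (m : ℕ) → List (Arcs m)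
allArcs m = allFuns (allFuns (true ∷ false ∷ []) m) m

isSpanEulerianᵇ : ∀ {m} → Arcs m → Arcs m → Bool
isSpanEulerianᵇ {m} D H =
  and (map (λ u → and (map (λ v → not (H u v) ∨ D u v) (allFin m))) (allFin m))
  ∧ and (map (λ v → indeg H v ≡ᵇ outdeg H v) (allFin m))

evenᵇ : ℕ → Bool
evenᵇ k = k % 2 ≡ᵇ 0

EE : ∀ {m} → Arcs m → ℕ
EE {m} D = length (filterᵇ (λ H → isSpanEulerianᵇ D H ∧ evenᵇ (size H)) (allArcs m))

EO : ∀ {m} → Arcs m → ℕ
EO {m} D = length (filterᵇ (λ H → isSpanEulerianᵇ D H ∧ not (evenᵇ (size H))) (allArcs m))

IsAT : ∀ {m} → Arcs m → Set
IsAT D = EE D ≢ EO D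

-- (G, h_x) is AT: an AT orientation with outdeg(v) ≤ d(v) - h_x(v) - 1 (over ℤ)
PairAT : (G : Graph) → Fin (n G) → Set
PairAT G x = Σ (Arcs (n G)) λ D → (IsOrientation G D × IsAT D
                     × (∀ v → outdeg D v + h x v + 1 ≤ deg G v))

PairChoosable : (G : Graph) → Fin (n G) → Set
PairChoosable G x =
  (L : Fin (n G) → List ℕ) →
  (∀ v → Unique (L v)) →
  (∀ v → length (L v) ≡ deg G v ∸ h x v) →
  Σ (Fin (n G) → ℕ) λ φ → ((∀ v → φ v ∈ L v) × (∀ u v → adj G u v ≡ true → φ u ≢ φ v))

-- f-paintability of the induced subgraph G[W], W ⊆ V(G)
data Paintable (G : Graph) : (Fin (n G) → Bool) → (Fin (n G) → ℕ) → Set where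
  empty : ∀ {W f} → (∀ v → W v ≡ false) → Paintable G W f
  move  : ∀ {W f} →
          (∀ v → W v ≡ true → 1 ≤ f v) →
          ((S : Fin (n G) → Bool) → (∀ v → S v ≡ true → W v ≡ true) → (Σ (Fin (n G)) λ v → S v ≡ true) →
            Σ (Fin (n G) → Bool) λ I → ((∀ v → I v ≡ true → S v ≡ true)
                   × (∀ u v → I u ≡ true → I v ≡ true → adj G u v ≡ false)
                   × Paintable G (λ v → W v ∧ not (I v))
                                 (λ v → if S v ∧ not (I v) then f v ∸ 1 else f v))) →
          Paintable G W f

PairPaintable : (G : Graph) → Fin (n G) → Set
PairPaintable G x = Paintable G (λ _ → true) (λ v → deg G v ∸ h x v)

-- The pair (G, h_x) is AT iff the graph polynomial ∏ (x_u - x_v) has a nonzero coefficient at some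
-- monomial ∏ x_v^m(v) with m(v) + h_x(v) < d(v). By homogeneity, the functional extracting this
-- coefficient may be changed above m; expanding the changed functional singles out an independent
-- subset of S to be painted and a nonzero coefficient for the remaining graph. So AT pairs are
-- paintable, and a painting strategy colours from lists.
--
-- Conversely, the property of not being AT passes to the connected induced subgraphs containing x,
-- and a vertex of degree 2 can be suppressed if the factors are allowed to be x_u ± x_v. With finitely
-- many small signed graphs whose relevant coefficient is computed to be nonzero, this excludes all
-- theta graphs and a few others as subgraphs. Hence, if G is not AT, has no cut vertex and d(x) ≥ 3,
-- it is complete, a K₄ in which the edges at x are replaced by paths of lengths of the same parity,
-- or one graph on 7 vertices. All these have bad list assignments, as does G when d(x) ≤ 2, and bad
-- lists on two sides of a cut vertex are glued.

module Submission where

open import Defs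
open import Data.Fin using (Fin)
open import Data.Product using (_×_)
open import Function.Bundles using (_⇔_)
open import Relation.Nullary using (¬_)
open import Data.Bool using (Bool; true; false; not; _∧_; _∨_; if_then_else_; T)
open import Data.Bool.ListAction using (and)
open import Data.Bool.Properties using (∨-zeroʳ; ∧-zeroʳ)
open import Data.Empty using (⊥; ⊥-elim)
open import Data.Fin using (zero; suc; _≟_; toℕ)
open import Data.Fin.Patterns using (0F; 1F; 2F; 3F; 4F; 5F; 6F; 7F)
open import Data.Fin.Properties using (toℕ-injective)
open import Data.Integer as ℤ using (ℤ; 0ℤ; 1ℤ; -1ℤ)
import Data.Integer.Properties as ℤₚ
open import Data.Integer.Tactic.RingSolver using (solve-∀)
open import Data.List using (List; []; _∷_; _++_; map; length; allFin; filterᵇ; tabulate; concatMap; filter; null; upTo)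
open import Data.List.Membership.Propositional using (_∈_; _∉_)
open import Data.List.Membership.Propositional.Properties using (∈-allFin; ∈-map⁻; ∈-++⁺ˡ; ∈-++⁺ʳ; ∈-++⁻; ∈-filter⁻; ∈-tabulate⁻; ∈-filter⁺; ∈-∃++; ∈-map⁺; ∈-upTo⁻)
open import Data.List.Membership.Propositional.Properties.WithK using (unique∧set⇒bag)
import Data.List.Properties as Listₚ
open import Data.List.Relation.Binary.BagAndSetEquality using (∼bag⇒↭)
open import Data.List.Relation.Binary.Permutation.Propositional using (_↭_; ↭-refl; ↭-sym; ↭-trans; refl; prep; swap; trans; ↭-reflexive)
import Data.List.Relation.Binary.Permutation.Propositional.Properties as ↭ₚ
open import Data.List.Relation.Unary.All as All using (All; []; _∷_)
import Data.List.Relation.Unary.All.Properties as Allₚ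
open import Data.List.Relation.Unary.AllPairs using ([]; _∷_)
open import Data.List.Relation.Unary.Any using (here; there)
open import Data.List.Relation.Unary.Unique.Propositional using (Unique)
import Data.List.Relation.Unary.Unique.Propositional.Properties as Uniqueₚ
open import Data.Nat using (ℕ; zero; suc; pred; _+_; _∸_; _*_; _≤_; _<_; _≡ᵇ_; z≤n; s≤s; _<ᵇ_; _%_; _≤ᵇ_; ⌊_/2⌋; >-nonZero)
import Data.Nat.DivMod as DivMod
open import Data.Nat.Induction using (<-rec)
open import Data.Nat.ListAction using (sum)
import Data.Nat.Properties as ℕₚ
open import Data.Nat.Tactic.RingSolver using () renaming (solve-∀ to ℕ-solve-∀)
open import Data.Product using (Σ; _,_; proj₁; proj₂)
open import Data.Sign as Sign using (Sign)
import Data.Sign.Properties as Signₚ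
open import Data.Sum using (_⊎_; inj₁; inj₂)
open import Data.Unit using (tt; ⊤)
open import Data.Vec as Vec using (Vec; lookup; _[_]≔_; []; _∷_)
import Data.Vec.Functional as VF
import Data.Vec.Properties as Vecₚ
open import Function using (_∘_; id; case_of_)
open import Function.Bundles using (mk⇔)
open import Relation.Binary using (tri<; tri≈; tri>)
open import Relation.Binary.PropositionalEquality as ≡ using (_≡_; _≢_; refl; cong; cong₂; subst)
open import Relation.Nullary using (Dec; yes; no; does)
open import Relation.Nullary.Decidable using (T?; ¬?)

-- Suppression is what makes computation possible: in (x_y + s x_u)(x_y + t x_v) the coefficient of
-- x_y is s (x_u + s t x_v). With exponent 1 at its interior vertices, an induced path therefore
-- enters a coefficient only through the parity of its length, and each infinite family of excluded
-- subgraphs becomes one small graph with three possible types for each of its paths.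
--
-- All excluded subgraphs are located relative to one structure. As x is no cut vertex, three of its
-- neighbours yield a triangle joined to x by three disjoint induced paths. Anything else attaches
-- to this structure by a further path to x, or by a path whose interior avoids the neighbours of x.
--
-- A side of a cut vertex that does not contain x has to respect the bound outdeg(v) < d(v) only, so
-- the version with lists of size d(v) everywhere is proved first, from cliques and odd cycles. If x
-- itself is the cut vertex, at most one side is AT under this bound. Which one is not decided; bad
-- lists are therefore obtained under a double negation, which is enough to refute choosability.

private variable
  N : ℕ

-- Linear functionals on polynomials, evaluated at products over signed edges.

Wt : ℕ → Set
Wt N = Fin N → ℕ → ℤ

record SEdge (N : ℕ) : Set where
  constructor ed
  field
    src tgt : Fin N
    sgn     : Sign
open SEdge public

sg : Sign → ℤ
sg Sign.+ = 1ℤ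
sg Sign.- = -1ℤ

sg-* : ∀ s t → sg (s Sign.* t) ≡ sg s ℤ.* sg t
sg-* Sign.+ Sign.+ = refl
sg-* Sign.+ Sign.- = refl
sg-* Sign.- Sign.+ = refl
sg-* Sign.- Sign.- = refl

sg² : ∀ s → sg s ℤ.* sg s ≡ 1ℤ
sg² Sign.+ = refl
sg² Sign.- = refl

prodF : (Fin N → ℤ) → ℤ
prodF {zero}  f = 1ℤ
prodF {suc N} f = f zero ℤ.* prodF (f ∘ suc)

sumF : (Fin N → ℕ) → ℕ
sumF {zero}  f = 0
sumF {suc N} f = f zero + sumF (f ∘ suc)

bump : Fin N → Fin N → ℕ → ℕ
bump u v k = if does (u ≟ v) then suc k else k

sh : Fin N → Wt N → Wt N
sh u w v k = w v (bump u v k)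

-- A weight w is the linear functional ⊗ᵥ (x_v ^ k ↦ w v k); c es w is its value
-- at the product of the factors x_u + s x_v over the signed edges ed u v s.
c : List (SEdge N) → Wt N → ℤ
c []              w = prodF (λ v → w v 0)
c (ed u v s ∷ es) w = c es (sh u w) ℤ.+ sg s ℤ.* c es (sh v w)

δ₁ : ℕ → ℕ → ℤ
δ₁ m k = if m ≡ᵇ k then 1ℤ else 0ℤ

δ : (Fin N → ℕ) → Wt N
δ m v = δ₁ (m v)

upd : {A : Set} → (Fin N → A) → Fin N → A → Fin N → A
upd f u a v = if does (u ≟ v) then a else f v

upd-same : {A : Set} (f : Fin N → A) (u : Fin N) (a : A) → upd f u a u ≡ a
upd-same f u a with u ≟ u
... | yes _ = refl
... | no ¬p = ⊥-elim (¬p refl)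

upd-other : {A : Set} (f : Fin N → A) (u : Fin N) (a : A) {v : Fin N} → u ≢ v → upd f u a v ≡ f v
upd-other f u a {v} u≢v with u ≟ v
... | yes p = ⊥-elim (u≢v p)
... | no _  = refl

infix 4 _≗₂_
_≗₂_ : Wt N → Wt N → Set
w ≗₂ w′ = ∀ v k → w v k ≡ w′ v k

prodF-cong : {f g : Fin N → ℤ} → (∀ v → f v ≡ g v) → prodF f ≡ prodF g
prodF-cong {zero}  e = refl
prodF-cong {suc N} e = cong₂ ℤ._*_ (e zero) (prodF-cong (e ∘ suc))

prodF-zero : (f : Fin N → ℤ) (v : Fin N) → f v ≡ 0ℤ → prodF f ≡ 0ℤ
prodF-zero f zero    e rewrite e = ℤₚ.*-zeroˡ (prodF (f ∘ suc))
prodF-zero f (suc v) e rewrite prodF-zero (f ∘ suc) v e = ℤₚ.*-zeroʳ (f zero)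

lin-head : ∀ a b x y z → (a ℤ.* x ℤ.+ b ℤ.* y) ℤ.* z ≡ a ℤ.* (x ℤ.* z) ℤ.+ b ℤ.* (y ℤ.* z)
lin-head = solve-∀

lin-tail : ∀ a b x y z → x ℤ.* (a ℤ.* y ℤ.+ b ℤ.* z) ≡ a ℤ.* (x ℤ.* y) ℤ.+ b ℤ.* (x ℤ.* z)
lin-tail = solve-∀

prodF-lin : ∀ (a b : ℤ) (v : Fin N) {f f₁ f₂ : Fin N → ℤ} →
  (∀ u → v ≢ u → f u ≡ f₁ u) → (∀ u → v ≢ u → f u ≡ f₂ u) →
  f v ≡ a ℤ.* f₁ v ℤ.+ b ℤ.* f₂ v → prodF f ≡ a ℤ.* prodF f₁ ℤ.+ b ℤ.* prodF f₂
prodF-lin a b zero {f} {f₁} {f₂} e₁ e₂ e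
  rewrite e | ≡.sym (prodF-cong {f = f ∘ suc} {f₁ ∘ suc} (λ u → e₁ (suc u) λ ()))
            | ≡.sym (prodF-cong {f = f ∘ suc} {f₂ ∘ suc} (λ u → e₂ (suc u) λ ()))
  = lin-head a b (f₁ zero) (f₂ zero) (prodF (f ∘ suc))
prodF-lin a b (suc v) {f} {f₁} {f₂} e₁ e₂ e
  rewrite ≡.sym (e₁ zero λ ()) | ≡.sym (e₂ zero λ ())
        | prodF-lin a b v {f ∘ suc} {f₁ ∘ suc} {f₂ ∘ suc}
            (λ u ne → e₁ (suc u) (λ { refl → ne refl })) (λ u ne → e₂ (suc u) (λ { refl → ne refl })) e
  = lin-tail a b (f zero) (prodF (f₁ ∘ suc)) (prodF (f₂ ∘ suc))

c-cong : ∀ (es : List (SEdge N)) {w w′} → w ≗₂ w′ → c es w ≡ c es w′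
c-cong []              e = prodF-cong (λ v → e v 0)
c-cong (ed u v s ∷ es) e = cong₂ (λ a b → a ℤ.+ sg s ℤ.* b)
  (c-cong es (λ z k → e z (bump u z k))) (c-cong es (λ z k → e z (bump v z k)))

sum-zero : ∀ s {a b} → a ≡ 0ℤ → b ≡ 0ℤ → a ℤ.+ sg s ℤ.* b ≡ 0ℤ
sum-zero s refl refl rewrite ℤₚ.*-zeroʳ (sg s) = refl

c-zero : ∀ (es : List (SEdge N)) {w} v → (∀ k → w v k ≡ 0ℤ) → c es w ≡ 0ℤ
c-zero []              v e = prodF-zero _ v (e 0)
c-zero (ed a b s ∷ es) v e = sum-zero s (c-zero es v (λ k → e (bump a v k))) (c-zero es v (λ k → e (bump b v k)))

Fresh : Fin N → List (SEdge N) → Set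
Fresh v = All (λ e → src e ≢ v × tgt e ≢ v)

bump-≢ : ∀ {u v : Fin N} k → u ≢ v → bump u v k ≡ k
bump-≢ {u = u} {v} k ne with u ≟ v
... | yes p = ⊥-elim (ne p)
... | no _  = refl

bump-≡ : ∀ (u : Fin N) k → bump u u k ≡ suc k
bump-≡ u k with u ≟ u
... | yes _ = refl
... | no ne = ⊥-elim (ne refl)

bump-comm : ∀ (u v z : Fin N) k → bump u z (bump v z k) ≡ bump v z (bump u z k)
bump-comm u v z k with u ≟ z | v ≟ z
... | yes _ | yes _ = refl
... | yes _ | no _  = refl
... | no _  | yes _ = refl
... | no _  | no _  = refl

-- A variable that occurs in no factor has exponent 0 in every monomial, so at `v` only the value at
-- 0 matters.
c-cong-fresh : ∀ (es : List (SEdge N)) {w w′} v → Fresh v es →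
  (∀ z → v ≢ z → ∀ k → w z k ≡ w′ z k) → w v 0 ≡ w′ v 0 → c es w ≡ c es w′
c-cong-fresh [] v [] e e₀ = prodF-cong λ z → case v ≟ z of λ { (yes refl) → e₀ ; (no ne) → e z ne 0 }
c-cong-fresh (ed a b s ∷ es) {w} {w′} v ((a≢ , b≢) ∷ fr) e e₀ = cong₂ (λ x y → x ℤ.+ sg s ℤ.* y) (go a a≢) (go b b≢)
  where
  go : ∀ u → u ≢ v → c es (sh u w) ≡ c es (sh u w′)
  go u ne = c-cong-fresh es v fr (λ z ne′ k → e z ne′ _)
              (≡.trans (cong (w v) (bump-≢ 0 ne)) (≡.trans e₀ (cong (w′ v) (≡.sym (bump-≢ 0 ne)))))

c-zero-fresh : ∀ (es : List (SEdge N)) {w} v → Fresh v es → w v 0 ≡ 0ℤ → c es w ≡ 0ℤ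
c-zero-fresh es {w} v fr e =
  ≡.trans (c-cong-fresh es {w} {upd w v (λ _ → 0ℤ)} v fr
            (λ z ne k → cong (λ f → f k) (≡.sym (upd-other w v _ ne)))
            (≡.trans e (cong (λ f → f 0) (≡.sym (upd-same w v _)))))
          (c-zero es v (λ k → cong (λ f → f k) (upd-same w v _)))

lin-edge : ∀ a b s x₁ x₂ y₁ y₂ → (a ℤ.* x₁ ℤ.+ b ℤ.* x₂) ℤ.+ s ℤ.* (a ℤ.* y₁ ℤ.+ b ℤ.* y₂)
  ≡ a ℤ.* (x₁ ℤ.+ s ℤ.* y₁) ℤ.+ b ℤ.* (x₂ ℤ.+ s ℤ.* y₂)
lin-edge = solve-∀

-- A tensor product is linear in its factor at `v`. The splittings of a weight at one vertex, in
-- `point-at` and in the painting step, rest on this.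
c-lin : ∀ (es : List (SEdge N)) (a b : ℤ) v {w w₁ w₂} →
  (∀ u → v ≢ u → ∀ k → w u k ≡ w₁ u k) → (∀ u → v ≢ u → ∀ k → w u k ≡ w₂ u k) →
  (∀ k → w v k ≡ a ℤ.* w₁ v k ℤ.+ b ℤ.* w₂ v k) → c es w ≡ a ℤ.* c es w₁ ℤ.+ b ℤ.* c es w₂
c-lin [] a b v e₁ e₂ e = prodF-lin a b v (λ u ne → e₁ u ne 0) (λ u ne → e₂ u ne 0) (e 0)
c-lin (ed p q s ∷ es) a b v {w} {w₁} {w₂} e₁ e₂ e =
  ≡.trans (cong₂ (λ x y → x ℤ.+ sg s ℤ.* y) (go p) (go q))
          (lin-edge a b (sg s) (c es (sh p w₁)) (c es (sh p w₂)) (c es (sh q w₁)) (c es (sh q w₂)))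
  where
  go : ∀ u → c es (sh u w) ≡ a ℤ.* c es (sh u w₁) ℤ.+ b ℤ.* c es (sh u w₂)
  go u = c-lin es a b v (λ z ne k → e₁ z ne _) (λ z ne k → e₂ z ne _) (λ k → e _)

sh-comm : ∀ (u v : Fin N) w → sh u (sh v w) ≗₂ sh v (sh u w)
sh-comm u v w z k = cong (w z) (bump-comm v u z k)

perm-edge : ∀ s t x₁ x₂ x₃ x₄ → (x₁ ℤ.+ t ℤ.* x₂) ℤ.+ s ℤ.* (x₃ ℤ.+ t ℤ.* x₄) ≡ (x₁ ℤ.+ s ℤ.* x₃) ℤ.+ t ℤ.* (x₂ ℤ.+ s ℤ.* x₄)
perm-edge = solve-∀

c-↭ : ∀ {es es′ : List (SEdge N)} → es ↭ es′ → ∀ w → c es w ≡ c es′ w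
c-↭ refl w = refl
c-↭ (prep (ed u v s) p) w = cong₂ (λ a b → a ℤ.+ sg s ℤ.* b) (c-↭ p (sh u w)) (c-↭ p (sh v w))
c-↭ {es = _ ∷ _ ∷ es} {_ ∷ _ ∷ es′} (swap (ed u v s) (ed u′ v′ t) p) w =
  ≡.trans (perm-edge (sg s) (sg t) (c es (sh u′ (sh u w))) (c es (sh v′ (sh u w))) (c es (sh u′ (sh v w))) (c es (sh v′ (sh v w))))
   (cong₂ (λ a b → a ℤ.+ sg t ℤ.* b)
     (cong₂ (λ a b → a ℤ.+ sg s ℤ.* b) (go u u′) (go v u′))
     (cong₂ (λ a b → a ℤ.+ sg s ℤ.* b) (go u v′) (go v v′)))
  where
  go : ∀ a b → c es (sh b (sh a w)) ≡ c es′ (sh a (sh b w))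
  go a b = ≡.trans (c-cong es (sh-comm b a w)) (c-↭ p _)
c-↭ (trans p q) w = ≡.trans (c-↭ p w) (c-↭ q w)

flip-edge : ∀ s x y → s ℤ.* s ≡ 1ℤ → x ℤ.+ s ℤ.* y ≡ s ℤ.* (y ℤ.+ s ℤ.* x)
flip-edge s x y e = ≡.trans (cong (ℤ._+ s ℤ.* y) (≡.trans (≡.sym (ℤₚ.*-identityˡ x)) (cong (ℤ._* x) (≡.sym e)))) (aux s x y)
  where
  aux : ∀ s x y → s ℤ.* s ℤ.* x ℤ.+ s ℤ.* y ≡ s ℤ.* (y ℤ.+ s ℤ.* x)
  aux = solve-∀

c-flip : ∀ (u v : Fin N) s es w → c (ed u v s ∷ es) w ≡ sg s ℤ.* c (ed v u s ∷ es) w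
c-flip u v s es w = flip-edge (sg s) (c es (sh u w)) (c es (sh v w)) (sg² s)

*-≢0 : ∀ {a b} → a ℤ.* b ≢ 0ℤ → b ≢ 0ℤ
*-≢0 {a} ne refl = ne (ℤₚ.*-zeroʳ a)

sg-≢0 : ∀ s {a} → a ≢ 0ℤ → sg s ℤ.* a ≢ 0ℤ
sg-≢0 s {a} ne e = ne (≡.trans (≡.trans (≡.sym (ℤₚ.*-identityˡ a)) (≡.trans (cong (ℤ._* a) (≡.sym (sg² s))) (ℤₚ.*-assoc (sg s) (sg s) a)))
                         (≡.trans (cong (sg s ℤ.*_) e) (ℤₚ.*-zeroʳ (sg s))))

+-≢0 : ∀ {a b} → a ℤ.+ b ≢ 0ℤ → a ≢ 0ℤ ⊎ b ≢ 0ℤ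
+-≢0 {a} {b} ne with a ℤₚ.≟ 0ℤ | b ℤₚ.≟ 0ℤ
... | no p | _ = inj₁ p
... | yes refl | no p = inj₂ p
... | yes refl | yes refl = ⊥-elim (ne refl)

edge-≢0 : ∀ (u v : Fin N) s es w → c (ed u v s ∷ es) w ≢ 0ℤ → c es (sh u w) ≢ 0ℤ ⊎ c es (sh v w) ≢ 0ℤ
edge-≢0 u v s es w ne with +-≢0 ne
... | inj₁ p = inj₁ p
... | inj₂ p = inj₂ (*-≢0 {sg s} p)

≡ᵇ-refl : ∀ n → (n ≡ᵇ n) ≡ true
≡ᵇ-refl zero    = refl
≡ᵇ-refl (suc n) = ≡ᵇ-refl n

≡ᵇ-≢ : ∀ m n → m ≢ n → (m ≡ᵇ n) ≡ false
≡ᵇ-≢ zero    zero    ne = ⊥-elim (ne refl)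
≡ᵇ-≢ zero    (suc n) ne = refl
≡ᵇ-≢ (suc m) zero    ne = refl
≡ᵇ-≢ (suc m) (suc n) ne = ≡ᵇ-≢ m n (ne ∘ cong suc)

δ₁-≢ : ∀ {m k} → m ≢ k → δ₁ m k ≡ 0ℤ
δ₁-≢ {m} {k} ne rewrite ≡ᵇ-≢ m k ne = refl

dec : Fin N → (Fin N → ℕ) → Fin N → ℕ
dec u m = upd m u (pred (m u))

sh-δ-zero : ∀ (u : Fin N) m → m u ≡ 0 → ∀ k → sh u (δ m) u k ≡ 0ℤ
sh-δ-zero u m e k rewrite bump-≡ u k | e = refl

sh-δ-suc : ∀ (u : Fin N) m {j} → m u ≡ suc j → sh u (δ m) ≗₂ δ (dec u m)
sh-δ-suc u m e v k with u ≟ v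
... | yes refl rewrite e = refl
... | no _ = refl

c-δ-zero : ∀ (es : List (SEdge N)) u m → m u ≡ 0 → c es (sh u (δ m)) ≡ 0ℤ
c-δ-zero es u m e = c-zero es u (sh-δ-zero u m e)

c-δ-suc : ∀ (es : List (SEdge N)) u m {j} → m u ≡ suc j → c es (sh u (δ m)) ≡ c es (δ (dec u m))
c-δ-suc es u m e = c-cong es (sh-δ-suc u m e)

sumF-cong : {f g : Fin N → ℕ} → (∀ v → f v ≡ g v) → sumF f ≡ sumF g
sumF-cong {zero}  e = refl
sumF-cong {suc N} e = cong₂ _+_ (e zero) (sumF-cong (e ∘ suc))

upd-suc : {A : Set} (f : Fin (suc N) → A) (u : Fin N) (a : A) (v : Fin N) → upd f (suc u) a (suc v) ≡ upd (f ∘ suc) u a v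
upd-suc f u a v with u ≟ v
... | yes _ = refl
... | no _  = refl

sumF-upd : ∀ (m : Fin N → ℕ) u k → sumF (upd m u k) + m u ≡ sumF m + k
sumF-upd {suc N} m zero k = begin
    k + sumF (m ∘ suc) + m zero   ≡⟨ ℕₚ.+-comm (k + _) (m zero) ⟩
    m zero + (k + sumF (m ∘ suc)) ≡⟨ cong (m zero +_) (ℕₚ.+-comm k _) ⟩
    m zero + (sumF (m ∘ suc) + k) ≡⟨ ℕₚ.+-assoc (m zero) _ k ⟨
    m zero + sumF (m ∘ suc) + k ∎
  where open ≡.≡-Reasoning
sumF-upd {suc N} m (suc u) k = begin
    m zero + sumF (upd m (suc u) k ∘ suc) + m (suc u) ≡⟨ cong (λ x → m zero + x + m (suc u)) (sumF-cong (upd-suc m u k)) ⟩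
    m zero + sumF (upd (m ∘ suc) u k) + m (suc u)     ≡⟨ ℕₚ.+-assoc (m zero) _ _ ⟩
    m zero + (sumF (upd (m ∘ suc) u k) + m (suc u))   ≡⟨ cong (m zero +_) (sumF-upd (m ∘ suc) u k) ⟩
    m zero + (sumF (m ∘ suc) + k)                     ≡⟨ ℕₚ.+-assoc (m zero) _ k ⟨
    m zero + sumF (m ∘ suc) + k ∎
  where open ≡.≡-Reasoning

sumF-dec : ∀ (m : Fin N → ℕ) u {j} → m u ≡ suc j → suc (sumF (dec u m)) ≡ sumF m
sumF-dec m u {j} e = ℕₚ.+-cancelʳ-≡ j _ _ (≡.trans (≡.trans (≡.sym (ℕₚ.+-suc (sumF (dec u m)) j)) (cong (sumF (dec u m) +_) (≡.sym e)))
   (≡.trans (sumF-upd m u (pred (m u))) (cong (λ x → sumF m + pred x) e)))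

sumF-dec-≤ : ∀ (m : Fin N → ℕ) u → sumF m ≤ suc (sumF (dec u m))
sumF-dec-≤ m u with m u in e
... | zero  = ℕₚ.m≤n⇒m≤1+n (ℕₚ.≤-reflexive (≡.sym (≡.trans (≡.sym (ℕₚ.+-identityʳ _)) (≡.trans (cong (sumF (upd m u 0) +_) (≡.sym e)) (≡.trans (sumF-upd m u 0) (ℕₚ.+-identityʳ _))))))
... | suc j = ℕₚ.≤-reflexive (≡.sym (≡.trans (cong (λ x → suc (sumF (upd m u (pred x)))) (≡.sym e)) (sumF-dec m u e)))

sumF-pos : ∀ (m : Fin N → ℕ) → 0 < sumF m → Σ (Fin N) λ v → 0 < m v
sumF-pos {suc N} m p with m zero in e
... | suc j = zero , subst (0 <_) (≡.sym e) (s≤s z≤n)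
... | zero  = let v , q = sumF-pos (m ∘ suc) p in suc v , q

-- Every monomial has degree `length es`. If the numbers `m v` add up to more, each monomial has
-- some exponent below `m v`, and there the weight is 0.
c-vanish : ∀ (es : List (SEdge N)) {w} m → (∀ v k → k < m v → w v k ≡ 0ℤ) → length es < sumF m → c es w ≡ 0ℤ
c-vanish [] m e p = let v , q = sumF-pos m p in prodF-zero _ v (e v 0 q)
c-vanish (ed a b s ∷ es) {w} m e p = sum-zero s (go a) (go b)
  where
  low : ∀ u v k → k < dec u m v → sh u w v k ≡ 0ℤ
  low u v k q with u ≟ v
  ... | yes refl = e v (suc k) (aux (m v) q)
    where aux : ∀ j → k < pred j → suc k < j
          aux (suc j) r = s≤s r
  ... | no _ = e v k q
  go : ∀ u → c es (sh u w) ≡ 0ℤ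
  go u = c-vanish es (dec u m) (low u) (ℕₚ.≤-pred (ℕₚ.≤-trans p (sumF-dec-≤ m u)))

c-below : ∀ (es : List (SEdge N)) m → sumF m < length es → c es (δ m) ≡ 0ℤ
c-below (ed a b s ∷ es) m p = sum-zero s (go a) (go b)
  where
  go : ∀ u → c es (sh u (δ m)) ≡ 0ℤ
  go u with m u in e
  ... | zero  = c-δ-zero es u m e
  ... | suc j = ≡.trans (c-δ-suc es u m e) (c-below es (dec u m) (ℕₚ.≤-pred (subst (_< suc (length es)) (≡.sym (sumF-dec m u e)) p)))

-- Only the monomials of degree length es matter, so weights may be changed freely above m.
c-hom : ∀ (es : List (SEdge N)) {w} m → (∀ v k → k ≤ m v → w v k ≡ δ m v k) → length es ≤ sumF m → c es w ≡ c es (δ m)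
c-hom [] m e p = prodF-cong (λ v → e v 0 z≤n)
c-hom (ed a b s ∷ es) {w} m e p = cong₂ (λ x y → x ℤ.+ sg s ℤ.* y) (go a) (go b)
  where
  low : ∀ v k → k < m v → w v k ≡ 0ℤ
  low v k q = ≡.trans (e v k (ℕₚ.<⇒≤ q)) (δ₁-≢ (λ r → ℕₚ.<-irrefl (≡.sym r) q))
  go : ∀ u → c es (sh u w) ≡ c es (sh u (δ m))
  go u with m u in eq
  -- With `m u` exhausted, fewer factors are left than the exponents `m` still demand, so both sides
  -- vanish.
  ... | zero = ≡.trans (c-vanish es m low′ p) (≡.sym (c-δ-zero es u m eq))
    where
    low′ : ∀ v k → k < m v → sh u w v k ≡ 0ℤ
    low′ v k q with u ≟ v
    ... | yes refl = ⊥-elim (ℕₚ.n≮0 (subst (k <_) eq q))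
    ... | no _ = low v k q
  ... | suc j = ≡.trans (c-hom es (dec u m) agree (ℕₚ.≤-pred (subst (suc (length es) ≤_) (≡.sym (sumF-dec m u eq)) p))) (≡.sym (c-δ-suc es u m eq))
    where
    agree : ∀ v k → k ≤ dec u m v → sh u w v k ≡ δ (dec u m) v k
    agree v k q = ≡.trans (aux v k q) (sh-δ-suc u m eq v k)
      where
      aux : ∀ v k → k ≤ dec u m v → sh u w v k ≡ sh u (δ m) v k
      aux v k q with u ≟ v
      ... | yes refl = e v (suc k) (subst (suc k ≤_) (≡.sym eq) (s≤s (subst (λ x → k ≤ pred x) eq q)))
      ... | no _ = e v k q

PointMass : (f : Fin N → ℕ) → Wt N → Fin N → Set
PointMass f w v = Σ ℕ λ k → k < f v × (∀ j → w v j ≡ δ₁ k j)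

-- At `v` the weight is a combination of the point masses `δ₁ k` with `k < F`. By linearity one of
-- them keeps the value nonzero; the point mass at the largest exponent is tried first and split off
-- if it fails.
point-at : ∀ (es : List (SEdge N)) v F w → (∀ k → F ≤ k → w v k ≡ 0ℤ) → c es w ≢ 0ℤ →
  Σ ℕ λ k → k < F × c es (upd w v (δ₁ k)) ≢ 0ℤ
point-at es v zero w e ne = ⊥-elim (ne (c-zero es v (λ k → e k z≤n)))
point-at es v (suc F) w e ne with c es (upd w v (δ₁ F)) ℤₚ.≟ 0ℤ
... | no p = F , ℕₚ.≤-refl , p
... | yes p = let k , q , r = point-at es v F w′ low ne′ in k , ℕₚ.m≤n⇒m≤1+n q ,
                 λ z → r (≡.trans (c-cong es (λ u j → same u k j)) z)
  where
  g : ℕ → ℤ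
  g k = if F ≡ᵇ k then 0ℤ else w v k
  w′ : Wt _
  w′ = upd w v g
  low : ∀ k → F ≤ k → w′ v k ≡ 0ℤ
  low k q rewrite upd-same w v g with F ≡ᵇ k in eq
  ... | true = refl
  ... | false = e k (ℕₚ.≤∧≢⇒< q λ { refl → case ≡.trans (≡.sym eq) (≡ᵇ-refl F) of λ () })
  same : ∀ u k j → upd w′ v (δ₁ k) u j ≡ upd w v (δ₁ k) u j
  same u k j with v ≟ u
  ... | yes _ = refl
  ... | no _ = refl
  split : ∀ k → w v k ≡ w v F ℤ.* upd w v (δ₁ F) v k ℤ.+ 1ℤ ℤ.* w′ v k
  split k rewrite upd-same w v g | upd-same w v (δ₁ F) with F ≡ᵇ k in eq
  ... | true rewrite ℕₚ.≡ᵇ⇒≡ F k (subst T (≡.sym eq) _) = ≡.sym (≡.trans (ℤₚ.+-identityʳ _) (ℤₚ.*-identityʳ _))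
  ... | false = ≡.sym (≡.trans (cong₂ ℤ._+_ (ℤₚ.*-zeroʳ (w v F)) (ℤₚ.*-identityˡ (w v k))) (ℤₚ.+-identityˡ _))
  off : ∀ h → ∀ u → v ≢ u → ∀ k → w u k ≡ upd w v h u k
  off h u q k = cong (λ z → z k) (≡.sym (upd-other w v h q))
  ne′ : c es w′ ≢ 0ℤ
  ne′ z = ne (≡.trans (c-lin es (w v F) 1ℤ v {w} {upd w v (δ₁ F)} {w′} (off (δ₁ F)) (off g) split)
           (≡.trans (cong₂ (λ a b → w v F ℤ.* a ℤ.+ 1ℤ ℤ.* b) p z) (≡.trans (ℤₚ.+-identityʳ _) (ℤₚ.*-zeroʳ (w v F)))))

-- The last conjunct keeps the point masses already made intact while the later vertices are
-- treated.
points : ∀ (es : List (SEdge N)) (f : Fin N → ℕ) vs w → (∀ v k → f v ≤ k → w v k ≡ 0ℤ) → c es w ≢ 0ℤ →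
  Σ (Wt N) λ w′ → c es w′ ≢ 0ℤ × (∀ {v} → v ∈ vs → PointMass f w′ v) × (∀ v → PointMass f w v → PointMass f w′ v)
points es f [] w e ne = w , ne , (λ ()) , (λ v p → p)
points es f (v ∷ vs) w e ne with point-at es v (f v) w (e v) ne
... | k , k< , ne₁ with points es f vs (upd w v (δ₁ k)) e₁ ne₁
  where
  e₁ : ∀ u j → f u ≤ j → upd w v (δ₁ k) u j ≡ 0ℤ
  e₁ u j q with v ≟ u
  ... | yes refl = δ₁-≢ {k} {j} (λ { refl → ℕₚ.<-irrefl refl (ℕₚ.<-≤-trans k< q) })
  ... | no _ = e u j q
... | w′ , ne′ , at , keep = w′ , ne′ , at′ , λ u p → keep u (mono u p)
  where
  mono : ∀ u → PointMass f w u → PointMass f (upd w v (δ₁ k)) u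
  mono u p with v ≟ u
  ... | yes refl = k , k< , λ j → refl
  ... | no _ = p
  at′ : ∀ {u} → u ∈ v ∷ vs → PointMass f w′ u
  at′ (here refl) = keep v (k , k< , λ j → cong (λ z → z j) (upd-same w v (δ₁ k)))
  at′ (there q) = at q

monomial : ∀ (es : List (SEdge N)) (f : Fin N → ℕ) w → (∀ v k → f v ≤ k → w v k ≡ 0ℤ) → c es w ≢ 0ℤ →
  Σ (Fin N → ℕ) λ m → (∀ v → m v < f v) × c es (δ m) ≢ 0ℤ
monomial es f w e ne with points es f (allFin _) w e ne
... | w′ , ne′ , at , _ = (λ v → proj₁ (at (∈-allFin v))) , (λ v → proj₁ (proj₂ (at (∈-allFin v)))) ,
      λ z → ne′ (≡.trans (c-cong es (λ v → proj₂ (proj₂ (at (∈-allFin v))))) z)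

zeros : Vec ℕ N → ℤ
zeros Vec.[] = 1ℤ
zeros (zero Vec.∷ m) = zeros m
zeros (suc _ Vec.∷ m) = 0ℤ

-- A form of `c es (δ m)` that the type checker can evaluate: the exponents are stored in a vector,
-- and a branch ends as soon as an exponent is used up.
coef : List (SEdge N) → Vec ℕ N → ℤ
coef-at : List (SEdge N) → Fin N → ℕ → Vec ℕ N → ℤ
coef [] m = zeros m
coef (ed u v s ∷ es) m = coef-at es u (lookup m u) m ℤ.+ sg s ℤ.* coef-at es v (lookup m v) m
coef-at es u zero    m = 0ℤ
coef-at es u (suc k) m = coef es (m [ u ]≔ k)

c-coef : ∀ (es : List (SEdge N)) m → c es (δ (lookup m)) ≡ coef es m
c-coef [] m = go m
  where
  go : ∀ {N} (m : Vec ℕ N) → prodF (λ v → δ (lookup m) v 0) ≡ zeros m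
  go Vec.[] = refl
  go (zero Vec.∷ m) = ≡.trans (ℤₚ.*-identityˡ (prodF (λ v → δ (lookup m) v 0))) (go m)
  go (suc _ Vec.∷ m) = ℤₚ.*-zeroˡ (prodF (λ v → δ (lookup m) v 0))
c-coef (ed u v s ∷ es) m = cong₂ (λ a b → a ℤ.+ sg s ℤ.* b) (go u) (go v)
  where
  go : ∀ u → c es (sh u (δ (lookup m))) ≡ coef-at es u (lookup m u) m
  go u with lookup m u in e
  ... | zero = c-δ-zero es u (lookup m) e
  ... | suc k = ≡.trans (c-δ-suc es u (lookup m) e) (≡.trans (c-cong es (λ z j → cong (λ q → δ₁ q j) (aux z))) (c-coef es (m [ u ]≔ k)))
    where
    aux : ∀ z → dec u (lookup m) z ≡ lookup (m [ u ]≔ k) z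
    aux z with u ≟ z
    ... | yes refl = ≡.trans (cong pred e) (≡.sym (Vecₚ.lookup∘update u m k))
    ... | no ne = ≡.sym (Vecₚ.lookup∘update′ (ne ∘ ≡.sym) m k)

Tt : ∀ {b} → T b → b ≡ true
Tt {true} _ = refl

tT : ∀ {b} → b ≡ true → T b
tT refl = tt

filterᵇ-true : ∀ {A : Set} (p : A → Bool) {x} {xs} → p x ≡ true → filterᵇ p (x ∷ xs) ≡ x ∷ filterᵇ p xs
filterᵇ-true p e rewrite e = refl

filterᵇ-false : ∀ {A : Set} (p : A → Bool) {x} {xs} → p x ≡ false → filterᵇ p (x ∷ xs) ≡ filterᵇ p xs
filterᵇ-false p e rewrite e = refl

filterᵇ-none : ∀ {A : Set} (p : A → Bool) xs → (∀ {x} → x ∈ xs → p x ≡ false) → filterᵇ p xs ≡ []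
filterᵇ-none p [] e = refl
filterᵇ-none p (x ∷ xs) e = ≡.trans (filterᵇ-false p (e (here refl))) (filterᵇ-none p xs (e ∘ there))

filterᵇ-one : ∀ {A : Set} (p : A → Bool) {xs u} → Unique xs → u ∈ xs → p u ≡ true →
  (∀ {x} → x ∈ xs → x ≢ u → p x ≡ false) → filterᵇ p xs ≡ u ∷ []
filterᵇ-one p (ne ∷ un) (here refl) pu e = ≡.trans (filterᵇ-true p pu)
  (cong (_ ∷_) (filterᵇ-none p _ (λ q → e (there q) (λ { refl → All.lookup ne q refl }))))
filterᵇ-one p (ne ∷ un) (there m) pu e = ≡.trans (filterᵇ-false p (e (here refl) (λ { refl → All.lookup ne m refl })))
  (filterᵇ-one p un m pu (e ∘ there))

∈-filterᵇ⁻ : ∀ {A : Set} (p : A → Bool) {xs x} → x ∈ filterᵇ p xs → x ∈ xs × p x ≡ true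
∈-filterᵇ⁻ p q with ∈-filter⁻ (T? ∘ p) q
... | m , t = m , Tt t

-- Edge lists up to order and reversal of edges, and the AT condition for them.

degE : List (SEdge N) → Fin N → ℕ
degE []              v = 0
degE (ed a b s ∷ es) v = bump a v (bump b v (degE es v))

star : Fin N → List (Fin N) → List (SEdge N)
star v us = map (λ u → ed v u Sign.-) us

edgesL : (Fin N → Fin N → Bool) → List (Fin N) → List (SEdge N)
edgesL a []       = []
edgesL a (v ∷ vs) = star v (filterᵇ (a v) vs) ++ edgesL a vs

infix 4 _≃_
-- Reversing an edge multiplies the product by a sign, so edge lists of one graph are compared up to
-- a global sign. Nonvanishing and degrees, all that `ATe` depends on, are preserved.
record _≃_ {N} (es es′ : List (SEdge N)) : Set where
  constructor mk≃
  field
    sign : Sign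
    c-eq : ∀ w → c es w ≡ sg sign ℤ.* c es′ w
    d-eq : ∀ v → degE es v ≡ degE es′ v
open _≃_ public

degE-↭ : ∀ {es es′ : List (SEdge N)} → es ↭ es′ → ∀ v → degE es v ≡ degE es′ v
degE-↭ refl v = refl
degE-↭ (prep (ed a b s) p) v = cong (bump a v ∘ bump b v) (degE-↭ p v)
degE-↭ {es = _ ∷ _ ∷ es} (swap (ed a b s) (ed a′ b′ t) p) v rewrite ≡.sym (degE-↭ p v) =
  ≡.trans (cong (bump a v) (≡.trans (bump-comm b a′ v _) (cong (bump a′ v) (bump-comm b b′ v _))))
    (≡.trans (bump-comm a a′ v _) (cong (bump a′ v) (bump-comm a b′ v _)))
degE-↭ (trans p q) v = ≡.trans (degE-↭ p v) (degE-↭ q v)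

↭⇒≃ : ∀ {es es′ : List (SEdge N)} → es ↭ es′ → es ≃ es′
↭⇒≃ p = mk≃ Sign.+ (λ w → ≡.trans (c-↭ p w) (≡.sym (ℤₚ.*-identityˡ _))) (degE-↭ p)

≃-refl : ∀ {es : List (SEdge N)} → es ≃ es
≃-refl = ↭⇒≃ ↭-refl

≃-trans : ∀ {es es′ es″ : List (SEdge N)} → es ≃ es′ → es′ ≃ es″ → es ≃ es″
≃-trans {es″ = es″} (mk≃ s p d) (mk≃ t q e) = mk≃ (s Sign.* t)
  (λ w → ≡.trans (p w) (≡.trans (cong (sg s ℤ.*_) (q w)) (≡.trans (≡.sym (ℤₚ.*-assoc (sg s) (sg t) (c es″ w))) (cong (ℤ._* c es″ w) (≡.sym (sg-* s t))))))
  (λ v → ≡.trans (d v) (e v))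

≃-sym : ∀ {es es′ : List (SEdge N)} → es ≃ es′ → es′ ≃ es
≃-sym {es = es} {es′} (mk≃ s p d) = mk≃ s
  (λ w → ≡.sym (≡.trans (cong (sg s ℤ.*_) (p w)) (≡.trans (≡.sym (ℤₚ.*-assoc (sg s) (sg s) (c es′ w))) (≡.trans (cong (ℤ._* c es′ w) (sg² s)) (ℤₚ.*-identityˡ _)))))
  (≡.sym ∘ d)

≃-prep : ∀ (e : SEdge N) {es es′} → es ≃ es′ → e ∷ es ≃ e ∷ es′
≃-prep (ed a b t) {es} {es′} (mk≃ s p d) = mk≃ s
  (λ w → ≡.trans (cong₂ (λ x y → x ℤ.+ sg t ℤ.* y) (p (sh a w)) (p (sh b w))) (aux (sg s) (sg t) (c es′ (sh a w)) (c es′ (sh b w))))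
  (λ v → cong (bump a v ∘ bump b v) (d v))
  where
  aux : ∀ s t x y → s ℤ.* x ℤ.+ t ℤ.* (s ℤ.* y) ≡ s ℤ.* (x ℤ.+ t ℤ.* y)
  aux = solve-∀

≃-++ˡ : ∀ (fs : List (SEdge N)) {es es′} → es ≃ es′ → fs ++ es ≃ fs ++ es′
≃-++ˡ [] p = p
≃-++ˡ (f ∷ fs) p = ≃-prep f (≃-++ˡ fs p)

≃-flip : ∀ (u v : Fin N) s es → ed u v s ∷ es ≃ ed v u s ∷ es
≃-flip u v s es = mk≃ s (c-flip u v s es) (λ z → bump-comm u v z _)

-- Exchanging two consecutive vertices of the order reverses at most the edge between them; the
-- other edges are only rearranged.
edgesL-↭ : ∀ (a : Fin N → Fin N → Bool) → (∀ u v → a u v ≡ a v u) → ∀ {vs vs′} → vs ↭ vs′ → edgesL a vs ≃ edgesL a vs′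
edgesL-↭ a sy refl = ≃-refl
edgesL-↭ a sy {v ∷ vs} {_ ∷ vs′} (prep _ p) =
  ≃-trans (≃-++ˡ (star v (filterᵇ (a v) vs)) (edgesL-↭ a sy p)) (↭⇒≃ (↭ₚ.++⁺ʳ (edgesL a vs′) (↭ₚ.map⁺ _ (↭ₚ.filter-↭ (T? ∘ a v) p))))
edgesL-↭ a sy {u ∷ v ∷ vs} {_ ∷ _ ∷ vs′} (swap _ _ p) with a u v in e
... | true rewrite ≡.trans (≡.sym (sy u v)) e =
  ≃-trans (≃-prep (ed u v Sign.-) rest) (≃-flip u v Sign.- _)
  where
  rest : star u (filterᵇ (a u) vs) ++ star v (filterᵇ (a v) vs) ++ edgesL a vs ≃ star v (filterᵇ (a v) vs′) ++ star u (filterᵇ (a u) vs′) ++ edgesL a vs′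
  rest = ≃-trans (↭⇒≃ (↭ₚ.shifts (star u (filterᵇ (a u) vs)) (star v (filterᵇ (a v) vs))))
        (≃-trans (≃-++ˡ (star v (filterᵇ (a v) vs)) (≃-++ˡ (star u (filterᵇ (a u) vs)) (edgesL-↭ a sy p)))
                 (↭⇒≃ (↭ₚ.++⁺ (↭ₚ.map⁺ _ (↭ₚ.filter-↭ (T? ∘ a v) p)) (↭ₚ.++⁺ʳ (edgesL a vs′) (↭ₚ.map⁺ _ (↭ₚ.filter-↭ (T? ∘ a u) p))))))
... | false rewrite ≡.trans (≡.sym (sy u v)) e =
  ≃-trans (↭⇒≃ (↭ₚ.shifts (star u (filterᵇ (a u) vs)) (star v (filterᵇ (a v) vs))))
        (≃-trans (≃-++ˡ (star v (filterᵇ (a v) vs)) (≃-++ˡ (star u (filterᵇ (a u) vs)) (edgesL-↭ a sy p)))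
                 (↭⇒≃ (↭ₚ.++⁺ (↭ₚ.map⁺ _ (↭ₚ.filter-↭ (T? ∘ a v) p)) (↭ₚ.++⁺ʳ (edgesL a vs′) (↭ₚ.map⁺ _ (↭ₚ.filter-↭ (T? ∘ a u) p))))))
edgesL-↭ a sy (trans p q) = ≃-trans (edgesL-↭ a sy p) (edgesL-↭ a sy q)

-- The algebraic form of the AT condition: in place of an orientation stands its sequence of
-- outdegrees `m`. Only the vertices in `vs` are subject to the bound.
ATe : (Fin N → ℕ) → List (Fin N) → List (SEdge N) → Set
ATe {N} h vs es = Σ (Fin N → ℕ) λ m → (∀ {v} → v ∈ vs → m v + h v < degE es v) × c es (δ m) ≢ 0ℤ

ATe-≃ : ∀ {h : Fin N → ℕ} {vs es es′} → es ≃ es′ → ATe h vs es → ATe h vs es′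
ATe-≃ {h = h} (mk≃ s p d) (m , b , ne) = m , (λ {v} q → subst (m v + h v <_) (d v) (b q)) , *-≢0 {sg s} (λ z → ne (≡.trans (p (δ m)) z))

ATe-⊆ : ∀ {h : Fin N → ℕ} {vs vs′ es} → (∀ {v} → v ∈ vs′ → v ∈ vs) → ATe h vs es → ATe h vs′ es
ATe-⊆ i (m , b , ne) = m , b ∘ i , ne

fresh-exp : ∀ {es : List (SEdge N)} {y} m → Fresh y es → c es (δ m) ≢ 0ℤ → m y ≡ 0
fresh-exp {es = es} {y} m fr ne with m y in e
... | zero = refl
... | suc k = ⊥-elim (ne (c-zero-fresh es y fr (cong (λ z → δ₁ z 0) e)))

degE-fresh : ∀ {es : List (SEdge N)} {y} → Fresh y es → degE es y ≡ 0
degE-fresh [] = refl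
degE-fresh {es = ed a b s ∷ es} {y} ((p , q) ∷ fr) rewrite bump-≢ (bump b y (degE es y)) p | bump-≢ (degE es y) q = degE-fresh fr

δ-upd-dec : ∀ (m : Fin N → ℕ) y → m y ≡ 0 → sh y (δ (upd m y 1)) ≗₂ δ m
δ-upd-dec m y e v k with y ≟ v
... | yes refl rewrite e = refl
... | no _ = refl

-- The new vertex `y` gets exponent 1. Extracting x_y from (x_y + s x_u)(x_y + t x_v) leaves s (x_u
-- + s t x_v), the single edge from `u` to `v` up to sign, while the degrees of all other vertices
-- stay the same.
contract : ∀ {h : Fin N → ℕ} {vs es} {y u v : Fin N} s t → h y ≡ 0 → Fresh y es → u ≢ y → v ≢ y → y ∉ vs →
  ATe h vs (ed u v (s Sign.* t) ∷ es) → ATe h (y ∷ vs) (ed y u s ∷ ed y v t ∷ es)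
contract {h = h} {vs} {es} {y} {u} {v} s t hy fr u≢ v≢ y∉ (m , b , ne) = m′ , b′ , λ z → ne (zero-back z)
  where
  m′ = upd m y 1
  my : m y ≡ 0
  my = fresh-exp {es = ed u v (s Sign.* t) ∷ es} m ((u≢ , v≢) ∷ fr) ne
  b′ : ∀ {z} → z ∈ y ∷ vs → m′ z + h z < degE (ed y u s ∷ ed y v t ∷ es) z
  b′ (here refl) rewrite upd-same m y 1 | hy | bump-≡ y (bump u y (bump y y (bump v y (degE es y)))) | bump-≢ (bump y y (bump v y (degE es y))) u≢
    | bump-≡ y (bump v y (degE es y)) = s≤s (s≤s z≤n)
  b′ {z} (there q) rewrite upd-other m y 1 {z} (λ { refl → y∉ q })
    | bump-≢ {u = y} {z} (bump u z (bump y z (bump v z (degE es z)))) (λ { refl → y∉ q })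
    | bump-≢ {u = y} {z} (bump v z (degE es z)) (λ { refl → y∉ q }) = b q
  A : Fin _ → ℤ
  A z = c es (sh z (δ m))
  w = δ m′
  t₁ : c es (sh y (sh y w)) ≡ 0ℤ
  t₁ = c-zero es y λ k → ≡.trans (cong (δ₁ (m′ y)) (≡.trans (cong (bump y y) (bump-≡ y k)) (bump-≡ y (suc k)))) (cong (λ z → δ₁ z (suc (suc k))) (upd-same m y 1))
  t₂ : c es (sh v (sh y w)) ≡ A v
  t₂ = c-cong es (λ z k → δ-upd-dec m y my z (bump v z k))
  t₃ : c es (sh y (sh u w)) ≡ A u
  t₃ = ≡.trans (c-cong es (sh-comm y u w)) (c-cong es (λ z k → δ-upd-dec m y my z (bump u z k)))
  t₄ : c es (sh v (sh u w)) ≡ 0ℤ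
  t₄ = c-zero-fresh es y fr (≡.trans (cong (δ₁ (m′ y)) (≡.trans (cong (bump u y) (bump-≢ 0 v≢)) (bump-≢ 0 u≢))) (cong (λ z → δ₁ z 0) (upd-same m y 1)))
  aux : ∀ s t x y → (0ℤ ℤ.+ t ℤ.* y) ℤ.+ s ℤ.* (x ℤ.+ t ℤ.* 0ℤ) ≡ s ℤ.* x ℤ.+ t ℤ.* y
  aux = solve-∀
  aux₂ : ∀ s t x y → s ℤ.* (s ℤ.* x ℤ.+ t ℤ.* y) ≡ s ℤ.* s ℤ.* x ℤ.+ s ℤ.* t ℤ.* y
  aux₂ = solve-∀
  value : c (ed y u s ∷ ed y v t ∷ es) w ≡ sg s ℤ.* A u ℤ.+ sg t ℤ.* A v
  value = ≡.trans (cong₂ (λ p q → p ℤ.+ sg s ℤ.* q) (cong₂ (λ p q → p ℤ.+ sg t ℤ.* q) t₁ t₂) (cong₂ (λ p q → p ℤ.+ sg t ℤ.* q) t₃ t₄))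
            (aux (sg s) (sg t) (A u) (A v))
  zero-back : c (ed y u s ∷ ed y v t ∷ es) w ≡ 0ℤ → c (ed u v (s Sign.* t) ∷ es) (δ m) ≡ 0ℤ
  zero-back z = begin
    A u ℤ.+ sg (s Sign.* t) ℤ.* A v ≡⟨ cong₂ (λ p q → p ℤ.+ q ℤ.* A v) (≡.trans (≡.sym (ℤₚ.*-identityˡ (A u))) (cong (ℤ._* A u) (≡.sym (sg² s)))) (sg-* s t) ⟩
    sg s ℤ.* sg s ℤ.* A u ℤ.+ sg s ℤ.* sg t ℤ.* A v ≡⟨ aux₂ (sg s) (sg t) (A u) (A v) ⟨
    sg s ℤ.* (sg s ℤ.* A u ℤ.+ sg t ℤ.* A v) ≡⟨ cong (sg s ℤ.*_) (≡.trans (≡.sym value) z) ⟩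
    sg s ℤ.* 0ℤ ≡⟨ ℤₚ.*-zeroʳ (sg s) ⟩
    0ℤ ∎
    where open ≡.≡-Reasoning

inc : Fin N → (Fin N → ℕ) → Fin N → ℕ
inc u m = upd m u (suc (m u))

add-edge : ∀ {es : List (SEdge N)} {v u} m → m v ≡ 0 → u ≢ v → c es (δ m) ≢ 0ℤ → c (ed v u Sign.- ∷ es) (δ (inc u m)) ≢ 0ℤ
add-edge {es = es} {v} {u} m mv u≢v ne z = sg-≢0 Sign.- ne (≡.trans (≡.sym val) z)
  where
  dec-inc : ∀ x → dec u (inc u m) x ≡ m x
  dec-inc x with u ≟ x
  ... | yes refl = cong pred (upd-same m u (suc (m u)))
  ... | no _ = refl
  val : c (ed v u Sign.- ∷ es) (δ (inc u m)) ≡ sg Sign.- ℤ.* c es (δ m)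
  val = ≡.trans (cong₂ (λ a b → a ℤ.+ -1ℤ ℤ.* b) (c-δ-zero es v (inc u m) (≡.trans (upd-other m u (suc (m u)) u≢v) mv))
          (≡.trans (c-δ-suc es u (inc u m) (upd-same m u (suc (m u)))) (c-cong es (λ x k → cong (λ q → δ₁ q k) (dec-inc x)))))
        (ℤₚ.+-identityˡ _)

degE-star : ∀ {es : List (SEdge N)} {v} us → v ∉ us → degE (star v us ++ es) v ≡ length us + degE es v
degE-star [] p = refl
degE-star {es = es} {v} (u ∷ us) p = ≡.trans (bump-≡ v _) (cong suc (≡.trans (bump-≢ {u = u} {v} _ (λ { refl → p (here refl) })) (degE-star us (p ∘ there))))

-- The new vertex `v` gets exponent 0, so every factor x_v - x_u has to contribute -x_u. This raises
-- the exponent and the degree of each neighbour by one and keeps its bound; at `v` the bound is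
-- `h v < length us`.
add-star : ∀ {h : Fin N → ℕ} {vs es v} us → Fresh v es → v ∉ us → v ∉ vs → h v < length us →
  ATe h vs es → ATe h (v ∷ vs) (star v us ++ es)
add-star {N = N} {h} {vs} {es} {v} us fr v∉us v∉vs hv (m , b , ne) =
  let m′ , mv , b′ , ne′ = go us v∉us in
  m′ , (λ { (here refl) → subst₂′ (cong (_+ h v) mv) (≡.trans (degE-star us v∉us) (≡.trans (cong (length us +_) (degE-fresh fr)) (ℕₚ.+-identityʳ _))) hv
          ; (there q) → b′ q }) , ne′
  where
  subst₂′ : ∀ {a b a′ b′ : ℕ} → a′ ≡ a → b′ ≡ b → a < b → a′ < b′
  subst₂′ refl refl p = p
  go : ∀ us → v ∉ us → Σ (Fin N → ℕ) λ m′ → m′ v ≡ 0 × (∀ {z} → z ∈ vs → m′ z + h z < degE (star v us ++ es) z) × c (star v us ++ es) (δ m′) ≢ 0ℤ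
  go [] p = m , fresh-exp m fr ne , b , ne
  go (u ∷ us) p with go us (p ∘ there)
  ... | m₁ , e₁ , b₁ , ne₁ = inc u m₁ , ≡.trans (upd-other m₁ u _ u≢v) e₁ , b₂ , add-edge {es = star v us ++ es} m₁ e₁ u≢v ne₁
    where
    u≢v : u ≢ v
    u≢v refl = p (here refl)
    b₂ : ∀ {z} → z ∈ vs → inc u m₁ z + h z < bump v z (bump u z (degE (star v us ++ es) z))
    b₂ {z} q rewrite bump-≢ {u = v} {z} (bump u z (degE (star v us ++ es) z)) (λ { refl → v∉vs q }) with u ≟ z
    ... | yes refl = s≤s (b₁ q)
    ... | no _ = b₁ q

-- Edges of a path y , ys , v, and the sign of the single edge to which it contracts.
pathE : Fin N → List (Fin N) → Fin N → List (SEdge N)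
pathE y []        v = ed y v Sign.- ∷ []
pathE y (y′ ∷ ys) v = ed y y′ Sign.- ∷ pathE y′ ys v

psign : ∀ {A : Set} → Sign → List A → Sign
psign s []       = s Sign.* Sign.-
psign s (_ ∷ ys) = psign (s Sign.* Sign.-) ys

fresh-pathE : ∀ {z y v : Fin N} ys → z ≢ y → z ∉ ys → z ≢ v → Fresh z (pathE y ys v)
fresh-pathE [] p q r = (p ∘ ≡.sym , r ∘ ≡.sym) ∷ []
fresh-pathE (y′ ∷ ys) p q r = (p ∘ ≡.sym , λ e → q (here (≡.sym e))) ∷ fresh-pathE ys (λ e → q (here e)) (q ∘ there) r

-- The interior vertices are suppressed one at a time, beginning at the end next to `u`. The sign
-- `s` of the first edge collects a factor -1 from every edge absorbed.
contract-path : ∀ {h : Fin N → ℕ} {vs es u v} y ys s → Unique (y ∷ ys) → (∀ {z} → z ∈ y ∷ ys → h z ≡ 0) →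
  (∀ {z} → z ∈ y ∷ ys → Fresh z es × z ∉ vs × u ≢ z × v ≢ z) →
  ATe h vs (ed u v (psign s ys) ∷ es) → ATe h ((y ∷ ys) ++ vs) (ed y u s ∷ pathE y ys v ++ es)
contract-path y [] s un h0 fr at = let f , ∉vs , a , b = fr (here refl) in contract s Sign.- (h0 (here refl)) f a b ∉vs at
contract-path {vs = vs} {es} {u} {v} y (y′ ∷ ys) s (ne ∷ un) h0 fr at =
  let f , ∉vs , a , b = fr (here refl) in
  contract s Sign.- (h0 (here refl)) (Allₚ.++⁺ (fresh-pathE ys (All.lookup ne (here refl)) (λ q → All.lookup ne (there q) refl) (b ∘ ≡.sym)) f)
    a (λ e → All.lookup ne (here refl) (≡.sym e)) (λ q → case ∈-++⁻ (y′ ∷ ys) q of λ { (inj₁ r) → All.lookup ne r refl ; (inj₂ r) → ∉vs r })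
    (ATe-≃ (≃-flip y′ u (s Sign.* Sign.-) (pathE y′ ys v ++ es)) (contract-path y′ ys (s Sign.* Sign.-) un (h0 ∘ there) (fr ∘ there) at))

-- Transport of coefficients along injections of small vertex sets.

mapE : ∀ {k} → (Fin k → Fin N) → SEdge k → SEdge N
mapE ι (ed u v s) = ed (ι u) (ι v) s

Injective : ∀ {k} → (Fin k → Fin N) → Set
Injective ι = ∀ {i j} → ι i ≡ ι j → i ≡ j

place : ∀ {k} → (Fin k → Fin N) → (Fin k → ℕ) → Fin N → ℕ
place {k = zero}  ι m v = 0
place {k = suc k} ι m v = if does (ι zero ≟ v) then m zero else place (ι ∘ suc) (m ∘ suc) v

place-ι : ∀ {k} (ι : Fin k → Fin N) m → Injective ι → ∀ i → place ι m (ι i) ≡ m i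
place-ι ι m inj zero with ι zero ≟ ι zero
... | yes _ = refl
... | no ne = ⊥-elim (ne refl)
place-ι ι m inj (suc i) with ι zero ≟ ι (suc i)
... | yes e = case inj e of λ ()
... | no _ = place-ι (ι ∘ suc) (m ∘ suc) (λ e → case inj e of λ { refl → refl }) i

place-off : ∀ {k} (ι : Fin k → Fin N) m v → (∀ i → ι i ≢ v) → place ι m v ≡ 0
place-off {k = zero} ι m v ne = refl
place-off {k = suc k} ι m v ne with ι zero ≟ v
... | yes e = ⊥-elim (ne zero e)
... | no _ = place-off (ι ∘ suc) (m ∘ suc) v (ne ∘ suc)

prodF-one : (f : Fin N → ℤ) → (∀ v → f v ≡ 1ℤ) → prodF f ≡ 1ℤ
prodF-one {zero} f e = refl
prodF-one {suc N} f e rewrite e zero | prodF-one (f ∘ suc) (e ∘ suc) = refl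

prodF-extract : (f : Fin N → ℤ) (u : Fin N) → prodF f ≡ f u ℤ.* prodF (upd f u 1ℤ)
prodF-extract {suc N} f zero = cong (f zero ℤ.*_) (≡.sym (ℤₚ.*-identityˡ (prodF (f ∘ suc))))
prodF-extract {suc N} f (suc u) rewrite prodF-cong (upd-suc f u 1ℤ) =
  ≡.trans (cong (f zero ℤ.*_) (prodF-extract (f ∘ suc) u)) (aux (f zero) (f (suc u)) (prodF (upd (f ∘ suc) u 1ℤ)))
  where
  aux : ∀ a b d → a ℤ.* (b ℤ.* d) ≡ b ℤ.* (a ℤ.* d)
  aux = solve-∀

prodF-ι : ∀ {k} (ι : Fin k → Fin N) (f : Fin N → ℤ) → Injective ι → (∀ v → (∀ i → ι i ≢ v) → f v ≡ 1ℤ) → prodF f ≡ prodF (f ∘ ι)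
prodF-ι {k = zero} ι f inj e = prodF-one f (λ v → e v λ ())
prodF-ι {k = suc k} ι f inj e = ≡.trans (prodF-extract f (ι zero)) (cong (f (ι zero) ℤ.*_)
  (≡.trans (prodF-ι (ι ∘ suc) (upd f (ι zero) 1ℤ) (λ e → case inj e of λ { refl → refl }) off)
           (prodF-cong {f = upd f (ι zero) 1ℤ ∘ ι ∘ suc} {f ∘ ι ∘ suc} (λ i → upd-other f (ι zero) 1ℤ (λ e → case inj {zero} {suc i} e of λ ())))))
  where
  off : ∀ v → (∀ i → ι (suc i) ≢ v) → upd f (ι zero) 1ℤ v ≡ 1ℤ
  off v ne with ι zero ≟ v
  ... | yes _ = refl
  ... | no ne₀ = e v λ { zero → ne₀ ; (suc i) → ne i }

bump-ι : ∀ {k} (ι : Fin k → Fin N) → Injective ι → ∀ u i j → bump (ι u) (ι i) j ≡ bump u i j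
bump-ι ι inj u i j with u ≟ i
... | yes refl = bump-≡ (ι u) j
... | no ne = bump-≢ j (ne ∘ inj)

-- Vertices outside the image are on no edge, so they contribute only the factor `w v 0`, which is
-- required to be 1.
c-ι : ∀ {k} (ι : Fin k → Fin N) → Injective ι → ∀ es w → (∀ v → (∀ i → ι i ≢ v) → w v 0 ≡ 1ℤ) →
  c (map (mapE ι) es) w ≡ c es (w ∘ ι)
c-ι ι inj [] w e = prodF-ι ι (λ v → w v 0) inj e
c-ι ι inj (ed u v s ∷ es) w e = cong₂ (λ a b → a ℤ.+ sg s ℤ.* b) (go u) (go v)
  where
  go : ∀ u → c (map (mapE ι) es) (sh (ι u) w) ≡ c es (sh u (w ∘ ι))
  go u = ≡.trans (c-ι ι inj es (sh (ι u) w) (λ v ne → ≡.trans (cong (w v) (bump-≢ 0 (ne u))) (e v ne)))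
                 (c-cong es (λ i j → cong (w (ι i)) (bump-ι ι inj u i j)))

degE-ι : ∀ {k} (ι : Fin k → Fin N) → Injective ι → ∀ es i → degE (map (mapE ι) es) (ι i) ≡ degE es i
degE-ι ι inj [] i = refl
degE-ι ι inj (ed u v s ∷ es) i rewrite bump-ι ι inj u i (bump (ι v) (ι i) (degE (map (mapE ι) es) (ι i)))
  | bump-ι ι inj v i (degE (map (mapE ι) es) (ι i)) | degE-ι ι inj es i = refl

ATe-ι : ∀ {k} (ι : Fin k → Fin N) → Injective ι → ∀ {h : Fin N → ℕ} es (m : Vec ℕ k) →
  (∀ i → lookup m i + h (ι i) < degE es i) → coef es m ≢ 0ℤ → ATe h (tabulate ι) (map (mapE ι) es)
ATe-ι ι inj {h} es m b ne = place ι (lookup m) , b′ , λ z → ne (≡.trans (≡.sym (c-coef es m)) (≡.trans (≡.sym val) z))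
  where
  b′ : ∀ {v} → v ∈ tabulate ι → place ι (lookup m) v + h v < degE (map (mapE ι) es) v
  b′ q with ∈-tabulate⁻ q
  ... | i , refl rewrite place-ι ι (lookup m) inj i | degE-ι ι inj es i = b i
  val : c (map (mapE ι) es) (δ (place ι (lookup m))) ≡ c es (δ (lookup m))
  val = ≡.trans (c-ι ι inj es _ (λ v ne → cong (λ z → δ₁ z 0) (place-off ι (lookup m) v ne)))
                (c-cong es (λ i j → cong (λ z → δ₁ z j) (place-ι ι (lookup m) inj i)))

-- Sums over sets of arcs and the Alon-Tarsi theorem.

absurdᵇ : ∀ {ℓ} {X : Set ℓ} {b : Bool} → b ≡ true → b ≡ false → X
absurdᵇ refl ()

∧-left : ∀ {a b} → a ∧ b ≡ true → a ≡ true
∧-left {true} e = refl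

bit : Bool → ℕ
bit b = if b then 1 else 0

allFinᵇ : ∀ {k} → (Fin k → Bool) → Bool
allFinᵇ {zero}  p = true
allFinᵇ {suc k} p = p zero ∧ allFinᵇ (p ∘ suc)

∧-T : ∀ {a b} → T (a ∧ b) → T a × T b
∧-T {true} {true} _ = tt , tt

allFinᵇ-sound : ∀ {k} (p : Fin k → Bool) → T (allFinᵇ p) → ∀ i → T (p i)
allFinᵇ-sound p t zero = proj₁ (∧-T {p zero} t)
allFinᵇ-sound p t (suc i) = allFinᵇ-sound (p ∘ suc) (proj₂ (∧-T {p zero} t)) i

sum-allFin : ∀ {k} (f : Fin k → ℕ) → sum (map f (allFin k)) ≡ sumF f
sum-allFin {zero} f = refl
sum-allFin {suc k} f = cong (f zero +_) (≡.trans (cong sum (≡.trans (Listₚ.map-tabulate suc f) (≡.sym (Listₚ.map-tabulate id (f ∘ suc))))) (sum-allFin (f ∘ suc)))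

and-allFin : ∀ {k} (p : Fin k → Bool) → and (map p (allFin k)) ≡ allFinᵇ p
and-allFin {zero} p = refl
and-allFin {suc k} p = cong (p zero ∧_) (≡.trans (cong and (≡.trans (Listₚ.map-tabulate suc p) (≡.sym (Listₚ.map-tabulate id (p ∘ suc))))) (and-allFin (p ∘ suc)))

countF : ∀ {k} → (Fin k → Bool) → ℕ
countF p = sumF (bit ∘ p)

count-F : ∀ {k} (p : Fin k → Bool) → countᵇ p ≡ countF p
count-F p = sum-allFin (bit ∘ p)

ΣL : ∀ {X : Set} → (X → ℤ) → List X → ℤ
ΣL f []       = 0ℤ
ΣL f (x ∷ xs) = f x ℤ.+ ΣL f xs

ΣL-cong : ∀ {X : Set} {f g : X → ℤ} → (∀ x → f x ≡ g x) → ∀ xs → ΣL f xs ≡ ΣL g xs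
ΣL-cong e [] = refl
ΣL-cong e (x ∷ xs) = cong₂ ℤ._+_ (e x) (ΣL-cong e xs)

ΣL-++ : ∀ {X : Set} (f : X → ℤ) xs ys → ΣL f (xs ++ ys) ≡ ΣL f xs ℤ.+ ΣL f ys
ΣL-++ f [] ys = ≡.sym (ℤₚ.+-identityˡ _)
ΣL-++ f (x ∷ xs) ys = ≡.trans (cong (λ q → f x ℤ.+ q) (ΣL-++ f xs ys)) (≡.sym (ℤₚ.+-assoc (f x) (ΣL f xs) (ΣL f ys)))

ΣL-map : ∀ {X Y : Set} (f : Y → ℤ) (g : X → Y) xs → ΣL f (map g xs) ≡ ΣL (f ∘ g) xs
ΣL-map f g [] = refl
ΣL-map f g (x ∷ xs) = cong (λ q → f (g x) ℤ.+ q) (ΣL-map f g xs)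

ΣL-concat : ∀ {X Y : Set} (f : Y → ℤ) (g : X → List Y) xs → ΣL f (concatMap g xs) ≡ ΣL (λ x → ΣL f (g x)) xs
ΣL-concat f g [] = refl
ΣL-concat f g (x ∷ xs) = ≡.trans (ΣL-++ f (g x) (concatMap g xs)) (cong (λ q → ΣL f (g x) ℤ.+ q) (ΣL-concat f g xs))

ΣL-funs : ∀ {X : Set} {k} (F : (Fin (suc k) → X) → ℤ) xs → ΣL F (allFuns xs (suc k)) ≡ ΣL (λ a → ΣL (λ f → F (a VF.∷ f)) (allFuns xs k)) xs
ΣL-funs {k = k} F xs = ≡.trans (ΣL-concat F (λ a → map (λ f → a VF.∷ f) (allFuns xs k)) xs) (ΣL-cong (λ a → ΣL-map F (λ f → a VF.∷ f) (allFuns xs k)) xs)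

ΣL-* : ∀ {X : Set} (a : ℤ) (f : X → ℤ) xs → a ℤ.* ΣL f xs ≡ ΣL (λ x → a ℤ.* f x) xs
ΣL-* a f [] = ℤₚ.*-zeroʳ a
ΣL-* a f (x ∷ xs) = ≡.trans (ℤₚ.*-distribˡ-+ a (f x) (ΣL f xs)) (cong (λ q → a ℤ.* f x ℤ.+ q) (ΣL-* a f xs))

ΣL-zero : ∀ {X : Set} (xs : List X) → ΣL (λ _ → 0ℤ) xs ≡ 0ℤ
ΣL-zero [] = refl
ΣL-zero (x ∷ xs) = ≡.trans (ℤₚ.+-identityˡ _) (ΣL-zero xs)

ΣL-≢0 : ∀ {X : Set} (f : X → ℤ) xs → ΣL f xs ≢ 0ℤ → Σ X λ x → f x ≢ 0ℤ
ΣL-≢0 f [] ne = ⊥-elim (ne refl)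
ΣL-≢0 f (x ∷ xs) ne with +-≢0 {f x} {ΣL f xs} ne
... | inj₁ p = x , p
... | inj₂ p = ΣL-≢0 f xs p

par : ℕ → ℤ
par k = if evenᵇ k then 1ℤ else -1ℤ

even-2 : ∀ k → evenᵇ (suc (suc k)) ≡ evenᵇ k
even-2 k = cong (_≡ᵇ 0) (≡.trans (cong (_% 2) (ℕₚ.+-comm 2 k)) (DivMod.[m+n]%n≡m%n k 2))

even-suc : ∀ k → evenᵇ (suc k) ≡ not (evenᵇ k)
even-suc zero = refl
even-suc (suc zero) = refl
even-suc (suc (suc k)) = ≡.trans (even-2 (suc k)) (≡.trans (even-suc k) (cong not (≡.sym (even-2 k))))

par-suc : ∀ k → par (suc k) ≡ -1ℤ ℤ.* par k
par-suc k rewrite even-suc k with evenᵇ k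
... | true = refl
... | false = refl

par-+ : ∀ k l → par (k + l) ≡ par k ℤ.* par l
par-+ zero l = ≡.sym (ℤₚ.*-identityˡ (par l))
par-+ (suc k) l = ≡.trans (par-suc (k + l)) (≡.trans (cong (λ q → -1ℤ ℤ.* q) (par-+ k l)) (≡.trans (≡.sym (ℤₚ.*-assoc -1ℤ (par k) (par l))) (cong (ℤ._* par l) (≡.sym (par-suc k)))))

guard : Bool → ℤ → ℤ
guard b z = if b then z else 0ℤ

EE-EO : ∀ {X : Set} (P : X → Bool) (s : X → ℕ) xs →
  ℤ.+ length (filterᵇ (λ H → P H ∧ evenᵇ (s H)) xs) ℤ.- ℤ.+ length (filterᵇ (λ H → P H ∧ not (evenᵇ (s H))) xs) ≡ ΣL (λ H → guard (P H) (par (s H))) xs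
EE-EO P s [] = refl
EE-EO P s (H ∷ xs) with P H | evenᵇ (s H)
... | false | _ = ≡.trans (EE-EO P s xs) (≡.sym (ℤₚ.+-identityˡ _))
... | true | true = ≡.trans (shift₁ (length (filterᵇ (λ H → P H ∧ evenᵇ (s H)) xs)) (length (filterᵇ (λ H → P H ∧ not (evenᵇ (s H))) xs))) (cong (λ q → 1ℤ ℤ.+ q) (EE-EO P s xs))
  where
  shift₁ : ∀ a b → ℤ.+ suc a ℤ.- ℤ.+ b ≡ 1ℤ ℤ.+ (ℤ.+ a ℤ.- ℤ.+ b)
  shift₁ a b = ℤₚ.+-assoc 1ℤ (ℤ.+ a) (ℤ.- (ℤ.+ b))
... | true | false = ≡.trans (shift₂ (length (filterᵇ (λ H → P H ∧ evenᵇ (s H)) xs)) (length (filterᵇ (λ H → P H ∧ not (evenᵇ (s H))) xs))) (cong (λ q → -1ℤ ℤ.+ q) (EE-EO P s xs))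
  where
  aux : ∀ p q → p ℤ.- (1ℤ ℤ.+ q) ≡ -1ℤ ℤ.+ (p ℤ.- q)
  aux = solve-∀
  shift₂ : ∀ a b → ℤ.+ a ℤ.- ℤ.+ suc b ≡ -1ℤ ℤ.+ (ℤ.+ a ℤ.- ℤ.+ b)
  shift₂ a b = aux (ℤ.+ a) (ℤ.+ b)

guard-* : ∀ b a z → a ℤ.* guard b z ≡ guard b (a ℤ.* z)
guard-* true  a z = refl
guard-* false a z = ℤₚ.*-zeroʳ a

guard-ΣL : ∀ {X : Set} b (f : X → ℤ) xs → guard b (ΣL f xs) ≡ ΣL (λ x → guard b (f x)) xs
guard-ΣL true  f xs = refl
guard-ΣL false f xs = ≡.sym (ΣL-zero xs)

guard-∧ : ∀ a b z → guard a (guard b z) ≡ guard (a ∧ b) z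
guard-∧ true  b z = refl
guard-∧ false b z = refl

-- Expanding a product of factors x_u - x_v over the arcs of a digraph: H is the set of arcs
-- from which the head is chosen, and eRow, eAll record the resulting exponents.
rowL : ∀ {k} → Fin N → (Fin k → Fin N) → (Fin k → Bool) → List (SEdge N)
rowL {k = zero}  u κ d = []
rowL {k = suc k} u κ d = (if d zero then ed u (κ zero) Sign.- ∷ [] else []) ++ rowL u (κ ∘ suc) (d ∘ suc)

arcRows : ∀ {k} → (Fin k → Fin N) → (Fin k → Fin N → Bool) → List (SEdge N)
arcRows {k = zero}  τ D = []
arcRows {k = suc k} τ D = rowL (τ zero) id (D zero) ++ arcRows (τ ∘ suc) (D ∘ suc)

choice : Fin N → Fin N → Bool → Bool → Fin N → ℕ
choice u v d ρ z = bit (if ρ then does (v ≟ z) else d ∧ does (u ≟ z))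

eRow : ∀ {k} → Fin N → (Fin k → Fin N) → (Fin k → Bool) → (Fin k → Bool) → Fin N → ℕ
eRow u κ d ρ z = sumF (λ i → choice u (κ i) (d i) (ρ i) z)

eAll : ∀ {k} → (Fin k → Fin N) → (Fin k → Fin N → Bool) → (Fin k → Fin N → Bool) → Fin N → ℕ
eAll τ D H z = sumF (λ i → eRow (τ i) id (D i) (H i) z)

shifts : (Fin N → ℕ) → Wt N → Wt N
shifts e w v k = w v (e v + k)

_⊆ᵇ_ : ∀ {k} → (Fin k → Bool) → (Fin k → Bool) → Bool
ρ ⊆ᵇ d = allFinᵇ (λ i → not (ρ i) ∨ d i)

bools : List Bool
bools = true ∷ false ∷ []

-- The sum runs over all Boolean rows, as the enumeration behind `EE` and `EO` does; rows that are
-- not subsets of `d` are given the value 0. Each chosen head carries the sign -1, which `par`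
-- collects.
c-row : ∀ {k} (u : Fin N) (κ : Fin k → Fin N) d es w →
  c (rowL u κ d ++ es) w ≡ ΣL (λ ρ → guard (ρ ⊆ᵇ d) (par (countF ρ) ℤ.* c es (shifts (eRow u κ d ρ) w))) (allFuns bools k)
c-row {k = zero} u κ d es w = ≡.sym (≡.trans (ℤₚ.+-identityʳ _) (ℤₚ.*-identityˡ _))
c-row {N} {suc k} u κ d es w = ≡.trans (expand (d zero) refl) (≡.sym (ΣL-funs F bools))
  where
  F : (Fin (suc k) → Bool) → ℤ
  F ρ = guard (ρ ⊆ᵇ d) (par (countF ρ) ℤ.* c es (shifts (eRow u κ d ρ) w))
  d′ = d ∘ suc
  κ′ = κ ∘ suc
  R = allFuns bools k
  inner : Wt N → (Fin k → Bool) → ℤ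
  inner w ρ = guard (ρ ⊆ᵇ d′) (par (countF ρ) ℤ.* c es (shifts (eRow u κ′ d′ ρ) w))
  moved : ∀ z e → shifts e (sh z w) ≗₂ shifts (λ v → bit (does (z ≟ v)) + e v) w
  moved z e v j with z ≟ v
  ... | yes _ = refl
  ... | no _  = refl
  expand : ∀ b → d zero ≡ b → c (rowL u κ d ++ es) w ≡ ΣL (λ a → ΣL (λ ρ → F (a VF.∷ ρ)) R) bools
  expand false e rewrite e = ≡.trans (c-row u κ′ d′ es w) (≡.sym
    (≡.trans (cong (ℤ._+ (ΣL (inner w) R ℤ.+ 0ℤ)) (ΣL-zero R)) (≡.trans (ℤₚ.+-identityˡ _) (ℤₚ.+-identityʳ _))))
  expand true e rewrite e = ≡.trans (cong₂ (λ p q → p ℤ.+ -1ℤ ℤ.* q) (c-row u κ′ d′ es (sh u w)) (c-row u κ′ d′ es (sh (κ zero) w)))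
    (≡.trans (cong₂ ℤ._+_ tail-case (≡.trans (ΣL-* -1ℤ (inner (sh (κ zero) w)) R) head-case))
      (≡.trans (ℤₚ.+-comm (ΣL (moved-term 0 u) R) (ΣL (moved-term 1 (κ zero)) R)) (cong (λ q → ΣL (moved-term 1 (κ zero)) R ℤ.+ q) (≡.sym (ℤₚ.+-identityʳ (ΣL (moved-term 0 u) R))))))
    where
    moved-term : ℕ → Fin N → (Fin k → Bool) → ℤ
    moved-term s z ρ = guard (ρ ⊆ᵇ d′) (par (s + countF ρ) ℤ.* c es (shifts (λ v → bit (does (z ≟ v)) + eRow u κ′ d′ ρ v) w))
    tail-case : ΣL (inner (sh u w)) R ≡ ΣL (moved-term 0 u) R
    tail-case = ΣL-cong (λ ρ → cong (λ q → guard (ρ ⊆ᵇ d′) (par (countF ρ) ℤ.* q)) (c-cong es (moved u (eRow u κ′ d′ ρ)))) R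
    head-case : ΣL (λ ρ → -1ℤ ℤ.* inner (sh (κ zero) w) ρ) R ≡ ΣL (moved-term 1 (κ zero)) R
    head-case = ΣL-cong (λ ρ → ≡.trans (guard-* (ρ ⊆ᵇ d′) -1ℤ _) (cong (guard (ρ ⊆ᵇ d′))
      (≡.trans (≡.sym (ℤₚ.*-assoc -1ℤ (par (countF ρ)) _)) (cong₂ ℤ._*_ (≡.sym (par-suc (countF ρ))) (c-cong es (moved (κ zero) (eRow u κ′ d′ ρ))))))) R

_⊑ᵇ_ : ∀ {k} → (Fin k → Fin N → Bool) → (Fin k → Fin N → Bool) → Bool
H ⊑ᵇ D = allFinᵇ (λ i → H i ⊆ᵇ D i)

sizeF : ∀ {k} → (Fin k → Fin N → Bool) → ℕ
sizeF H = sumF (λ i → countF (H i))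

c-rows : ∀ {k} (τ : Fin k → Fin N) D w →
  c (arcRows τ D) w ≡ ΣL (λ H → guard (H ⊑ᵇ D) (par (sizeF H) ℤ.* prodF (λ v → w v (eAll τ D H v)))) (allFuns (allFuns bools N) k)
c-rows {k = zero} τ D w = ≡.sym (≡.trans (ℤₚ.+-identityʳ _) (ℤₚ.*-identityˡ _))
c-rows {N} {suc k} τ D w = ≡.trans (c-row (τ zero) id (D zero) (arcRows (τ ∘ suc) (D ∘ suc)) w)
  (≡.trans (ΣL-cong by-row (allFuns bools N)) (≡.sym (ΣL-funs F (allFuns bools N))))
  where
  F : (Fin (suc k) → Fin N → Bool) → ℤ
  F H = guard (H ⊑ᵇ D) (par (sizeF H) ℤ.* prodF (λ v → w v (eAll τ D H v)))
  R = allFuns (allFuns bools N) k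
  by-row : ∀ ρ → guard (ρ ⊆ᵇ D zero) (par (countF ρ) ℤ.* c (arcRows (τ ∘ suc) (D ∘ suc)) (shifts (eRow (τ zero) id (D zero) ρ) w)) ≡ ΣL (λ H → F (ρ VF.∷ H)) R
  by-row ρ = ≡.trans (cong (λ q → guard (ρ ⊆ᵇ D zero) (par (countF ρ) ℤ.* q)) (c-rows (τ ∘ suc) (D ∘ suc) w′))
    (≡.trans (cong (guard (ρ ⊆ᵇ D zero)) (ΣL-* (par (countF ρ)) G R)) (≡.trans (guard-ΣL (ρ ⊆ᵇ D zero) (λ H → par (countF ρ) ℤ.* G H) R)
      (ΣL-cong (λ H → ≡.trans (cong (guard (ρ ⊆ᵇ D zero)) (≡.trans (guard-* (H ⊑ᵇ (D ∘ suc)) (par (countF ρ)) (par (sizeF H) ℤ.* Z H))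
          (cong (guard (H ⊑ᵇ (D ∘ suc))) (≡.trans (≡.sym (ℤₚ.*-assoc (par (countF ρ)) (par (sizeF H)) (Z H))) (cong (ℤ._* Z H) (≡.sym (par-+ (countF ρ) (sizeF H))))))))
        (guard-∧ (ρ ⊆ᵇ D zero) (H ⊑ᵇ (D ∘ suc)) _)) R)))
    where
    w′ = shifts (eRow (τ zero) id (D zero) ρ) w
    Z G : (Fin k → Fin N → Bool) → ℤ
    Z H = prodF (λ v → w′ v (eAll (τ ∘ suc) (D ∘ suc) H v))
    G H = guard (H ⊑ᵇ (D ∘ suc)) (par (sizeF H) ℤ.* Z H)

sumF-+ : (f g : Fin N → ℕ) → sumF (λ v → f v + g v) ≡ sumF f + sumF g
sumF-+ {zero}  f g = refl
sumF-+ {suc N} f g rewrite sumF-+ (f ∘ suc) (g ∘ suc) = interchange (f zero) (g zero) (sumF (f ∘ suc)) (sumF (g ∘ suc))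
  where
  interchange : ∀ a b x y → (a + b) + (x + y) ≡ (a + x) + (b + y)
  interchange = ℕ-solve-∀

sumF-0 : (f : Fin N → ℕ) → (∀ v → f v ≡ 0) → sumF f ≡ 0
sumF-0 {zero}  f e = refl
sumF-0 {suc N} f e rewrite e zero = sumF-0 (f ∘ suc) (e ∘ suc)

sumF-single : (f : Fin N → ℕ) (v : Fin N) → (∀ u → u ≢ v → f u ≡ 0) → sumF f ≡ f v
sumF-single f zero e = ≡.trans (cong (f zero +_) (sumF-0 (f ∘ suc) (λ u → e (suc u) λ ()))) (ℕₚ.+-identityʳ _)
sumF-single f (suc v) e rewrite e zero (λ ()) = sumF-single (f ∘ suc) v (λ u ne → e (suc u) (λ { refl → ne refl }))

kept : Arcs N → Arcs N → Fin N → ℕ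
kept D H v = countF (λ j → D v j ∧ not (H v j))

-- The variable of `v` is chosen as a head by the arcs of `H` that enter `v`, and as a tail by the
-- arcs of `D` outside `H` that leave `v`.
eAll-id : (D H : Arcs N) → ∀ v → eAll id D H v ≡ countF (λ i → H i v) + kept D H v
eAll-id D H v = ≡.trans (sumF-cong (λ i → ≡.trans (sumF-cong (cell i)) (≡.trans (sumF-+ (heads i) (tails i)) (cong (_+ sumF (tails i)) (head-sum i)))))
  (≡.trans (sumF-+ (λ i → bit (H i v)) (λ i → sumF (tails i))) (cong (countF (λ i → H i v) +_)
    (≡.trans (sumF-single (λ i → sumF (tails i)) v (λ u ne → sumF-0 (tails u) (λ j → tail-off u j ne))) (sumF-cong tail-at))))
  where
  heads tails : ∀ i → Fin _ → ℕ
  heads i j = bit (H i j ∧ does (j ≟ v))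
  tails i j = bit ((D i j ∧ not (H i j)) ∧ does (i ≟ v))
  cell : ∀ i j → choice i j (D i j) (H i j) v ≡ heads i j + tails i j
  cell i j with H i j | D i j
  ... | true  | true  = ≡.sym (ℕₚ.+-identityʳ _)
  ... | true  | false = ≡.sym (ℕₚ.+-identityʳ _)
  ... | false | true  = refl
  ... | false | false = refl
  head-sum : ∀ i → sumF (heads i) ≡ bit (H i v)
  head-sum i = ≡.trans (sumF-single (heads i) v off) at
    where
    off : ∀ u → u ≢ v → heads i u ≡ 0
    off u ne with u ≟ v
    ... | yes e = ⊥-elim (ne e)
    ... | no _ with H i u
    ...   | true = refl
    ...   | false = refl
    at : heads i v ≡ bit (H i v)
    at with v ≟ v
    ... | no ne = ⊥-elim (ne refl)
    ... | yes _ with H i v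
    ...   | true = refl
    ...   | false = refl
  tail-off : ∀ u j → u ≢ v → tails u j ≡ 0
  tail-off u j ne with u ≟ v
  ... | yes e = ⊥-elim (ne e)
  ... | no _ with D u j ∧ not (H u j)
  ...   | true = refl
  ...   | false = refl
  tail-at : ∀ j → tails v j ≡ bit (D v j ∧ not (H v j))
  tail-at j with v ≟ v
  ... | no ne = ⊥-elim (ne refl)
  ... | yes _ with D v j ∧ not (H v j)
  ...   | true = refl
  ...   | false = refl

allFinᵇ-true : ∀ {k} {p : Fin k → Bool} → allFinᵇ p ≡ true → ∀ i → p i ≡ true
allFinᵇ-true {p = p} e i = Tt (allFinᵇ-sound p (tT e) i)

⊑ᵇ-cell : ∀ {k} {H D : Fin k → Fin N → Bool} → H ⊑ᵇ D ≡ true → ∀ i j → not (H i j) ∨ D i j ≡ true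
⊑ᵇ-cell e i j = allFinᵇ-true (allFinᵇ-true e i) j

kept-out : ∀ {H D : Arcs N} → H ⊑ᵇ D ≡ true → ∀ v → outdeg D v ≡ countF (H v) + kept D H v
kept-out {H = H} {D} sub v = ≡.trans (count-F (D v)) (≡.trans (sumF-cong cell) (sumF-+ (bit ∘ H v) (λ j → bit (D v j ∧ not (H v j)))))
  where
  cell : ∀ j → bit (D v j) ≡ bit (H v j) + bit (D v j ∧ not (H v j))
  cell j with H v j | D v j | ⊑ᵇ-cell {H = H} {D} sub v j
  ... | true  | true  | _ = refl
  ... | false | true  | _ = refl
  ... | false | false | _ = refl

prodF-δ : (m e : Fin N → ℕ) → prodF (λ v → δ m v (e v)) ≡ guard (allFinᵇ (λ v → m v ≡ᵇ e v)) 1ℤ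
prodF-δ {zero}  m e = refl
prodF-δ {suc N} m e rewrite prodF-δ (m ∘ suc) (e ∘ suc) with m zero ≡ᵇ e zero | allFinᵇ (λ v → m (suc v) ≡ᵇ e (suc v))
... | true  | true  = refl
... | true  | false = refl
... | false | true  = refl
... | false | false = refl

allFinᵇ-cong : ∀ {k} {p q : Fin k → Bool} → (∀ i → p i ≡ q i) → allFinᵇ p ≡ allFinᵇ q
allFinᵇ-cong {zero}  e = refl
allFinᵇ-cong {suc k} e = cong₂ _∧_ (e zero) (allFinᵇ-cong (e ∘ suc))

≡ᵇ-cancel : ∀ a b k → (a + k ≡ᵇ b + k) ≡ (b ≡ᵇ a)
≡ᵇ-cancel a b k with a ℕₚ.≟ b
... | yes refl = ≡.trans (≡ᵇ-refl (a + k)) (≡.sym (≡ᵇ-refl a))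
... | no ne = ≡.trans (≡ᵇ-≢ _ _ (ne ∘ ℕₚ.+-cancelʳ-≡ k a b)) (≡.sym (≡ᵇ-≢ b a (ne ∘ ≡.sym)))

-- Alon and Tarsi: the coefficient of ∏ x_v^outdeg(v) is the signed count of Eulerian subdigraphs.
alon-tarsi : (D : Arcs N) → c (arcRows id D) (δ (outdeg D)) ≡ ℤ.+ EE D ℤ.- ℤ.+ EO D
alon-tarsi {N} D = ≡.trans (c-rows id D (δ (outdeg D))) (≡.trans (ΣL-cong term (allArcs N)) (≡.sym (EE-EO (isSpanEulerianᵇ D) size (allArcs N))))
  where
  term : ∀ H → guard (H ⊑ᵇ D) (par (sizeF H) ℤ.* prodF (λ v → δ (outdeg D) v (eAll id D H v))) ≡ guard (isSpanEulerianᵇ D H) (par (size H))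
  term H = ≡.trans (body (H ⊑ᵇ D) refl) (cong₂ guard (≡.sym euler) (cong par (≡.sym size≡)))
    where
    size≡ : size H ≡ sizeF H
    size≡ = ≡.trans (sum-allFin (outdeg H)) (sumF-cong (λ v → count-F (H v)))
    euler : isSpanEulerianᵇ D H ≡ (H ⊑ᵇ D) ∧ allFinᵇ (λ v → indeg H v ≡ᵇ outdeg H v)
    euler = cong₂ _∧_ (≡.trans (and-allFin (λ u → and (map (λ v → not (H u v) ∨ D u v) (allFin N)))) (allFinᵇ-cong (λ u → and-allFin (λ v → not (H u v) ∨ D u v))))
                      (and-allFin (λ v → indeg H v ≡ᵇ outdeg H v))
    body : ∀ b → H ⊑ᵇ D ≡ b → guard b (par (sizeF H) ℤ.* prodF (λ v → δ (outdeg D) v (eAll id D H v))) ≡ guard (b ∧ allFinᵇ (λ v → indeg H v ≡ᵇ outdeg H v)) (par (sizeF H))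
    body false e = refl
    body true e = ≡.trans (cong (par (sizeF H) ℤ.*_) (prodF-δ (outdeg D) (eAll id D H)))
      (≡.trans (guard-* (allFinᵇ (λ v → outdeg D v ≡ᵇ eAll id D H v)) (par (sizeF H)) 1ℤ)
        (cong₂ guard (allFinᵇ-cong cell) (ℤₚ.*-identityʳ (par (sizeF H)))))
      where
      cell : ∀ v → (outdeg D v ≡ᵇ eAll id D H v) ≡ (indeg H v ≡ᵇ outdeg H v)
      -- Both exponents contain `kept D H v`. Cancelling it turns equality with the outdegree in `D`
      -- into the Eulerian condition for `H` at `v`.
      cell v = ≡.trans (cong₂ _≡ᵇ_ (kept-out {H = H} {D} e v) (eAll-id D H v)) (≡.trans (≡ᵇ-cancel (countF (H v)) (countF (λ i → H i v)) (kept D H v))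
        (cong₂ _≡ᵇ_ (≡.sym (count-F (λ i → H i v))) (≡.sym (count-F (H v)))))

arcsL : Arcs N → List (Fin N) → List (Fin N) → List (SEdge N)
arcsL D U vs = concatMap (λ u → star u (filterᵇ (D u) U)) vs

rowL-star : ∀ {k} (u : Fin N) (κ : Fin k → Fin N) (d : Fin N → Bool) → rowL u κ (d ∘ κ) ≡ star u (filterᵇ d (tabulate κ))
rowL-star {k = zero} u κ d = refl
rowL-star {k = suc k} u κ d with d (κ zero)
... | true = cong (_ ∷_) (rowL-star u (κ ∘ suc) d)
... | false = rowL-star u (κ ∘ suc) d

arcRows-arcsL : ∀ {k} (τ : Fin k → Fin N) (D : Arcs N) → arcRows τ (D ∘ τ) ≡ arcsL D (allFin N) (tabulate τ)
arcRows-arcsL {k = zero} τ D = refl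
arcRows-arcsL {k = suc k} τ D = cong₂ _++_ (rowL-star (τ zero) id (D (τ zero))) (arcRows-arcsL (τ ∘ suc) D)

module Orient (a D : Arcs N) (cover : ∀ u v → a u v ≡ (D u v ∨ D v u)) (once : ∀ u v → ¬ (D u v ≡ true × D v u ≡ true)) where

  costar : Fin N → List (Fin N) → List (SEdge N)
  costar v us = map (λ u → ed u v Sign.-) us

  star-split : ∀ v U X → star v (filterᵇ (a v) U) ++ X ≃ star v (filterᵇ (D v) U) ++ costar v (filterᵇ (λ u → D u v) U) ++ X
  star-split v [] X = ≃-refl
  star-split v (u ∷ U) X rewrite cover v u with D v u in e₁ | D u v in e₂
  ... | true  | true  = ⊥-elim (once v u (e₁ , e₂))
  ... | true  | false = ≃-prep _ (star-split v U X)
  ... | false | true  = ≃-trans (≃-prep _ (star-split v U X)) (≃-trans (≃-flip v u Sign.- _)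
                          (↭⇒≃ (↭-sym (↭ₚ.shift (ed u v Sign.-) (star v (filterᵇ (D v) U)) _))))
  ... | false | false = star-split v U X

  arcsL-∷ : ∀ v U vs → arcsL D (v ∷ U) vs ↭ costar v (filterᵇ (λ u → D u v) vs) ++ arcsL D U vs
  arcsL-∷ v U [] = ↭-refl
  arcsL-∷ v U (u ∷ vs) with D u v
  ... | true = prep _ (↭-trans (↭ₚ.++⁺ˡ (star u (filterᵇ (D u) U)) (arcsL-∷ v U vs)) (↭ₚ.shifts (star u (filterᵇ (D u) U)) (costar v (filterᵇ (λ u → D u v) vs))))
  ... | false = ↭-trans (↭ₚ.++⁺ˡ (star u (filterᵇ (D u) U)) (arcsL-∷ v U vs)) (↭ₚ.shifts (star u (filterᵇ (D u) U)) (costar v (filterᵇ (λ u → D u v) vs)))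

  no-loop : ∀ v → D v v ≡ false
  no-loop v with D v v in e
  ... | true = ⊥-elim (once v v (e , e))
  ... | false = refl

  -- Every edge is an arc in exactly one direction, so any orientation yields the product over the
  -- graph up to order and sign.
  edges-arcs : ∀ U → edgesL a U ≃ arcsL D U U
  edges-arcs [] = ≃-refl
  edges-arcs (v ∷ U) rewrite no-loop v = ≃-trans (≃-++ˡ (star v (filterᵇ (a v) U)) (edges-arcs U))
    (≃-trans (star-split v U (arcsL D U U)) (↭⇒≃ (↭ₚ.++⁺ˡ (star v (filterᵇ (D v) U)) (↭-sym (arcsL-∷ v U U)))))

  edges-rows : edgesL a (allFin N) ≃ arcRows id D
  edges-rows = subst (edgesL a (allFin N) ≃_) (≡.sym (arcRows-arcsL id D)) (edges-arcs (allFin N))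

upward : Arcs N → Arcs N
upward a u v = a u v ∧ (toℕ u <ᵇ toℕ v)

-- Reversing the arcs from which the head was chosen turns the exponents into outdegrees.
realise : (a : Arcs N) → (∀ u v → a u v ≡ a v u) → (∀ v → a v v ≡ false) → ∀ m → c (edgesL a (allFin N)) (δ m) ≢ 0ℤ →
  Σ (Arcs N) λ D → ((∀ u v → a u v ≡ (D u v ∨ D v u)) × (∀ u v → ¬ (D u v ≡ true × D v u ≡ true))) × (∀ v → outdeg D v ≡ m v)
realise {N} a a-sym a-irr m ne = D , (cover , once) , out
  where
  U = upward a
  U-once : ∀ u v → ¬ (U u v ≡ true × U v u ≡ true)
  U-once u v (p , q) with a u v | a v u
  ... | true | true = ℕₚ.<-asym (ℕₚ.<ᵇ⇒< (toℕ u) (toℕ v) (tT p)) (ℕₚ.<ᵇ⇒< (toℕ v) (toℕ u) (tT q))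
  U-cover : ∀ u v → a u v ≡ (U u v ∨ U v u)
  U-cover u v rewrite a-sym v u with a u v in e
  ... | false = refl
  ... | true with ℕₚ.<-cmp (toℕ u) (toℕ v)
  ...   | tri< p _ _ rewrite Tt (ℕₚ.<⇒<ᵇ p) = refl
  ...   | tri> _ _ p rewrite Tt (ℕₚ.<⇒<ᵇ p) = ≡.sym (∨-zeroʳ _)
  ...   | tri≈ _ p _ = absurdᵇ e (≡.trans (cong (a u) (≡.sym (toℕ-injective p))) (a-irr u))
  iso = Orient.edges-rows a U U-cover U-once
  term : Arcs N → ℤ
  term H = guard (H ⊑ᵇ U) (par (sizeF H) ℤ.* prodF (λ v → δ m v (eAll id U H v)))
  -- One nonzero term of the expansion is enough to obtain an orientation with outdegrees `m`. That
  -- this orientation is AT follows afterwards from `alon-tarsi`, as the whole coefficient is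
  -- nonzero.
  found = ΣL-≢0 term (allArcs N) (λ z → *-≢0 {sg (sign iso)} (λ z → ne (≡.trans (c-eq iso (δ m)) z)) (≡.trans (c-rows id U (δ m)) z))
  H = proj₁ found
  parts : ∀ b k {z} → guard b (k ℤ.* z) ≢ 0ℤ → b ≡ true × z ≢ 0ℤ
  parts true  k p = refl , *-≢0 {k} p
  parts false k p = ⊥-elim (p refl)
  good = parts (H ⊑ᵇ U) (par (sizeF H)) (proj₂ found)
  exps : ∀ v → eAll id U H v ≡ m v
  exps v with m v ℕₚ.≟ eAll id U H v
  ... | yes e = ≡.sym e
  ... | no q = ⊥-elim (proj₂ good (prodF-zero (λ v → δ m v (eAll id U H v)) v (δ₁-≢ q)))
  D : Arcs N
  D u v = (U u v ∧ not (H u v)) ∨ H v u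
  sub : ∀ u v → not (H u v) ∨ U u v ≡ true
  sub = ⊑ᵇ-cell {H = H} {U} (proj₁ good)
  cover : ∀ u v → a u v ≡ (D u v ∨ D v u)
  cover u v = ≡.trans (U-cover u v) (swapped u v)
   where
   swapped : ∀ u v → (U u v ∨ U v u) ≡ (D u v ∨ D v u)
   swapped u v with U u v | U v u | H u v | H v u | sub u v | sub v u
   ... | true | true | true | true | _ | _ = refl
   ... | true | true | true | false | _ | _ = refl
   ... | true | true | false | true | _ | _ = refl
   ... | true | true | false | false | _ | _ = refl
   ... | true | false | true | false | _ | _ = refl
   ... | true | false | false | false | _ | _ = refl
   ... | false | true | false | true | _ | _ = refl
   ... | false | true | false | false | _ | _ = refl
   ... | false | false | false | false | _ | _ = refl
  once : ∀ u v → ¬ (D u v ≡ true × D v u ≡ true)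
  once u v pq with U u v | U v u | H u v | H v u | sub u v | sub v u | U-once u v
  once u v pq | true | true | _ | _ | _ | _ | o = o (refl , refl)
  once u v (() , _) | true | false | true | false | _ | _ | _
  once u v (_ , ()) | true | false | false | false | _ | _ | _
  once u v (_ , ()) | false | true | false | true | _ | _ | _
  once u v (() , _) | false | true | false | false | _ | _ | _
  once u v (() , _) | false | false | false | false | _ | _ | _
  out : ∀ v → outdeg D v ≡ m v
  out v = ≡.trans (count-F (D v)) (≡.trans (sumF-cong cell) (≡.trans (sumF-+ (λ u → bit (H u v)) (λ u → bit (U v u ∧ not (H v u))))
            (≡.trans (≡.sym (eAll-id U H v)) (exps v))))
    where
    cell : ∀ u → bit (D v u) ≡ bit (H u v) + bit (U v u ∧ not (H v u))
    cell u with U v u | U u v | H u v | H v u | sub u v | U-once v u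
    ... | true | true | _ | _ | _ | o = ⊥-elim (o (refl , refl))
    ... | true | false | false | true | _ | _ = refl
    ... | true | false | false | false | _ | _ = refl
    ... | false | true | true | b | _ | _ = refl
    ... | false | true | false | b | _ | _ = refl
    ... | false | false | false | b | _ | _ = refl

-- Induced subgraphs of a fixed graph that are not AT.

module OnGraph (G : Graph) where

  open import Data.List.Membership.DecPropositional (_≟_ {n G}) using (_∈?_)

  V : Set
  V = Fin (n G)

  A : V → V → Bool
  A = adj G

  A-sym : ∀ u v → A u v ≡ A v u
  A-sym = sym G

  A-irr : ∀ v → A v v ≡ false
  A-irr = irrefl G

  A-≢ : ∀ {u v} → A u v ≡ true → u ≢ v
  A-≢ {u} p refl = absurdᵇ p (A-irr u)

  flipA : ∀ {u v b} → A u v ≡ b → A v u ≡ b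
  flipA {u} {v} e = ≡.trans (A-sym v u) e

  E : List V → List (SEdge (n G))
  E = edgesL A

  NonAT : (V → ℕ) → List V → Set
  NonAT h W = ¬ ATe h W (E W)

  dg : List V → V → ℕ
  dg W v = length (filterᵇ (A v) W)

  ↭-set : ∀ {X : Set} {xs ys : List X} → Unique xs → Unique ys → (∀ {v} → v ∈ xs → v ∈ ys) → (∀ {v} → v ∈ ys → v ∈ xs) → xs ↭ ys
  ↭-set p q f g = ∼bag⇒↭ (unique∧set⇒bag p q (mk⇔ f g))

  edges-in : ∀ U → All (λ e → src e ∈ U × tgt e ∈ U) (E U)
  edges-in [] = []
  edges-in (v ∷ U) = Allₚ.++⁺ (Allₚ.map⁺ (All.tabulate λ q → here refl , there (proj₁ (∈-filterᵇ⁻ (A v) q)))) (All.map (λ { (a , b) → there a , there b }) (edges-in U))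

  fresh-in : ∀ {U y} {es : List (SEdge (n G))} → y ∉ U → All (λ e → src e ∈ U × tgt e ∈ U) es → Fresh y es
  fresh-in y∉ = All.map (λ { (a , b) → (λ { refl → y∉ a }) , (λ { refl → y∉ b }) })

  -- Contrapositive of `add-star`: all edges at `v` would be oriented towards `v`.
  NonAT-tail : ∀ {h v U} → v ∉ U → h v < dg U v → NonAT h (v ∷ U) → NonAT h U
  NonAT-tail {v = v} {U} v∉ hv na at =
    na (add-star (filterᵇ (A v) U) (fresh-in v∉ (edges-in U)) (λ q → v∉ (proj₁ (∈-filterᵇ⁻ (A v) q))) v∉ hv at)

  NonAT-↭ : ∀ {h U U′} → U ↭ U′ → NonAT h U → NonAT h U′
  NonAT-↭ {h} {U} {U′} p na at = na (ATe-⊆ {es = E U} (↭ₚ.∈-resp-↭ p) (ATe-≃ {h = h} {U′} (≃-sym (edgesL-↭ A A-sym p)) at))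

  data Walk (W : List V) : V → V → Set where
    stop : ∀ {v} → v ∈ W → Walk W v v
    step : ∀ {u w v} → u ∈ W → A u w ≡ true → Walk W w v → Walk W u v

  walk-start : ∀ {W u v} → Walk W u v → u ∈ W
  walk-start (stop p) = p
  walk-start (step p _ _) = p

  Conn : List V → Set
  Conn W = ∀ {u v} → u ∈ W → v ∈ W → Walk W u v

  crossing : ∀ {W u v} (P : V → Bool) → Walk W u v → P u ≡ true → P v ≡ false →
    Σ V λ a → Σ V λ b → a ∈ W × b ∈ W × P a ≡ true × P b ≡ false × A a b ≡ true
  crossing P (stop _) pu pv = absurdᵇ pu pv
  crossing P (step {u} {w} q e wk) pu pv with P w in eq
  ... | true = crossing P wk eq pv
  ... | false = u , w , q , walk-start wk , pu , eq , e

  ∈ᵇ : List V → V → Bool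
  ∈ᵇ U z = does (z ∈? U)

  ∈ᵇ-true : ∀ {U z} → ∈ᵇ U z ≡ true → z ∈ U
  ∈ᵇ-true {U} {z} e with z ∈? U
  ... | yes p = p

  ∈ᵇ-false : ∀ {U z} → ∈ᵇ U z ≡ false → z ∉ U
  ∈ᵇ-false {U} {z} e with z ∈? U
  ... | no p = p

  true-∈ᵇ : ∀ {U z} → z ∈ U → ∈ᵇ U z ≡ true
  true-∈ᵇ {U} {z} p with z ∈? U
  ... | yes _ = refl
  ... | no ne = ⊥-elim (ne p)

  false-∈ᵇ : ∀ {U z} → z ∉ U → ∈ᵇ U z ≡ false
  false-∈ᵇ {U} {z} p with z ∈? U
  ... | yes q = ⊥-elim (p q)
  ... | no _ = refl

  dg-pos : ∀ {U v u} → u ∈ U → A v u ≡ true → 0 < dg U v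
  dg-pos {_ ∷ U} {v} (here refl) e rewrite filterᵇ-true (A v) {xs = U} e = s≤s z≤n
  dg-pos {x ∷ U} {v} (there q) e with A v x
  ... | true = s≤s z≤n
  ... | false = dg-pos q e

  _─_ : List V → List V → List V
  W ─ U = filter (λ z → ¬? (z ∈? U)) W

  ∈-─⁻ : ∀ {W U z} → z ∈ W ─ U → z ∈ W × z ∉ U
  ∈-─⁻ {U = U} = ∈-filter⁻ (λ z → ¬? (z ∈? U))

  ∈-─⁺ : ∀ {W U z} → z ∈ W → z ∉ U → z ∈ W ─ U
  ∈-─⁺ {U = U} = ∈-filter⁺ (λ z → ¬? (z ∈? U))

  Unique-─ : ∀ {W} U → Unique W → Unique (W ─ U)
  Unique-─ U = Uniqueₚ.filter⁺ (λ z → ¬? (z ∈? U))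

  split-↭ : ∀ {W U} → Unique W → Unique U → (∀ {v} → v ∈ U → v ∈ W) → W ↭ (W ─ U) ++ U
  split-↭ {W} {U} uW uU i = ↭-set uW (Uniqueₚ.++⁺ (Unique-─ U uW) uU (λ { (p , q) → proj₂ (∈-─⁻ {W} {U} p) q }))
    (λ {v} p → case v ∈? U of λ { (yes q) → ∈-++⁺ʳ (W ─ U) q ; (no q) → ∈-++⁺ˡ (∈-─⁺ p q) })
    (λ p → case ∈-++⁻ (W ─ U) p of λ { (inj₁ q) → proj₁ (∈-─⁻ {W} {U} q) ; (inj₂ q) → i q })

  unique-↭ : ∀ {xs ys : List V} → xs ↭ ys → Unique xs → Unique ys
  unique-↭ refl u = u
  unique-↭ (prep x p) (a ∷ u) = ↭ₚ.All-resp-↭ p a ∷ unique-↭ p u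
  unique-↭ (swap x y p) ((xy ∷ ax) ∷ (ay ∷ u)) = ((xy ∘ ≡.sym) ∷ ↭ₚ.All-resp-↭ p ay) ∷ (↭ₚ.All-resp-↭ p ax ∷ unique-↭ p u)
  unique-↭ (trans p q) u = unique-↭ q (unique-↭ p u)

  unique-tail : ∀ {x : V} {xs} → Unique (x ∷ xs) → Unique xs
  unique-tail (_ ∷ u) = u

  unique-head : ∀ {x : V} {xs} → Unique (x ∷ xs) → x ∉ xs
  unique-head = Uniqueₚ.Unique[x∷xs]⇒x∉xs

  -- Vertices outside U are added one at a time, each adjacent to an earlier one.
  NonAT-sub : ∀ {h W U u₀} → Conn W → Unique W → Unique U → u₀ ∈ U → (∀ {v} → v ∈ U → v ∈ W) →
    (∀ {v} → v ∈ W → v ∉ U → h v ≡ 0) → NonAT h W → NonAT h U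
  NonAT-sub {h} {W} {U} {u₀} con uW uU u₀∈ i h0 na = go (length (W ─ U)) (W ─ U) U ≡.refl u₀∈ (split-↭ uW uU i) i h0
    where
    go : ∀ k R U → length R ≡ k → u₀ ∈ U → W ↭ R ++ U → (∀ {v} → v ∈ U → v ∈ W) → (∀ {v} → v ∈ W → v ∉ U → h v ≡ 0) → NonAT h U
    go k [] U eq u₀∈ p i h0 = NonAT-↭ p na
    go (suc k) (r ∷ R) U eq u₀∈ p i h0
      with crossing (∈ᵇ U) (con (i u₀∈) (↭ₚ.∈-resp-↭ (↭-sym p) (here refl))) (true-∈ᵇ u₀∈) (false-∈ᵇ {U} {r} r∉)
      where
      uRU : Unique (r ∷ R ++ U)
      uRU = unique-↭ p uW
      r∉ : r ∉ U
      r∉ q = unique-head uRU (∈-++⁺ʳ R q)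
    ... | a , b , a∈ , b∈ , pa , pb , e with ∈-++⁻ (r ∷ R) (↭ₚ.∈-resp-↭ p b∈)
    ...   | inj₂ q = ⊥-elim (∈ᵇ-false {U} pb q)
    ...   | inj₁ q with ∈-∃++ q
    ...     | ys , zs , eq′ = NonAT-tail b∉ (subst (_< dg U b) (≡.sym (h0 b∈ b∉)) (dg-pos {U} (∈ᵇ-true {U} pa) (flipA e)))
                (go k (ys ++ zs) (b ∷ U) len (there u₀∈) p′ (λ { (here refl) → b∈ ; (there r) → i r }) (λ v∈ v∉ → h0 v∈ (v∉ ∘ there)))
      where
      b∉ : b ∉ U
      b∉ = ∈ᵇ-false {U} pb
      len : length (ys ++ zs) ≡ k
      len = ℕₚ.suc-injective (≡.trans (≡.sym (↭ₚ.↭-length (↭ₚ.shift b ys zs))) (≡.trans (cong length (≡.sym eq′)) eq))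
      p′ : W ↭ (ys ++ zs) ++ b ∷ U
      p′ = ↭-trans (subst (λ l → W ↭ l ++ U) eq′ p) (↭-trans (↭ₚ.++⁺ʳ U (↭ₚ.shift b ys zs)) (↭-sym (↭ₚ.shift b (ys ++ zs) U)))

  -- Induced paths and their contraction inside larger subgraphs.

  data IP : V → List V → Set where
    one  : ∀ {a} → IP a []
    cons : ∀ {a b qs} → A a b ≡ true → (∀ {z} → z ∈ qs → A a z ≡ false) → a ∉ qs → IP b qs → IP a (b ∷ qs)

  -- For `g = A v` this says that the path from `y` can be prolonged by `v` and remains induced; for
  -- other `g` it marks a path that stops at the first vertex with property `g`.
  Hit : (V → Bool) → V → List V → Set
  Hit g y []       = g y ≡ true
  Hit g y (z ∷ zs) = g y ≡ false × Hit g z zs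

  HitZ : V → V → List V → Set
  HitZ v u []       = A v u ≡ true
  HitZ v u (z ∷ zs) = Hit (A v) z zs

  -- Z is the list of interior vertices of an induced path from u to v (except that u ~ v is allowed).
  Leg : V → List V → V → Set
  Leg u Z v = IP u Z × HitZ v u Z × v ∉ u ∷ Z

  ip-unique : ∀ {a qs} → IP a qs → Unique (a ∷ qs)
  ip-unique one = [] ∷ []
  ip-unique (cons e f a∉ p) = ((A-≢ e) ∷ All.tabulate (λ q r → a∉ (subst (_∈ _) (≡.sym r) q))) ∷ ip-unique p

  filterᵇ-two : ∀ (p : V → Bool) {xs u v} → Unique xs → u ∈ xs → v ∈ xs → u ≢ v → p u ≡ true → p v ≡ true →
    (∀ {x} → x ∈ xs → x ≢ u → x ≢ v → p x ≡ false) → filterᵇ p xs ↭ u ∷ v ∷ []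
  filterᵇ-two p (ne ∷ un) (here refl) (here refl) u≢v pu pv e = ⊥-elim (u≢v ≡.refl)
  filterᵇ-two p (ne ∷ un) (here refl) (there q) u≢v pu pv e = ↭-reflexive (≡.trans (filterᵇ-true p pu) (cong (_ ∷_)
    (filterᵇ-one p un q pv (λ r x≢v → e (there r) (λ { refl → All.lookup ne r ≡.refl }) x≢v))))
  filterᵇ-two p (ne ∷ un) (there q) (here refl) u≢v pu pv e = ↭-trans (↭-reflexive (≡.trans (filterᵇ-true p pv) (cong (_ ∷_)
    (filterᵇ-one p un q pu (λ r x≢u → e (there r) x≢u (λ { refl → All.lookup ne r ≡.refl })))))) (swap _ _ refl)
  filterᵇ-two p (ne ∷ un) (there q) (there r) u≢v pu pv e = ↭-trans
    (↭-reflexive (filterᵇ-false p (e (here refl) (λ { refl → All.lookup ne q ≡.refl }) (λ { refl → All.lookup ne r ≡.refl }))))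
    (filterᵇ-two p un q r u≢v pu pv (e ∘ there))

  tail-edges : ∀ {B v} z zs → Unique B → v ∈ B → IP z zs → Hit (A v) z zs →
    (∀ {y b} → y ∈ z ∷ zs → b ∈ B → b ≢ v → A y b ≡ false) → E ((z ∷ zs) ++ B) ≡ pathE z zs v ++ E B
  tail-edges {B} {v} z [] uB v∈ ip hit no-adj = cong (λ l → star z l ++ E B) (filterᵇ-one (A z) uB v∈ (flipA hit) (no-adj (here refl)))
  tail-edges {B} {v} z (z′ ∷ zs) uB v∈ (cons e f z∉ ip) (miss , hit) no-adj = ≡.trans
    (cong (λ l → star z l ++ E ((z′ ∷ zs) ++ B)) (≡.trans (filterᵇ-true (A z) e) (cong (z′ ∷_) (filterᵇ-none (A z) (zs ++ B) nb))))
    (cong (_ ∷_) (tail-edges z′ zs uB v∈ ip hit (no-adj ∘ there)))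
    where
    nb : ∀ {x} → x ∈ zs ++ B → A z x ≡ false
    nb {x} q with ∈-++⁻ zs q
    ... | inj₁ r = f r
    ... | inj₂ r with x ≟ v
    ...   | yes refl = flipA miss
    ...   | no ne = no-adj (here refl) r ne

  leg-edges : ∀ {B u v} y ys → Unique B → u ∈ B → v ∈ B → u ≢ v → Leg u (y ∷ ys) v →
    (∀ {z b} → z ∈ y ∷ ys → b ∈ B → b ≢ u → b ≢ v → A z b ≡ false) →
    E ((y ∷ ys) ++ B) ↭ ed y u Sign.- ∷ pathE y ys v ++ E B
  leg-edges {B} {u} {v} y [] uB u∈ v∈ u≢v (cons e f u∉ ip , hit , v∉) no-adj =
    ↭ₚ.++⁺ʳ (E B) (↭ₚ.map⁺ _ (filterᵇ-two (A y) uB u∈ v∈ u≢v (flipA e) (flipA hit) (no-adj (here refl))))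
  leg-edges {B} {u} {v} y (y′ ∷ ys) uB u∈ v∈ u≢v (cons e f u∉ (cons e′ f′ y∉ ip) , (miss , hit) , v∉) no-adj =
    ↭-trans (↭-reflexive (cong₂ (λ l m → star y l ++ m) first
      (tail-edges y′ ys uB v∈ ip hit rest))) (swap _ _ refl)
    where
    first : filterᵇ (A y) (y′ ∷ ys ++ B) ≡ y′ ∷ u ∷ []
    first = ≡.trans (filterᵇ-true (A y) e′) (cong (y′ ∷_) (≡.trans (Listₚ.filter-++ (T? ∘ A y) ys B)
      (cong₂ _++_ (filterᵇ-none (A y) ys f′) (filterᵇ-one (A y) uB u∈ (flipA e) oth))))
      where
      oth : ∀ {x} → x ∈ B → x ≢ u → A y x ≡ false
      oth {x} q x≢u with x ≟ v
      ... | yes refl = flipA miss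
      ... | no x≢v = no-adj (here refl) q x≢u x≢v
    rest : ∀ {z b} → z ∈ y′ ∷ ys → b ∈ B → b ≢ v → A z b ≡ false
    rest {z} {b} z∈ b∈ b≢v with b ≟ u
    ... | yes refl = flipA (f z∈)
    ... | no b≢u = no-adj (there z∈) b∈ b≢u b≢v

  -- All that a coefficient sees of a leg. A leg without interior vertices is an edge of the base,
  -- already counted there, and adds nothing; any other leg adds an edge whose sign is the parity of
  -- its length.
  data LegT : Set where
    triv : LegT
    ear  : Sign → LegT

  legT : List V → LegT
  legT []       = triv
  legT (_ ∷ ys) = ear (psign Sign.- ys)

  legE : ∀ {k} → Fin k → LegT → Fin k → List (SEdge k)
  legE i triv    j = []
  legE i (ear s) j = ed i j s ∷ []

  isTriv : LegT → Bool
  isTriv triv    = true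
  isTriv (ear _) = false

  -- U is B together with induced paths joining vertices of B; es are the edges to which these contract.
  data Build (h : V → ℕ) (B : List V) : List V → List (SEdge (n G)) → Set where
    base : Build h B B []
    leg  : ∀ {U es} u Z v → Build h B U es → u ∈ B → v ∈ B → u ≢ v → Leg u Z v →
           (∀ {z b} → z ∈ Z → b ∈ U → b ≢ u → b ≢ v → A z b ≡ false) → (∀ {z} → z ∈ Z → z ∉ U) →
           (∀ {z} → z ∈ Z → h z ≡ 0) → Build h B (Z ++ U) (legE u (legT Z) v ++ es)

  build-⊇ : ∀ {h B U es} → Build h B U es → ∀ {z} → z ∈ B → z ∈ U
  build-⊇ base q = q
  build-⊇ (leg u Z v b _ _ _ _ _ _ _) q = ∈-++⁺ʳ Z (build-⊇ b q)

  build-unique : ∀ {h B U es} → Build h B U es → Unique B → Unique U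
  build-unique base u = u
  build-unique (leg u [] v b _ _ _ _ _ _ _) uB = build-unique b uB
  build-unique (leg u (y ∷ ys) v b _ _ _ (ip , _) _ dis _) uB = Uniqueₚ.++⁺ (unique-tail (ip-unique ip)) (build-unique b uB) (λ { (p , q) → dis p q })

  -- The outermost leg is contracted first. `es′` holds the edges obtained so far; their ends lie in
  -- `B`, so they do not touch the interiors of the remaining legs.
  build-AT′ : ∀ {h B U es} es′ → Build h B U es → Unique B → All (λ e → src e ∈ B × tgt e ∈ B) es′ →
    ATe h B (es′ ++ es ++ E B) → ATe h U (es′ ++ E U)
  build-AT′ es′ base uB ends at = at
  build-AT′ es′ (leg u [] v b _ _ _ _ _ _ _) uB ends at = build-AT′ es′ b uB ends at
  build-AT′ {h} {B} es′ (leg {U} {es} u (y ∷ ys) v b u∈ v∈ u≢v lg@(ip , _ , v∉) no-adj dis h0) uB ends at =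
    ATe-≃ (↭⇒≃ (↭-trans moved (↭ₚ.++⁺ˡ es′ (↭-sym (leg-edges y ys (build-unique b uB) (build-⊇ b u∈) (build-⊇ b v∈) u≢v lg no-adj)))))
      (contract-path y ys Sign.- (unique-tail (ip-unique ip)) h0 fr
        (build-AT′ (ed u v (psign Sign.- ys) ∷ es′) b uB ((u∈ , v∈) ∷ ends) (ATe-≃ (↭⇒≃ (↭ₚ.shift (ed u v (psign Sign.- ys)) es′ (es ++ E B))) at)))
    where
    fr : ∀ {z} → z ∈ y ∷ ys → Fresh z (es′ ++ E U) × z ∉ U × u ≢ z × v ≢ z
    fr z∈ = Allₚ.++⁺ (fresh-in (dis z∈) (All.map (λ { (p , q) → build-⊇ b p , build-⊇ b q }) ends)) (fresh-in (dis z∈) (edges-in U)) ,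
            dis z∈ , (λ { refl → dis z∈ (build-⊇ b u∈) }) , (λ { refl → dis z∈ (build-⊇ b v∈) })
    moved : ed y u Sign.- ∷ pathE y ys v ++ es′ ++ E U ↭ es′ ++ (ed y u Sign.- ∷ pathE y ys v ++ E U)
    moved = ↭ₚ.shifts (ed y u Sign.- ∷ pathE y ys v) es′

  build-AT : ∀ {h B U es} → Build h B U es → Unique B → ATe h B (es ++ E B) → ATe h U (E U)
  build-AT b uB at = build-AT′ [] b uB [] at

  -- Small signed graphs given by tables, with computed coefficients.

  Rows : ℕ → Set
  Rows zero    = ⊤
  Rows (suc k) = Vec Bool k × Rows k

  RowF : ∀ {k} → V → Vec V k → Vec Bool k → Set
  RowF x []       []       = ⊤
  RowF x (y ∷ ys) (b ∷ bs) = A x y ≡ b × RowF x ys bs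

  Facts : ∀ {k} → Vec V k → Rows k → Set
  Facts []       _        = ⊤
  Facts (x ∷ ys) (r , rs) = RowF x ys r × Facts ys rs

  rowE : ∀ {k} → Vec Bool k → List (Fin k)
  rowE [] = []
  rowE (true ∷ bs) = zero ∷ map suc (rowE bs)
  rowE (false ∷ bs) = map suc (rowE bs)

  -- A table of type `Rows k` is the strict upper triangle of an adjacency matrix.
  smallE : ∀ {k} → Rows k → List (SEdge k)
  smallE {zero}  _        = []
  smallE {suc k} (r , rs) = star zero (map suc (rowE r)) ++ map (mapE suc) (smallE rs)

  row-edges : ∀ {k} x (ys : Vec V k) r → RowF x ys r → filterᵇ (A x) (Vec.toList ys) ≡ map (lookup ys) (rowE r)
  row-edges x [] [] _ = refl
  row-edges x (y ∷ ys) (true ∷ r) (e , f) = ≡.trans (filterᵇ-true (A x) e) (cong (y ∷_) (≡.trans (row-edges x ys r f) (Listₚ.map-∘ (rowE r))))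
  row-edges x (y ∷ ys) (false ∷ r) (e , f) = ≡.trans (filterᵇ-false (A x) e) (≡.trans (row-edges x ys r f) (Listₚ.map-∘ (rowE r)))

  small-edges : ∀ {k} (vs : Vec V k) rs → Facts vs rs → E (Vec.toList vs) ≡ map (mapE (lookup vs)) (smallE rs)
  small-edges [] _ _ = refl
  small-edges (x ∷ ys) (r , rs) (f , fs) = ≡.trans (cong₂ _++_
      (≡.trans (cong (star x) (row-edges x ys r f)) (≡.trans (≡.sym (Listₚ.map-∘ (rowE r))) (≡.trans (Listₚ.map-∘ (rowE r)) (Listₚ.map-∘ (map suc (rowE r))))))
      (≡.trans (small-edges ys rs fs) (Listₚ.map-∘ (smallE rs))))
    (≡.sym (Listₚ.map-++ (mapE (lookup (x ∷ ys))) (star zero (map suc (rowE r))) (map (mapE suc) (smallE rs))))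

  -- By convention `x`, if it occurs in a table, has index 0.
  h₀ : ∀ {k} → Fin k → ℕ
  h₀ zero    = 1
  h₀ (suc _) = 0

  nonzeroᵇ : ℤ → Bool
  nonzeroᵇ (ℤ.+ zero) = false
  nonzeroᵇ _          = true

  nonzeroᵇ-sound : ∀ z → T (nonzeroᵇ z) → z ≢ 0ℤ
  nonzeroᵇ-sound (ℤ.+ suc _) _ ()
  nonzeroᵇ-sound ℤ.-[1+ _ ] _ ()

  okᵇ : ∀ {k} → List (SEdge k) → Vec ℕ k → Bool
  okᵇ es m = allFinᵇ (λ i → lookup m i + h₀ i <ᵇ degE es i) ∧ nonzeroᵇ (coef es m)

  allL : (LegT → Bool) → Bool
  allL p = p triv ∧ p (ear Sign.+) ∧ p (ear Sign.-)

  allL-sound : ∀ p → T (allL p) → ∀ l → T (p l)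
  allL-sound p t triv = proj₁ (∧-T {p triv} t)
  allL-sound p t (ear Sign.+) = proj₁ (∧-T {p (ear Sign.+)} (proj₂ (∧-T {p triv} t)))
  allL-sound p t (ear Sign.-) = proj₂ (∧-T {p (ear Sign.+)} (proj₂ (∧-T {p triv} t)))

  lookup-inj : ∀ {k} (vs : Vec V k) → Unique (Vec.toList vs) → Injective (lookup vs)
  lookup-inj (x ∷ vs) (ne ∷ u) {zero} {zero} e = refl
  lookup-inj (x ∷ vs) (ne ∷ u) {zero} {suc j} e = ⊥-elim (All.lookup ne (mem vs j) e)
    where mem : ∀ {k} (vs : Vec V k) j → lookup vs j ∈ Vec.toList vs
          mem (x ∷ vs) zero = here refl
          mem (x ∷ vs) (suc j) = there (mem vs j)
  lookup-inj (x ∷ vs) (ne ∷ u) {suc i} {zero} e = ⊥-elim (All.lookup ne (mem vs i) (≡.sym e))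
    where mem : ∀ {k} (vs : Vec V k) j → lookup vs j ∈ Vec.toList vs
          mem (x ∷ vs) zero = here refl
          mem (x ∷ vs) (suc j) = there (mem vs j)
  lookup-inj (x ∷ vs) (ne ∷ u) {suc i} {suc j} e = cong suc (lookup-inj vs u e)

  tabulate-lookup : ∀ {k} (vs : Vec V k) → tabulate (lookup vs) ≡ Vec.toList vs
  tabulate-lookup [] = refl
  tabulate-lookup (x ∷ vs) = cong (x ∷_) (tabulate-lookup vs)

  -- Since `h` is only required to be at most `h₀`, the same criterion serves subgraphs through `x`
  -- and subgraphs avoiding it.
  small-AT : ∀ {k} {h : V → ℕ} (vs : Vec V k) rs es₀ m → Unique (Vec.toList vs) → Facts vs rs → (∀ i → h (lookup vs i) ≤ h₀ i) →
    T (okᵇ (es₀ ++ smallE rs) m) → ATe h (Vec.toList vs) (map (mapE (lookup vs)) es₀ ++ E (Vec.toList vs))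
  small-AT {h = h} vs rs es₀ m u f hb t rewrite small-edges vs rs f | ≡.sym (Listₚ.map-++ (mapE (lookup vs)) es₀ (smallE rs)) =
    subst (λ l → ATe h l (map (mapE (lookup vs)) (es₀ ++ smallE rs))) (tabulate-lookup vs)
      (ATe-ι (lookup vs) (lookup-inj vs u) (es₀ ++ smallE rs) m
        (λ i → ℕₚ.≤-<-trans (ℕₚ.+-monoʳ-≤ (lookup m i) (hb i)) (ℕₚ.<ᵇ⇒< _ _ (allFinᵇ-sound (λ i → lookup m i + h₀ i <ᵇ degE (es₀ ++ smallE rs) i) (proj₁ both) i)))
        (nonzeroᵇ-sound _ (proj₂ both)))
    where both = ∧-T {allFinᵇ (λ i → lookup m i + h₀ i <ᵇ degE (es₀ ++ smallE rs) i)} t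

  -- Non-adjacency of paths, and subgraphs assembled from a table and legs.

  NA : List V → List V → Set
  NA X Y = ∀ {a b} → a ∈ X → b ∈ Y → A a b ≡ false × a ≢ b

  NA-sym : ∀ {X Y} → NA X Y → NA Y X
  NA-sym f p q = let e , ne = f q p in flipA e , ne ∘ ≡.sym

  NA-⊆ : ∀ {X Y X′ Y′} → (∀ {z} → z ∈ X′ → z ∈ X) → (∀ {z} → z ∈ Y′ → z ∈ Y) → NA X Y → NA X′ Y′
  NA-⊆ i j f p q = f (i p) (j q)

  NA-[] : ∀ {Y} → NA [] Y
  NA-[] ()

  NA-∷ : ∀ {a X Y} → NA (a ∷ []) Y → NA X Y → NA (a ∷ X) Y
  NA-∷ f g (here refl) q = f (here refl) q
  NA-∷ f g (there p) q = g p q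

  Off : List V → List V → V → V → Set
  Off Z U u v = ∀ {z b} → z ∈ Z → b ∈ U → b ≢ u → b ≢ v → A z b ≡ false × z ≢ b

  off-[] : ∀ {Z u v} → Off Z [] u v
  off-[] _ ()

  off-++ : ∀ {Z Y U u v} → NA Z Y → Off Z U u v → Off Z (Y ++ U) u v
  off-++ {Y = Y} f g p q b≢u b≢v with ∈-++⁻ Y q
  ... | inj₁ r = f p r
  ... | inj₂ r = g p r b≢u b≢v

  off-∷ : ∀ {Z y U u v} → NA Z (y ∷ []) → Off Z U u v → Off Z (y ∷ U) u v
  off-∷ f g = off-++ {Y = _ ∷ []} f g

  off-src : ∀ {Z U u v} → Off Z U u v → Off Z (u ∷ U) u v
  off-src g p (here refl) b≢u _ = ⊥-elim (b≢u ≡.refl)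
  off-src g p (there q) b≢u b≢v = g p q b≢u b≢v

  off-tgt : ∀ {Z U u v} → Off Z U u v → Off Z (v ∷ U) u v
  off-tgt g p (here refl) _ b≢v = ⊥-elim (b≢v ≡.refl)
  off-tgt g p (there q) b≢u b≢v = g p q b≢u b≢v

  -- The form of `Build` whose legs refer to indices of the table, so that the edges obtained by
  -- contraction can be appended to the table and evaluated together with it.
  data Bld (h : V → ℕ) {k} (vs : Vec V k) : List V → List (SEdge k) → Set where
    base : Bld h vs (Vec.toList vs) []
    leg  : ∀ {U es} i Z j → lookup vs i ≢ lookup vs j → Leg (lookup vs i) Z (lookup vs j) → Off Z U (lookup vs i) (lookup vs j) →
           (∀ {z} → z ∈ Z → h z ≡ 0) → Bld h vs U es → Bld h vs (Z ++ U) (legE i (legT Z) j ++ es)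

  lookup-∈ : ∀ {k} (vs : Vec V k) i → lookup vs i ∈ Vec.toList vs
  lookup-∈ (x ∷ vs) zero = here refl
  lookup-∈ (x ∷ vs) (suc i) = there (lookup-∈ vs i)

  legE-map : ∀ {k} (ι : Fin k → V) i l j → map (mapE ι) (legE i l j) ≡ legE (ι i) l (ι j)
  legE-map ι i triv j = refl
  legE-map ι i (ear s) j = refl

  leg-∉ : ∀ {u Z v z} → Leg u Z v → z ∈ Z → z ≢ u × z ≢ v
  leg-∉ (ip , _ , v∉) q = (λ { refl → unique-head (ip-unique ip) q }) , (λ { refl → v∉ (there q) })

  toBuild : ∀ {h k} {vs : Vec V k} {U es} → Bld h vs U es → Build h (Vec.toList vs) U (map (mapE (lookup vs)) es)
  toBuild base = base
  toBuild {vs = vs} (leg {U} {es} i Z j ne lg off h0 b)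
    rewrite Listₚ.map-++ (mapE (lookup vs)) (legE i (legT Z) j) es | legE-map (lookup vs) i (legT Z) j =
    leg (lookup vs i) Z (lookup vs j) (toBuild b) (lookup-∈ vs i) (lookup-∈ vs j) ne lg
      (λ p q b≢u b≢v → proj₁ (off p q b≢u b≢v))
      (λ {z} p q → case z ≟ lookup vs i of λ { (yes e) → proj₁ (leg-∉ lg p) e ; (no ne₁) → case z ≟ lookup vs j of λ
         { (yes e) → proj₂ (leg-∉ lg p) e ; (no ne₂) → proj₂ (off p q ne₁ ne₂) ≡.refl } })
      h0

  -- Cutting induced paths at prescribed vertices.

  data FirstIn (P : V → Bool) (R : List V) : Set where
    none : (∀ {z} → z ∈ R → P z ≡ false) → FirstIn P R
    some : ∀ M r S → R ≡ M ++ r ∷ S → P r ≡ true → (∀ {z} → z ∈ M → P z ≡ false) → FirstIn P R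

  firstIn : ∀ P R → FirstIn P R
  firstIn P [] = none λ ()
  firstIn P (r ∷ R) with P r in e
  ... | true = some [] r R refl e λ ()
  ... | false with firstIn P R
  ...   | none f = none λ { (here refl) → e ; (there q) → f q }
  ...   | some M r′ S eq p f = some (r ∷ M) r′ S (cong (r ∷_) eq) p λ { (here refl) → e ; (there q) → f q }

  data LastIn (P : V → Bool) (R : List V) : Set where
    none : (∀ {z} → z ∈ R → P z ≡ false) → LastIn P R
    some : ∀ M r S → R ≡ M ++ r ∷ S → P r ≡ true → (∀ {z} → z ∈ S → P z ≡ false) → LastIn P R

  lastIn : ∀ P R → LastIn P R
  lastIn P [] = none λ ()
  lastIn P (r ∷ R) with lastIn P R
  ... | some M r′ S eq p f = some (r ∷ M) r′ S (cong (r ∷_) eq) p f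
  ... | none f with P r in e
  ...   | true = some [] r R refl e f
  ...   | false = none λ { (here refl) → e ; (there q) → f q }

  ip-suffix : ∀ {a} M {r S} → IP a (M ++ r ∷ S) → IP r S
  ip-suffix [] (cons _ _ _ ip) = ip
  ip-suffix (m ∷ M) (cons _ _ _ ip) = ip-suffix M ip

  ip-suffix′ : ∀ {t Z} M {q S} → t ∷ Z ≡ M ++ q ∷ S → IP t Z → IP q S
  ip-suffix′ [] refl ip = ip
  ip-suffix′ (m ∷ M) refl ip = ip-suffix M ip

  ip-prefix : ∀ {a} M {S} → IP a (M ++ S) → IP a M
  ip-prefix [] ip = one
  ip-prefix (m ∷ M) (cons e f a∉ ip) = cons e (f ∘ ∈-++⁺ˡ) (a∉ ∘ ∈-++⁺ˡ) (ip-prefix M ip)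

  hit-suffix : ∀ {g a} M {r S} → Hit g a (M ++ r ∷ S) → Hit g r S
  hit-suffix [] (_ , ht) = ht
  hit-suffix (m ∷ M) (_ , ht) = hit-suffix M ht

  hit-suffix′ : ∀ {g t Z} M {q S} → t ∷ Z ≡ M ++ q ∷ S → Hit g t Z → Hit g q S
  hit-suffix′ [] refl ht = ht
  hit-suffix′ (m ∷ M) refl ht = hit-suffix M ht

  hit-⊥ : ∀ {g a} M {r S} → Hit g a (M ++ r ∷ S) → ∀ {z} → z ∈ a ∷ M → g z ≡ false
  hit-⊥ [] (e , _) (here refl) = e
  hit-⊥ (m ∷ M) (e , ht) (here refl) = e
  hit-⊥ (m ∷ M) (e , ht) (there q) = hit-⊥ M ht q

  -- On an induced path, the initial segment before p is itself an induced path hitting N(p) at its end only.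
  ip-hit : ∀ {a} M {p S} → IP a (M ++ p ∷ S) → Hit (A p) a M
  ip-hit [] (cons e _ _ _) = flipA e
  ip-hit (m ∷ M) (cons _ f _ ip) = flipA (f (∈-++⁺ʳ M (here refl))) , ip-hit M ip

  hit→Z : ∀ {v u} Z → Hit (A v) u Z → HitZ v u Z
  hit→Z [] e = e
  hit→Z (z ∷ zs) (_ , ht) = ht

  hit-isTriv : ∀ {v u} Z → Hit (A v) u Z → A v u ≡ isTriv (legT Z)
  hit-isTriv [] e = e
  hit-isTriv (_ ∷ _) (e , _) = e

  hitZ-snoc : ∀ {v u} M {r} → A v r ≡ true → (∀ {z} → z ∈ M → A v z ≡ false) → HitZ v u (M ++ r ∷ [])
  hitZ-snoc [] e f = e
  hitZ-snoc (m ∷ M) e f = go m M f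
    where
    go : ∀ m M → (∀ {z} → z ∈ m ∷ M → _ ≡ false) → Hit (A _) m (M ++ _ ∷ [])
    go m [] f = f (here refl) , e
    go m (m′ ∷ M) f = f (here refl) , go m′ M (f ∘ there)

  ip-nohead : ∀ {q m M S} → IP q (m ∷ M ++ S) → ∀ {z} → z ∈ S → A q z ≡ false × q ≢ z
  ip-nohead {M = M} (cons _ f q∉ _) z∈ = f (∈-++⁺ʳ M z∈) , (λ { refl → q∉ (∈-++⁺ʳ M z∈) })

  ip-head : ∀ {q r S} → IP q (r ∷ S) → ∀ {z} → z ∈ S → A q z ≡ false × q ≢ z
  ip-head (cons _ f q∉ _) z∈ = f z∈ , (λ { refl → q∉ z∈ })

  h-other : ∀ {x z : V} → z ≢ x → h x z ≡ 0
  h-other {x} {z} ne with x ≟ z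
  ... | yes e = ⊥-elim (ne (≡.sym e))
  ... | no _ = refl

  h-same : ∀ (x : V) → h x x ≡ 1
  h-same x with x ≟ x
  ... | yes _ = refl
  ... | no ne = ⊥-elim (ne refl)

  h-≤1 : ∀ (x z : V) → h x z ≤ 1
  h-≤1 x z with x ≟ z
  ... | yes _ = ℕₚ.≤-refl
  ... | no _ = z≤n

  allLs : ∀ {k} → (Vec LegT k → Bool) → Bool
  allLs {zero}  p = p []
  allLs {suc k} p = allL λ l → allLs (p ∘ (l ∷_))

  allLs-sound : ∀ {k} (p : Vec LegT k → Bool) → T (allLs p) → ∀ ls → T (p ls)
  allLs-sound p t [] = t
  allLs-sound p t (l ∷ ls) = allLs-sound (p ∘ (l ∷_)) (allL-sound (λ l → allLs (p ∘ (l ∷_))) t l) ls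

  -- A theta graph contracts to three parallel edges. The coefficient of x_p x_q^2 in the product of
  -- the factors x_q + s_i x_p is s_1 + s_2 + s_3, an odd number. In a simple graph only one of the
  -- three paths can be an edge, taken to be the first.
  thetaP : Vec LegT 3 → Bool
  thetaP (l ∷ ear s ∷ ear t ∷ []) = okᵇ ((legE (suc zero) l zero ++ ed (suc zero) zero s ∷ ed (suc zero) zero t ∷ []) ++ smallE {2} ((isTriv l ∷ []) , [] , tt)) (1 ∷ 2 ∷ [])
  thetaP _ = true

  -- Graphs without cut vertex that are not AT, and the exclusion of theta graphs.

  record Setting (W : List V) (x : V) : Set where
    field
      uW    : Unique W
      x∈W   : x ∈ W
      con   : Conn W
      noCut : ∀ {p} → p ∈ W → Conn (W ─ (p ∷ []))
      na    : NonAT (h x) W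
      d2    : 2 ≤ dg (W ─ (x ∷ [])) x

  module Core {W : List V} {x : V} (S : Setting W x) where

    open Setting S public

    H : List V
    H = W ─ (x ∷ [])

    H⊆W : ∀ {z} → z ∈ H → z ∈ W
    H⊆W q = proj₁ (∈-─⁻ {W} {x ∷ []} q)

    H-≢ : ∀ {z} → z ∈ H → z ≢ x
    H-≢ q refl = proj₂ (∈-─⁻ {W} {x ∷ []} q) (here refl)

    ∈-H : ∀ {z} → z ∈ W → z ≢ x → z ∈ H
    ∈-H q ne = ∈-─⁺ q λ { (here e) → ne e }

    killX : ∀ {U} → Unique U → x ∈ U → (∀ {v} → v ∈ U → v ∈ W) → ATe (h x) U (E U) → ⊥
    killX uU x∈ i = NonAT-sub con uW uU x∈ i (λ _ v∉ → h-other (λ { refl → v∉ x∈ })) na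

    -- `x` itself may be the vertex added last. Its bound asks for more than `h x x ≡ 1` neighbours
    -- in `H`, which is what `d2` provides.
    naH : NonAT (h x) H
    naH = NonAT-tail (λ q → H-≢ q ≡.refl) (subst (_< dg H x) (≡.sym (h-same x)) d2)
            (NonAT-sub con uW ((All.tabulate λ q e → H-≢ q (≡.sym e)) ∷ Unique-─ (x ∷ []) uW) (here refl) (λ { (here refl) → x∈W ; (there q) → H⊆W q })
               (λ _ v∉ → h-other (λ { refl → v∉ (here refl) })) na)

    killH : ∀ {U u₀} → Unique U → u₀ ∈ U → (∀ {v} → v ∈ U → v ∈ H) → ATe (h x) U (E U) → ⊥
    killH uU u₀∈ i = NonAT-sub (noCut x∈W) (Unique-─ (x ∷ []) uW) uU u₀∈ i (λ q _ → h-other (H-≢ q)) naH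

    hH : ∀ {Z} → (∀ {z} → z ∈ Z → z ∈ H) → ∀ {z} → z ∈ Z → h x z ≡ 0
    hH f q = h-other (H-≢ (f q))

    -- The vector consists of the branch vertices behind `x`, and the legs replace edges between
    -- them. With the geometry recorded in `Bld`, a whole family of subgraphs is refuted by one
    -- Boolean.
    certX : ∀ {k U} {es : List (SEdge (suc k))} (vs : Vec V k) rs m → Bld (h x) (x ∷ vs) U es → Unique (Vec.toList (x ∷ vs)) → Facts (x ∷ vs) rs →
      (∀ {z} → z ∈ U → z ∈ W) → T (okᵇ (es ++ smallE rs) m) → ⊥
    certX {es = es} vs rs m b u f i t = killX (build-unique (toBuild b) u) (build-⊇ (toBuild b) (here refl)) i
      (build-AT (toBuild b) u (small-AT (x ∷ vs) rs es m u f hb t))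
      where
      hb : ∀ j → h x (lookup (x ∷ vs) j) ≤ h₀ j
      hb zero = h-≤1 x x
      hb (suc j) = ℕₚ.≤-reflexive (h-other (λ e → unique-head u (subst (_∈ Vec.toList vs) e (lookup-∈ vs j))))

    certH : ∀ {k U} {es : List (SEdge (suc k))} (vs : Vec V (suc k)) rs m → Bld (h x) vs U es → Unique (Vec.toList vs) → Facts vs rs →
      (∀ {z} → z ∈ U → z ∈ H) → T (okᵇ (es ++ smallE rs) m) → ⊥
    certH {es = es} vs rs m b u f i t = killH (build-unique (toBuild b) u) (build-⊇ (toBuild b) (lookup-∈ vs zero)) i
      (build-AT (toBuild b) u (small-AT vs rs es m u f (λ j → ℕₚ.≤-trans (ℕₚ.≤-reflexive (h-other (H-≢ (i (build-⊇ (toBuild b) (lookup-∈ vs j)))))) z≤n) t))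

    theta-bld : ∀ {p q} Z y₂ ys₂ y₃ ys₃ → p ≢ q → Leg q Z p → Leg q (y₂ ∷ ys₂) p → Leg q (y₃ ∷ ys₃) p →
      NA Z (y₂ ∷ ys₂) → NA Z (y₃ ∷ ys₃) → NA (y₂ ∷ ys₂) (y₃ ∷ ys₃) → (∀ {z} → z ∈ Z ++ (y₂ ∷ ys₂) ++ (y₃ ∷ ys₃) → z ∈ H) →
      Bld (h x) (p ∷ q ∷ []) (Z ++ (y₂ ∷ ys₂) ++ (y₃ ∷ ys₃) ++ p ∷ q ∷ []) (legE {2} (suc zero) (legT Z) zero ++ ed (suc zero) zero (psign Sign.- ys₂) ∷ ed (suc zero) zero (psign Sign.- ys₃) ∷ [])
    theta-bld {p} {q} Z y₂ ys₂ y₃ ys₃ p≢q l₁ l₂ l₃ n₁₂ n₁₃ n₂₃ i =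
      leg (suc zero) Z zero (p≢q ∘ ≡.sym) l₁ (off-++ n₁₂ (off-++ n₁₃ hubs)) (hH (i ∘ ∈-++⁺ˡ))
      (leg (suc zero) (y₂ ∷ ys₂) zero (p≢q ∘ ≡.sym) l₂ (off-++ n₂₃ hubs) (hH (i ∘ ∈-++⁺ʳ Z ∘ ∈-++⁺ˡ))
      (leg (suc zero) (y₃ ∷ ys₃) zero (p≢q ∘ ≡.sym) l₃ hubs (hH (i ∘ ∈-++⁺ʳ Z ∘ ∈-++⁺ʳ (y₂ ∷ ys₂)))
      base))
      where
      hubs : ∀ {Z} → Off Z (p ∷ q ∷ []) q p
      hubs = off-tgt (off-src off-[])

    thetaH : ∀ {p q} Z y₂ ys₂ y₃ ys₃ → p ∈ H → q ∈ H → p ≢ q → Leg q Z p → Leg q (y₂ ∷ ys₂) p → Leg q (y₃ ∷ ys₃) p →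
      A p q ≡ isTriv (legT Z) →
      NA Z (y₂ ∷ ys₂) → NA Z (y₃ ∷ ys₃) → NA (y₂ ∷ ys₂) (y₃ ∷ ys₃) → (∀ {z} → z ∈ Z ++ (y₂ ∷ ys₂) ++ (y₃ ∷ ys₃) → z ∈ H) → ⊥
    thetaH {p} {q} Z y₂ ys₂ y₃ ys₃ p∈ q∈ p≢q l₁ l₂ l₃ e n₁₂ n₁₃ n₂₃ i =
      certH (p ∷ q ∷ []) ((isTriv (legT Z) ∷ []) , [] , tt) (1 ∷ 2 ∷ []) (theta-bld Z y₂ ys₂ y₃ ys₃ p≢q l₁ l₂ l₃ n₁₂ n₁₃ n₂₃ i)
        ((p≢q ∷ []) ∷ [] ∷ []) ((e , tt) , tt , tt)
        (λ r → case ∈-++⁻ Z r of λ { (inj₁ r) → i (∈-++⁺ˡ r) ; (inj₂ r) → case ∈-++⁻ (y₂ ∷ ys₂) r of λ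
          { (inj₁ r) → i (∈-++⁺ʳ Z (∈-++⁺ˡ r)) ; (inj₂ r) → case ∈-++⁻ (y₃ ∷ ys₃) r of λ { (inj₁ r) → i (∈-++⁺ʳ Z (∈-++⁺ʳ (y₂ ∷ ys₂) r)) ; (inj₂ (here refl)) → p∈ ; (inj₂ (there (here refl))) → q∈ } } })
        (allLs-sound thetaP tt (legT Z ∷ legT (y₂ ∷ ys₂) ∷ legT (y₃ ∷ ys₃) ∷ []))

    thetaX : ∀ {q} Z y₂ ys₂ y₃ ys₃ → q ∈ H → Leg q Z x → Leg q (y₂ ∷ ys₂) x → Leg q (y₃ ∷ ys₃) x →
      A x q ≡ isTriv (legT Z) →
      NA Z (y₂ ∷ ys₂) → NA Z (y₃ ∷ ys₃) → NA (y₂ ∷ ys₂) (y₃ ∷ ys₃) → (∀ {z} → z ∈ Z ++ (y₂ ∷ ys₂) ++ (y₃ ∷ ys₃) → z ∈ H) → ⊥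
    thetaX {q} Z y₂ ys₂ y₃ ys₃ q∈ l₁ l₂ l₃ e n₁₂ n₁₃ n₂₃ i =
      certX (q ∷ []) ((isTriv (legT Z) ∷ []) , [] , tt) (1 ∷ 2 ∷ []) (theta-bld Z y₂ ys₂ y₃ ys₃ x≢q l₁ l₂ l₃ n₁₂ n₁₃ n₂₃ i)
        ((x≢q ∷ []) ∷ [] ∷ []) ((e , tt) , tt , tt)
        (λ r → case ∈-++⁻ Z r of λ { (inj₁ r) → H⊆W (i (∈-++⁺ˡ r)) ; (inj₂ r) → case ∈-++⁻ (y₂ ∷ ys₂) r of λ
          { (inj₁ r) → H⊆W (i (∈-++⁺ʳ Z (∈-++⁺ˡ r))) ; (inj₂ r) → case ∈-++⁻ (y₃ ∷ ys₃) r of λ { (inj₁ r) → H⊆W (i (∈-++⁺ʳ Z (∈-++⁺ʳ (y₂ ∷ ys₂) r))) ; (inj₂ (here refl)) → x∈W ; (inj₂ (there (here refl))) → H⊆W q∈ } } })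
        (allLs-sound thetaP tt (legT Z ∷ legT (y₂ ∷ ys₂) ∷ legT (y₃ ∷ ys₃) ∷ []))
      where
      x≢q : x ≢ q
      x≢q = H-≢ q∈ ∘ ≡.sym

  hit-cong : ∀ {g g′ : V → Bool} z zs → (∀ {y} → y ∈ z ∷ zs → g y ≡ g′ y) → Hit g z zs → Hit g′ z zs
  hit-cong z [] e p = ≡.trans (≡.sym (e (here refl))) p
  hit-cong z (z′ ∷ zs) e (p , q) = ≡.trans (≡.sym (e (here refl))) p , hit-cong z′ zs (e ∘ there) q

  hit-unique : ∀ {g : V → Bool} z zs {b c} → Hit g z zs → b ∈ z ∷ zs → c ∈ z ∷ zs → g b ≡ true → g c ≡ true → b ≡ c
  hit-unique z [] ht (here refl) (here refl) gb gc = refl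
  hit-unique z (z′ ∷ zs) (e , ht) (here refl) q gb gc = absurdᵇ gb e
  hit-unique z (z′ ∷ zs) (e , ht) (there p) (here refl) gb gc = absurdᵇ gc e
  hit-unique z (z′ ∷ zs) (e , ht) (there p) (there q) gb gc = hit-unique z′ zs ht p q gb gc

  hit-end : ∀ {g : V → Bool} z zs → Hit g z zs → Σ V λ e → e ∈ z ∷ zs × g e ≡ true
  hit-end z [] p = z , here refl , p
  hit-end z (z′ ∷ zs) (_ , p) = let e , q , r = hit-end z′ zs p in e , there q , r

  -- Induction on the walk. If `u` already lies on the induced path found for the rest, the path is
  -- cut off there; otherwise `u` is joined to its last neighbour on that path, which keeps the path
  -- induced.
  hit-walk : ∀ {U u v} (g : V → Bool) → Walk U u v → g v ≡ true →
    Σ (List V) λ qs → IP u qs × Hit g u qs × (∀ {z} → z ∈ u ∷ qs → z ∈ U)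
  hit-walk g (stop p) gv = [] , one , gv , λ { (here refl) → p }
  hit-walk g (step {u} {w} u∈ e wk) gv with g u in gu
  ... | true = [] , one , gu , λ { (here refl) → u∈ }
  ... | false with hit-walk g wk gv
  ...   | qs , ip , ht , i with u ∈? (w ∷ qs)
  ...     | yes q with ∈-∃++ q
  ...       | M , S , eq = S , ip-suffix′ M eq ip , hit-suffix′ M eq ht , λ r → i (subst (_ ∈_) (≡.sym eq) (∈-++⁺ʳ M r))
  hit-walk g (step {u} {w} u∈ e wk) gv | false | qs , ip , ht , i | no u∉ with lastIn (A u) (w ∷ qs)
  ... | none f = absurdᵇ e (f (here refl))
  ... | some M r S eq er f = r ∷ S , cons er f (u∉ ∘ inside ∘ there) (ip-suffix′ M eq ip) , (gu , hit-suffix′ M eq ht) ,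
          λ { (here refl) → u∈ ; (there q) → i (inside q) }
    where
    inside : ∀ {z} → z ∈ r ∷ S → z ∈ w ∷ qs
    inside q = subst (_ ∈_) (≡.sym eq) (∈-++⁺ʳ M q)

  adjTo : List V → V → Bool
  adjTo S z = not (null (filterᵇ (A z) S))

  adjTo-true : ∀ S z → adjTo S z ≡ true → Σ V λ s → s ∈ S × A z s ≡ true
  adjTo-true (s ∷ S) z e with A z s in eq
  ... | true = s , here refl , eq
  ... | false = let s′ , q , r = adjTo-true S z e in s′ , there q , r

  adjTo-false : ∀ S z → adjTo S z ≡ false → ∀ {s} → s ∈ S → A z s ≡ false
  adjTo-false (s ∷ S) z e q with A z s in eq
  adjTo-false (s ∷ S) z () q | true
  adjTo-false (s ∷ S) z e (here refl) | false = eq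
  adjTo-false (s ∷ S) z e (there q) | false = adjTo-false S z e q

  true-adjTo : ∀ {S z s} → s ∈ S → A z s ≡ true → adjTo S z ≡ true
  true-adjTo {S} {z} q e with adjTo S z in eq
  ... | true = refl
  ... | false = absurdᵇ e (adjTo-false S z eq q)

  -- Reverse an induced path, keeping track of its part already traversed.
  to-end : ∀ {q L} R → IP q L → IP q R → NA L R → ∀ {g} → Hit g q R → (∀ {z} → z ∈ L → g z ≡ false) →
    Σ V λ e → Σ (List V) λ K → IP e K × g e ≡ true × (∀ {z} → z ∈ K → g z ≡ false) ×
      (∀ {z} → z ∈ q ∷ L ++ R → z ∈ e ∷ K) × (∀ {z} → z ∈ e ∷ K → z ∈ q ∷ L ++ R)
  to-end {q} {L} [] ipL ipR na ht gL = q , L , ipL , ht , gL , (λ { (here e) → here e ; (there p) → there (subst (_ ∈_) (Listₚ.++-identityʳ L) p) }) ,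
    λ { (here e) → here e ; (there p) → there (∈-++⁺ˡ p) }
  to-end {q} {L} (r ∷ R) ipL (cons e f q∉ ipR) na {g} (gq , ht) gL
    with to-end {r} {q ∷ L} R (cons (flipA e) (λ z∈ → flipA (proj₁ (na z∈ (here refl)))) (λ r∈ → proj₂ (na r∈ (here refl)) ≡.refl) ipL) ipR na′ ht gL′
    where
    na′ : NA (q ∷ L) R
    na′ (here refl) b∈ = f b∈ , λ { refl → q∉ b∈ }
    na′ (there a∈) b∈ = na a∈ (there b∈)
    gL′ : ∀ {z} → z ∈ q ∷ L → g z ≡ false
    gL′ (here refl) = gq
    gL′ (there p) = gL p
  ... | e′ , K , ip , ge , gK , i , j = e′ , K , ip , ge , gK , i ∘ mv , mv′ ∘ j
    where
    mv : ∀ {z} → z ∈ q ∷ L ++ r ∷ R → z ∈ r ∷ (q ∷ L) ++ R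
    mv (here p) = there (here p)
    mv (there p) with ∈-++⁻ L p
    ... | inj₁ p′ = there (there (∈-++⁺ˡ p′))
    ... | inj₂ (here p′) = here p′
    ... | inj₂ (there p′) = there (there (∈-++⁺ʳ L p′))
    mv′ : ∀ {z} → z ∈ r ∷ (q ∷ L) ++ R → z ∈ q ∷ L ++ r ∷ R
    mv′ (here p) = there (∈-++⁺ʳ L (here p))
    mv′ (there (here p)) = here p
    mv′ (there (there p)) with ∈-++⁻ L p
    ... | inj₁ p′ = there (∈-++⁺ˡ p′)
    ... | inj₂ p′ = there (∈-++⁺ʳ L (there p′))

  hit-snoc : ∀ {g : V → Bool} {e} M {r} → (∀ {z} → z ∈ e ∷ M → g z ≡ false) → g r ≡ true → Hit g e (M ++ r ∷ [])
  hit-snoc [] f gr = f (here refl) , gr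
  hit-snoc (m ∷ M) f gr = f (here refl) , hit-snoc M (f ∘ there) gr

  -- A triangle joined to `x` by three induced paths.

  module Core₁ {W : List V} {x : V} (S : Setting W x) where

    open Core S public

    -- With `x` appended, an arm is an induced path from `y` to `x`.
    Arm : V → List V → Set
    Arm y Z = IP y Z × Hit (A x) y Z × (∀ {z} → z ∈ y ∷ Z → z ∈ H)

    x∉H : ∀ {Z} → (∀ {z} → z ∈ Z → z ∈ H) → x ∉ Z
    x∉H i p = H-≢ (i p) ≡.refl

    arm-leg : ∀ {y Z} → Arm y Z → Leg y Z x
    arm-leg {Z = Z} (ip , ht , i) = ip , hit→Z Z ht , x∉H i

    -- An induced cycle through `x`, opened at `x` and seen from its vertex `q`: `L` and `R` are the
    -- two ways from `q` to `x`. By `nn`, `q` is a neighbour of `x` exactly if one of these ways is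
    -- empty; `ne` forbids that both are. `line-goto` changes the vertex `q`.
    record Line (q : V) (L R : List V) : Set where
      field
        ipL : IP q L
        ipR : IP q R
        crs : NA L R
        hL  : HitZ x q L
        hR  : HitZ x q R
        nn  : A x q ≡ null L ∨ null R
        ne  : null L ∧ null R ≡ false
        inH : ∀ {z} → z ∈ q ∷ L ++ R → z ∈ H
    open Line public

    line-armR : ∀ {q l L R} → Line q (l ∷ L) R → Hit (A x) q R
    line-armR {R = []} ℓ = hR ℓ
    line-armR {R = r ∷ R} ℓ = nn ℓ , hR ℓ

    line-move : ∀ {q l L R} → Line q (l ∷ L) R → Line l L (q ∷ R)
    line-move {q} {l} {L} {R} ℓ with ipL ℓ
    ... | cons e f q∉ ip = record
      { ipL = ip ; ipR = cons (flipA e) (λ z∈ → proj₁ (crs ℓ (here refl) z∈)) (λ l∈ → proj₂ (crs ℓ (here refl) l∈) ≡.refl) (ipR ℓ)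
      ; crs = λ { a∈ (here refl) → flipA (f a∈) , (λ { refl → q∉ a∈ }) ; a∈ (there b∈) → crs ℓ (there a∈) b∈ }
      ; hL = hit→Z L (hL ℓ) ; hR = line-armR ℓ ; nn = ≡.trans (aux L (hL ℓ)) (≡.sym (∨-identityʳ (null L))) ; ne = ∧-zeroʳ (null L)
      ; inH = λ { (here e) → inH ℓ (there (here e)) ; (there p) → case ∈-++⁻ L p of λ
          { (inj₁ r) → inH ℓ (there (there (∈-++⁺ˡ r))) ; (inj₂ (here r)) → inH ℓ (here r) ; (inj₂ (there r)) → inH ℓ (there (there (∈-++⁺ʳ L r))) } } }
      where
      open import Data.Bool.Properties using (∨-identityʳ; ∧-zeroʳ)
      aux : ∀ L → Hit (A x) l L → A x l ≡ null L
      aux [] e = e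
      aux (_ ∷ _) (e , _) = e

    line-goto : ∀ {t Z R} M {q S} → t ∷ Z ≡ M ++ q ∷ S → Line t Z R →
      Σ (List V) λ R′ → Line q S R′ × (∀ {z} → z ∈ R′ → z ∈ M ⊎ z ∈ R) × (∀ {z} → z ∈ M ⊎ z ∈ R → z ∈ R′)
    line-goto [] refl ℓ = _ , ℓ , inj₂ , λ { (inj₂ p) → p }
    line-goto {Z = []} (m ∷ []) () ℓ
    line-goto {Z = []} (m ∷ _ ∷ _) () ℓ
    line-goto {t} {z ∷ Z} {R} (m ∷ M) eq ℓ with Listₚ.∷-injective eq
    ... | refl , eq′ with line-goto M eq′ (line-move ℓ)
    ...   | R′ , ℓ′ , i , j = R′ , ℓ′ ,
            (λ p → case i p of λ { (inj₁ r) → inj₁ (there r) ; (inj₂ (here r)) → inj₁ (here r) ; (inj₂ (there r)) → inj₂ r }) ,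
            λ { (inj₁ (here r)) → j (inj₂ (here r)) ; (inj₁ (there r)) → j (inj₁ r) ; (inj₂ r) → j (inj₂ (there r)) }

    -- x and q are the hubs of a theta graph
    hub-line : ∀ {q L R y Z} → Line q L R → Arm y Z → A y q ≡ true → NA (y ∷ []) (L ++ R) → NA Z (q ∷ L ++ R) → ⊥
    hub-line {q} {L} {R} {y} {Z} ℓ (ip , ht , i) e ny nz = go L R ≡.refl ≡.refl
      where
      third : Leg q (y ∷ Z) x
      third = cons (flipA e) (λ z∈ → flipA (proj₁ (nz z∈ (here refl)))) (λ q∈ → proj₂ (nz q∈ (here refl)) ≡.refl) ip , ht ,
              λ { (here refl) → H-≢ (inH ℓ (here refl)) ≡.refl ; (there p) → x∉H i p }
      q∈H : q ∈ H
      q∈H = inH ℓ (here refl)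
      sub : ∀ {z} → z ∈ L ++ R ++ y ∷ Z → z ∈ H
      sub p = case ∈-++⁻ L p of λ { (inj₁ r) → inH ℓ (there (∈-++⁺ˡ r)) ; (inj₂ r) → case ∈-++⁻ R r of λ { (inj₁ r) → inH ℓ (there (∈-++⁺ʳ L r)) ; (inj₂ r) → i r } }
      yz : NA (y ∷ Z) (L ++ R)
      yz = NA-∷ ny (NA-⊆ id there nz)
      legL : Leg q L x
      legL = ipL ℓ , hL ℓ , x∉H (λ { (here refl) → q∈H ; (there p) → inH ℓ (there (∈-++⁺ˡ p)) })
      legR : Leg q R x
      legR = ipR ℓ , hR ℓ , x∉H (λ { (here refl) → q∈H ; (there p) → inH ℓ (there (∈-++⁺ʳ L p)) })
      go : ∀ L′ R′ → L ≡ L′ → R ≡ R′ → ⊥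
      go [] [] refl refl = case ne ℓ of λ ()
      go [] (r ∷ R′) refl refl = thetaX [] r R′ y Z q∈H legL legR third (nn ℓ) NA-[] NA-[] (NA-sym yz) sub
      go (l ∷ L′) [] refl refl = thetaX [] l L′ y Z q∈H legR legL third (nn ℓ) NA-[] NA-[] (NA-sym (NA-⊆ id ∈-++⁺ˡ yz)) sub
      go (l ∷ L′) (r ∷ R′) refl refl = thetaX (l ∷ L′) r R′ y Z q∈H legL legR third (nn ℓ) (crs ℓ) (NA-sym (NA-⊆ id ∈-++⁺ˡ yz)) (NA-sym (NA-⊆ id (∈-++⁺ʳ L) yz)) sub

    -- x and y are the hubs of a theta graph
    hub-arm : ∀ {q L R y Z} m M {r T} → Line q L R → L ≡ m ∷ M ++ r ∷ T → Arm y Z → A y q ≡ true → A y r ≡ true → y ∉ q ∷ L ++ R →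
      (∀ {z} → z ∈ R → A y z ≡ false) → (∀ {z} → z ∈ T → A y z ≡ false) → NA Z (q ∷ L ++ R) → ⊥
    hub-arm {q} {_} {R} {y} {Z} m M {r} {T} ℓ refl ar@(ip , ht , i) eq er y∉ nR nT nz =
      thetaX Z q R r T (i (here refl)) (arm-leg ar) leg₂ leg₃ (hit-isTriv Z ht)
        (NA-⊆ id (λ { (here e) → here e ; (there p) → there (∈-++⁺ʳ L p) }) nz) (NA-⊆ id (there ∘ ∈-++⁺ˡ ∘ inL) nz) n₂₃
        (λ p → case ∈-++⁻ Z p of λ { (inj₁ p) → i (there p) ; (inj₂ p) → case ∈-++⁻ (q ∷ R) p of λ
            { (inj₁ (here refl)) → inH ℓ (here refl) ; (inj₁ (there p)) → inH ℓ (there (∈-++⁺ʳ L p)) ; (inj₂ p) → inH ℓ (there (∈-++⁺ˡ (inL p))) } })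
      where
      L = m ∷ M ++ r ∷ T
      inL : ∀ {z} → z ∈ r ∷ T → z ∈ L
      inL p = there (∈-++⁺ʳ M p)
      leg₂ : Leg y (q ∷ R) x
      leg₂ = cons eq nR (λ p → y∉ (there (∈-++⁺ʳ L p))) (ipR ℓ) , line-armR ℓ ,
             λ { (here refl) → H-≢ (i (here refl)) ≡.refl ; (there (here refl)) → H-≢ (inH ℓ (here refl)) ≡.refl ; (there (there p)) → H-≢ (inH ℓ (there (∈-++⁺ʳ L p))) ≡.refl }
      leg₃ : Leg y (r ∷ T) x
      leg₃ = cons er nT (λ p → y∉ (there (∈-++⁺ˡ (inL (there p))))) (ip-suffix (m ∷ M) (ipL ℓ)) , hit-suffix M (hL ℓ) ,
             λ { (here refl) → H-≢ (i (here refl)) ≡.refl ; (there p) → H-≢ (inH ℓ (there (∈-++⁺ˡ (inL p)))) ≡.refl }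
      n₂₃ : NA (q ∷ R) (r ∷ T)
      n₂₃ (here refl) p = ip-nohead {M = M} (ipL ℓ) p
      n₂₃ (there a∈) p = NA-sym (crs ℓ) a∈ (inL p)

    thetaH′ : ∀ {p q} Z Z₂ Z₃ → null Z₂ ≡ false → null Z₃ ≡ false → p ∈ H → q ∈ H → p ≢ q → Leg q Z p → Leg q Z₂ p → Leg q Z₃ p →
      A p q ≡ isTriv (legT Z) → NA Z Z₂ → NA Z Z₃ → NA Z₂ Z₃ → (∀ {z} → z ∈ Z ++ Z₂ ++ Z₃ → z ∈ H) → ⊥
    thetaH′ Z (y₂ ∷ ys₂) (y₃ ∷ ys₃) _ _ = thetaH Z y₂ ys₂ y₃ ys₃

    null-snoc : ∀ (M : List V) {r} → null (M ++ r ∷ []) ≡ false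
    null-snoc [] = refl
    null-snoc (_ ∷ _) = refl

    -- y and q are the hubs of a theta graph avoiding x
    three-nbrs : ∀ {q L R y l r} → Line q L R → y ∈ H → y ∉ q ∷ L ++ R → A y q ≡ true → l ∈ L → A y l ≡ true → r ∈ R → A y r ≡ true → ⊥
    three-nbrs {q} {L} {R} {y} ℓ y∈ y∉ e l∈ el r∈ er with firstIn (A y) L | firstIn (A y) R
    ... | none f | _ = absurdᵇ el (f l∈)
    ... | some _ _ _ _ _ _ | none f = absurdᵇ er (f r∈)
    ... | some M l S eq p f | some M′ r S′ eq′ p′ f′ =
      thetaH′ [] (M ++ l ∷ []) (M′ ++ r ∷ []) (null-snoc M) (null-snoc M′) y∈ (inH ℓ (here refl)) (λ e → y∉ (here e))
        (one , e , λ { (here e) → y∉ (here e) }) (mk M eq p f (ipL ℓ) (there ∘ ∈-++⁺ˡ)) (mk M′ eq′ p′ f′ (ipR ℓ) (there ∘ ∈-++⁺ʳ L)) e NA-[] NA-[]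
        (NA-⊆ (inl M eq) (inl M′ eq′) (crs ℓ))
        (λ z∈ → case ∈-++⁻ (M ++ l ∷ []) z∈ of λ { (inj₁ p) → inH ℓ (there (∈-++⁺ˡ (inl M eq p))) ; (inj₂ p) → inH ℓ (there (∈-++⁺ʳ L (inl M′ eq′ p))) })
      where
      inl : ∀ M {l S K} → K ≡ M ++ l ∷ S → ∀ {z} → z ∈ M ++ l ∷ [] → z ∈ K
      inl M refl p with ∈-++⁻ M p
      ... | inj₁ r = ∈-++⁺ˡ r
      ... | inj₂ (here r) = ∈-++⁺ʳ M (here r)
      mk : ∀ M {l S K} → K ≡ M ++ l ∷ S → A y l ≡ true → (∀ {z} → z ∈ M → A y z ≡ false) → IP q K → (∀ {z} → z ∈ K → z ∈ q ∷ L ++ R) → Leg q (M ++ l ∷ []) y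
      mk M {l} {S} eq p f ip i = ip-prefix (M ++ l ∷ []) (subst (IP q) (≡.trans eq (≡.sym (Listₚ.++-assoc M (l ∷ []) S))) ip) , hitZ-snoc M p f ,
        λ { (here e) → y∉ (here e) ; (there r) → y∉ (i (inl M eq r)) }

    Join : V → List V → V → List V → Set
    Join s Z t Z′ = A s t ≡ true × NA Z (t ∷ Z′) × NA (s ∷ Z) Z′

    join-sym : ∀ {s Z t Z′} → Join s Z t Z′ → Join t Z′ s Z
    join-sym (e , f , g) = flipA e , NA-sym g , NA-sym f

    -- With `x` this is an induced K₄ whose three edges at `x` are replaced by paths; an empty list
    -- stands for an edge that is kept.
    record Config (t₁ t₂ t₃ : V) (Z₁ Z₂ Z₃ : List V) : Set where
      constructor cfg
      field
        a₁ : Arm t₁ Z₁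
        a₂ : Arm t₂ Z₂
        a₃ : Arm t₃ Z₃
        j₁₂ : Join t₁ Z₁ t₂ Z₂
        j₁₃ : Join t₁ Z₁ t₃ Z₃
        j₂₃ : Join t₂ Z₂ t₃ Z₃
    open Config public

    cfg-swap : ∀ {t₁ t₂ t₃ Z₁ Z₂ Z₃} → Config t₁ t₂ t₃ Z₁ Z₂ Z₃ → Config t₂ t₁ t₃ Z₂ Z₁ Z₃
    cfg-swap (cfg a b c d e f) = cfg b a c (join-sym d) f e

    cfg-rot : ∀ {t₁ t₂ t₃ Z₁ Z₂ Z₃} → Config t₁ t₂ t₃ Z₁ Z₂ Z₃ → Config t₂ t₃ t₁ Z₂ Z₃ Z₁
    cfg-rot (cfg a b c d e f) = cfg b c a f (join-sym d) (join-sym e)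

    cfg-line : ∀ {t₁ t₂ t₃ Z₁ Z₂ Z₃} → Config t₁ t₂ t₃ Z₁ Z₂ Z₃ → Line t₁ Z₁ (t₂ ∷ Z₂)
    cfg-line {t₁} {t₂} {Z₁ = Z₁} {Z₂} (cfg (ip₁ , h₁ , i₁) (ip₂ , h₂ , i₂) _ (e , f , g) _ _) = record
      { ipL = ip₁ ; ipR = cons e (λ p → proj₁ (g (here refl) p)) (λ p → proj₂ (g (here refl) p) ≡.refl) ip₂
      ; crs = f ; hL = hit→Z Z₁ h₁ ; hR = h₂ ; nn = ≡.trans (aux Z₁ h₁) (≡.sym (∨-identityʳ (null Z₁))) ; ne = ∧-zeroʳ (null Z₁)
      ; inH = λ { (here e) → i₁ (here e) ; (there p) → case ∈-++⁻ Z₁ p of λ { (inj₁ r) → i₁ (there r) ; (inj₂ r) → i₂ r } } }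
      where
      open import Data.Bool.Properties using (∨-identityʳ; ∧-zeroʳ)
      aux : ∀ L → Hit (A x) t₁ L → A x t₁ ≡ null L
      aux [] e = e
      aux (_ ∷ _) (e , _) = e

    -- An arm reaching from the neighbourhood of S to x without touching S.
    record ArmTo (S : List V) : Set where
      field
        {y}  : V
        {Z}  : List V
        arm  : Arm y Z
        y∉   : y ∉ S
        Z-S  : NA Z S
        {s}  : V
        s∈   : s ∈ S
        y~s  : A y s ≡ true

    -- A path from the neighbour `c` of `x` to the neighbourhood of `S`, which exists as `x` is no
    -- cut vertex, is read backwards and cut at the first neighbour of `x`.
    find-arm : ∀ {S s₀ c} → s₀ ∈ H → adjTo S s₀ ≡ true → c ∈ H → c ∉ S → A x c ≡ true → ArmTo S
    find-arm {S} {s₀} {c} s₀∈ adj₀ c∈ c∉ xc with hit-walk (adjTo S) (noCut x∈W c∈ s₀∈) adj₀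
    ... | qs , ip , ht , i with to-end qs one ip NA-[] ht (λ ())
    ...   | e , K , ipK , ge , gK , fwd , bwd with firstIn (A x) (e ∷ K)
    ...     | none f = absurdᵇ xc (f (fwd (here refl)))
    ...     | some M r T eq p f = go M eq f
      where
      -- A vertex of `S` on the path would be preceded by a neighbour of `S`, at which the path has
      -- already ended.
      off-S : ∀ {y} zs → IP y zs → Hit (adjTo S) y zs → y ∉ S → ∀ {z} → z ∈ y ∷ zs → z ∉ S
      off-S [] ip ht y∉ (here refl) = y∉
      off-S (z ∷ zs) ip ht y∉ (here refl) = y∉
      off-S {y} (z ∷ zs) (cons e _ _ ip) (gy , ht) y∉ (there q) = off-S zs ip ht (λ z∈ → absurdᵇ e (adjTo-false S y gy z∈)) q
      e∉ : ∀ {z} → z ∈ e ∷ K → z ∉ S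
      e∉ q = off-S qs ip ht c∉ (bwd q)
      inH′ : ∀ {z} → z ∈ e ∷ K → z ∈ H
      inH′ q = i (bwd q)
      far : NA K S
      far a∈ b∈ = adjTo-false S _ (gK a∈) b∈ , λ { refl → e∉ (there a∈) b∈ }
      near = adjTo-true S e ge
      go : ∀ M → e ∷ K ≡ M ++ r ∷ T → (∀ {z} → z ∈ M → A x z ≡ false) → ArmTo S
      go [] refl f = record { arm = one , p , (λ { (here refl) → inH′ (here refl) }) ; y∉ = e∉ (here refl) ; Z-S = λ () ; s∈ = proj₁ (proj₂ near) ; y~s = proj₂ (proj₂ near) }
      go (m ∷ M) eq′ f with Listₚ.∷-injective eq′
      ... | refl , refl = record { arm = ip-prefix (M ++ r ∷ []) (subst (IP e) (≡.sym (Listₚ.++-assoc M (r ∷ []) T)) ipK) , hit-snoc M f p , (λ { (here refl) → inH′ (here refl) ; (there q) → inH′ (there (inM q)) })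
            ; y∉ = e∉ (here refl) ; Z-S = NA-⊆ inM id far ; s∈ = proj₁ (proj₂ near) ; y~s = proj₂ (proj₂ near) }
        where
        inM : ∀ {z} → z ∈ M ++ r ∷ [] → z ∈ M ++ r ∷ T
        inM q with ∈-++⁻ M q
        ... | inj₁ s = ∈-++⁺ˡ s
        ... | inj₂ (here s) = ∈-++⁺ʳ M (here s)

    AnyConfig : Set
    AnyConfig = Σ V λ t₁ → Σ V λ t₂ → Σ V λ t₃ → Σ (List V) λ Z₁ → Σ (List V) λ Z₂ → Σ (List V) λ Z₃ → Config t₁ t₂ t₃ Z₁ Z₂ Z₃

    -- The cases are the neighbours of `y` on the cycle. A single one, or a first and a last one
    -- that are not consecutive, gives a theta graph with `x` as a hub. If they are consecutive,
    -- they form the triangle with `y`, and the cycle splits into two of the arms.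
    line-config : ∀ {a qs} → Line a qs [] → ArmTo (a ∷ qs) → AnyConfig
    line-config {a} {qs} ℓ₀ record { y = y ; Z = Z ; arm = ar@(ip , ht , i) ; y∉ = y∉ ; Z-S = zS ; s∈ = s∈ ; y~s = y~s } with firstIn (A y) (a ∷ qs)
    ... | none f = absurdᵇ y~s (f s∈)
    ... | some M q T eq eq′ f with line-goto M eq ℓ₀
    ...   | R , ℓ , bwd , fwd with lastIn (A y) T
    ...     | none g = ⊥-elim (hub-line ℓ ar eq′ ny (NA-⊆ id on-path zS))
      where
      on-path : ∀ {z} → z ∈ q ∷ T ++ R → z ∈ a ∷ qs
      on-path p = subst (_ ∈_) (≡.sym eq) (case p of λ { (here e) → ∈-++⁺ʳ M (here e) ; (there p) → case ∈-++⁻ T p of λ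
        { (inj₁ r) → ∈-++⁺ʳ M (there r) ; (inj₂ r) → case bwd r of λ { (inj₁ s) → ∈-++⁺ˡ s } } })
      ny : NA (y ∷ []) (T ++ R)
      ny (here refl) p = (case ∈-++⁻ T p of λ { (inj₁ r) → g r ; (inj₂ r) → case bwd r of λ { (inj₁ s) → f s } }) , λ { refl → y∉ (on-path (there p)) }
    ...     | some (m ∷ M′) r T′ refl er g = ⊥-elim (hub-arm m M′ ℓ ≡.refl ar eq′ er (y∉ ∘ on-path) (λ p → case bwd p of λ { (inj₁ s) → f s }) g (NA-⊆ id on-path zS))
      where
      on-path : ∀ {z} → z ∈ q ∷ T ++ R → z ∈ a ∷ qs
      on-path p = subst (_ ∈_) (≡.sym eq) (case p of λ { (here e) → ∈-++⁺ʳ M (here e) ; (there p) → case ∈-++⁻ T p of λ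
        { (inj₁ r) → ∈-++⁺ʳ M (there r) ; (inj₂ r) → case bwd r of λ { (inj₁ s) → ∈-++⁺ˡ s } } })
    ...     | some [] r T′ refl er g = q , r , y , R , T′ , Z ,
        cfg (ipR ℓ , line-armR ℓ , (λ { (here e) → inH ℓ (here e) ; (there p) → inH ℓ (there (∈-++⁺ʳ T p)) }))
            (ip-suffix [] (ipL ℓ) , hL ℓ , (λ p → inH ℓ (there (∈-++⁺ˡ p)))) ar
            (first-adj (ipL ℓ) , NA-sym (crs ℓ) , (λ { (here refl) p → ip-head (ipL ℓ) p ; (there a∈) p → NA-sym (crs ℓ) a∈ (there p) }))
            (flipA eq′ , (λ { a∈ (here refl) → flipA (Ry a∈) , (λ { refl → y∉ (on-path (there (∈-++⁺ʳ T a∈))) }) ; a∈ (there b∈) → NA-sym zS (on-path (there (∈-++⁺ʳ T a∈))) b∈ })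
                       , (λ a∈ b∈ → NA-sym zS (on-path (case a∈ of λ { (here e) → here e ; (there p) → there (∈-++⁺ʳ T p) })) b∈))
            (flipA er , (λ { a∈ (here refl) → flipA (g a∈) , (λ { refl → y∉ (on-path (there (∈-++⁺ˡ (there a∈)))) }) ; a∈ (there b∈) → NA-sym zS (on-path (there (∈-++⁺ˡ (there a∈)))) b∈ })
                       , (λ a∈ b∈ → NA-sym zS (on-path (there (∈-++⁺ˡ a∈))) b∈))
      where
      on-path : ∀ {z} → z ∈ q ∷ T ++ R → z ∈ a ∷ qs
      on-path p = subst (_ ∈_) (≡.sym eq) (case p of λ { (here e) → ∈-++⁺ʳ M (here e) ; (there p) → case ∈-++⁻ T p of λ
        { (inj₁ r) → ∈-++⁺ʳ M (there r) ; (inj₂ r) → case bwd r of λ { (inj₁ s) → ∈-++⁺ˡ s } } })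
      Ry : ∀ {z} → z ∈ R → A y z ≡ false
      Ry p = case bwd p of λ { (inj₁ s) → f s }
      first-adj : ∀ {b l L} → IP b (l ∷ L) → A b l ≡ true
      first-adj (cons e _ _ _) = e

    -- A shortest detour in `H` between two neighbours of `x` closes to an induced cycle that
    -- contains only these two neighbours. A third neighbour lies off the cycle and supplies the
    -- arm.
    find-config : 3 ≤ dg H x → AnyConfig
    find-config d3 = go (filterᵇ (A x) H) (∈-filterᵇ⁻ (A x) {H}) (Uniqueₚ.filter⁺ (T? ∘ A x) (Unique-─ (x ∷ []) uW)) d3
      where
      go : ∀ ns → (∀ {z} → z ∈ ns → z ∈ H × A x z ≡ true) → Unique ns → 3 ≤ length ns → AnyConfig
      go (_ ∷ []) _ _ (s≤s ())
      go (_ ∷ _ ∷ []) _ _ (s≤s (s≤s ()))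
      go (a ∷ b ∷ c ∷ _) i ((a≢b ∷ a≢c ∷ _) ∷ (b≢c ∷ _) ∷ _) _
        -- Excluding `a` from the goal makes the path end at another neighbour of `x`.
        with hit-walk (λ z → A x z ∧ not (does (z ≟ a))) (noCut x∈W (proj₁ (i (here refl))) (proj₁ (i (there (here refl))))) gb
        where
        gb : A x b ∧ not (does (b ≟ a)) ≡ true
        gb rewrite proj₂ (i (there (here refl))) with b ≟ a
        ... | yes e = ⊥-elim (a≢b (≡.sym e))
        ... | no _ = refl
      ... | [] , ip , ht , iH = ⊥-elim (no-a ht)
        where
        no-a : A x a ∧ not (does (a ≟ a)) ≡ true → ⊥
        no-a e with A x a | a ≟ a
        no-a () | false | _
        no-a () | true | yes _
        ... | true | no ne = ne ≡.refl
      ... | z ∷ zs , ip@(cons e f a∉ ipz) , (_ , ht) , iH = line-config ℓ (choose (b ∈? (a ∷ z ∷ zs)) (c ∈? (a ∷ z ∷ zs)))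
        where
        ht′ : Hit (A x) z zs
        ht′ = hit-cong z zs (λ {y} y∈ → aux y (λ { refl → unique-head (ip-unique ip) y∈ })) ht
          where
          aux : ∀ y → y ≢ a → A x y ∧ not (does (y ≟ a)) ≡ A x y
          aux y ne with A x y | y ≟ a
          ... | false | _ = refl
          ... | true | yes e = ⊥-elim (ne e)
          ... | true | no _ = refl
        ℓ : Line a (z ∷ zs) []
        ℓ = record { ipL = ip ; ipR = one ; crs = λ _ () ; hL = ht′ ; hR = proj₂ (i (here refl)) ; nn = proj₂ (i (here refl)) ; ne = refl
                   ; inH = λ {v} p → iH (subst (λ l → v ∈ a ∷ l) (Listₚ.++-identityʳ (z ∷ zs)) p) }
        a-adj : adjTo (a ∷ z ∷ zs) a ≡ true
        a-adj = true-adjTo {a ∷ z ∷ zs} (there (here refl)) e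
        choose : Dec (b ∈ a ∷ z ∷ zs) → Dec (c ∈ a ∷ z ∷ zs) → ArmTo (a ∷ z ∷ zs)
        choose (no b∉) _ = find-arm (proj₁ (i (here refl))) a-adj (proj₁ (i (there (here refl)))) b∉ (proj₂ (i (there (here refl))))
        choose (yes _) (no c∉) = find-arm (proj₁ (i (here refl))) a-adj (proj₁ (i (there (there (here refl))))) c∉ (proj₂ (i (there (there (here refl)))))
        choose (yes (here e)) (yes _) = ⊥-elim (a≢b (≡.sym e))
        choose (yes (there _)) (yes (here e)) = ⊥-elim (a≢c (≡.sym e))
        choose (yes (there p)) (yes (there q)) = ⊥-elim (b≢c (hit-unique z zs ht′ p q (proj₂ (i (there (here refl)))) (proj₂ (i (there (there (here refl)))))))

  -- Tables of the excluded signed graphs.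

  sgnT : LegT → Sign
  sgnT triv    = Sign.-
  sgnT (ear s) = s

  sk4E : LegT → LegT → LegT → List (SEdge 4)
  sk4E l₁ l₂ l₃ = legE 1F l₁ 0F ++ legE 2F l₂ 0F ++ legE 3F l₃ 0F ++ []

  sk4R : LegT → LegT → LegT → Rows 4
  sk4R l₁ l₂ l₃ = (isTriv l₁ ∷ isTriv l₂ ∷ isTriv l₃ ∷ []) , (true ∷ true ∷ []) , (true ∷ []) , [] , tt

  -- K₄ with signs on the edges at `x`, where an unsubdivided edge counts as negative. The
  -- coefficient is certified to be nonzero whenever the first two signs differ; rotating the
  -- triangle compares the other pairs.
  sk4P : Vec LegT 3 → Bool
  sk4P (l₁ ∷ l₂ ∷ l₃ ∷ []) = does (sgnT l₁ Signₚ.≟ sgnT l₂) ∨ okᵇ (sk4E l₁ l₂ l₃ ++ smallE (sk4R l₁ l₂ l₃)) (1 ∷ 2 ∷ 2 ∷ 1 ∷ [])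

  f3E : LegT → LegT → LegT → List (SEdge 5)
  f3E l₁ l₂ l₃ = legE 1F l₁ 0F ++ legE 2F l₂ 0F ++ legE 3F l₃ 0F ++ []

  f3R : LegT → LegT → LegT → Rows 5
  f3R l₁ l₂ l₃ = (isTriv l₁ ∷ isTriv l₂ ∷ isTriv l₃ ∷ false ∷ []) , (true ∷ true ∷ true ∷ []) , (true ∷ true ∷ []) , (true ∷ []) , [] , tt

  f3P : Vec LegT 3 → Bool
  f3P (l₁ ∷ l₂ ∷ l₃ ∷ []) = okᵇ (f3E l₁ l₂ l₃ ++ smallE (f3R l₁ l₂ l₃)) (1 ∷ 1 ∷ 2 ∷ 3 ∷ 2 ∷ [])

  -- base x , p , q , t₁ , t₂ , t₃ with two p–q paths; the flag gives the direction of the second one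
  c5E : Bool → LegT → LegT → LegT → LegT → LegT → LegT → List (SEdge 6)
  c5E o lC lM lY lA l₂ l₃ = legE 1F lC 0F ++ legE 2F lM 1F ++ (if o then legE 2F lY 1F else legE 1F lY 2F) ++ legE 3F lA 2F ++ legE 4F l₂ 0F ++ legE 5F l₃ 0F ++ []

  c5R : LegT → LegT → LegT → LegT → LegT → Rows 6
  c5R lC lM lA l₂ l₃ = (isTriv lC ∷ false ∷ false ∷ isTriv l₂ ∷ isTriv l₃ ∷ []) , (isTriv lM ∷ false ∷ false ∷ false ∷ []) , (isTriv lA ∷ false ∷ false ∷ []) , (true ∷ true ∷ []) , (true ∷ []) , [] , tt

  c5P : Bool → Vec LegT 6 → Bool
  c5P o (lC ∷ lM ∷ ear s ∷ lA ∷ l₂ ∷ l₃ ∷ []) = okᵇ (c5E o lC lM (ear s) lA l₂ l₃ ++ smallE (c5R lC lM lA l₂ l₃)) (1 ∷ 1 ∷ 2 ∷ 2 ∷ 1 ∷ 2 ∷ [])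
  c5P o _ = true

  c5dE : Bool → LegT → LegT → LegT → LegT → LegT → List (SEdge 5)
  c5dE o lC lM lY l₂ l₃ = legE 1F lC 0F ++ legE 2F lM 1F ++ (if o then legE 2F lY 1F else legE 1F lY 2F) ++ legE 3F l₂ 0F ++ legE 4F l₃ 0F ++ []

  c5dR : LegT → LegT → LegT → LegT → Rows 5
  c5dR lC lM l₂ l₃ = (isTriv lC ∷ false ∷ isTriv l₂ ∷ isTriv l₃ ∷ []) , (isTriv lM ∷ false ∷ false ∷ []) , (true ∷ true ∷ []) , (true ∷ []) , [] , tt

  c5dP : Bool → Vec LegT 5 → Bool
  c5dP o (lC ∷ lM ∷ ear s ∷ l₂ ∷ l₃ ∷ []) = okᵇ (c5dE o lC lM (ear s) l₂ l₃ ++ smallE (c5dR lC lM l₂ l₃)) (1 ∷ 1 ∷ 3 ∷ 1 ∷ 2 ∷ [])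
  c5dP o _ = true

  -- base x , p , y , q , t₂ , t₃
  bowE : LegT → LegT → LegT → LegT → List (SEdge 6)
  bowE lC lD l₂ l₃ = legE 1F lC 0F ++ legE 2F lD 0F ++ legE 4F l₂ 0F ++ legE 5F l₃ 0F ++ []

  bowR : LegT → LegT → LegT → LegT → Rows 6
  bowR lC lD l₂ l₃ = (isTriv lC ∷ isTriv lD ∷ false ∷ isTriv l₂ ∷ isTriv l₃ ∷ []) , (true ∷ true ∷ false ∷ false ∷ []) , (true ∷ false ∷ false ∷ []) , (true ∷ true ∷ []) , (true ∷ []) , [] , tt

  bowP : Vec LegT 4 → Bool
  bowP (lC ∷ lD ∷ l₂ ∷ l₃ ∷ []) = okᵇ (bowE lC lD l₂ l₃ ++ smallE (bowR lC lD l₂ l₃)) (2 ∷ 1 ∷ 2 ∷ 2 ∷ 1 ∷ 2 ∷ [])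

  -- base x , v , p , y , q , t₁ , t₂ , t₃; the extra vertex v subdivides x–p, x–t₂ and q–t₁ respectively
  dtlE : LegT → LegT → LegT → LegT → LegT → List (SEdge 8)
  dtlE lC lD lA l₂ l₃ = legE 1F lC 0F ++ legE 3F lD 0F ++ legE 5F lA 4F ++ legE 6F l₂ 0F ++ legE 7F l₃ 0F ++ []

  dtlR : LegT → LegT → LegT → LegT → LegT → Rows 8
  dtlR lC lD lA l₂ l₃ = (isTriv lC ∷ false ∷ isTriv lD ∷ false ∷ false ∷ isTriv l₂ ∷ isTriv l₃ ∷ []) , (true ∷ false ∷ false ∷ false ∷ false ∷ false ∷ []) ,
    (true ∷ true ∷ false ∷ false ∷ false ∷ []) , (true ∷ false ∷ false ∷ false ∷ []) , (isTriv lA ∷ false ∷ false ∷ []) , (true ∷ true ∷ []) , (true ∷ []) , [] , tt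

  dtlP : Vec LegT 5 → Bool
  dtlP (lC ∷ lD ∷ lA ∷ l₂ ∷ l₃ ∷ []) = okᵇ (dtlE lC lD lA l₂ l₃ ++ smallE (dtlR lC lD lA l₂ l₃)) (2 ∷ 0 ∷ 2 ∷ 1 ∷ 2 ∷ 2 ∷ 1 ∷ 2 ∷ [])

  dtrE : LegT → LegT → LegT → LegT → LegT → List (SEdge 8)
  dtrE lC lD lA l₂ l₃ = legE 2F lC 0F ++ legE 3F lD 0F ++ legE 5F lA 4F ++ legE 1F l₂ 0F ++ legE 7F l₃ 0F ++ []

  dtrR : LegT → LegT → LegT → LegT → LegT → Rows 8
  dtrR lC lD lA l₂ l₃ = (isTriv l₂ ∷ isTriv lC ∷ isTriv lD ∷ false ∷ false ∷ false ∷ isTriv l₃ ∷ []) , (false ∷ false ∷ false ∷ false ∷ true ∷ false ∷ []) ,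
    (true ∷ true ∷ false ∷ false ∷ false ∷ []) , (true ∷ false ∷ false ∷ false ∷ []) , (isTriv lA ∷ false ∷ false ∷ []) , (true ∷ true ∷ []) , (true ∷ []) , [] , tt

  dtrP : Vec LegT 5 → Bool
  dtrP (lC ∷ lD ∷ lA ∷ l₂ ∷ l₃ ∷ []) = okᵇ (dtrE lC lD lA l₂ l₃ ++ smallE (dtrR lC lD lA l₂ l₃)) (2 ∷ 0 ∷ 1 ∷ 2 ∷ 2 ∷ 1 ∷ 2 ∷ 2 ∷ [])

  dtmE : LegT → List (SEdge 8)
  dtmE lA = legE 1F lA 4F ++ []

  dtmR : LegT → Rows 8
  dtmR lA = (false ∷ true ∷ true ∷ false ∷ false ∷ true ∷ true ∷ []) , (false ∷ false ∷ isTriv lA ∷ true ∷ false ∷ false ∷ []) ,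
    (true ∷ true ∷ false ∷ false ∷ false ∷ []) , (true ∷ false ∷ false ∷ false ∷ []) , (false ∷ false ∷ false ∷ []) , (true ∷ true ∷ []) , (true ∷ []) , [] , tt

  dtmP : Vec LegT 1 → Bool
  dtmP (lA ∷ []) = okᵇ (dtmE lA ++ smallE (dtmR lA)) (2 ∷ 0 ∷ 1 ∷ 2 ∷ 2 ∷ 2 ∷ 1 ∷ 2 ∷ [])

  -- base t₁ , t₂ , t₃ , p (, q)
  od₁E : LegT → LegT → List (SEdge 4)
  od₁E l₁ lY = legE 0F l₁ 3F ++ legE 3F lY 1F ++ []

  od₁R : LegT → Rows 4
  od₁R l₁ = (true ∷ true ∷ isTriv l₁ ∷ []) , (true ∷ false ∷ []) , (false ∷ []) , [] , tt

  od₁P : Vec LegT 2 → Bool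
  od₁P (l₁ ∷ ear s ∷ []) = okᵇ (od₁E l₁ (ear s) ++ smallE (od₁R l₁)) (1 ∷ 2 ∷ 1 ∷ 1 ∷ [])
  od₁P _ = true

  od₁′E : LegT → LegT → List (SEdge 4)
  od₁′E l₁ lY = legE 0F l₁ 3F ++ legE 1F lY 3F ++ []

  od₁′P : Vec LegT 2 → Bool
  od₁′P (l₁ ∷ ear s ∷ []) = okᵇ (od₁′E l₁ (ear s) ++ smallE (od₁R l₁)) (1 ∷ 2 ∷ 1 ∷ 1 ∷ [])
  od₁′P _ = true

  od₂E : LegT → LegT → LegT → List (SEdge 5)
  od₂E l₁ l₂ lY = legE 0F l₁ 3F ++ legE 1F l₂ 4F ++ legE 3F lY 4F ++ []

  od₂R : LegT → LegT → Rows 5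
  od₂R l₁ l₂ = (true ∷ true ∷ isTriv l₁ ∷ false ∷ []) , (true ∷ false ∷ isTriv l₂ ∷ []) , (false ∷ false ∷ []) , (false ∷ []) , [] , tt

  od₂P : Vec LegT 3 → Bool
  od₂P (l₁ ∷ l₂ ∷ ear s ∷ []) = okᵇ (od₂E l₁ l₂ (ear s) ++ smallE (od₂R l₁ l₂)) (1 ∷ 2 ∷ 1 ∷ 1 ∷ 1 ∷ [])
  od₂P _ = true

  -- Here and below, accepting `tt` makes the type checker evaluate the coefficient for every
  -- combination of leg types.
  sk4-ok : ∀ ls → T (sk4P ls)
  sk4-ok = allLs-sound sk4P tt

  f3-ok : ∀ ls → T (f3P ls)
  f3-ok = allLs-sound f3P tt

  c5t-ok : ∀ ls → T (c5P true ls)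
  c5t-ok = allLs-sound (c5P true) tt

  c5f-ok : ∀ ls → T (c5P false ls)
  c5f-ok = allLs-sound (c5P false) tt

  c5dt-ok : ∀ ls → T (c5dP true ls)
  c5dt-ok = allLs-sound (c5dP true) tt

  c5df-ok : ∀ ls → T (c5dP false ls)
  c5df-ok = allLs-sound (c5dP false) tt

  bow-ok : ∀ ls → T (bowP ls)
  bow-ok = allLs-sound bowP tt

  dtl-ok : ∀ ls → T (dtlP ls)
  dtl-ok = allLs-sound dtlP tt

  dtr-ok : ∀ ls → T (dtrP ls)
  dtr-ok = allLs-sound dtrP tt

  dtm-ok : ∀ ls → T (dtmP ls)
  dtm-ok = allLs-sound dtmP tt

  od₁-ok : ∀ ls → T (od₁P ls)
  od₁-ok = allLs-sound od₁P tt

  od₂-ok : ∀ ls → T (od₂P ls)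
  od₂-ok = allLs-sound od₂P tt

  od₁′-ok : ∀ ls → T (od₁′P ls)
  od₁′-ok = allLs-sound od₁′P tt

  infixr 5 _⊕_
  _⊕_ : ∀ {X Y U : List V} → (∀ {z} → z ∈ X → z ∈ U) → (∀ {z} → z ∈ Y → z ∈ U) → ∀ {z} → z ∈ X ++ Y → z ∈ U
  _⊕_ {X} f g p with ∈-++⁻ X p
  ... | inj₁ q = f q
  ... | inj₂ q = g q

  infixr 5 _⊙_
  _⊙_ : ∀ {a} {Y U : List V} → a ∈ U → (∀ {z} → z ∈ Y → z ∈ U) → ∀ {z} → z ∈ a ∷ Y → z ∈ U
  _⊙_ a∈ g (here refl) = a∈
  _⊙_ a∈ g (there q) = g q

  ⊆[] : ∀ {U : List V} {z} → z ∈ [] → z ∈ U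
  ⊆[] ()

  ip-sep : ∀ {a} M {q T} → IP a (M ++ q ∷ T) → NA (a ∷ M) T
  ip-sep [] ip (here refl) b∈ = ip-head ip b∈
  ip-sep (m ∷ M) {q} {T} ip (here refl) b∈ = ip-nohead {M = M} {q ∷ T} ip (there b∈)
  ip-sep (m ∷ M) (cons _ _ _ ip) (there a∈) b∈ = ip-sep M ip a∈ b∈

  NA-one : ∀ {X Y a} → NA X Y → a ∈ Y → NA X (a ∷ [])
  NA-one f a∈ p (here refl) = f p a∈

  NA-hd : ∀ {X Y a b} → NA X Y → a ∈ X → b ∈ Y → A a b ≡ false
  NA-hd f p q = proj₁ (f p q)

  NA-ne : ∀ {X Y a b} → NA X Y → a ∈ X → b ∈ Y → a ≢ b
  NA-ne f p q = proj₂ (f p q)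

  leg-of-path : ∀ {a} M {p T} → IP a (M ++ p ∷ T) → Leg a M p
  leg-of-path M {p} {T} ip = ip-prefix M ip , hit→Z M (ip-hit M ip) , λ { (here refl) → unique-head (ip-unique ip) (∈-++⁺ʳ M (here refl)) ; (there q) → go M (ip-unique ip) q }
    where
    go : ∀ M {a} → Unique (a ∷ M ++ p ∷ T) → p ∉ M
    go (m ∷ M) (_ ∷ u) (here refl) = unique-head u (∈-++⁺ʳ M (here refl))
    go (m ∷ M) (_ ∷ u) (there q) = go M u q

  -- Excluded subgraphs around a triangle with three arms.

  module Core₂ {W : List V} {x : V} (S : Setting W x) where

    open Core₁ S public

    join-NA : ∀ {s Z t Z′} → Join s Z t Z′ → NA Z Z′
    join-NA (_ , f , _) p q = f p (there q)

    join-NAₜ : ∀ {s Z t Z′} → Join s Z t Z′ → NA Z (t ∷ [])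
    join-NAₜ (_ , f , _) p (here refl) = f p (here refl)

    arm-H : ∀ {y Z} → Arm y Z → ∀ {z} → z ∈ y ∷ Z → z ∈ H
    arm-H (_ , _ , i) = i

    arm-Z : ∀ {y Z} → Arm y Z → ∀ {z} → z ∈ Z → z ∈ H
    arm-Z (_ , _ , i) = i ∘ there

    arm-hit : ∀ {y Z} → Arm y Z → A x y ≡ isTriv (legT Z)
    arm-hit {Z = Z} (_ , ht , _) = hit-isTriv Z ht

    x≢ : ∀ {z} → z ∈ H → x ≢ z
    x≢ q = H-≢ q ∘ ≡.sym

    top : ∀ {y Z} → Arm y Z → y ∈ H
    top a = arm-H a (here refl)

    -- Only lengths of equal parity survive: different signs would leave the computed coefficient of
    -- `sk4P` nonzero.
    sk4-signs : ∀ {t₁ t₂ t₃ Z₁ Z₂ Z₃} → Config t₁ t₂ t₃ Z₁ Z₂ Z₃ → sgnT (legT Z₁) ≡ sgnT (legT Z₂)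
    sk4-signs {t₁} {t₂} {t₃} {Z₁} {Z₂} {Z₃} (cfg a₁ a₂ a₃ j₁₂ j₁₃ j₂₃) = go (sk4-ok (legT Z₁ ∷ legT Z₂ ∷ legT Z₃ ∷ []))
      where
      kill : T (okᵇ (sk4E (legT Z₁) (legT Z₂) (legT Z₃) ++ smallE (sk4R (legT Z₁) (legT Z₂) (legT Z₃))) (1 ∷ 2 ∷ 2 ∷ 1 ∷ [])) → ⊥
      kill = certX (t₁ ∷ t₂ ∷ t₃ ∷ []) (sk4R (legT Z₁) (legT Z₂) (legT Z₃)) (1 ∷ 2 ∷ 2 ∷ 1 ∷ [])
        (leg 1F Z₁ 0F (H-≢ (top a₁)) (arm-leg a₁) (off-++ (join-NA j₁₂) (off-++ (join-NA j₁₃) (off-tgt (off-src (off-∷ (join-NAₜ j₁₂) (off-∷ (join-NAₜ j₁₃) off-[])))))) (hH (arm-Z a₁))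
        (leg 2F Z₂ 0F (H-≢ (top a₂)) (arm-leg a₂) (off-++ (join-NA j₂₃) (off-tgt (off-∷ (join-NAₜ (join-sym j₁₂)) (off-src (off-∷ (join-NAₜ j₂₃) off-[]))))) (hH (arm-Z a₂))
        (leg 3F Z₃ 0F (H-≢ (top a₃)) (arm-leg a₃) (off-tgt (off-∷ (join-NAₜ (join-sym j₁₃)) (off-∷ (join-NAₜ (join-sym j₂₃)) (off-src off-[])))) (hH (arm-Z a₃))
        base)))
        ((x≢ (top a₁) ∷ x≢ (top a₂) ∷ x≢ (top a₃) ∷ []) ∷ (A-≢ (proj₁ j₁₂) ∷ A-≢ (proj₁ j₁₃) ∷ []) ∷ (A-≢ (proj₁ j₂₃) ∷ []) ∷ [] ∷ [])
        ((arm-hit a₁ , arm-hit a₂ , arm-hit a₃ , tt) , (proj₁ j₁₂ , proj₁ j₁₃ , tt) , (proj₁ j₂₃ , tt) , tt , tt)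
        (H⊆W ∘ arm-Z a₁ ⊕ H⊆W ∘ arm-Z a₂ ⊕ H⊆W ∘ arm-Z a₃ ⊕ x∈W ⊙ H⊆W (top a₁) ⊙ H⊆W (top a₂) ⊙ H⊆W (top a₃) ⊙ ⊆[])
      go : T (sk4P (legT Z₁ ∷ legT Z₂ ∷ legT Z₃ ∷ [])) → sgnT (legT Z₁) ≡ sgnT (legT Z₂)
      go t with sgnT (legT Z₁) Signₚ.≟ sgnT (legT Z₂)
      ... | yes e = e
      ... | no _ = ⊥-elim (kill t)

    -- K₄ with only three of its vertices joined to x
    f3 : ∀ {t₁ t₂ t₃ Z₁ Z₂ Z₃ d} → Config t₁ t₂ t₃ Z₁ Z₂ Z₃ → d ∈ H → A x d ≡ false → A t₁ d ≡ true → A t₂ d ≡ true → A t₃ d ≡ true →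
      NA Z₁ (d ∷ []) → NA Z₂ (d ∷ []) → NA Z₃ (d ∷ []) → ⊥
    f3 {t₁} {t₂} {t₃} {Z₁} {Z₂} {Z₃} {d} (cfg a₁ a₂ a₃ j₁₂ j₁₃ j₂₃) d∈ xd e₁ e₂ e₃ n₁ n₂ n₃ =
      certX (t₁ ∷ t₂ ∷ t₃ ∷ d ∷ []) (f3R (legT Z₁) (legT Z₂) (legT Z₃)) (1 ∷ 1 ∷ 2 ∷ 3 ∷ 2 ∷ [])
        (leg 1F Z₁ 0F (H-≢ (top a₁)) (arm-leg a₁) (off-++ (join-NA j₁₂) (off-++ (join-NA j₁₃) (off-tgt (off-src (off-∷ (join-NAₜ j₁₂) (off-∷ (join-NAₜ j₁₃) (off-∷ n₁ off-[]))))))) (hH (arm-Z a₁))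
        (leg 2F Z₂ 0F (H-≢ (top a₂)) (arm-leg a₂) (off-++ (join-NA j₂₃) (off-tgt (off-∷ (join-NAₜ (join-sym j₁₂)) (off-src (off-∷ (join-NAₜ j₂₃) (off-∷ n₂ off-[])))))) (hH (arm-Z a₂))
        (leg 3F Z₃ 0F (H-≢ (top a₃)) (arm-leg a₃) (off-tgt (off-∷ (join-NAₜ (join-sym j₁₃)) (off-∷ (join-NAₜ (join-sym j₂₃)) (off-src (off-∷ n₃ off-[]))))) (hH (arm-Z a₃))
        base)))
        ((x≢ (top a₁) ∷ x≢ (top a₂) ∷ x≢ (top a₃) ∷ x≢ d∈ ∷ []) ∷ (A-≢ (proj₁ j₁₂) ∷ A-≢ (proj₁ j₁₃) ∷ A-≢ e₁ ∷ []) ∷ (A-≢ (proj₁ j₂₃) ∷ A-≢ e₂ ∷ []) ∷ (A-≢ e₃ ∷ []) ∷ [] ∷ [])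
        ((arm-hit a₁ , arm-hit a₂ , arm-hit a₃ , xd , tt) , (proj₁ j₁₂ , proj₁ j₁₃ , e₁ , tt) , (proj₁ j₂₃ , e₂ , tt) , (e₃ , tt) , tt , tt)
        (H⊆W ∘ arm-Z a₁ ⊕ H⊆W ∘ arm-Z a₂ ⊕ H⊆W ∘ arm-Z a₃ ⊕ x∈W ⊙ H⊆W (top a₁) ⊙ H⊆W (top a₂) ⊙ H⊆W (top a₃) ⊙ H⊆W d∈ ⊙ ⊆[])
        (f3-ok (legT Z₁ ∷ legT Z₂ ∷ legT Z₃ ∷ []))

    arm-suffix : ∀ {t Z} M {q T} → t ∷ Z ≡ M ++ q ∷ T → Arm t Z → Arm q T
    arm-suffix M eq (ip , ht , i) = ip-suffix′ M eq ip , hit-suffix′ M eq ht , λ p → i (subst (_ ∈_) (≡.sym eq) (∈-++⁺ʳ M p))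

    -- Triangles t₁ t₂ t₃ and q p r joined by the path A′.
    module Double {t₁ t₂ t₃ q p r : V} {A′ C Z₂ Z₃ Zr : List V} (k : Config t₁ t₂ t₃ (A′ ++ q ∷ p ∷ C) Z₂ Z₃) (ar : Arm r Zr)
      (rq : A r q ≡ true) (rp : A r p ≡ true) (nr : NA (r ∷ []) (t₁ ∷ A′)) (nrC : NA (r ∷ []) C) (nr₂ : NA (r ∷ Zr) (t₂ ∷ Z₂)) (nr₃ : NA (r ∷ Zr) (t₃ ∷ Z₃))
      (nz : NA Zr (t₁ ∷ A′ ++ q ∷ p ∷ C)) where

      ip₁ : IP t₁ (A′ ++ q ∷ p ∷ C)
      ip₁ = proj₁ (a₁ k)
      ip₂ : IP q (p ∷ C)
      ip₂ = ip-suffix A′ ip₁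
      aq : Arm q (p ∷ C)
      aq = arm-suffix (t₁ ∷ A′) refl (a₁ k)
      ap : Arm p C
      ap = arm-suffix (t₁ ∷ A′ ++ q ∷ []) (cong (t₁ ∷_) (≡.sym (Listₚ.++-assoc A′ (q ∷ []) (p ∷ C)))) (a₁ k)
      inA : ∀ {z} → z ∈ A′ → z ∈ A′ ++ q ∷ p ∷ C
      inA = ∈-++⁺ˡ
      inq : q ∈ A′ ++ q ∷ p ∷ C
      inq = ∈-++⁺ʳ A′ (here refl)
      inp : p ∈ A′ ++ q ∷ p ∷ C
      inp = ∈-++⁺ʳ A′ (there (here refl))
      inC : ∀ {z} → z ∈ C → z ∈ A′ ++ q ∷ p ∷ C
      inC = ∈-++⁺ʳ A′ ∘ there ∘ there
      sep : NA (t₁ ∷ A′) (p ∷ C)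
      sep = ip-sep A′ ip₁
      qp : A q p ≡ true
      qp with ip₂
      ... | cons e _ _ _ = e
      qC : NA (q ∷ []) C
      qC (here refl) b∈ = ip-head ip₂ b∈
      n₂ : NA (A′ ++ q ∷ p ∷ C) (t₂ ∷ Z₂)
      n₂ = proj₁ (proj₂ (j₁₂ k))
      n₃ : NA (A′ ++ q ∷ p ∷ C) (t₃ ∷ Z₃)
      n₃ = proj₁ (proj₂ (j₁₃ k))
      CA : NA C A′
      CA = NA-sym (NA-⊆ there there sep)
      Ct₁ : NA C (t₁ ∷ [])
      Ct₁ = NA-sym (NA-⊆ (λ { (here e) → here e }) there sep)
      Cq : NA C (q ∷ [])
      Cq = NA-sym qC
      C₂ : NA C (t₂ ∷ Z₂)
      C₂ = NA-⊆ inC id n₂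
      C₃ : NA C (t₃ ∷ Z₃)
      C₃ = NA-⊆ inC id n₃
      Cr : NA C (r ∷ Zr)
      Cr = NA-sym (NA-∷ nrC (NA-⊆ id (there ∘ inC) nz))
      rA : NA (r ∷ []) A′
      rA = NA-⊆ id there nr
      ZrA : NA Zr A′
      ZrA = NA-⊆ id (there ∘ inA) nz
      Zr1 : ∀ {z} → z ∈ t₁ ∷ A′ ++ q ∷ p ∷ C → NA Zr (z ∷ [])
      Zr1 z∈ = NA-one nz z∈
      Zr₂ : NA Zr (t₂ ∷ Z₂)
      Zr₂ = NA-⊆ there id nr₂
      Zr₃ : NA Zr (t₃ ∷ Z₃)
      Zr₃ = NA-⊆ there id nr₃
      A₂ : NA A′ (t₂ ∷ Z₂)
      A₂ = NA-⊆ inA id n₂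
      A₃ : NA A′ (t₃ ∷ Z₃)
      A₃ = NA-⊆ inA id n₃
      Ap : NA A′ (p ∷ [])
      Ap = NA-one (NA-⊆ there id sep) (here refl)
      Ar : NA A′ (r ∷ Zr)
      Ar = NA-sym (NA-∷ rA ZrA)
      hd : ∀ {X a Y} → NA X (a ∷ Y) → NA X (a ∷ [])
      hd f = NA-one f (here refl)
      tl : ∀ {X a Y} → NA X (a ∷ Y) → NA X Y
      tl f = NA-⊆ id there f
      Z₂1 : ∀ {z} → z ∈ t₁ ∷ A′ ++ q ∷ p ∷ C → NA Z₂ (z ∷ [])
      Z₂1 z∈ = NA-one (NA-sym (proj₂ (proj₂ (j₁₂ k)))) z∈
      Z₃1 : ∀ {z} → z ∈ t₁ ∷ A′ ++ q ∷ p ∷ C → NA Z₃ (z ∷ [])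
      Z₃1 z∈ = NA-one (NA-sym (proj₂ (proj₂ (j₁₃ k)))) z∈
      Z₂r : NA Z₂ (r ∷ [])
      Z₂r = NA-⊆ there (λ { (here e) → here e }) (NA-sym nr₂)
      Z₃r : NA Z₃ (r ∷ [])
      Z₃r = NA-⊆ there (λ { (here e) → here e }) (NA-sym nr₃)
      Z₂t₃ : NA Z₂ (t₃ ∷ [])
      Z₂t₃ = join-NAₜ (j₂₃ k)
      Z₃t₂ : NA Z₃ (t₂ ∷ [])
      Z₃t₂ = join-NAₜ (join-sym (j₂₃ k))
      lA : Leg t₁ A′ q
      lA = leg-of-path A′ ip₁
      t₁q : A t₁ q ≡ isTriv (legT A′)
      t₁q = flipA (hit-isTriv A′ (ip-hit A′ ip₁))
      t₁p : A t₁ p ≡ false × t₁ ≢ p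
      t₁p = sep (here refl) (here refl)
      xq : A x q ≡ false
      xq = arm-hit aq
      xt₁ : A x t₁ ≡ false
      xt₁ = go A′ (arm-hit (a₁ k))
        where
        go : ∀ L → A x t₁ ≡ isTriv (legT (L ++ q ∷ p ∷ C)) → A x t₁ ≡ false
        go [] e = e
        go (_ ∷ _) e = e
      rt₁ : A r t₁ ≡ false × r ≢ t₁
      rt₁ = nr (here refl) (here refl)
      rt₂ : A r t₂ ≡ false × r ≢ t₂
      rt₂ = nr₂ (here refl) (here refl)
      rt₃ : A r t₃ ≡ false × r ≢ t₃
      rt₃ = nr₃ (here refl) (here refl)
      pt₂ : A p t₂ ≡ false × p ≢ t₂
      pt₂ = n₂ inp (here refl)
      pt₃ : A p t₃ ≡ false × p ≢ t₃
      pt₃ = n₃ inp (here refl)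
      qt₂ : A q t₂ ≡ false × q ≢ t₂
      qt₂ = n₂ inq (here refl)
      qt₃ : A q t₃ ≡ false × q ≢ t₃
      qt₃ = n₃ inq (here refl)
      t₁≢q : t₁ ≢ q
      t₁≢q refl = unique-head (ip-unique ip₁) inq
      tri₁₂ = proj₁ (j₁₂ k)
      tri₁₃ = proj₁ (j₁₃ k)
      tri₂₃ = proj₁ (j₂₃ k)
      W₂ : ∀ {z} → z ∈ Z₂ → z ∈ W
      W₂ = H⊆W ∘ arm-Z (a₂ k)
      W₃ : ∀ {z} → z ∈ Z₃ → z ∈ W
      W₃ = H⊆W ∘ arm-Z (a₃ k)
      Wr : ∀ {z} → z ∈ Zr → z ∈ W
      Wr = H⊆W ∘ arm-Z ar
      WC : ∀ {z} → z ∈ C → z ∈ W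
      WC = H⊆W ∘ arm-Z ap
      A-H : ∀ {z} → z ∈ A′ → z ∈ H
      A-H = arm-Z (a₁ k) ∘ inA

      Ax : NA A′ (x ∷ [])
      Ax z∈ (here refl) = flipA (hit-⊥ A′ (proj₁ (proj₂ (a₁ k))) (there z∈)) , H-≢ (A-H z∈)

      -- The vertex `v` has degree 2 but stays in the table. Contraction would force exponent 1 on
      -- it, whereas the monomial used here has exponent 0 at `v`. The same holds in `left′`,
      -- `right` and `middle`.
      left : ∀ {v C′} → C ≡ v ∷ C′ → ⊥
      left {v} {C′} refl = certX (v ∷ p ∷ r ∷ q ∷ t₁ ∷ t₂ ∷ t₃ ∷ []) (dtlR (legT C′) (legT Zr) (legT A′) (legT Z₂) (legT Z₃)) (2 ∷ 0 ∷ 2 ∷ 1 ∷ 2 ∷ 2 ∷ 1 ∷ 2 ∷ [])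
        (leg 1F C′ 0F (H-≢ (top av)) (arm-leg av) (off-++ (tl Cr′) (off-++ (c′ CA) (off-++ (tl (c′ C₂)) (off-++ (tl (c′ C₃))
            (off-tgt (off-src (off-∷ C′p (off-∷ (hd Cr′) (off-∷ (c′ Cq) (off-∷ (c′ Ct₁) (off-∷ (hd (c′ C₂)) (off-∷ (hd (c′ C₃)) off-[])))))))))))) (hH (arm-Z av))
        (leg 3F Zr 0F (H-≢ (top ar)) (arm-leg ar) (off-++ ZrA (off-++ (tl Zr₂) (off-++ (tl Zr₃)
            (off-tgt (off-∷ (Zr1 (there (inC (here refl)))) (off-∷ (Zr1 (there inp)) (off-src (off-∷ (Zr1 (there inq)) (off-∷ (Zr1 (here refl)) (off-∷ (hd Zr₂) (off-∷ (hd Zr₃) off-[])))))))))) ) (hH (arm-Z ar))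
        (leg 5F A′ 4F t₁≢q lA (off-++ (tl A₂) (off-++ (tl A₃) (off-∷ Ax (off-∷ (NA-one (NA-⊆ there id sep) (there (here refl))) (off-∷ Ap (off-∷ (hd Ar) (off-tgt (off-src (off-∷ (hd A₂) (off-∷ (hd A₃) off-[])))))))))) (hH A-H)
        (leg 6F Z₂ 0F (H-≢ (top (a₂ k))) (arm-leg (a₂ k)) (off-++ (join-NA (j₂₃ k)) (off-tgt (off-∷ (Z₂1 (there (inC (here refl)))) (off-∷ (Z₂1 (there inp)) (off-∷ Z₂r (off-∷ (Z₂1 (there inq)) (off-∷ (Z₂1 (here refl)) (off-src (off-∷ Z₂t₃ off-[]))))))))) (hH (arm-Z (a₂ k)))
        (leg 7F Z₃ 0F (H-≢ (top (a₃ k))) (arm-leg (a₃ k)) (off-tgt (off-∷ (Z₃1 (there (inC (here refl)))) (off-∷ (Z₃1 (there inp)) (off-∷ Z₃r (off-∷ (Z₃1 (there inq)) (off-∷ (Z₃1 (here refl)) (off-∷ Z₃t₂ (off-src off-[])))))))) (hH (arm-Z (a₃ k)))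
        base)))))
        ((x≢ (top av) ∷ x≢ (top ap) ∷ x≢ (top ar) ∷ x≢ (top aq) ∷ x≢ (top (a₁ k)) ∷ x≢ (top (a₂ k)) ∷ x≢ (top (a₃ k)) ∷ []) ∷
         (A-≢ vp ∷ proj₂ vr ∷ proj₂ vq ∷ proj₂ vt₁ ∷ proj₂ vt₂ ∷ proj₂ vt₃ ∷ []) ∷
         ((A-≢ rp ∘ ≡.sym) ∷ (A-≢ qp ∘ ≡.sym) ∷ (proj₂ t₁p ∘ ≡.sym) ∷ proj₂ pt₂ ∷ proj₂ pt₃ ∷ []) ∷
         (A-≢ rq ∷ proj₂ rt₁ ∷ proj₂ rt₂ ∷ proj₂ rt₃ ∷ []) ∷ ((t₁≢q ∘ ≡.sym) ∷ proj₂ qt₂ ∷ proj₂ qt₃ ∷ []) ∷ (A-≢ tri₁₂ ∷ A-≢ tri₁₃ ∷ []) ∷ (A-≢ tri₂₃ ∷ []) ∷ [] ∷ [])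
        ((arm-hit av , arm-hit ap , arm-hit ar , xq , xt₁ , arm-hit (a₂ k) , arm-hit (a₃ k) , tt) ,
         (vp , proj₁ vr , proj₁ vq , proj₁ vt₁ , proj₁ vt₂ , proj₁ vt₃ , tt) ,
         (flipA rp , flipA qp , flipA (proj₁ t₁p) , proj₁ pt₂ , proj₁ pt₃ , tt) ,
         (rq , proj₁ rt₁ , proj₁ rt₂ , proj₁ rt₃ , tt) , (flipA t₁q , proj₁ qt₂ , proj₁ qt₃ , tt) , (tri₁₂ , tri₁₃ , tt) , (tri₂₃ , tt) , tt , tt)
        ((WC ∘ there) ⊕ Wr ⊕ H⊆W ∘ A-H ⊕ W₂ ⊕ W₃ ⊕ x∈W ⊙ WC (here refl) ⊙ H⊆W (top ap) ⊙ H⊆W (top ar) ⊙ H⊆W (top aq) ⊙ H⊆W (top (a₁ k)) ⊙ H⊆W (top (a₂ k)) ⊙ H⊆W (top (a₃ k)) ⊙ ⊆[])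
        (dtl-ok (legT C′ ∷ legT Zr ∷ legT A′ ∷ legT Z₂ ∷ legT Z₃ ∷ []))
        where
        av : Arm v C′
        av = arm-suffix (p ∷ []) refl ap
        c′ : ∀ {Y} → NA (v ∷ C′) Y → NA C′ Y
        c′ = NA-⊆ there id
        Cr′ = c′ Cr
        ipp : IP p (v ∷ C′)
        ipp = proj₁ ap
        C′p : NA C′ (p ∷ [])
        C′p a∈ (here refl) = let e , ne = ip-head ipp a∈ in flipA e , ne ∘ ≡.sym
        vp : A v p ≡ true
        vp with ipp
        ... | cons e _ _ _ = flipA e
        vr = Cr (here refl) (here refl)
        vq = Cq (here refl) (here refl)
        vt₁ = Ct₁ (here refl) (here refl)
        vt₂ = C₂ (here refl) (here refl)
        vt₃ = C₃ (here refl) (here refl)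

      left′ : ∀ {v Y} → Zr ≡ v ∷ Y → ⊥
      left′ {v} {Y} refl = certX (v ∷ r ∷ p ∷ q ∷ t₁ ∷ t₂ ∷ t₃ ∷ []) (dtlR (legT Y) (legT C) (legT A′) (legT Z₂) (legT Z₃)) (2 ∷ 0 ∷ 2 ∷ 1 ∷ 2 ∷ 2 ∷ 1 ∷ 2 ∷ [])
        (leg 1F Y 0F (H-≢ (top av)) (arm-leg av) (off-++ (y′ (NA-⊆ id (there ∘ inC) nz)) (off-++ (y′ ZrA) (off-++ (tl (y′ Zr₂)) (off-++ (tl (y′ Zr₃))
            (off-tgt (off-src (off-∷ Yr (off-∷ (y′ (Zr1 (there inp))) (off-∷ (y′ (Zr1 (there inq))) (off-∷ (y′ (Zr1 (here refl))) (off-∷ (hd (y′ Zr₂)) (off-∷ (hd (y′ Zr₃)) off-[])))))))))))) (hH (arm-Z av))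
        (leg 3F C 0F (H-≢ (top ap)) (arm-leg ap) (off-++ CA (off-++ (tl C₂) (off-++ (tl C₃)
            (off-tgt (off-∷ (NA-one Cr (there (here refl))) (off-∷ (hd Cr) (off-src (off-∷ Cq (off-∷ Ct₁ (off-∷ (hd C₂) (off-∷ (hd C₃) off-[])))))))))) ) (hH (arm-Z ap))
        (leg 5F A′ 4F t₁≢q lA (off-++ (tl A₂) (off-++ (tl A₃) (off-∷ Ax (off-∷ (NA-one Ar (there (here refl))) (off-∷ (hd Ar) (off-∷ Ap (off-tgt (off-src (off-∷ (hd A₂) (off-∷ (hd A₃) off-[])))))))))) (hH A-H)
        (leg 6F Z₂ 0F (H-≢ (top (a₂ k))) (arm-leg (a₂ k)) (off-++ (join-NA (j₂₃ k)) (off-tgt (off-∷ Z₂v (off-∷ Z₂r (off-∷ (Z₂1 (there inp)) (off-∷ (Z₂1 (there inq)) (off-∷ (Z₂1 (here refl)) (off-src (off-∷ Z₂t₃ off-[]))))))))) (hH (arm-Z (a₂ k)))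
        (leg 7F Z₃ 0F (H-≢ (top (a₃ k))) (arm-leg (a₃ k)) (off-tgt (off-∷ Z₃v (off-∷ Z₃r (off-∷ (Z₃1 (there inp)) (off-∷ (Z₃1 (there inq)) (off-∷ (Z₃1 (here refl)) (off-∷ Z₃t₂ (off-src off-[])))))))) (hH (arm-Z (a₃ k)))
        base)))))
        ((x≢ (top av) ∷ x≢ (top ar) ∷ x≢ (top ap) ∷ x≢ (top aq) ∷ x≢ (top (a₁ k)) ∷ x≢ (top (a₂ k)) ∷ x≢ (top (a₃ k)) ∷ []) ∷
         (A-≢ vr ∷ proj₂ vp ∷ proj₂ vq ∷ proj₂ vt₁ ∷ proj₂ vt₂ ∷ proj₂ vt₃ ∷ []) ∷
         (A-≢ rp ∷ A-≢ rq ∷ proj₂ rt₁ ∷ proj₂ rt₂ ∷ proj₂ rt₃ ∷ []) ∷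
         ((A-≢ qp ∘ ≡.sym) ∷ (proj₂ t₁p ∘ ≡.sym) ∷ proj₂ pt₂ ∷ proj₂ pt₃ ∷ []) ∷ ((t₁≢q ∘ ≡.sym) ∷ proj₂ qt₂ ∷ proj₂ qt₃ ∷ []) ∷ (A-≢ tri₁₂ ∷ A-≢ tri₁₃ ∷ []) ∷ (A-≢ tri₂₃ ∷ []) ∷ [] ∷ [])
        ((arm-hit av , arm-hit ar , arm-hit ap , xq , xt₁ , arm-hit (a₂ k) , arm-hit (a₃ k) , tt) ,
         (vr , proj₁ vp , proj₁ vq , proj₁ vt₁ , proj₁ vt₂ , proj₁ vt₃ , tt) ,
         (rp , rq , proj₁ rt₁ , proj₁ rt₂ , proj₁ rt₃ , tt) ,
         (flipA qp , flipA (proj₁ t₁p) , proj₁ pt₂ , proj₁ pt₃ , tt) , (flipA t₁q , proj₁ qt₂ , proj₁ qt₃ , tt) , (tri₁₂ , tri₁₃ , tt) , (tri₂₃ , tt) , tt , tt)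
        ((Wr ∘ there) ⊕ WC ⊕ H⊆W ∘ A-H ⊕ W₂ ⊕ W₃ ⊕ x∈W ⊙ Wr (here refl) ⊙ H⊆W (top ar) ⊙ H⊆W (top ap) ⊙ H⊆W (top aq) ⊙ H⊆W (top (a₁ k)) ⊙ H⊆W (top (a₂ k)) ⊙ H⊆W (top (a₃ k)) ⊙ ⊆[])
        (dtl-ok (legT Y ∷ legT C ∷ legT A′ ∷ legT Z₂ ∷ legT Z₃ ∷ []))
        where
        av : Arm v Y
        av = arm-suffix (r ∷ []) refl ar
        y′ : ∀ {U} → NA (v ∷ Y) U → NA Y U
        y′ = NA-⊆ there id
        ipr : IP r (v ∷ Y)
        ipr = proj₁ ar
        Yr : NA Y (r ∷ [])
        Yr a∈ (here refl) = let e , ne = ip-head ipr a∈ in flipA e , ne ∘ ≡.sym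
        vr : A v r ≡ true
        vr with ipr
        ... | cons e _ _ _ = flipA e
        vp = nz (here refl) (there inp)
        vq = nz (here refl) (there inq)
        vt₁ = nz (here refl) (here refl)
        vt₂ = Zr₂ (here refl) (here refl)
        vt₃ = Zr₃ (here refl) (here refl)
        Z₂v : NA Z₂ (v ∷ [])
        Z₂v = NA-⊆ there id (NA-one (NA-sym nr₂) (there (here refl)))
        Z₃v : NA Z₃ (v ∷ [])
        Z₃v = NA-⊆ there id (NA-one (NA-sym nr₃) (there (here refl)))

      right : ∀ {v Y} → Z₂ ≡ v ∷ Y → ⊥
      right {v} {Y} refl = certX (v ∷ p ∷ r ∷ q ∷ t₁ ∷ t₂ ∷ t₃ ∷ []) (dtrR (legT C) (legT Zr) (legT A′) (legT Y) (legT Z₃)) (2 ∷ 0 ∷ 1 ∷ 2 ∷ 2 ∷ 1 ∷ 2 ∷ 2 ∷ [])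
        (leg 2F C 0F (H-≢ (top ap)) (arm-leg ap) (off-++ (tl Cr) (off-++ CA (off-++ (tl (tl C₂)) (off-++ (tl C₃)
            (off-tgt (off-∷ (hd (tl C₂)) (off-src (off-∷ (hd Cr) (off-∷ Cq (off-∷ Ct₁ (off-∷ (hd C₂) (off-∷ (hd C₃) off-[])))))))))))) (hH (arm-Z ap))
        (leg 3F Zr 0F (H-≢ (top ar)) (arm-leg ar) (off-++ ZrA (off-++ (tl (tl Zr₂)) (off-++ (tl Zr₃)
            (off-tgt (off-∷ (hd (tl Zr₂)) (off-∷ (Zr1 (there inp)) (off-src (off-∷ (Zr1 (there inq)) (off-∷ (Zr1 (here refl)) (off-∷ (hd Zr₂) (off-∷ (hd Zr₃) off-[])))))))))) ) (hH (arm-Z ar))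
        (leg 5F A′ 4F t₁≢q lA (off-++ (tl (tl A₂)) (off-++ (tl A₃) (off-∷ Ax (off-∷ (hd (tl A₂)) (off-∷ Ap (off-∷ (hd Ar) (off-tgt (off-src (off-∷ (hd A₂) (off-∷ (hd A₃) off-[])))))))))) (hH A-H)
        (leg 1F Y 0F (H-≢ (top av)) (arm-leg av) (off-++ (y′ (join-NA (j₂₃ k))) (off-tgt (off-src (off-∷ (y′ (Z₂1 (there inp))) (off-∷ (y′ Z₂r) (off-∷ (y′ (Z₂1 (there inq))) (off-∷ (y′ (Z₂1 (here refl))) (off-∷ Yt₂ (off-∷ (y′ Z₂t₃) off-[]))))))))) (hH (arm-Z av))
        (leg 7F Z₃ 0F (H-≢ (top (a₃ k))) (arm-leg (a₃ k)) (off-tgt (off-∷ Z₃v (off-∷ (Z₃1 (there inp)) (off-∷ Z₃r (off-∷ (Z₃1 (there inq)) (off-∷ (Z₃1 (here refl)) (off-∷ Z₃t₂ (off-src off-[])))))))) (hH (arm-Z (a₃ k)))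
        base)))))
        ((x≢ (top av) ∷ x≢ (top ap) ∷ x≢ (top ar) ∷ x≢ (top aq) ∷ x≢ (top (a₁ k)) ∷ x≢ (top (a₂ k)) ∷ x≢ (top (a₃ k)) ∷ []) ∷
         (proj₂ vp ∷ proj₂ vr ∷ proj₂ vq ∷ proj₂ vt₁ ∷ A-≢ vt₂ ∷ proj₂ vt₃ ∷ []) ∷
         ((A-≢ rp ∘ ≡.sym) ∷ (A-≢ qp ∘ ≡.sym) ∷ (proj₂ t₁p ∘ ≡.sym) ∷ proj₂ pt₂ ∷ proj₂ pt₃ ∷ []) ∷
         (A-≢ rq ∷ proj₂ rt₁ ∷ proj₂ rt₂ ∷ proj₂ rt₃ ∷ []) ∷ ((t₁≢q ∘ ≡.sym) ∷ proj₂ qt₂ ∷ proj₂ qt₃ ∷ []) ∷ (A-≢ tri₁₂ ∷ A-≢ tri₁₃ ∷ []) ∷ (A-≢ tri₂₃ ∷ []) ∷ [] ∷ [])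
        ((arm-hit av , arm-hit ap , arm-hit ar , xq , xt₁ , arm-hit (a₂ k) , arm-hit (a₃ k) , tt) ,
         (proj₁ vp , proj₁ vr , proj₁ vq , proj₁ vt₁ , vt₂ , proj₁ vt₃ , tt) ,
         (flipA rp , flipA qp , flipA (proj₁ t₁p) , proj₁ pt₂ , proj₁ pt₃ , tt) ,
         (rq , proj₁ rt₁ , proj₁ rt₂ , proj₁ rt₃ , tt) , (flipA t₁q , proj₁ qt₂ , proj₁ qt₃ , tt) , (tri₁₂ , tri₁₃ , tt) , (tri₂₃ , tt) , tt , tt)
        (WC ⊕ Wr ⊕ H⊆W ∘ A-H ⊕ (W₂ ∘ there) ⊕ W₃ ⊕ x∈W ⊙ W₂ (here refl) ⊙ H⊆W (top ap) ⊙ H⊆W (top ar) ⊙ H⊆W (top aq) ⊙ H⊆W (top (a₁ k)) ⊙ H⊆W (top (a₂ k)) ⊙ H⊆W (top (a₃ k)) ⊙ ⊆[])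
        (dtr-ok (legT C ∷ legT Zr ∷ legT A′ ∷ legT Y ∷ legT Z₃ ∷ []))
        where
        av : Arm v Y
        av = arm-suffix (t₂ ∷ []) refl (a₂ k)
        y′ : ∀ {U} → NA (v ∷ Y) U → NA Y U
        y′ = NA-⊆ there id
        ipt : IP t₂ (v ∷ Y)
        ipt = proj₁ (a₂ k)
        Yt₂ : NA Y (t₂ ∷ [])
        Yt₂ a∈ (here refl) = let e , ne = ip-head ipt a∈ in flipA e , ne ∘ ≡.sym
        vt₂ : A v t₂ ≡ true
        vt₂ with ipt
        ... | cons e _ _ _ = flipA e
        vp = Z₂1 (there inp) (here refl) (here refl)
        vq = Z₂1 (there inq) (here refl) (here refl)
        vt₁ = Z₂1 (here refl) (here refl) (here refl)
        vr = Z₂r (here refl) (here refl)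
        vt₃ = Z₂t₃ (here refl) (here refl)
        Z₃v : NA Z₃ (v ∷ [])
        Z₃v = NA-one (NA-sym (join-NA (j₂₃ k))) (here refl)

      -- With all other paths as short as possible, the one remaining freedom is the path between
      -- the two triangles; `v` is a vertex on it next to `t₁`.
      middle : C ≡ [] → Zr ≡ [] → Z₂ ≡ [] → Z₃ ≡ [] → ∀ {v Y} → A′ ≡ v ∷ Y → ⊥
      middle refl refl refl refl {v} {Y} refl = certX (v ∷ p ∷ r ∷ q ∷ t₁ ∷ t₂ ∷ t₃ ∷ []) (dtmR (legT Y)) (2 ∷ 0 ∷ 1 ∷ 2 ∷ 2 ∷ 2 ∷ 1 ∷ 2 ∷ [])
        (leg 1F Y 4F v≢q (leg-of-path Y ipv) (off-∷ (y′ Ax) (off-src (off-∷ (y′ Ap) (off-∷ (hd (y′ Ar)) (off-tgt (off-∷ Yt₁ (off-∷ (hd (y′ A₂)) (off-∷ (hd (y′ A₃)) off-[])))))))) (hH (A-H ∘ there))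
        base)
        ((x≢ (A-H (here refl)) ∷ x≢ (top ap) ∷ x≢ (top ar) ∷ x≢ (top aq) ∷ x≢ (top (a₁ k)) ∷ x≢ (top (a₂ k)) ∷ x≢ (top (a₃ k)) ∷ []) ∷
         (proj₂ vp ∷ proj₂ vr ∷ v≢q ∷ A-≢ vt₁ ∷ proj₂ vt₂ ∷ proj₂ vt₃ ∷ []) ∷
         ((A-≢ rp ∘ ≡.sym) ∷ (A-≢ qp ∘ ≡.sym) ∷ (proj₂ t₁p ∘ ≡.sym) ∷ proj₂ pt₂ ∷ proj₂ pt₃ ∷ []) ∷
         (A-≢ rq ∷ proj₂ rt₁ ∷ proj₂ rt₂ ∷ proj₂ rt₃ ∷ []) ∷ ((t₁≢q ∘ ≡.sym) ∷ proj₂ qt₂ ∷ proj₂ qt₃ ∷ []) ∷ (A-≢ tri₁₂ ∷ A-≢ tri₁₃ ∷ []) ∷ (A-≢ tri₂₃ ∷ []) ∷ [] ∷ [])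
        ((flipA (proj₁ (Ax (here refl) (here refl))) , arm-hit ap , arm-hit ar , xq , xt₁ , arm-hit (a₂ k) , arm-hit (a₃ k) , tt) ,
         (proj₁ vp , proj₁ vr , vq , vt₁ , proj₁ vt₂ , proj₁ vt₃ , tt) ,
         (flipA rp , flipA qp , flipA (proj₁ t₁p) , proj₁ pt₂ , proj₁ pt₃ , tt) ,
         (rq , proj₁ rt₁ , proj₁ rt₂ , proj₁ rt₃ , tt) , (flipA t₁q , proj₁ qt₂ , proj₁ qt₃ , tt) , (tri₁₂ , tri₁₃ , tt) , (tri₂₃ , tt) , tt , tt)
        ((H⊆W ∘ A-H ∘ there) ⊕ x∈W ⊙ H⊆W (A-H (here refl)) ⊙ H⊆W (top ap) ⊙ H⊆W (top ar) ⊙ H⊆W (top aq) ⊙ H⊆W (top (a₁ k)) ⊙ H⊆W (top (a₂ k)) ⊙ H⊆W (top (a₃ k)) ⊙ ⊆[])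
        (dtm-ok (legT Y ∷ []))
        where
        y′ : ∀ {U} → NA (v ∷ Y) U → NA Y U
        y′ = NA-⊆ there id
        ipv : IP v (Y ++ q ∷ p ∷ [])
        ipv = ip-suffix [] ip₁
        v≢q : v ≢ q
        v≢q refl = unique-head (ip-unique ipv) (∈-++⁺ʳ Y (here refl))
        vq : A v q ≡ isTriv (legT Y)
        vq = flipA (hit-isTriv Y (ip-hit Y ipv))
        vt₁ : A v t₁ ≡ true
        vt₁ with ip₁
        ... | cons e _ _ _ = flipA e
        Yt₁ : NA Y (t₁ ∷ [])
        Yt₁ a∈ (here refl) = let e , ne = ip-head ip₁ (∈-++⁺ˡ a∈) in flipA e , ne ∘ ≡.sym
        vp = Ap (here refl) (here refl)
        vr = Ar (here refl) (here refl)
        vt₂ = A₂ (here refl) (here refl)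
        vt₃ = A₃ (here refl) (here refl)

    -- The degenerate form of `Double`, in which the two triangles share the vertex `t₁`.
    bowtie : ∀ {t₁ t₂ t₃ p r C Z₂ Z₃ Zr} → Config t₁ t₂ t₃ (p ∷ C) Z₂ Z₃ → Arm r Zr → A r t₁ ≡ true → A r p ≡ true → NA (r ∷ []) C →
      NA (r ∷ Zr) (t₂ ∷ Z₂) → NA (r ∷ Zr) (t₃ ∷ Z₃) → NA Zr (t₁ ∷ p ∷ C) → ⊥
    bowtie {t₁} {t₂} {t₃} {p} {r} {C} {Z₂} {Z₃} {Zr} k ar rt rp nrC nr₂ nr₃ nz =
      certX (p ∷ r ∷ t₁ ∷ t₂ ∷ t₃ ∷ []) (bowR (legT C) (legT Zr) (legT Z₂) (legT Z₃)) (2 ∷ 1 ∷ 2 ∷ 2 ∷ 1 ∷ 2 ∷ [])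
        (leg 1F C 0F (H-≢ (top ap)) (arm-leg ap) (off-++ (tl Cr) (off-++ (tl C₂) (off-++ (tl C₃) (off-tgt (off-src (off-∷ (hd Cr) (off-∷ Ct₁ (off-∷ (hd C₂) (off-∷ (hd C₃) off-[]))))))))) (hH (arm-Z ap))
        (leg 2F Zr 0F (H-≢ (top ar)) (arm-leg ar) (off-++ (NA-⊆ there there nr₂) (off-++ (NA-⊆ there there nr₃) (off-tgt (off-∷ (NA-one nz (there (here refl))) (off-src (off-∷ (NA-one nz (here refl)) (off-∷ (hd (NA-⊆ there id nr₂)) (off-∷ (hd (NA-⊆ there id nr₃)) off-[])))))))) (hH (arm-Z ar))
        (leg 4F Z₂ 0F (H-≢ (top (a₂ k))) (arm-leg (a₂ k)) (off-++ (join-NA (j₂₃ k)) (off-tgt (off-∷ (Z₂1 (there (here refl))) (off-∷ (NA-⊆ there id (hd (NA-sym nr₂))) (off-∷ (Z₂1 (here refl)) (off-src (off-∷ (join-NAₜ (j₂₃ k)) off-[]))))))) (hH (arm-Z (a₂ k)))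
        (leg 5F Z₃ 0F (H-≢ (top (a₃ k))) (arm-leg (a₃ k)) (off-tgt (off-∷ (Z₃1 (there (here refl))) (off-∷ (NA-⊆ there id (hd (NA-sym nr₃))) (off-∷ (Z₃1 (here refl)) (off-∷ (join-NAₜ (join-sym (j₂₃ k))) (off-src off-[])))))) (hH (arm-Z (a₃ k)))
        base))))
        ((x≢ (top ap) ∷ x≢ (top ar) ∷ x≢ (top (a₁ k)) ∷ x≢ (top (a₂ k)) ∷ x≢ (top (a₃ k)) ∷ []) ∷
         ((A-≢ rp ∘ ≡.sym) ∷ (A-≢ tp ∘ ≡.sym) ∷ NA-ne n₂ (here refl) (here refl) ∷ NA-ne n₃ (here refl) (here refl) ∷ []) ∷
         (A-≢ rt ∷ NA-ne nr₂ (here refl) (here refl) ∷ NA-ne nr₃ (here refl) (here refl) ∷ []) ∷ (A-≢ (proj₁ (j₁₂ k)) ∷ A-≢ (proj₁ (j₁₃ k)) ∷ []) ∷ (A-≢ (proj₁ (j₂₃ k)) ∷ []) ∷ [] ∷ [])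
        ((arm-hit ap , arm-hit ar , arm-hit (a₁ k) , arm-hit (a₂ k) , arm-hit (a₃ k) , tt) ,
         (flipA rp , flipA tp , NA-hd n₂ (here refl) (here refl) , NA-hd n₃ (here refl) (here refl) , tt) ,
         (rt , NA-hd nr₂ (here refl) (here refl) , NA-hd nr₃ (here refl) (here refl) , tt) , (proj₁ (j₁₂ k) , proj₁ (j₁₃ k) , tt) , (proj₁ (j₂₃ k) , tt) , tt , tt)
        (H⊆W ∘ arm-Z ap ⊕ H⊆W ∘ arm-Z ar ⊕ H⊆W ∘ arm-Z (a₂ k) ⊕ H⊆W ∘ arm-Z (a₃ k) ⊕ x∈W ⊙ H⊆W (top ap) ⊙ H⊆W (top ar) ⊙ H⊆W (top (a₁ k)) ⊙ H⊆W (top (a₂ k)) ⊙ H⊆W (top (a₃ k)) ⊙ ⊆[])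
        (bow-ok (legT C ∷ legT Zr ∷ legT Z₂ ∷ legT Z₃ ∷ []))
      where
      ap : Arm p C
      ap = arm-suffix (t₁ ∷ []) refl (a₁ k)
      ip₁ = proj₁ (a₁ k)
      n₂ = proj₁ (proj₂ (j₁₂ k))
      n₃ = proj₁ (proj₂ (j₁₃ k))
      hd : ∀ {X a Y} → NA X (a ∷ Y) → NA X (a ∷ [])
      hd f = NA-one f (here refl)
      tl : ∀ {X a Y} → NA X (a ∷ Y) → NA X Y
      tl f = NA-⊆ id there f
      tp : A t₁ p ≡ true
      tp with ip₁
      ... | cons e _ _ _ = e
      C₂ : NA C (t₂ ∷ Z₂)
      C₂ = NA-⊆ there id n₂
      C₃ : NA C (t₃ ∷ Z₃)
      C₃ = NA-⊆ there id n₃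
      Cr : NA C (r ∷ Zr)
      Cr = NA-sym (NA-∷ nrC (NA-⊆ id (there ∘ there) nz))
      Ct₁ : NA C (t₁ ∷ [])
      Ct₁ a∈ (here refl) = let e , ne = ip-head ip₁ a∈ in flipA e , ne ∘ ≡.sym
      Z₂1 : ∀ {z} → z ∈ t₁ ∷ p ∷ C → NA Z₂ (z ∷ [])
      Z₂1 z∈ = NA-one (NA-sym (proj₂ (proj₂ (j₁₂ k)))) z∈
      Z₃1 : ∀ {z} → z ∈ t₁ ∷ p ∷ C → NA Z₃ (z ∷ [])
      Z₃1 z∈ = NA-one (NA-sym (proj₂ (proj₂ (j₁₃ k)))) z∈

  off-⊆ : ∀ {Y U U′ u v} → (∀ {z} → z ∈ U′ → z ∈ U) → Off Y U u v → Off Y U′ u v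
  off-⊆ i f p q = f p (i q)

  off-swap : ∀ {Y U u v} → Off Y U u v → Off Y U v u
  off-swap f p q a b = f p q b a

  off-NA : ∀ {Y U u v X} → Off Y U u v → (∀ {z} → z ∈ X → z ∈ U) → u ∉ X → v ∉ X → NA Y X
  off-NA f i u∉ v∉ y∈ b∈ = f y∈ (i b∈) (λ { refl → u∉ b∈ }) (λ { refl → v∉ b∈ })

  Tri : V → List V → V → List V → V → List V → List V
  Tri t₁ Z₁ t₂ Z₂ t₃ Z₃ = (t₁ ∷ Z₁) ++ (t₂ ∷ Z₂) ++ (t₃ ∷ Z₃)

  ∈-1 : ∀ {t₁ Z₁ t₂ Z₂ t₃ Z₃ z} → z ∈ t₁ ∷ Z₁ → z ∈ Tri t₁ Z₁ t₂ Z₂ t₃ Z₃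
  ∈-1 = ∈-++⁺ˡ

  ∈-2 : ∀ {t₁ Z₁ t₂ Z₂ t₃ Z₃ z} → z ∈ t₂ ∷ Z₂ → z ∈ Tri t₁ Z₁ t₂ Z₂ t₃ Z₃
  ∈-2 {t₁} {Z₁} = ∈-++⁺ʳ (t₁ ∷ Z₁) ∘ ∈-++⁺ˡ

  ∈-3 : ∀ {t₁ Z₁ t₂ Z₂ t₃ Z₃ z} → z ∈ t₃ ∷ Z₃ → z ∈ Tri t₁ Z₁ t₂ Z₂ t₃ Z₃
  ∈-3 {t₁} {Z₁} {t₂} {Z₂} = ∈-++⁺ʳ (t₁ ∷ Z₁) ∘ ∈-++⁺ʳ (t₂ ∷ Z₂)

  data Where (t₁ : V) (Z₁ : List V) (t₂ : V) (Z₂ : List V) (t₃ : V) (Z₃ : List V) (z : V) : Set where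
    in₁ : z ∈ t₁ ∷ Z₁ → Where t₁ Z₁ t₂ Z₂ t₃ Z₃ z
    in₂ : z ∈ t₂ ∷ Z₂ → Where t₁ Z₁ t₂ Z₂ t₃ Z₃ z
    in₃ : z ∈ t₃ ∷ Z₃ → Where t₁ Z₁ t₂ Z₂ t₃ Z₃ z

  whereT : ∀ {t₁ Z₁ t₂ Z₂ t₃ Z₃ z} → z ∈ Tri t₁ Z₁ t₂ Z₂ t₃ Z₃ → Where t₁ Z₁ t₂ Z₂ t₃ Z₃ z
  whereT {t₁} {Z₁} {t₂} {Z₂} p with ∈-++⁻ (t₁ ∷ Z₁) p
  ... | inj₁ q = in₁ q
  ... | inj₂ q with ∈-++⁻ (t₂ ∷ Z₂) q
  ...   | inj₁ r = in₂ r
  ...   | inj₂ r = in₃ r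

  tri-rot : ∀ {t₁ Z₁ t₂ Z₂ t₃ Z₃ z} → z ∈ Tri t₂ Z₂ t₃ Z₃ t₁ Z₁ → z ∈ Tri t₁ Z₁ t₂ Z₂ t₃ Z₃
  tri-rot {t₁} {Z₁} {t₂} {Z₂} {t₃} {Z₃} p with whereT {t₂} {Z₂} {t₃} {Z₃} p
  ... | in₁ q = ∈-2 {t₁} {Z₁} q
  ... | in₂ q = ∈-3 {t₁} {Z₁} {t₂} {Z₂} q
  ... | in₃ q = ∈-1 q

  tri-swap : ∀ {t₁ Z₁ t₂ Z₂ t₃ Z₃ z} → z ∈ Tri t₂ Z₂ t₁ Z₁ t₃ Z₃ → z ∈ Tri t₁ Z₁ t₂ Z₂ t₃ Z₃
  tri-swap {t₁} {Z₁} {t₂} {Z₂} {t₃} {Z₃} p with whereT {t₂} {Z₂} {t₁} {Z₁} p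
  ... | in₁ q = ∈-2 {t₁} {Z₁} q
  ... | in₂ q = ∈-1 q
  ... | in₃ q = ∈-3 {t₁} {Z₁} {t₂} {Z₂} q

  -- A further path to `x`.

  module Core₃ {W : List V} {x : V} (S : Setting W x) where

    open Core₂ S public

    cfg-swap₂₃ : ∀ {t₁ t₂ t₃ Z₁ Z₂ Z₃} → Config t₁ t₂ t₃ Z₁ Z₂ Z₃ → Config t₁ t₃ t₂ Z₁ Z₃ Z₂
    cfg-swap₂₃ (cfg a b c d e f) = cfg a c b e d (join-sym f)

    -- With `x` these are seven vertices: the triangles `r q p` and `t₁ t₂ t₃`, the edge between `q`
    -- and `t₁`, and `x` joined to the other four.
    Beta : V → V → V → List V → List V → List V → V → List V → Set
    Beta t₁ t₂ t₃ Z₁ Z₂ Z₃ r Zr = Σ V λ q → Σ V λ p → Z₁ ≡ q ∷ p ∷ [] × Z₂ ≡ [] × Z₃ ≡ [] × Zr ≡ [] × A r q ≡ true × A r p ≡ true × A r t₁ ≡ false × A r t₂ ≡ false × A r t₃ ≡ false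

    -- All four arms are single vertices and `r` meets the whole triangle, so that they form a K₅
    -- with `x`.
    Alpha : V → V → V → List V → List V → List V → V → List V → Set
    Alpha t₁ t₂ t₃ Z₁ Z₂ Z₃ r Zr = Z₁ ≡ [] × Z₂ ≡ [] × Z₃ ≡ [] × Zr ≡ [] × A r t₁ ≡ true × A r t₂ ≡ true × A r t₃ ≡ true

    -- The first two arms close to an induced cycle through `x`. As in `line-config`, the neighbours
    -- of `r` on it have to be two consecutive vertices, so a second triangle arises; `bowtie` and
    -- `Double` leave only the seven-vertex graph.
    one-arm : ∀ {t₁ t₂ t₃ Z₁ Z₂ Z₃ r Zr s} → Config t₁ t₂ t₃ Z₁ Z₂ Z₃ → Arm r Zr → r ∉ t₁ ∷ Z₁ → s ∈ t₁ ∷ Z₁ → A r s ≡ true →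
      NA (r ∷ Zr) (t₂ ∷ Z₂) → NA (r ∷ Zr) (t₃ ∷ Z₃) → NA Zr (t₁ ∷ Z₁) → Beta t₁ t₂ t₃ Z₁ Z₂ Z₃ r Zr
    one-arm {t₁} {t₂} {t₃} {Z₁} {Z₂} {Z₃} {r} {Zr} k ar r∉ s∈ rs n₂ n₃ n₁ with firstIn (A r) (t₁ ∷ Z₁)
    ... | none f = absurdᵇ rs (f s∈)
    ... | some M q T eq rq f with line-goto M eq (cfg-line k)
    ...   | R , ℓ , bwd , _ = go (lastIn (A r) T)
      where
      onT : ∀ {z} → z ∈ q ∷ T → z ∈ t₁ ∷ Z₁
      onT p = subst (_ ∈_) (≡.sym eq) (∈-++⁺ʳ M p)
      onM : ∀ {z} → z ∈ M → z ∈ t₁ ∷ Z₁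
      onM p = subst (_ ∈_) (≡.sym eq) (∈-++⁺ˡ p)
      rR : ∀ {z} → z ∈ R → A r z ≡ false × r ≢ z
      rR p = case bwd p of λ { (inj₁ p) → f p , (λ { refl → r∉ (onM p) }) ; (inj₂ p) → n₂ (here refl) p }
      zL : NA Zr (q ∷ T ++ R)
      zL z∈ (here refl) = n₁ z∈ (onT (here refl))
      zL z∈ (there p) = case ∈-++⁻ T p of λ { (inj₁ p) → n₁ z∈ (onT (there p)) ; (inj₂ p) → case bwd p of λ { (inj₁ p) → n₁ z∈ (onM p) ; (inj₂ p) → n₂ (there z∈) p } }
      go : LastIn (A r) T → Beta t₁ t₂ t₃ Z₁ Z₂ Z₃ r Zr
      go (none g) = ⊥-elim (hub-line ℓ ar rq (λ { (here refl) p → case ∈-++⁻ T p of λ { (inj₁ p) → g p , (λ { refl → r∉ (onT (there p)) }) ; (inj₂ p) → rR p } }) zL)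
      go (some (m ∷ M′) p C eq′ rp g) = ⊥-elim (hub-arm m M′ ℓ eq′ ar rq rp
         (λ { (here refl) → r∉ (onT (here refl)) ; (there p) → case ∈-++⁻ T p of λ { (inj₁ p) → r∉ (onT (there p)) ; (inj₂ p) → proj₂ (rR p) ≡.refl } }) (proj₁ ∘ rR) g zL)
      go (some [] p C refl rp g) = dbl M eq f k
        where
        rC : NA (r ∷ []) C
        rC (here refl) p = g p , λ { refl → r∉ (onT (there (there p))) }
        dbl : ∀ M → t₁ ∷ Z₁ ≡ M ++ q ∷ p ∷ C → (∀ {z} → z ∈ M → A r z ≡ false) → Config t₁ t₂ t₃ Z₁ Z₂ Z₃ → Beta t₁ t₂ t₃ Z₁ Z₂ Z₃ r Zr
        dbl [] refl f k = ⊥-elim (bowtie k ar rq rp rC n₂ n₃ n₁)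
        dbl (_ ∷ A′) eq f k with Listₚ.∷-injective eq
        ... | refl , refl = fin A′ C Zr Z₂ Z₃ ≡.refl ≡.refl ≡.refl ≡.refl ≡.refl
          where
          nA : NA (r ∷ []) (t₁ ∷ A′)
          nA (here refl) p = f p , λ { refl → r∉ (case p of λ { (here e) → here e ; (there p) → there (∈-++⁺ˡ p) }) }
          module D = Double {A′ = A′} k ar rq rp nA rC n₂ n₃ n₁
          module D′ = Double {A′ = A′} (cfg-swap₂₃ k) ar rq rp nA rC n₃ n₂ n₁
          fin : ∀ A₀ C₀ Zr₀ Z₂₀ Z₃₀ → A′ ≡ A₀ → C ≡ C₀ → Zr ≡ Zr₀ → Z₂ ≡ Z₂₀ → Z₃ ≡ Z₃₀ → Beta t₁ t₂ t₃ (A′ ++ q ∷ p ∷ C) Z₂ Z₃ r Zr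
          fin A₀ (_ ∷ _) Zr₀ Z₂₀ Z₃₀ _ e _ _ _ = ⊥-elim (D.left e)
          fin A₀ [] (_ ∷ _) Z₂₀ Z₃₀ _ _ e _ _ = ⊥-elim (D.left′ e)
          fin A₀ [] [] (_ ∷ _) Z₃₀ _ _ _ e _ = ⊥-elim (D.right e)
          fin A₀ [] [] [] (_ ∷ _) _ _ _ _ e = ⊥-elim (D′.right e)
          fin (_ ∷ _) [] [] [] [] e a b c d = ⊥-elim (D.middle a b c d e)
          fin [] [] [] [] [] refl refl refl refl refl = q , p , refl , refl , refl , refl , rq , rp , proj₁ (nA (here refl) (here refl)) , proj₁ (n₂ (here refl) (here refl)) , proj₁ (n₃ (here refl) (here refl))

    Unit-nbr : V → V → List V → Set
    Unit-nbr r t Z = A r t ≡ true × NA (r ∷ []) Z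

    -- From the last neighbours `q₁` and `q₂` of `r` two paths lead to `x`, and the arm of `r` is a
    -- third one. They form a theta graph with hubs `r` and `x` unless `q₁` and `q₂` are adjacent,
    -- which happens only at `t₁` and `t₂`.
    two-arms : ∀ {t₁ t₂ t₃ Z₁ Z₂ Z₃ r Zr q₁ q₂ T₁ T₂} M₁ M₂ → Config t₁ t₂ t₃ Z₁ Z₂ Z₃ → Arm r Zr → r ∉ t₁ ∷ Z₁ → r ∉ t₂ ∷ Z₂ →
      NA Zr (t₁ ∷ Z₁) → NA Zr (t₂ ∷ Z₂) → t₁ ∷ Z₁ ≡ M₁ ++ q₁ ∷ T₁ → A r q₁ ≡ true → (∀ {z} → z ∈ T₁ → A r z ≡ false) →
      t₂ ∷ Z₂ ≡ M₂ ++ q₂ ∷ T₂ → A r q₂ ≡ true → (∀ {z} → z ∈ T₂ → A r z ≡ false) → Unit-nbr r t₁ Z₁ × Unit-nbr r t₂ Z₂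
    two-arms {t₁} {t₂} {t₃} {Z₁} {Z₂} {Z₃} {r} {Zr} {q₁} {q₂} {T₁} {T₂} M₁ M₂ k ar r∉₁ r∉₂ n₁ n₂ eq₁ e₁ f₁ eq₂ e₂ f₂ = go M₁ M₂ eq₁ eq₂
      where
      on₁ : ∀ {z} → z ∈ q₁ ∷ T₁ → z ∈ t₁ ∷ Z₁
      on₁ p = subst (_ ∈_) (≡.sym eq₁) (∈-++⁺ʳ M₁ p)
      on₂ : ∀ {z} → z ∈ q₂ ∷ T₂ → z ∈ t₂ ∷ Z₂
      on₂ p = subst (_ ∈_) (≡.sym eq₂) (∈-++⁺ʳ M₂ p)
      b₁ : Arm q₁ T₁
      b₁ = arm-suffix M₁ eq₁ (a₁ k)
      b₂ : Arm q₂ T₂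
      b₂ = arm-suffix M₂ eq₂ (a₂ k)
      mk : ∀ {q T} → A r q ≡ true → (∀ {z} → z ∈ T → A r z ≡ false) → r ∉ q ∷ T → Arm q T → Leg r (q ∷ T) x
      mk e f r∉ (ip , ht , i) = cons e f (r∉ ∘ there) ip , ht , λ { (here refl) → H-≢ (top ar) ≡.refl ; (there p) → x∉H i p }
      theta : NA (q₁ ∷ T₁) (q₂ ∷ T₂) → ⊥
      theta na = thetaX Zr q₁ T₁ q₂ T₂ (top ar) (arm-leg ar) (mk e₁ f₁ (r∉₁ ∘ on₁) b₁) (mk e₂ f₂ (r∉₂ ∘ on₂) b₂) (arm-hit ar)
        (NA-⊆ id on₁ n₁) (NA-⊆ id on₂ n₂) na (arm-Z ar ⊕ arm-H b₁ ⊕ arm-H b₂)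
      go : ∀ M₁ M₂ → t₁ ∷ Z₁ ≡ M₁ ++ q₁ ∷ T₁ → t₂ ∷ Z₂ ≡ M₂ ++ q₂ ∷ T₂ → Unit-nbr r t₁ Z₁ × Unit-nbr r t₂ Z₂
      go [] [] refl refl = (e₁ , λ { (here refl) p → f₁ p , λ { refl → r∉₁ (there p) } }) , (e₂ , λ { (here refl) p → f₂ p , λ { refl → r∉₂ (there p) } })
      go (_ ∷ M) M₂ eq _ with Listₚ.∷-injective eq
      ... | refl , refl = ⊥-elim (theta (NA-⊆ (∈-++⁺ʳ M) on₂ (proj₁ (proj₂ (j₁₂ k)))))
      go [] (_ ∷ M) _ eq with Listₚ.∷-injective eq
      ... | refl , refl = ⊥-elim (theta (NA-⊆ on₁ (∈-++⁺ʳ M) (proj₂ (proj₂ (j₁₂ k)))))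

    -- t₁ and t₂ are the hubs of a K₄ minus an edge
    diamond : ∀ {t₁ t₂ t₃ Z₁ Z₂ Z₃ r} → Config t₁ t₂ t₃ Z₁ Z₂ Z₃ → r ∈ H → A r t₁ ≡ true → A r t₂ ≡ true → A r t₃ ≡ false → r ≢ t₃ → ⊥
    diamond {t₁} {t₂} {t₃} {r = r} k r∈ e₁ e₂ e₃ r≢ =
      thetaH [] t₃ [] r [] (top (a₁ k)) (top (a₂ k)) (A-≢ (proj₁ (j₁₂ k))) (one , proj₁ (j₁₂ k) , λ { (here e) → A-≢ (proj₁ (j₁₂ k)) e })
        (cons (proj₁ (j₂₃ k)) (λ ()) (λ ()) one , proj₁ (j₁₃ k) , λ { (here e) → A-≢ (proj₁ (j₁₂ k)) e ; (there (here e)) → A-≢ (proj₁ (j₁₃ k)) e })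
        (cons (flipA e₂) (λ ()) (λ ()) one , flipA e₁ , λ { (here e) → A-≢ (proj₁ (j₁₂ k)) e ; (there (here e)) → A-≢ e₁ (≡.sym e) })
        (proj₁ (j₁₂ k)) NA-[] NA-[] (λ { (here refl) (here refl) → flipA e₃ , r≢ ∘ ≡.sym })
        (λ { (here refl) → top (a₃ k) ; (there (here refl)) → r∈ })

    -- The four tops form a K₄. If one of the arms is longer than a vertex, its top is not adjacent
    -- to `x` and plays the role of `d` in `f3`, while the other three tops form the configuration.
    four-clique : ∀ {t₁ t₂ t₃ Z₁ Z₂ Z₃ r Zr} → Config t₁ t₂ t₃ Z₁ Z₂ Z₃ → Arm r Zr → NA Zr (t₁ ∷ Z₁) → NA Zr (t₂ ∷ Z₂) → NA Zr (t₃ ∷ Z₃) →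
      Unit-nbr r t₁ Z₁ → Unit-nbr r t₂ Z₂ → Unit-nbr r t₃ Z₃ → Alpha t₁ t₂ t₃ Z₁ Z₂ Z₃ r Zr
    four-clique {t₁} {t₂} {t₃} {Z₁} {Z₂} {Z₃} {r} {Zr} k ar z₁ z₂ z₃ u₁ u₂ u₃ = go Zr Z₁ Z₂ Z₃ ≡.refl ≡.refl ≡.refl ≡.refl
      where
      jr : ∀ {t Z} → NA Zr (t ∷ Z) → Unit-nbr r t Z → Join r Zr t Z
      jr z (e , f) = e , z , NA-∷ f (NA-⊆ id there z)
      off₁ : ∀ {s Z t Z′} → Join s Z t Z′ → NA Z′ (s ∷ [])
      off₁ j = join-NAₜ (join-sym j)
      nontriv : ∀ {y L z zs} → Arm y L → L ≡ z ∷ zs → A x y ≡ false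
      nontriv a refl = arm-hit a
      go : ∀ Zr₀ Z₁₀ Z₂₀ Z₃₀ → Zr ≡ Zr₀ → Z₁ ≡ Z₁₀ → Z₂ ≡ Z₂₀ → Z₃ ≡ Z₃₀ → Alpha t₁ t₂ t₃ Z₁ Z₂ Z₃ r Zr
      go (_ ∷ _) _ _ _ e _ _ _ = ⊥-elim (f3 k (top ar) (nontriv ar e) (flipA (proj₁ u₁)) (flipA (proj₁ u₂)) (flipA (proj₁ u₃)) (NA-sym (proj₂ u₁)) (NA-sym (proj₂ u₂)) (NA-sym (proj₂ u₃)))
      go [] (_ ∷ _) _ _ _ e _ _ = ⊥-elim (f3 (cfg ar (a₂ k) (a₃ k) (jr z₂ u₂) (jr z₃ u₃) (j₂₃ k)) (top (a₁ k)) (nontriv (a₁ k) e) (proj₁ u₁) (flipA (proj₁ (j₁₂ k))) (flipA (proj₁ (j₁₃ k)))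
         (NA-one z₁ (here refl)) (off₁ (j₁₂ k)) (off₁ (j₁₃ k)))
      go [] [] (_ ∷ _) _ _ _ e _ = ⊥-elim (f3 (cfg ar (a₁ k) (a₃ k) (jr z₁ u₁) (jr z₃ u₃) (j₁₃ k)) (top (a₂ k)) (nontriv (a₂ k) e) (proj₁ u₂) (proj₁ (j₁₂ k)) (flipA (proj₁ (j₂₃ k)))
         (NA-one z₂ (here refl)) (join-NAₜ (j₁₂ k)) (off₁ (j₂₃ k)))
      go [] [] [] (_ ∷ _) _ _ _ e = ⊥-elim (f3 (cfg ar (a₁ k) (a₂ k) (jr z₁ u₁) (jr z₂ u₂) (j₁₂ k)) (top (a₃ k)) (nontriv (a₃ k) e) (proj₁ u₃) (proj₁ (j₁₃ k)) (proj₁ (j₂₃ k))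
         (NA-one z₃ (here refl)) (join-NAₜ (j₁₃ k)) (join-NAₜ (j₂₃ k)))
      go [] [] [] [] refl refl refl refl = refl , refl , refl , refl , proj₁ u₁ , proj₁ u₂ , proj₁ u₃

    data XResult (t₁ t₂ t₃ : V) (Z₁ Z₂ Z₃ : List V) (r : V) (Zr : List V) : Set where
      alpha : Alpha t₁ t₂ t₃ Z₁ Z₂ Z₃ r Zr → XResult t₁ t₂ t₃ Z₁ Z₂ Z₃ r Zr
      beta₁ : Beta t₁ t₂ t₃ Z₁ Z₂ Z₃ r Zr → XResult t₁ t₂ t₃ Z₁ Z₂ Z₃ r Zr
      beta₂ : Beta t₂ t₃ t₁ Z₂ Z₃ Z₁ r Zr → XResult t₁ t₂ t₃ Z₁ Z₂ Z₃ r Zr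
      beta₃ : Beta t₃ t₁ t₂ Z₃ Z₁ Z₂ r Zr → XResult t₁ t₂ t₃ Z₁ Z₂ Z₃ r Zr

    -- The number of arms that `r` meets decides: one arm gives a `Beta`, two arms a diamond, which
    -- is excluded, and three arms the `Alpha`.
    caseX : ∀ {t₁ t₂ t₃ Z₁ Z₂ Z₃ r Zr s} → Config t₁ t₂ t₃ Z₁ Z₂ Z₃ → Arm r Zr → r ∉ Tri t₁ Z₁ t₂ Z₂ t₃ Z₃ → NA Zr (Tri t₁ Z₁ t₂ Z₂ t₃ Z₃) →
      s ∈ Tri t₁ Z₁ t₂ Z₂ t₃ Z₃ → A r s ≡ true → XResult t₁ t₂ t₃ Z₁ Z₂ Z₃ r Zr
    caseX {t₁} {t₂} {t₃} {Z₁} {Z₂} {Z₃} {r} {Zr} k ar r∉ nz s∈ rs = go (lastIn (A r) (t₁ ∷ Z₁)) (lastIn (A r) (t₂ ∷ Z₂)) (lastIn (A r) (t₃ ∷ Z₃))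
      where
      m₁ : ∀ {z} → z ∈ t₁ ∷ Z₁ → z ∈ Tri t₁ Z₁ t₂ Z₂ t₃ Z₃
      m₁ = ∈-1
      m₂ : ∀ {z} → z ∈ t₂ ∷ Z₂ → z ∈ Tri t₁ Z₁ t₂ Z₂ t₃ Z₃
      m₂ = ∈-2 {t₁} {Z₁}
      m₃ : ∀ {z} → z ∈ t₃ ∷ Z₃ → z ∈ Tri t₁ Z₁ t₂ Z₂ t₃ Z₃
      m₃ = ∈-3 {t₁} {Z₁} {t₂} {Z₂}
      n₁ : NA Zr (t₁ ∷ Z₁)
      n₁ = NA-⊆ id m₁ nz
      n₂ : NA Zr (t₂ ∷ Z₂)
      n₂ = NA-⊆ id m₂ nz
      n₃ : NA Zr (t₃ ∷ Z₃)
      n₃ = NA-⊆ id m₃ nz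
      miss : ∀ {L} → (∀ {z} → z ∈ L → A r z ≡ false) → (∀ {z} → z ∈ L → z ∈ Tri t₁ Z₁ t₂ Z₂ t₃ Z₃) → NA (r ∷ Zr) L
      miss f i (here refl) p = f p , λ { refl → r∉ (i p) }
      miss f i (there q) p = nz q (i p)
      k₂ = cfg-rot k
      k₃ = cfg-rot k₂
      hit : ∀ {L} M {q T} → L ≡ M ++ q ∷ T → q ∈ L
      hit M refl = ∈-++⁺ʳ M (here refl)
      go : LastIn (A r) (t₁ ∷ Z₁) → LastIn (A r) (t₂ ∷ Z₂) → LastIn (A r) (t₃ ∷ Z₃) → XResult t₁ t₂ t₃ Z₁ Z₂ Z₃ r Zr
      go (none f) (none g) (none h) = case whereT {t₁} {Z₁} {t₂} {Z₂} s∈ of λ { (in₁ p) → absurdᵇ rs (f p) ; (in₂ p) → absurdᵇ rs (g p) ; (in₃ p) → absurdᵇ rs (h p) }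
      go (some M q T eq e _) (none g) (none h) = beta₁ (one-arm k ar (r∉ ∘ m₁) (hit M eq) e (miss g m₂) (miss h m₃) n₁)
      go (none f) (some M q T eq e _) (none h) = beta₂ (one-arm k₂ ar (r∉ ∘ m₂) (hit M eq) e (miss h m₃) (miss f m₁) n₂)
      go (none f) (none g) (some M q T eq e _) = beta₃ (one-arm k₃ ar (r∉ ∘ m₃) (hit M eq) e (miss f m₁) (miss g m₂) n₃)
      go (some M q T eq e f) (some M′ q′ T′ eq′ e′ f′) (none h) =
        let u₁ , u₂ = two-arms M M′ k ar (r∉ ∘ m₁) (r∉ ∘ m₂) n₁ n₂ eq e f eq′ e′ f′ in
        ⊥-elim (diamond k (top ar) (proj₁ u₁) (proj₁ u₂) (h (here refl)) (λ { refl → r∉ (m₃ (here refl)) }))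
      go (none h) (some M q T eq e f) (some M′ q′ T′ eq′ e′ f′) =
        let u₁ , u₂ = two-arms M M′ k₂ ar (r∉ ∘ m₂) (r∉ ∘ m₃) n₂ n₃ eq e f eq′ e′ f′ in
        ⊥-elim (diamond k₂ (top ar) (proj₁ u₁) (proj₁ u₂) (h (here refl)) (λ { refl → r∉ (m₁ (here refl)) }))
      go (some M q T eq e f) (none h) (some M′ q′ T′ eq′ e′ f′) =
        let u₁ , u₂ = two-arms M′ M k₃ ar (r∉ ∘ m₃) (r∉ ∘ m₁) n₃ n₁ eq′ e′ f′ eq e f in
        ⊥-elim (diamond k₃ (top ar) (proj₁ u₁) (proj₁ u₂) (h (here refl)) (λ { refl → r∉ (m₂ (here refl)) }))
      go (some M q T eq e f) (some M′ q′ T′ eq′ e′ f′) (some M″ q″ T″ eq″ e″ f″) =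
        let u₁ , u₂ = two-arms M M′ k ar (r∉ ∘ m₁) (r∉ ∘ m₂) n₁ n₂ eq e f eq′ e′ f′
            _ , u₃ = two-arms M′ M″ k₂ ar (r∉ ∘ m₂) (r∉ ∘ m₃) n₂ n₃ eq′ e′ f′ eq″ e″ f″ in
        alpha (four-clique k ar n₁ n₂ n₃ u₁ u₂ u₃)

  -- A path between two vertices of the configuration whose interior avoids the neighbours of `x`.

  module Core₄ {W : List V} {x : V} (S : Setting W x) where

    open Core₃ S public

    arm-x : ∀ {t Z} → Arm t Z → ∀ M {q T} → t ∷ Z ≡ M ++ q ∷ T → T ≢ [] → A x q ≡ false
    arm-x a M {T = []} eq ne = ⊥-elim (ne ≡.refl)
    arm-x a M {T = _ ∷ _} eq ne = arm-hit (arm-suffix M eq a)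

    -- A second path between two vertices p , q of the same arm.
    module Same {t₁ t₂ t₃ q p y : V} {M C Z₂ Z₃ ys : List V} (o : Bool)
      (yH : ∀ {z} → z ∈ y ∷ ys → z ∈ H) (xY : ∀ {z} → z ∈ y ∷ ys → A x z ≡ false)
      (lY : if o then Leg q (y ∷ ys) p else Leg p (y ∷ ys) q) where

      Y = y ∷ ys

      xN : NA Y (x ∷ [])
      xN z∈ (here refl) = flipA (xY z∈) , H-≢ (yH z∈)

      earB : ∀ {k} {vs : Vec V k} {U es} (i j : Fin k) → lookup vs i ≡ p → lookup vs j ≡ q → p ≢ q → Off Y U q p → Bld (h x) vs U es →
        Bld (h x) vs (Y ++ U) ((if o then legE j (legT Y) i else legE i (legT Y) j) ++ es)
      earB {vs = vs} i j refl refl ne off b = go o lY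
        where
        go : ∀ o → (if o then Leg (lookup vs j) Y (lookup vs i) else Leg (lookup vs i) Y (lookup vs j)) → Bld (h x) vs (Y ++ _) ((if o then legE j (legT Y) i else legE i (legT Y) j) ++ _)
        go true l = leg j Y i (ne ∘ ≡.sym) l off (hH yH) b
        go false l = leg i Y j ne l (off-swap off) (hH yH) b

      -- If the path starts at the top of the arm, there is no leg from `t₁` to `q`, and the table
      -- has one vertex less than in `far`.
      near : Config t₁ t₂ t₃ (M ++ p ∷ C) Z₂ Z₃ → q ≡ t₁ → Off Y (Tri t₁ (M ++ p ∷ C) t₂ Z₂ t₃ Z₃) q p → ⊥
      near k refl off = certX (p ∷ t₁ ∷ t₂ ∷ t₃ ∷ []) (c5dR (legT C) (legT M) (legT Z₂) (legT Z₃)) (1 ∷ 1 ∷ 3 ∷ 1 ∷ 2 ∷ [])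
        (leg 1F C 0F (H-≢ (top ap)) (arm-leg ap) (off-++ CM (off-++ CY (off-++ (tl C₂) (off-++ (tl C₃) (off-tgt (off-src (off-∷ Ct (off-∷ (hd C₂) (off-∷ (hd C₃) off-[]))))))))) (hH (arm-Z ap))
        (leg 2F M 1F t≢p lM (off-++ MY (off-++ (tl M₂) (off-++ (tl M₃) (off-∷ Mx (off-tgt (off-src (off-∷ (hd M₂) (off-∷ (hd M₃) off-[])))))))) (hH MH)
        (earB 1F 2F ≡.refl ≡.refl (t≢p ∘ ≡.sym) (off-++ (tl Y₂) (off-++ (tl Y₃) (off-∷ xN (off-tgt (off-src (off-∷ (hd Y₂) (off-∷ (hd Y₃) off-[])))))))
        (leg 3F Z₂ 0F (H-≢ (top (a₂ k))) (arm-leg (a₂ k)) (off-++ (join-NA (j₂₃ k)) (off-tgt (off-∷ (Z₂1 (there inp)) (off-∷ (Z₂1 (here refl)) (off-src (off-∷ (join-NAₜ (j₂₃ k)) off-[])))))) (hH (arm-Z (a₂ k)))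
        (leg 4F Z₃ 0F (H-≢ (top (a₃ k))) (arm-leg (a₃ k)) (off-tgt (off-∷ (Z₃1 (there inp)) (off-∷ (Z₃1 (here refl)) (off-∷ (join-NAₜ (join-sym (j₂₃ k))) (off-src off-[]))))) (hH (arm-Z (a₃ k)))
        base)))))
        ((x≢ (top ap) ∷ x≢ (top (a₁ k)) ∷ x≢ (top (a₂ k)) ∷ x≢ (top (a₃ k)) ∷ []) ∷ ((t≢p ∘ ≡.sym) ∷ NA-ne n₂ inp (here refl) ∷ NA-ne n₃ inp (here refl) ∷ []) ∷
          (A-≢ (proj₁ (j₁₂ k)) ∷ A-≢ (proj₁ (j₁₃ k)) ∷ []) ∷ (A-≢ (proj₁ (j₂₃ k)) ∷ []) ∷ [] ∷ [])
        ((arm-hit ap , arm-x (a₁ k) [] ≡.refl (nonempty M) , arm-hit (a₂ k) , arm-hit (a₃ k) , tt) ,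
         (hit-isTriv M (ip-hit M ip₁) , NA-hd n₂ inp (here refl) , NA-hd n₃ inp (here refl) , tt) , (proj₁ (j₁₂ k) , proj₁ (j₁₃ k) , tt) , (proj₁ (j₂₃ k) , tt) , tt , tt)
        (H⊆W ∘ arm-Z ap ⊕ H⊆W ∘ MH ⊕ H⊆W ∘ yH ⊕ H⊆W ∘ arm-Z (a₂ k) ⊕ H⊆W ∘ arm-Z (a₃ k) ⊕ x∈W ⊙ H⊆W (top ap) ⊙ H⊆W (top (a₁ k)) ⊙ H⊆W (top (a₂ k)) ⊙ H⊆W (top (a₃ k)) ⊙ ⊆[])
        (chk o)
        where
        chk : ∀ o → T (okᵇ (c5dE o (legT C) (legT M) (legT Y) (legT Z₂) (legT Z₃) ++ smallE (c5dR (legT C) (legT M) (legT Z₂) (legT Z₃))) (1 ∷ 1 ∷ 3 ∷ 1 ∷ 2 ∷ []))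
        chk true = c5dt-ok (legT C ∷ legT M ∷ legT Y ∷ legT Z₂ ∷ legT Z₃ ∷ [])
        chk false = c5df-ok (legT C ∷ legT M ∷ legT Y ∷ legT Z₂ ∷ legT Z₃ ∷ [])
        nonempty : ∀ (M : List V) {b : V} {B} → M ++ b ∷ B ≢ []
        nonempty [] ()
        nonempty (_ ∷ _) ()
        ip₁ = proj₁ (a₁ k)
        uni : Unique (t₁ ∷ M ++ p ∷ C)
        uni = ip-unique ip₁
        ap : Arm p C
        ap = arm-suffix (t₁ ∷ M) ≡.refl (a₁ k)
        inp : p ∈ M ++ p ∷ C
        inp = ∈-++⁺ʳ M (here refl)
        inM : ∀ {z} → z ∈ M → z ∈ M ++ p ∷ C
        inM = ∈-++⁺ˡ
        inC : ∀ {z} → z ∈ C → z ∈ M ++ p ∷ C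
        inC = ∈-++⁺ʳ M ∘ there
        MH : ∀ {z} → z ∈ M → z ∈ H
        MH = arm-Z (a₁ k) ∘ inM
        t≢p : t₁ ≢ p
        t≢p refl = unique-head uni inp
        lM : Leg t₁ M p
        lM = leg-of-path M ip₁
        sep : NA (t₁ ∷ M) C
        sep = ip-sep M ip₁
        CM : NA C M
        CM = NA-sym (NA-⊆ there id sep)
        Ct : NA C (t₁ ∷ [])
        Ct = NA-one (NA-sym sep) (here refl)
        n₂ = proj₁ (proj₂ (j₁₂ k))
        n₃ = proj₁ (proj₂ (j₁₃ k))
        C₂ : NA C (t₂ ∷ Z₂)
        C₂ = NA-⊆ inC id n₂
        C₃ : NA C (t₃ ∷ Z₃)
        C₃ = NA-⊆ inC id n₃
        M₂ : NA M (t₂ ∷ Z₂)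
        M₂ = NA-⊆ inM id n₂
        M₃ : NA M (t₃ ∷ Z₃)
        M₃ = NA-⊆ inM id n₃
        Mx : NA M (x ∷ [])
        Mx z∈ (here refl) = flipA (hit-⊥ M (proj₁ (proj₂ (a₁ k))) (there z∈)) , H-≢ (MH z∈)
        hd : ∀ {X a Y} → NA X (a ∷ Y) → NA X (a ∷ [])
        hd f = NA-one f (here refl)
        tl : ∀ {X a Y} → NA X (a ∷ Y) → NA X Y
        tl f = NA-⊆ id there f
        p∉ : ∀ {t Z} → NA (M ++ p ∷ C) (t ∷ Z) → p ∉ t ∷ Z
        p∉ f q = NA-ne f inp q ≡.refl
        t∉ : ∀ {t Z} → Join t₁ (M ++ p ∷ C) t Z → t₁ ∉ t ∷ Z
        t∉ (e , f , g) (here refl) = A-≢ e ≡.refl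
        t∉ (e , f , g) (there q) = NA-ne g (here refl) q ≡.refl
        Y₂ : NA Y (t₂ ∷ Z₂)
        Y₂ = off-NA off (∈-2 {t₁} {M ++ p ∷ C}) (t∉ (j₁₂ k)) (p∉ n₂)
        Y₃ : NA Y (t₃ ∷ Z₃)
        Y₃ = off-NA off (∈-3 {t₁} {M ++ p ∷ C} {t₂} {Z₂}) (t∉ (j₁₃ k)) (p∉ n₃)
        uniC : Unique (p ∷ C)
        uniC = ip-unique (proj₁ ap)
        CY : NA C Y
        CY = NA-sym (off-NA off (∈-1 ∘ there ∘ inC) (unique-head uni ∘ inC) (unique-head uniC))
        p∉M : p ∉ M
        p∉M q = proj₂ (proj₂ lM) (there q)
        MY : NA M Y
        MY = NA-sym (off-NA off (∈-1 ∘ there ∘ inM) (unique-head uni ∘ inM) p∉M)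
        Z₂1 : ∀ {z} → z ∈ t₁ ∷ M ++ p ∷ C → NA Z₂ (z ∷ [])
        Z₂1 z∈ = NA-one (NA-sym (proj₂ (proj₂ (j₁₂ k)))) z∈
        Z₃1 : ∀ {z} → z ∈ t₁ ∷ M ++ p ∷ C → NA Z₃ (z ∷ [])
        Z₃1 z∈ = NA-one (NA-sym (proj₂ (proj₂ (j₁₃ k)))) z∈

      far : ∀ A′ → Config t₁ t₂ t₃ (A′ ++ q ∷ M ++ p ∷ C) Z₂ Z₃ → Off Y (Tri t₁ (A′ ++ q ∷ M ++ p ∷ C) t₂ Z₂ t₃ Z₃) q p → ⊥
      far A′ k off = certX (p ∷ q ∷ t₁ ∷ t₂ ∷ t₃ ∷ []) (c5R (legT C) (legT M) (legT A′) (legT Z₂) (legT Z₃)) (1 ∷ 1 ∷ 2 ∷ 2 ∷ 1 ∷ 2 ∷ [])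
        (leg 1F C 0F (H-≢ (top ap)) (arm-leg ap) (off-++ CM (off-++ CY (off-++ CA (off-++ (tl C₂) (off-++ (tl C₃) (off-tgt (off-src (off-∷ Cq (off-∷ Ct (off-∷ (hd C₂) (off-∷ (hd C₃) off-[]))))))))))) (hH (arm-Z ap))
        (leg 2F M 1F q≢p lM (off-++ MY (off-++ MA (off-++ (tl M₂) (off-++ (tl M₃) (off-∷ Mx (off-tgt (off-src (off-∷ Mt (off-∷ (hd M₂) (off-∷ (hd M₃) off-[])))))))))) (hH MH)
        (earB 1F 2F ≡.refl ≡.refl (q≢p ∘ ≡.sym) (off-++ YA (off-++ (tl Y₂) (off-++ (tl Y₃) (off-∷ xN (off-tgt (off-src (off-∷ Yt (off-∷ (hd Y₂) (off-∷ (hd Y₃) off-[])))))))))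
        (leg 3F A′ 2F t≢q lA (off-++ (tl A₂) (off-++ (tl A₃) (off-∷ Ax (off-∷ Ap (off-tgt (off-src (off-∷ (hd A₂) (off-∷ (hd A₃) off-[])))))))) (hH AH)
        (leg 4F Z₂ 0F (H-≢ (top (a₂ k))) (arm-leg (a₂ k)) (off-++ (join-NA (j₂₃ k)) (off-tgt (off-∷ (Z₂1 (there inp)) (off-∷ (Z₂1 (there inq)) (off-∷ (Z₂1 (here refl)) (off-src (off-∷ (join-NAₜ (j₂₃ k)) off-[]))))))) (hH (arm-Z (a₂ k)))
        (leg 5F Z₃ 0F (H-≢ (top (a₃ k))) (arm-leg (a₃ k)) (off-tgt (off-∷ (Z₃1 (there inp)) (off-∷ (Z₃1 (there inq)) (off-∷ (Z₃1 (here refl)) (off-∷ (join-NAₜ (join-sym (j₂₃ k))) (off-src off-[])))))) (hH (arm-Z (a₃ k)))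
        base))))))
        ((x≢ (top ap) ∷ x≢ (top aq) ∷ x≢ (top (a₁ k)) ∷ x≢ (top (a₂ k)) ∷ x≢ (top (a₃ k)) ∷ []) ∷ ((q≢p ∘ ≡.sym) ∷ (proj₂ tp ∘ ≡.sym) ∷ NA-ne n₂ inp (here refl) ∷ NA-ne n₃ inp (here refl) ∷ []) ∷
          ((t≢q ∘ ≡.sym) ∷ NA-ne n₂ inq (here refl) ∷ NA-ne n₃ inq (here refl) ∷ []) ∷ (A-≢ (proj₁ (j₁₂ k)) ∷ A-≢ (proj₁ (j₁₃ k)) ∷ []) ∷ (A-≢ (proj₁ (j₂₃ k)) ∷ []) ∷ [] ∷ [])
        ((arm-hit ap , arm-x aq [] ≡.refl (nonempty M) , arm-x (a₁ k) [] ≡.refl (nonempty A′) , arm-hit (a₂ k) , arm-hit (a₃ k) , tt) ,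
         (hit-isTriv M (ip-hit M ipq) , flipA (proj₁ tp) , NA-hd n₂ inp (here refl) , NA-hd n₃ inp (here refl) , tt) ,
         (hit-isTriv A′ (ip-hit A′ ip₁) , NA-hd n₂ inq (here refl) , NA-hd n₃ inq (here refl) , tt) , (proj₁ (j₁₂ k) , proj₁ (j₁₃ k) , tt) , (proj₁ (j₂₃ k) , tt) , tt , tt)
        (H⊆W ∘ arm-Z ap ⊕ H⊆W ∘ MH ⊕ H⊆W ∘ yH ⊕ H⊆W ∘ AH ⊕ H⊆W ∘ arm-Z (a₂ k) ⊕ H⊆W ∘ arm-Z (a₃ k) ⊕ x∈W ⊙ H⊆W (top ap) ⊙ H⊆W (top aq) ⊙ H⊆W (top (a₁ k)) ⊙ H⊆W (top (a₂ k)) ⊙ H⊆W (top (a₃ k)) ⊙ ⊆[])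
        (chk o)
        where
        chk : ∀ o → T (okᵇ (c5E o (legT C) (legT M) (legT Y) (legT A′) (legT Z₂) (legT Z₃) ++ smallE (c5R (legT C) (legT M) (legT A′) (legT Z₂) (legT Z₃))) (1 ∷ 1 ∷ 2 ∷ 2 ∷ 1 ∷ 2 ∷ []))
        chk true = c5t-ok (legT C ∷ legT M ∷ legT Y ∷ legT A′ ∷ legT Z₂ ∷ legT Z₃ ∷ [])
        chk false = c5f-ok (legT C ∷ legT M ∷ legT Y ∷ legT A′ ∷ legT Z₂ ∷ legT Z₃ ∷ [])
        nonempty : ∀ (M : List V) {b : V} {B} → M ++ b ∷ B ≢ []
        nonempty [] ()
        nonempty (_ ∷ _) ()
        Z = A′ ++ q ∷ M ++ p ∷ C
        ip₁ : IP t₁ Z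
        ip₁ = proj₁ (a₁ k)
        uni : Unique (t₁ ∷ Z)
        uni = ip-unique ip₁
        aq : Arm q (M ++ p ∷ C)
        aq = arm-suffix (t₁ ∷ A′) ≡.refl (a₁ k)
        ipq = proj₁ aq
        uniq : Unique (q ∷ M ++ p ∷ C)
        uniq = ip-unique ipq
        ap : Arm p C
        ap = arm-suffix (q ∷ M) ≡.refl aq
        uniC : Unique (p ∷ C)
        uniC = ip-unique (proj₁ ap)
        inq : q ∈ Z
        inq = ∈-++⁺ʳ A′ (here refl)
        inA : ∀ {z} → z ∈ A′ → z ∈ Z
        inA = ∈-++⁺ˡ
        inM : ∀ {z} → z ∈ M → z ∈ Z
        inM = ∈-++⁺ʳ A′ ∘ there ∘ ∈-++⁺ˡ
        inp : p ∈ Z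
        inp = ∈-++⁺ʳ A′ (there (∈-++⁺ʳ M (here refl)))
        inC : ∀ {z} → z ∈ C → z ∈ Z
        inC = ∈-++⁺ʳ A′ ∘ there ∘ ∈-++⁺ʳ M ∘ there
        MH : ∀ {z} → z ∈ M → z ∈ H
        MH = arm-Z (a₁ k) ∘ inM
        AH : ∀ {z} → z ∈ A′ → z ∈ H
        AH = arm-Z (a₁ k) ∘ inA
        q≢p : q ≢ p
        q≢p refl = unique-head uniq (∈-++⁺ʳ M (here refl))
        t≢q : t₁ ≢ q
        t≢q refl = unique-head uni inq
        lM : Leg q M p
        lM = leg-of-path M ipq
        lA : Leg t₁ A′ q
        lA = leg-of-path A′ ip₁
        sepq : NA (q ∷ M) C
        sepq = ip-sep M ipq
        sept : NA (t₁ ∷ A′) (M ++ p ∷ C)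
        sept = ip-sep A′ ip₁
        tp : A t₁ p ≡ false × t₁ ≢ p
        tp = sept (here refl) (∈-++⁺ʳ M (here refl))
        CM : NA C M
        CM = NA-sym (NA-⊆ there id sepq)
        Cq : NA C (q ∷ [])
        Cq = NA-one (NA-sym sepq) (here refl)
        Ct : NA C (t₁ ∷ [])
        Ct = NA-one (NA-⊆ (∈-++⁺ʳ M ∘ there) id (NA-sym sept)) (here refl)
        CA : NA C A′
        CA = NA-⊆ (∈-++⁺ʳ M ∘ there) there (NA-sym sept)
        MA : NA M A′
        MA = NA-⊆ ∈-++⁺ˡ there (NA-sym sept)
        Mt : NA M (t₁ ∷ [])
        Mt = NA-one (NA-⊆ ∈-++⁺ˡ id (NA-sym sept)) (here refl)
        Ap : NA A′ (p ∷ [])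
        Ap = NA-one (NA-⊆ there id sept) (∈-++⁺ʳ M (here refl))
        n₂ = proj₁ (proj₂ (j₁₂ k))
        n₃ = proj₁ (proj₂ (j₁₃ k))
        C₂ : NA C (t₂ ∷ Z₂)
        C₂ = NA-⊆ inC id n₂
        C₃ : NA C (t₃ ∷ Z₃)
        C₃ = NA-⊆ inC id n₃
        M₂ : NA M (t₂ ∷ Z₂)
        M₂ = NA-⊆ inM id n₂
        M₃ : NA M (t₃ ∷ Z₃)
        M₃ = NA-⊆ inM id n₃
        A₂ : NA A′ (t₂ ∷ Z₂)
        A₂ = NA-⊆ inA id n₂
        A₃ : NA A′ (t₃ ∷ Z₃)
        A₃ = NA-⊆ inA id n₃
        Mx : NA M (x ∷ [])
        Mx z∈ (here refl) = flipA (hit-⊥ M (proj₁ (proj₂ aq)) (there z∈)) , H-≢ (MH z∈)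
        Ax : NA A′ (x ∷ [])
        Ax z∈ (here refl) = flipA (hit-⊥ A′ (proj₁ (proj₂ (a₁ k))) (there z∈)) , H-≢ (AH z∈)
        hd : ∀ {X a Y} → NA X (a ∷ Y) → NA X (a ∷ [])
        hd f = NA-one f (here refl)
        tl : ∀ {X a Y} → NA X (a ∷ Y) → NA X Y
        tl f = NA-⊆ id there f
        ∉₂ : ∀ {z t Y} → z ∈ Z → NA Z (t ∷ Y) → z ∉ t ∷ Y
        ∉₂ z∈ f q = NA-ne f z∈ q ≡.refl
        Y₂ : NA Y (t₂ ∷ Z₂)
        Y₂ = off-NA off (∈-2 {t₁} {Z}) (∉₂ inq n₂) (∉₂ inp n₂)
        Y₃ : NA Y (t₃ ∷ Z₃)
        Y₃ = off-NA off (∈-3 {t₁} {Z} {t₂} {Z₂}) (∉₂ inq n₃) (∉₂ inp n₃)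
        CY : NA C Y
        CY = NA-sym (off-NA off (∈-1 ∘ there ∘ inC) (unique-head uniq ∘ ∈-++⁺ʳ M ∘ there) (unique-head uniC))
        MY : NA M Y
        MY = NA-sym (off-NA off (∈-1 ∘ there ∘ inM) (unique-head uniq ∘ ∈-++⁺ˡ) (λ r → proj₂ (proj₂ lM) (there r)))
        YA : NA Y A′
        YA = off-NA off (∈-1 ∘ there ∘ inA) (λ r → proj₂ (proj₂ lA) (there r)) (λ r → NA-ne sept (there r) (∈-++⁺ʳ M (here refl)) ≡.refl)
        Yt : NA Y (t₁ ∷ [])
        Yt = off-NA off (λ { (here e) → ∈-1 (here e) }) (λ { (here e) → t≢q (≡.sym e) }) (λ { (here e) → proj₂ tp (≡.sym e) })
        Z₂1 : ∀ {z} → z ∈ t₁ ∷ Z → NA Z₂ (z ∷ [])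
        Z₂1 z∈ = NA-one (NA-sym (proj₂ (proj₂ (j₁₂ k)))) z∈
        Z₃1 : ∀ {z} → z ∈ t₁ ∷ Z → NA Z₃ (z ∷ [])
        Z₃1 z∈ = NA-one (NA-sym (proj₂ (proj₂ (j₁₃ k)))) z∈

    same : ∀ {t₁ t₂ t₃ Z₁ Z₂ Z₃ q p y ys M C} (o : Bool) A₀ → Config t₁ t₂ t₃ Z₁ Z₂ Z₃ → t₁ ∷ Z₁ ≡ A₀ ++ q ∷ M ++ p ∷ C →
      (∀ {z} → z ∈ y ∷ ys → z ∈ H) → (∀ {z} → z ∈ y ∷ ys → A x z ≡ false) → (if o then Leg q (y ∷ ys) p else Leg p (y ∷ ys) q) →
      Off (y ∷ ys) (Tri t₁ Z₁ t₂ Z₂ t₃ Z₃) q p → ⊥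
    same {M = M} {C} o [] k refl yH xY lY off = Same.near {M = M} {C} o yH xY lY k ≡.refl off
    same {M = M} {C} o (_ ∷ A′) k eq yH xY lY off with Listₚ.∷-injective eq
    ... | refl , refl = Same.far {M = M} {C} o yH xY lY A′ k off

    -- A path between two arms, off the third triangle vertex: t₁ and t₂ are the hubs of a theta graph.
    diff : ∀ {t₁ t₂ t₃ Z₁ Z₂ Z₃ q p y ys T₁ T₂} M₁ M₂ → Config t₁ t₂ t₃ Z₁ Z₂ Z₃ → t₁ ∷ Z₁ ≡ M₁ ++ p ∷ T₁ → t₂ ∷ Z₂ ≡ M₂ ++ q ∷ T₂ →
      (∀ {z} → z ∈ y ∷ ys → z ∈ H) → Leg p (y ∷ ys) q → NA (y ∷ ys) M₁ → NA (y ∷ ys) M₂ → NA (y ∷ ys) (t₃ ∷ []) → ⊥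
    diff {t₁} {t₂} {t₃} {y = y} {ys} [] [] k refl refl yH lY n₁ n₂ n₃ =
      thetaH [] t₃ [] y ys (top (a₂ k)) (top (a₁ k)) (A-≢ (flipA e₁₂)) (one , flipA e₁₂ , λ { (here e) → A-≢ (flipA e₁₂) e })
        (cons e₁₃ (λ ()) (λ ()) one , e₂₃ , λ { (here e) → A-≢ (flipA e₁₂) e ; (there (here e)) → A-≢ e₂₃ e }) lY (flipA e₁₂) NA-[] NA-[] (NA-sym n₃)
        (λ { (here refl) → top (a₃ k) ; (there p) → yH p })
      where
      e₁₂ = proj₁ (j₁₂ k)
      e₁₃ = proj₁ (j₁₃ k)
      e₂₃ = proj₁ (j₂₃ k)
    diff {t₁} {t₂} {t₃} {p = p} {y} {ys} {T₁} (_ ∷ M) [] k eq refl yH lY n₁ n₂ n₃ with Listₚ.∷-injective eq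
    ... | refl , refl = certH (t₁ ∷ t₂ ∷ t₃ ∷ p ∷ []) (od₁R (legT M)) (1 ∷ 2 ∷ 1 ∷ 1 ∷ [])
        (leg 0F M 3F t≢p lM (off-++ (NA-sym (NA-⊆ id there n₁)) (off-src (off-∷ (hd M₂) (off-∷ (hd M₃) (off-tgt off-[]))))) (hH MH)
        (leg 3F (y ∷ ys) 1F p≢t₂ lY (off-∷ (NA-one n₁ (here refl)) (off-tgt (off-∷ n₃ (off-src off-[])))) (hH yH)
        base))
        ((A-≢ (proj₁ (j₁₂ k)) ∷ A-≢ (proj₁ (j₁₃ k)) ∷ t≢p ∷ []) ∷ (A-≢ (proj₁ (j₂₃ k)) ∷ (p≢t₂ ∘ ≡.sym) ∷ []) ∷ ((NA-ne N₃ inp (here refl) ∘ ≡.sym) ∷ []) ∷ [] ∷ [])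
        ((proj₁ (j₁₂ k) , proj₁ (j₁₃ k) , flipA (hit-isTriv M (ip-hit M ip₁)) , tt) , (proj₁ (j₂₃ k) , flipA (NA-hd N₂ inp (here refl)) , tt) , (flipA (NA-hd N₃ inp (here refl)) , tt) , tt , tt)
        (MH ⊕ yH ⊕ top (a₁ k) ⊙ top (a₂ k) ⊙ top (a₃ k) ⊙ arm-Z (a₁ k) inp ⊙ ⊆[])
        (od₁-ok (legT M ∷ legT (y ∷ ys) ∷ []))
      where
      ip₁ = proj₁ (a₁ k)
      inp : p ∈ M ++ p ∷ T₁
      inp = ∈-++⁺ʳ M (here refl)
      MH : ∀ {z} → z ∈ M → z ∈ H
      MH = arm-Z (a₁ k) ∘ ∈-++⁺ˡ
      t≢p : t₁ ≢ p
      t≢p refl = unique-head (ip-unique ip₁) inp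
      lM = leg-of-path M ip₁
      N₂ = proj₁ (proj₂ (j₁₂ k))
      N₃ = proj₁ (proj₂ (j₁₃ k))
      M₂ = NA-⊆ {X′ = M} ∈-++⁺ˡ id N₂
      M₃ = NA-⊆ {X′ = M} ∈-++⁺ˡ id N₃
      p≢t₂ = NA-ne N₂ inp (here refl)
      hd : ∀ {X a Y} → NA X (a ∷ Y) → NA X (a ∷ [])
      hd f = NA-one f (here refl)
    diff {t₁} {t₂} {t₃} {q = q} {y = y} {ys} {T₂ = T₂} [] (_ ∷ M) k refl eq yH lY n₁ n₂ n₃ with Listₚ.∷-injective eq
    ... | refl , refl = certH (t₂ ∷ t₁ ∷ t₃ ∷ q ∷ []) (od₁R (legT M)) (1 ∷ 2 ∷ 1 ∷ 1 ∷ [])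
        (leg 0F M 3F t≢q lM (off-++ (NA-sym (NA-⊆ id there n₂)) (off-src (off-∷ (hd M₁) (off-∷ (hd M₃) (off-tgt off-[]))))) (hH MH)
        (leg 1F (y ∷ ys) 3F (q≢t₁ ∘ ≡.sym) lY (off-∷ (NA-one n₂ (here refl)) (off-src (off-∷ n₃ (off-tgt off-[])))) (hH yH)
        base))
        ((A-≢ (flipA (proj₁ (j₁₂ k))) ∷ A-≢ (proj₁ (j₂₃ k)) ∷ t≢q ∷ []) ∷ (A-≢ (proj₁ (j₁₃ k)) ∷ (q≢t₁ ∘ ≡.sym) ∷ []) ∷ ((NA-ne N₃ inq (here refl) ∘ ≡.sym) ∷ []) ∷ [] ∷ [])
        ((flipA (proj₁ (j₁₂ k)) , proj₁ (j₂₃ k) , flipA (hit-isTriv M (ip-hit M ip₂)) , tt) , (proj₁ (j₁₃ k) , flipA (NA-hd N₁ inq (here refl)) , tt) , (flipA (NA-hd N₃ inq (here refl)) , tt) , tt , tt)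
        (MH ⊕ yH ⊕ top (a₂ k) ⊙ top (a₁ k) ⊙ top (a₃ k) ⊙ arm-Z (a₂ k) inq ⊙ ⊆[])
        (od₁′-ok (legT M ∷ legT (y ∷ ys) ∷ []))
      where
      ip₂ = proj₁ (a₂ k)
      inq : q ∈ M ++ q ∷ T₂
      inq = ∈-++⁺ʳ M (here refl)
      MH : ∀ {z} → z ∈ M → z ∈ H
      MH = arm-Z (a₂ k) ∘ ∈-++⁺ˡ
      t≢q : t₂ ≢ q
      t≢q refl = unique-head (ip-unique ip₂) inq
      lM = leg-of-path M ip₂
      N₁ = NA-sym (proj₂ (proj₂ (j₁₂ k)))
      N₃ = proj₁ (proj₂ (j₂₃ k))
      M₁ = NA-⊆ {X′ = M} ∈-++⁺ˡ id N₁
      M₃ = NA-⊆ {X′ = M} ∈-++⁺ˡ id N₃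
      q≢t₁ = NA-ne N₁ inq (here refl)
      hd : ∀ {X a Y} → NA X (a ∷ Y) → NA X (a ∷ [])
      hd f = NA-one f (here refl)
    diff {t₁} {t₂} {t₃} {q = q} {p} {y} {ys} {T₁} {T₂} (_ ∷ M) (_ ∷ M′) k eq eq′ yH lY n₁ n₂ n₃ with Listₚ.∷-injective eq | Listₚ.∷-injective eq′
    ... | refl , refl | refl , refl = certH (t₁ ∷ t₂ ∷ t₃ ∷ p ∷ q ∷ []) (od₂R (legT M) (legT M′)) (1 ∷ 2 ∷ 1 ∷ 1 ∷ 1 ∷ [])
        (leg 0F M 3F t≢p lM (off-++ (NA-⊆ ∈-++⁺ˡ (there ∘ ∈-++⁺ˡ) N₂) (off-++ (NA-sym (NA-⊆ id there n₁)) (off-src (off-∷ (NA-one (NA-⊆ ∈-++⁺ˡ id N₂) (here refl)) (off-∷ (NA-one (NA-⊆ ∈-++⁺ˡ id N₃) (here refl)) (off-tgt (off-∷ (NA-one (NA-⊆ ∈-++⁺ˡ id N₂) (there inq)) off-[]))))))) (hH MH)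
        (leg 1F M′ 4F t≢q lM′ (off-++ (NA-sym (NA-⊆ id there n₂)) (off-∷ (NA-one (NA-⊆ ∈-++⁺ˡ id N₁) (here refl)) (off-src (off-∷ (NA-one (NA-⊆ ∈-++⁺ˡ id N₃′) (here refl)) (off-∷ (NA-one (NA-⊆ ∈-++⁺ˡ id N₁) (there inp)) (off-tgt off-[])))))) (hH MH′)
        (leg 3F (y ∷ ys) 4F p≢q lY (off-∷ (NA-one n₁ (here refl)) (off-∷ (NA-one n₂ (here refl)) (off-∷ n₃ (off-src (off-tgt off-[]))))) (hH yH)
        base)))
        ((A-≢ (proj₁ (j₁₂ k)) ∷ A-≢ (proj₁ (j₁₃ k)) ∷ t≢p ∷ (NA-ne N₁ inq (here refl) ∘ ≡.sym) ∷ []) ∷ (A-≢ (proj₁ (j₂₃ k)) ∷ (NA-ne N₂ inp (here refl) ∘ ≡.sym) ∷ t≢q ∷ []) ∷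
          ((NA-ne N₃ inp (here refl) ∘ ≡.sym) ∷ (NA-ne N₃′ inq (here refl) ∘ ≡.sym) ∷ []) ∷ (p≢q ∷ []) ∷ [] ∷ [])
        ((proj₁ (j₁₂ k) , proj₁ (j₁₃ k) , flipA (hit-isTriv M (ip-hit M ip₁)) , flipA (NA-hd N₁ inq (here refl)) , tt) , (proj₁ (j₂₃ k) , flipA (NA-hd N₂ inp (here refl)) , flipA (hit-isTriv M′ (ip-hit M′ ip₂)) , tt) ,
          (flipA (NA-hd N₃ inp (here refl)) , flipA (NA-hd N₃′ inq (here refl)) , tt) , (NA-hd N₂ inp (there inq) , tt) , tt , tt)
        (MH ⊕ MH′ ⊕ yH ⊕ top (a₁ k) ⊙ top (a₂ k) ⊙ top (a₃ k) ⊙ arm-Z (a₁ k) inp ⊙ arm-Z (a₂ k) inq ⊙ ⊆[])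
        (od₂-ok (legT M ∷ legT M′ ∷ legT (y ∷ ys) ∷ []))
      where
      ip₁ = proj₁ (a₁ k)
      ip₂ = proj₁ (a₂ k)
      inp : p ∈ M ++ p ∷ T₁
      inp = ∈-++⁺ʳ M (here refl)
      inq : q ∈ M′ ++ q ∷ T₂
      inq = ∈-++⁺ʳ M′ (here refl)
      MH : ∀ {z} → z ∈ M → z ∈ H
      MH = arm-Z (a₁ k) ∘ ∈-++⁺ˡ
      MH′ : ∀ {z} → z ∈ M′ → z ∈ H
      MH′ = arm-Z (a₂ k) ∘ ∈-++⁺ˡ
      t≢p : t₁ ≢ p
      t≢p refl = unique-head (ip-unique ip₁) inp
      t≢q : t₂ ≢ q
      t≢q refl = unique-head (ip-unique ip₂) inq
      lM = leg-of-path M ip₁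
      lM′ = leg-of-path M′ ip₂
      N₁ = NA-sym (proj₂ (proj₂ (j₁₂ k)))
      N₂ = proj₁ (proj₂ (j₁₂ k))
      N₃ = proj₁ (proj₂ (j₁₃ k))
      N₃′ = proj₁ (proj₂ (j₂₃ k))
      p≢q = NA-ne N₂ inp (there inq)

  unique-split : ∀ M {u : V} {T} → Unique (M ++ u ∷ T) → u ∉ M × u ∉ T
  unique-split [] u = (λ ()) , unique-head u
  unique-split (m ∷ M) (ne ∷ u) = (λ { (here refl) → All.lookup ne (∈-++⁺ʳ M (here refl)) refl ; (there p) → proj₁ (unique-split M u) p }) , proj₂ (unique-split M u)

  module Core₅ {W : List V} {x : V} (S : Setting W x) where

    open Core₄ S public

    join-disj : ∀ {s Z t Z′ z} → Join s Z t Z′ → z ∈ s ∷ Z → z ∉ t ∷ Z′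
    join-disj (e , f , g) (here refl) (here refl) = A-≢ e refl
    join-disj (e , f , g) (here refl) (there q) = NA-ne g (here refl) q refl
    join-disj (e , f , g) (there p) q = NA-ne f p q refl

    arm-split : ∀ {t Z M u T} → Arm t Z → t ∷ Z ≡ M ++ u ∷ T → u ∉ M × u ∉ T
    arm-split {M = M} (ip , _) eq = unique-split M (subst Unique eq (ip-unique ip))

    diffO : ∀ {t₁ t₂ t₃ Z₁ Z₂ Z₃ u v y ys} → Config t₁ t₂ t₃ Z₁ Z₂ Z₃ → u ∈ t₁ ∷ Z₁ → v ∈ t₂ ∷ Z₂ →
      (∀ {z} → z ∈ y ∷ ys → z ∈ H) → Leg u (y ∷ ys) v → Off (y ∷ ys) (Tri t₁ Z₁ t₂ Z₂ t₃ Z₃) u v → ⊥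
    diffO {t₁} {t₂} {t₃} {Z₁} {Z₂} {Z₃} {u} {v} k u∈ v∈ yH lY off with ∈-∃++ u∈ | ∈-∃++ v∈
    ... | M₁ , T₁ , eq₁ | M₂ , T₂ , eq₂ = diff M₁ M₂ k eq₁ eq₂ yH lY
        (off-NA off (∈-1 ∘ on₁) (proj₁ (arm-split {M = M₁} (a₁ k) eq₁)) (λ p → join-disj (j₁₂ k) (on₁ p) v∈))
        (off-NA off (∈-2 {t₁} {Z₁} ∘ on₂) (λ p → join-disj (j₁₂ k) u∈ (on₂ p)) (proj₁ (arm-split {M = M₂} (a₂ k) eq₂)))
        (off-NA off (λ { (here e) → ∈-3 {t₁} {Z₁} {t₂} {Z₂} (here e) }) (λ { (here refl) → join-disj (j₁₃ k) u∈ (here refl) }) (λ { (here refl) → join-disj (j₂₃ k) v∈ (here refl) }))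
      where
      on₁ : ∀ {z} → z ∈ M₁ → z ∈ t₁ ∷ Z₁
      on₁ p = subst (_ ∈_) (≡.sym eq₁) (∈-++⁺ˡ p)
      on₂ : ∀ {z} → z ∈ M₂ → z ∈ t₂ ∷ Z₂
      on₂ p = subst (_ ∈_) (≡.sym eq₂) (∈-++⁺ˡ p)

    sameO : ∀ {t₁ t₂ t₃ Z₁ Z₂ Z₃ u v y ys} → Config t₁ t₂ t₃ Z₁ Z₂ Z₃ → u ∈ t₁ ∷ Z₁ → v ∈ t₁ ∷ Z₁ → u ≢ v →
      (∀ {z} → z ∈ y ∷ ys → z ∈ H) → (∀ {z} → z ∈ y ∷ ys → A x z ≡ false) → Leg u (y ∷ ys) v → Off (y ∷ ys) (Tri t₁ Z₁ t₂ Z₂ t₃ Z₃) u v → ⊥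
    sameO {u = u} {v} k u∈ v∈ u≢v yH xY lY off with ∈-∃++ u∈
    ... | M , T , eq with ∈-++⁻ M (subst (v ∈_) eq v∈)
    ...   | inj₂ (here e) = u≢v (≡.sym e)
    ...   | inj₂ (there q) with ∈-∃++ q
    ...     | M₂ , C , refl = same {M = M₂} {C} true M k eq yH xY lY off
    sameO {u = u} {v} k u∈ v∈ u≢v yH xY lY off | M , T , eq | inj₁ q with ∈-∃++ q
    ... | A₀ , M₂ , refl = same {M = M₂} {T} false A₀ k (≡.trans eq (Listₚ.++-assoc A₀ (v ∷ M₂) (u ∷ T))) yH xY lY (off-swap off)

    caseO₁ : ∀ {t₁ t₂ t₃ Z₁ Z₂ Z₃ u v y ys} → Config t₁ t₂ t₃ Z₁ Z₂ Z₃ → u ∈ Tri t₁ Z₁ t₂ Z₂ t₃ Z₃ → v ∈ Tri t₁ Z₁ t₂ Z₂ t₃ Z₃ → u ≢ v →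
      (∀ {z} → z ∈ y ∷ ys → z ∈ H) → (∀ {z} → z ∈ y ∷ ys → A x z ≡ false) → Leg u (y ∷ ys) v → Off (y ∷ ys) (Tri t₁ Z₁ t₂ Z₂ t₃ Z₃) u v → ⊥
    caseO₁ {t₁} {t₂} {t₃} {Z₁} {Z₂} {Z₃} k u∈ v∈ u≢v yH xY lY off = go (whereT {t₁} {Z₁} {t₂} {Z₂} u∈) (whereT {t₁} {Z₁} {t₂} {Z₂} v∈)
      where
      k₂ = cfg-rot k
      k₃ = cfg-rot k₂
      off₂ : Off _ (Tri t₂ Z₂ t₃ Z₃ t₁ Z₁) _ _
      off₂ = off-⊆ (tri-rot {t₁} {Z₁} {t₂} {Z₂} {t₃} {Z₃}) off
      off₃ : Off _ (Tri t₃ Z₃ t₁ Z₁ t₂ Z₂) _ _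
      off₃ = off-⊆ (tri-rot {t₂} {Z₂} {t₃} {Z₃} {t₁} {Z₁}) off₂
      sw : ∀ {s₁ Y₁ s₂ Y₂ s₃ Y₃ Y u v} → Off Y (Tri s₁ Y₁ s₂ Y₂ s₃ Y₃) u v → Off Y (Tri s₂ Y₂ s₁ Y₁ s₃ Y₃) u v
      sw {s₁} {Y₁} {s₂} {Y₂} {s₃} {Y₃} = off-⊆ (tri-swap {s₁} {Y₁} {s₂} {Y₂} {s₃} {Y₃})
      go : Where t₁ Z₁ t₂ Z₂ t₃ Z₃ _ → Where t₁ Z₁ t₂ Z₂ t₃ Z₃ _ → ⊥
      go (in₁ p) (in₁ q) = sameO k p q u≢v yH xY lY off
      go (in₂ p) (in₂ q) = sameO k₂ p q u≢v yH xY lY off₂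
      go (in₃ p) (in₃ q) = sameO k₃ p q u≢v yH xY lY off₃
      go (in₁ p) (in₂ q) = diffO k p q yH lY off
      go (in₂ p) (in₃ q) = diffO k₂ p q yH lY off₂
      go (in₃ p) (in₁ q) = diffO k₃ p q yH lY off₃
      go (in₂ p) (in₁ q) = diffO (cfg-swap k) p q yH lY (sw {t₁} {Z₁} {t₂} {Z₂} off)
      go (in₃ p) (in₂ q) = diffO (cfg-swap k₂) p q yH lY (sw {t₂} {Z₂} {t₃} {Z₃} off₂)
      go (in₁ p) (in₃ q) = diffO (cfg-swap k₃) p q yH lY (sw {t₃} {Z₃} {t₁} {Z₁} off₃)

    data Prof (y : V) (L : List V) : Set where
      zeroN : (∀ {z} → z ∈ L → A y z ≡ false) → Prof y L
      oneN  : ∀ M p C → L ≡ M ++ p ∷ C → A y p ≡ true → (∀ {z} → z ∈ M → A y z ≡ false) → (∀ {z} → z ∈ C → A y z ≡ false) → Prof y L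

    -- Suppose `y` has two neighbours on the arm. A third neighbour, earlier on this arm or on
    -- another one, gives a theta graph with hub `y` by `three-nbrs`; without a third one, `y` is a
    -- second path between two vertices of the arm, excluded by `same`.
    prof : ∀ {t₁ t₂ t₃ Z₁ Z₂ Z₃ y} → Config t₁ t₂ t₃ Z₁ Z₂ Z₃ → y ∈ H → y ∉ Tri t₁ Z₁ t₂ Z₂ t₃ Z₃ → A x y ≡ false → Prof y (t₁ ∷ Z₁)
    prof {t₁} {t₂} {t₃} {Z₁} {Z₂} {Z₃} {y} k y∈ y∉ xy with lastIn (A y) (t₁ ∷ Z₁)
    ... | none f = zeroN f
    ... | some M p C eq yp fC with lastIn (A y) M
    ...   | none f = oneN M p C eq yp f fC
    ...   | some A₀ q M₂ refl yq fM = ⊥-elim (go (firstIn (A y) A₀) (firstIn (A y) (t₂ ∷ Z₂)) (firstIn (A y) (t₃ ∷ Z₃)))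
      where
      eq′ : t₁ ∷ Z₁ ≡ A₀ ++ q ∷ M₂ ++ p ∷ C
      eq′ = ≡.trans eq (Listₚ.++-assoc A₀ (q ∷ M₂) (p ∷ C))
      on : ∀ {z} → z ∈ A₀ ++ q ∷ M₂ ++ p ∷ C → z ∈ t₁ ∷ Z₁
      on r = subst (_ ∈_) (≡.sym eq′) r
      q≢p : q ≢ p
      q≢p refl = proj₂ (arm-split {M = A₀} (a₁ k) eq′) (∈-++⁺ʳ M₂ (here refl))
      beyond : ∀ {s₂ s₃ Y₂ Y₃ r} → Config t₁ s₂ s₃ Z₁ Y₂ Y₃ → (∀ {z} → z ∈ s₂ ∷ Y₂ → y ≢ z) → A y r ≡ true → r ∈ A₀ ⊎ r ∈ s₂ ∷ Y₂ → ⊥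
      beyond k′ ne yr r∈ with line-goto A₀ eq′ (cfg-line k′)
      ... | R , ℓ , bwd , fwd = three-nbrs ℓ y∈ (λ { (here e) → y∉ (∈-1 (on (∈-++⁺ʳ A₀ (here e)))) ; (there r) → case ∈-++⁻ (M₂ ++ p ∷ C) r of λ
            { (inj₁ r) → y∉ (∈-1 (on (∈-++⁺ʳ A₀ (there r)))) ; (inj₂ r) → case bwd r of λ { (inj₁ r) → y∉ (∈-1 (on (∈-++⁺ˡ r))) ; (inj₂ r) → ne r refl } } })
            yq (∈-++⁺ʳ M₂ (here refl)) yp (fwd r∈) yr
      ne₂ : ∀ {z} → z ∈ t₂ ∷ Z₂ → y ≢ z
      ne₂ r refl = y∉ (∈-2 {t₁} {Z₁} r)
      ne₃ : ∀ {z} → z ∈ t₃ ∷ Z₃ → y ≢ z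
      ne₃ r refl = y∉ (∈-3 {t₁} {Z₁} {t₂} {Z₂} r)
      go : FirstIn (A y) A₀ → FirstIn (A y) (t₂ ∷ Z₂) → FirstIn (A y) (t₃ ∷ Z₃) → ⊥
      go (some M′ r _ e yr _) _ _ = beyond k ne₂ yr (inj₁ (subst (r ∈_) (≡.sym e) (∈-++⁺ʳ M′ (here refl))))
      go (none _) (some M′ r _ e yr _) _ = beyond k ne₂ yr (inj₂ (subst (r ∈_) (≡.sym e) (∈-++⁺ʳ M′ (here refl))))
      go (none _) (none _) (some M′ r _ e yr _) = beyond (cfg-swap₂₃ k) ne₃ yr (inj₂ (subst (r ∈_) (≡.sym e) (∈-++⁺ʳ M′ (here refl))))
      go (none f₁) (none f₂) (none f₃) = same {ys = []} {M = M₂} {C} true A₀ k eq′ (λ { (here refl) → y∈ }) (λ { (here refl) → xy })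
          (cons (flipA yq) (λ ()) (λ ()) one , flipA yp , λ { (here e) → q≢p (≡.sym e) ; (there (here e)) → A-≢ yp (≡.sym e) }) off
        where
        off : Off (y ∷ []) (Tri t₁ Z₁ t₂ Z₂ t₃ Z₃) q p
        off (here refl) b∈ b≢q b≢p = adj0 (whereT {t₁} {Z₁} {t₂} {Z₂} b∈) , λ { refl → y∉ b∈ }
          where
          adj0 : Where t₁ Z₁ t₂ Z₂ t₃ Z₃ _ → A y _ ≡ false
          adj0 (in₂ r) = f₂ r
          adj0 (in₃ r) = f₃ r
          adj0 (in₁ r) with ∈-++⁻ A₀ (subst (_ ∈_) eq′ r)
          ... | inj₁ r = f₁ r
          ... | inj₂ (here e) = ⊥-elim (b≢q e)
          ... | inj₂ (there r) with ∈-++⁻ M₂ r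
          ...   | inj₁ r = fM r
          ...   | inj₂ (here e) = ⊥-elim (b≢p e)
          ...   | inj₂ (there r) = fC r

    diff₁ : ∀ {t₁ t₂ t₃ Z₁ Z₂ Z₃ y p q T₁ T₂} M₁ M₂ → Config t₁ t₂ t₃ Z₁ Z₂ Z₃ → y ∈ H → y ∉ Tri t₁ Z₁ t₂ Z₂ t₃ Z₃ →
      t₁ ∷ Z₁ ≡ M₁ ++ p ∷ T₁ → A y p ≡ true → (∀ {z} → z ∈ M₁ → A y z ≡ false) → t₂ ∷ Z₂ ≡ M₂ ++ q ∷ T₂ → A y q ≡ true → (∀ {z} → z ∈ M₂ → A y z ≡ false) → A y t₃ ≡ false → ⊥
    diff₁ {t₁} {t₂} {t₃} {Z₁} {Z₂} {y = y} {p} {q} M₁ M₂ k y∈ y∉ eq₁ yp f₁ eq₂ yq f₂ e₃ = diff {ys = []} M₁ M₂ k eq₁ eq₂ (λ { (here refl) → y∈ })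
      (cons (flipA yp) (λ ()) (λ ()) one , flipA yq , λ { (here e) → q≢p e ; (there (here e)) → A-≢ yq (≡.sym e) })
      (λ { (here refl) r → f₁ r , λ { refl → y∉ (∈-1 (on₁ (∈-++⁺ˡ r))) } }) (λ { (here refl) r → f₂ r , λ { refl → y∉ (∈-2 {t₁} {Z₁} (on₂ (∈-++⁺ˡ r))) } })
      (λ { (here refl) (here refl) → e₃ , λ { refl → y∉ (∈-3 {t₁} {Z₁} {t₂} {Z₂} (here refl)) } })
      where
      on₁ : ∀ {z} → z ∈ M₁ ++ p ∷ _ → z ∈ t₁ ∷ Z₁
      on₁ r = subst (_ ∈_) (≡.sym eq₁) r
      on₂ : ∀ {z} → z ∈ M₂ ++ q ∷ _ → z ∈ t₂ ∷ Z₂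
      on₂ r = subst (_ ∈_) (≡.sym eq₂) r
      q≢p : q ≢ p
      q≢p refl = join-disj (j₁₂ k) (on₁ (∈-++⁺ʳ M₁ (here refl))) (on₂ (∈-++⁺ʳ M₂ (here refl)))

    -- By `prof`, `y` meets each arm at most once. Two arms met while the third top is missed are
    -- excluded by `diff`; what remains is that `y` is joined to precisely the three tops, excluded
    -- by `f3`.
    caseO₀ : ∀ {t₁ t₂ t₃ Z₁ Z₂ Z₃ u v y} → Config t₁ t₂ t₃ Z₁ Z₂ Z₃ → y ∈ H → y ∉ Tri t₁ Z₁ t₂ Z₂ t₃ Z₃ → A x y ≡ false →
      u ∈ Tri t₁ Z₁ t₂ Z₂ t₃ Z₃ → v ∈ Tri t₁ Z₁ t₂ Z₂ t₃ Z₃ → u ≢ v → A y u ≡ true → A y v ≡ true → ⊥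
    caseO₀ {t₁} {t₂} {t₃} {Z₁} {Z₂} {Z₃} {u} {v} {y} k y∈ y∉ xy u∈ v∈ u≢v yu yv = go (prof k y∈ y∉ xy) (prof k₂ y∈ y∉₂ xy) (prof k₃ y∈ y∉₃ xy)
      where
      k₂ = cfg-rot k
      k₃ = cfg-rot k₂
      y∉₂ : y ∉ Tri t₂ Z₂ t₃ Z₃ t₁ Z₁
      y∉₂ = y∉ ∘ tri-rot {t₁} {Z₁} {t₂} {Z₂} {t₃} {Z₃}
      y∉₃ : y ∉ Tri t₃ Z₃ t₁ Z₁ t₂ Z₂
      y∉₃ = y∉₂ ∘ tri-rot {t₂} {Z₂} {t₃} {Z₃} {t₁} {Z₁}
      uq : ∀ {L M p C} → L ≡ M ++ p ∷ C → (∀ {z} → z ∈ M → A y z ≡ false) → (∀ {z} → z ∈ C → A y z ≡ false) → ∀ {z} → z ∈ L → A y z ≡ true → z ≡ p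
      uq {M = M} refl f g r e with ∈-++⁻ M r
      ... | inj₁ r = absurdᵇ e (f r)
      ... | inj₂ (here e) = e
      ... | inj₂ (there r) = absurdᵇ e (g r)
      only : ∀ {w} → (∀ {z} → Where t₁ Z₁ t₂ Z₂ t₃ Z₃ z → A y z ≡ true → z ≡ w) → ⊥
      only f = u≢v (≡.trans (f (whereT {t₁} {Z₁} {t₂} {Z₂} u∈) yu) (≡.sym (f (whereT {t₁} {Z₁} {t₂} {Z₂} v∈) yv)))
      nb : ∀ {t Z} M {p C} → t ∷ Z ≡ M ++ p ∷ C → (∀ {z} → z ∈ M → A y z ≡ false) → A y t ≡ false ⊎ M ≡ []
      nb [] eq f = inj₂ refl
      nb (m ∷ M) eq f with Listₚ.∷-injective eq
      ... | refl , _ = inj₁ (f (here refl))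
      Y : ∀ {L} → (∀ {z} → z ∈ L → A y z ≡ false) → (∀ {z} → z ∈ L → z ∈ Tri t₁ Z₁ t₂ Z₂ t₃ Z₃) → NA L (y ∷ [])
      Y f i r (here refl) = flipA (f r) , λ { refl → y∉ (i r) }
      go : Prof y (t₁ ∷ Z₁) → Prof y (t₂ ∷ Z₂) → Prof y (t₃ ∷ Z₃) → ⊥
      go (zeroN f) (zeroN g) (zeroN h) = only {y} λ { (in₁ r) e → absurdᵇ e (f r) ; (in₂ r) e → absurdᵇ e (g r) ; (in₃ r) e → absurdᵇ e (h r) }
      go (oneN M p C eq yp f f′) (zeroN g) (zeroN h) = only {p} λ { (in₁ r) e → uq {M = M} eq f f′ r e ; (in₂ r) e → absurdᵇ e (g r) ; (in₃ r) e → absurdᵇ e (h r) }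
      go (zeroN g) (oneN M p C eq yp f f′) (zeroN h) = only {p} λ { (in₁ r) e → absurdᵇ e (g r) ; (in₂ r) e → uq {M = M} eq f f′ r e ; (in₃ r) e → absurdᵇ e (h r) }
      go (zeroN g) (zeroN h) (oneN M p C eq yp f f′) = only {p} λ { (in₁ r) e → absurdᵇ e (g r) ; (in₂ r) e → absurdᵇ e (h r) ; (in₃ r) e → uq {M = M} eq f f′ r e }
      go (oneN M p C eq yp f f′) (oneN M₂ p₂ C₂ eq₂ yp₂ f₂ f₂′) (zeroN h) = diff₁ M M₂ k y∈ y∉ eq yp f eq₂ yp₂ f₂ (h (here refl))
      go (zeroN h) (oneN M p C eq yp f f′) (oneN M₂ p₂ C₂ eq₂ yp₂ f₂ f₂′) = diff₁ M M₂ k₂ y∈ y∉₂ eq yp f eq₂ yp₂ f₂ (h (here refl))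
      go (oneN M p C eq yp f f′) (zeroN h) (oneN M₂ p₂ C₂ eq₂ yp₂ f₂ f₂′) = diff₁ M₂ M k₃ y∈ y∉₃ eq₂ yp₂ f₂ eq yp f (h (here refl))
      go (oneN M p C eq yp f f′) (oneN M₂ p₂ C₂ eq₂ yp₂ f₂ f₂′) (oneN M₃ p₃ C₃ eq₃ yp₃ f₃ f₃′) with nb M eq f | nb M₂ eq₂ f₂ | nb M₃ eq₃ f₃
      ... | _ | _ | inj₁ e = diff₁ M M₂ k y∈ y∉ eq yp f eq₂ yp₂ f₂ e
      ... | inj₁ e | _ | _ = diff₁ M₂ M₃ k₂ y∈ y∉₂ eq₂ yp₂ f₂ eq₃ yp₃ f₃ e
      ... | _ | inj₁ e | _ = diff₁ M₃ M k₃ y∈ y∉₃ eq₃ yp₃ f₃ eq yp f e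
      go (oneN _ p C refl yp f f′) (oneN _ p₂ C₂ refl yp₂ f₂ f₂′) (oneN _ p₃ C₃ refl yp₃ f₃ f₃′) | inj₂ refl | inj₂ refl | inj₂ refl =
        f3 k y∈ xy (flipA yp) (flipA yp₂) (flipA yp₃) (Y f′ (∈-1 ∘ there)) (Y f₂′ (∈-2 {t₁} {Z₁} ∘ there)) (Y f₃′ (∈-3 {t₁} {Z₁} {t₂} {Z₂} ∘ there))

    -- A clique or the seven-vertex graph is larger than a single configuration, but any two of its
    -- vertices lie in a common one. That is enough, since the excluded paths have two ends.
    record CoverAt (T₁ : List V) (p q : V) : Set where
      field
        {t₁ t₂ t₃} : V
        {Z₁ Z₂ Z₃} : List V
        k  : Config t₁ t₂ t₃ Z₁ Z₂ Z₃
        p∈ : p ∈ Tri t₁ Z₁ t₂ Z₂ t₃ Z₃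
        q∈ : q ∈ Tri t₁ Z₁ t₂ Z₂ t₃ Z₃
        ⊆T : ∀ {z} → z ∈ Tri t₁ Z₁ t₂ Z₂ t₃ Z₃ → z ∈ T₁

    otherNbr : V → V → V → Bool
    otherNbr y s t = A y t ∧ not (does (t ≟ s))

    otherNbr-true : ∀ {y s t} → A y t ∧ not (does (t ≟ s)) ≡ true → A y t ≡ true × t ≢ s
    otherNbr-true {y} {s} {t} e with A y t | t ≟ s
    ... | true | no ne = refl , ne

    otherNbr-false : ∀ {y s t} → A y t ∧ not (does (t ≟ s)) ≡ false → t ≢ s → A y t ≡ false
    otherNbr-false {y} {s} {t} e ne with A y t | t ≟ s
    ... | false | _ = refl
    ... | true | yes e′ = ⊥-elim (ne e′)

    -- A vertex outside `T₁` would begin a path that leaves `T₁` at `p` and, as `p` is no cut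
    -- vertex, returns to `T₁` elsewhere. All neighbours of `x` lie in `T₁`, so `caseO₀` or `caseO₁`
    -- applies to the configuration through both ends.
    outside : ∀ T₁ {s₀ s₁} → s₀ ∈ T₁ → s₁ ∈ T₁ → s₀ ≢ s₁ → (∀ {z} → z ∈ T₁ → z ∈ H) → (∀ {z} → z ∈ H → A x z ≡ true → z ∈ T₁) →
      (∀ {p q} → p ∈ T₁ → q ∈ T₁ → p ≢ q → CoverAt T₁ p q) → ∀ {z} → z ∈ H → z ∈ T₁
    outside T₁ {s₀} {s₁} s₀∈ s₁∈ s₀≢s₁ T-H N-T cover {z} z∈ with z ∈? T₁
    ... | yes p = p
    ... | no z∉ = ⊥-elim (go (crossing (∈ᵇ T₁) (noCut x∈W (T-H s₀∈) z∈) (true-∈ᵇ s₀∈) (false-∈ᵇ z∉)))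
      where
      multi : ∀ {y s t} → y ∈ H → y ∉ T₁ → s ∈ T₁ → A y s ≡ true → t ∈ T₁ → A y t ≡ true → t ≢ s → ⊥
      multi {y} y∈ y∉ s∈ ys t∈ yt ne = caseO₀ (CoverAt.k cv) y∈ (y∉ ∘ CoverAt.⊆T cv) xy (CoverAt.p∈ cv) (CoverAt.q∈ cv) ne yt ys
        where
        cv = cover t∈ s∈ ne
        xy : A x y ≡ false
        xy with A x y in e
        ... | true = ⊥-elim (y∉ (N-T y∈ e))
        ... | false = refl
      go : (Σ V λ a → Σ V λ b → a ∈ H × b ∈ H × ∈ᵇ T₁ a ≡ true × ∈ᵇ T₁ b ≡ false × A a b ≡ true) → ⊥
      go (p , y , _ , y∈ , pT , yT , py) with firstIn (otherNbr y p) T₁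
      ... | some M t _ eq e _ = multi y∈ (∈ᵇ-false {T₁} yT) (∈ᵇ-true {T₁} pT) (flipA py) (subst (t ∈_) (≡.sym eq) (∈-++⁺ʳ M (here refl))) (proj₁ (otherNbr-true e)) (proj₂ (otherNbr-true e))
      ... | none uy = ear-case other
        where
        p∈ : p ∈ T₁
        p∈ = ∈ᵇ-true {T₁} pT
        y∉ : y ∉ T₁
        y∉ = ∈ᵇ-false {T₁} yT
        T′ = T₁ ─ (p ∷ [])
        Wp = W ─ (p ∷ [])
        T′⁺ : ∀ {t} → t ∈ T₁ → t ≢ p → t ∈ T′
        T′⁺ t∈ ne = ∈-─⁺ t∈ λ { (here e) → ne e }
        T′⁻ : ∀ {t} → t ∈ T′ → t ∈ T₁ × t ≢ p
        T′⁻ t∈ = proj₁ (∈-─⁻ {T₁} {p ∷ []} t∈) , λ { refl → proj₂ (∈-─⁻ {T₁} {p ∷ []} t∈) (here refl) }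
        Wp⁺ : ∀ {t} → t ∈ W → t ≢ p → t ∈ Wp
        Wp⁺ t∈ ne = ∈-─⁺ t∈ λ { (here e) → ne e }
        Wp⁻ : ∀ {t} → t ∈ Wp → t ∈ W × t ≢ p
        Wp⁻ t∈ = proj₁ (∈-─⁻ {W} {p ∷ []} t∈) , λ { refl → proj₂ (∈-─⁻ {W} {p ∷ []} t∈) (here refl) }
        other : Σ V λ t → t ∈ T′
        other with s₀ ≟ p
        ... | no ne = s₀ , T′⁺ s₀∈ ne
        ... | yes refl = s₁ , T′⁺ s₁∈ (s₀≢s₁ ∘ ≡.sym)
        conP : Conn Wp
        conP = noCut (H⊆W (T-H p∈))
        y∈p : y ∈ Wp
        y∈p = Wp⁺ (H⊆W y∈) (λ { refl → y∉ p∈ })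
        ear-case : (Σ V λ t → t ∈ T′) → ⊥
        ear-case (t , t∈) with crossing (λ z → not (∈ᵇ T′ z)) (conP y∈p (Wp⁺ (H⊆W (T-H (proj₁ (T′⁻ t∈)))) (proj₂ (T′⁻ t∈)))) notT isT
          where
          notT : not (∈ᵇ T′ y) ≡ true
          notT rewrite false-∈ᵇ {T′} {y} (y∉ ∘ proj₁ ∘ T′⁻) = refl
          isT : not (∈ᵇ T′ t) ≡ false
          isT rewrite true-∈ᵇ {T′} {t} t∈ = refl
        ... | a , b , a∈ , b∈ , _ , bT , ab with hit-walk (adjTo T′) (conP y∈p a∈) (true-adjTo {T′} b∈T ab)
          where
          b∈T : b ∈ T′
          b∈T with ∈ᵇ T′ b in e
          ... | true = ∈ᵇ-true {T′} e
          b∈T | false = case bT of λ ()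
        ...   | rs , ip , ht , inP = fin (hit-end y rs ht)
          where
          -- Connectivity is used in `W` without `p`, which still contains `x`. The path cannot run
          -- through `x`, since its predecessor would be a neighbour of `x` outside `T₁`.
          free : ∀ y′ rs → IP y′ rs → Hit (adjTo T′) y′ rs → y′ ∈ H → y′ ∉ T₁ → (∀ {z} → z ∈ y′ ∷ rs → z ∈ Wp) → ∀ {z} → z ∈ y′ ∷ rs → z ∈ H × z ∉ T₁
          free y′ rs ip ht y∈ y∉ i (here refl) = y∈ , y∉
          free y′ (r ∷ rs) (cons e _ _ ip) (g , ht) y∈ y∉ i (there q) = free r rs ip ht r∈H r∉ (i ∘ there) q
            where
            r∉ : r ∉ T₁
            r∉ r∈ = absurdᵇ e (adjTo-false T′ y′ g (T′⁺ r∈ (proj₂ (Wp⁻ (i (there (here refl)))))))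
            r∈H : r ∈ H
            r∈H = ∈-H (proj₁ (Wp⁻ (i (there (here refl))))) (λ { refl → y∉ (N-T y∈ (flipA e)) })
          fr : ∀ {z} → z ∈ y ∷ rs → z ∈ H × z ∉ T₁
          fr = free y rs ip ht y∈ y∉ inP
          fin : (Σ V λ e → e ∈ y ∷ rs × adjTo T′ e ≡ true) → ⊥
          fin (e , e∈ , ge) with adjTo-true T′ e ge
          ... | q , q∈ , eq with firstIn (otherNbr e q) T₁
          ...   | some M t _ eq′ e′ _ = multi (proj₁ (fr e∈)) (proj₂ (fr e∈)) (proj₁ (T′⁻ q∈)) eq (subst (t ∈_) (≡.sym eq′) (∈-++⁺ʳ M (here refl))) (proj₁ (otherNbr-true e′)) (proj₂ (otherNbr-true e′))
          ...   | none ue with lastIn (A p) (y ∷ rs)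
          ...     | none f = absurdᵇ py (f (here refl))
          -- Starting from the last neighbour `u` of `p` leaves `p` with a single neighbour on the
          -- path.
          ...     | some M u rs′ eq′ pu f = caseO₁ (CoverAt.k cv) (CoverAt.p∈ cv) (CoverAt.q∈ cv) (proj₂ (T′⁻ q∈) ∘ ≡.sym) (proj₁ ∘ fr ∘ on) xY
                      (cons pu f (λ r → proj₂ (fr (on (there r))) p∈) (ip-suffix′ M eq′ ip) , hit-q u rs′ (hit-suffix′ M eq′ ht) id ,
                         λ { (here r) → proj₂ (T′⁻ q∈) r ; (there r) → proj₂ (fr (on r)) (proj₁ (T′⁻ q∈)) })
                      (off-⊆ (CoverAt.⊆T cv) off)
            where
            cv = cover p∈ (proj₁ (T′⁻ q∈)) (proj₂ (T′⁻ q∈) ∘ ≡.sym)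
            on : ∀ {z} → z ∈ u ∷ rs′ → z ∈ y ∷ rs
            on r = subst (_ ∈_) (≡.sym eq′) (∈-++⁺ʳ M r)
            xY : ∀ {z} → z ∈ u ∷ rs′ → A x z ≡ false
            xY {z} r with A x z in ez
            ... | true = ⊥-elim (proj₂ (fr (on r)) (N-T (proj₁ (fr (on r))) ez))
            ... | false = refl
            is-e : ∀ {z} → z ∈ u ∷ rs′ → adjTo T′ z ≡ true → z ≡ e
            is-e r g = hit-unique y rs ht (on r) e∈ g ge
            hit-q : ∀ v vs → Hit (adjTo T′) v vs → (∀ {z} → z ∈ v ∷ vs → z ∈ u ∷ rs′) → Hit (A q) v vs
            hit-q v [] g i = subst (λ z → A q z ≡ true) (≡.sym (is-e (i (here refl)) g)) (flipA eq)
            hit-q v (v′ ∷ vs) (g , ht) i = flipA (adjTo-false T′ v g q∈) , hit-q v′ vs ht (i ∘ there)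
            off : Off (u ∷ rs′) T₁ p q
            off {z} {b} r b∈ b≢p b≢q = nonadj , λ { refl → proj₂ (fr (on r)) b∈ }
              where
              nonadj : A z b ≡ false
              nonadj with adjTo T′ z in gz
              ... | false = adjTo-false T′ z gz (T′⁺ b∈ b≢p)
              ... | true rewrite is-e r gz = otherNbr-false (ue b∈) b≢q

  third : ∀ {a b c : V} {ks} → Unique (a ∷ b ∷ c ∷ ks) → ∀ s t → Σ V λ u → u ∈ a ∷ b ∷ c ∷ ks × u ≢ s × u ≢ t
  third {a} {b} {c} ((a≢b ∷ a≢c ∷ _) ∷ (b≢c ∷ _) ∷ _) s t with a ≟ s | a ≟ t | b ≟ s | b ≟ t
  ... | no p | no q | _ | _ = a , here refl , p , q
  ... | _ | _ | no p | no q = b , there (here refl) , p , q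
  ... | yes refl | _ | yes e | _ = ⊥-elim (a≢b (≡.sym e))
  ... | _ | yes refl | _ | yes e = ⊥-elim (a≢b (≡.sym e))
  ... | yes refl | _ | _ | yes refl = c , there (there (here refl)) , (a≢c ∘ ≡.sym) , (b≢c ∘ ≡.sym)
  ... | _ | yes refl | yes refl | _ = c , there (there (here refl)) , (b≢c ∘ ≡.sym) , (a≢c ∘ ≡.sym)

  -- Classification of the graphs without cut vertex.

  module Core₆ {W : List V} {x : V} (S : Setting W x) where

    open Core₅ S public

    -- Two triangles q p r and t₁ t₂ t₃ joined by the edge q t₁; x is joined to the other four vertices.
    record Seven (t₁ t₂ t₃ q p r : V) : Set where
      field
        k   : Config t₁ t₂ t₃ (q ∷ p ∷ []) [] []
        r∈  : r ∈ H
        xr  : A x r ≡ true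
        rq  : A r q ≡ true
        rp  : A r p ≡ true
        rt₁ : A r t₁ ≡ false
        rt₂ : A r t₂ ≡ false
        rt₃ : A r t₃ ≡ false

    data Shape : Set where
      clique : (∀ {u v} → u ∈ W → v ∈ W → u ≢ v → A u v ≡ true) → Shape
      sk4    : ∀ {t₁ t₂ t₃ z Z₁ Z₂ Z₃} → Config t₁ t₂ t₃ (z ∷ Z₁) Z₂ Z₃ → (∀ {v} → v ∈ H → v ∈ Tri t₁ (z ∷ Z₁) t₂ Z₂ t₃ Z₃) → Shape
      seven  : ∀ {t₁ t₂ t₃ q p r} → Seven t₁ t₂ t₃ q p r → (∀ {v} → v ∈ H → v ∈ r ∷ Tri t₁ (q ∷ p ∷ []) t₂ [] t₃ []) → Shape

    newN : List V → V → Bool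
    newN T₁ z = A x z ∧ not (∈ᵇ T₁ z)

    newN-true : ∀ {T₁ z} → newN T₁ z ≡ true → A x z ≡ true × z ∉ T₁
    newN-true {T₁} {z} e with A x z | ∈ᵇ T₁ z in m
    ... | true | false = refl , ∈ᵇ-false {T₁} m

    newN-false : ∀ {T₁ z} → newN T₁ z ≡ false → A x z ≡ true → z ∈ T₁
    newN-false {T₁} {z} e xz with A x z | ∈ᵇ T₁ z in m
    newN-false e () | false | _
    newN-false {T₁} e xz | true | true = ∈ᵇ-true {T₁} m

    search : ∀ T₁ → (Σ V λ c → c ∈ H × A x c ≡ true × c ∉ T₁) ⊎ (∀ {z} → z ∈ H → A x z ≡ true → z ∈ T₁)
    search T₁ with firstIn (newN T₁) H
    ... | some M c _ eq e _ = inj₁ (c , subst (c ∈_) (≡.sym eq) (∈-++⁺ʳ M (here refl)) , newN-true e)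
    ... | none f = inj₂ λ z∈ xz → newN-false (f z∈) xz

    triple : ∀ {a b c} → a ∈ H → b ∈ H → c ∈ H → A x a ≡ true → A x b ≡ true → A x c ≡ true → A a b ≡ true → A a c ≡ true → A b c ≡ true → Config a b c [] [] []
    triple a∈ b∈ c∈ xa xb xc ab ac bc = cfg (one , xa , λ { (here refl) → a∈ }) (one , xb , λ { (here refl) → b∈ }) (one , xc , λ { (here refl) → c∈ })
      (ab , (λ ()) , λ _ ()) (ac , (λ ()) , λ _ ()) (bc , (λ ()) , λ _ ())

    Clique : List V → Set
    Clique K = (∀ {u v} → u ∈ K → v ∈ K → u ≢ v → A u v ≡ true) × (∀ {z} → z ∈ K → z ∈ H × A x z ≡ true)

    -- While `x` has a neighbour outside the clique, a further arm exists. For every triple of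
    -- clique vertices through its attachment `s`, `caseX` can only answer `Alpha`, so the new
    -- vertex joins the clique. Afterwards `outside` applies.
    grow : ∀ m {a b c ks} → length H ∸ length (a ∷ b ∷ c ∷ ks) ≡ m → Unique (a ∷ b ∷ c ∷ ks) → Clique (a ∷ b ∷ c ∷ ks) → Shape
    grow = <-rec _ step′
      where
      step′ : ∀ m → (∀ {m′} → m′ < m → ∀ {a b c ks} → length H ∸ length (a ∷ b ∷ c ∷ ks) ≡ m′ → Unique (a ∷ b ∷ c ∷ ks) → Clique (a ∷ b ∷ c ∷ ks) → Shape) →
        ∀ {a b c ks} → length H ∸ length (a ∷ b ∷ c ∷ ks) ≡ m → Unique (a ∷ b ∷ c ∷ ks) → Clique (a ∷ b ∷ c ∷ ks) → Shape
      step′ m rec {a} {b} {c} {ks} eq uK@((a≢b ∷ _) ∷ _) (adj-K , in-K) with search (a ∷ b ∷ c ∷ ks)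
      ... | inj₂ N-K = clique cl
        where
        K = a ∷ b ∷ c ∷ ks
        cover : ∀ {p q} → p ∈ K → q ∈ K → p ≢ q → CoverAt K p q
        cover {p} {q} p∈ q∈ p≢q with third uK p q
        ... | u , u∈ , u≢p , u≢q = record { k = triple (proj₁ (in-K p∈)) (proj₁ (in-K q∈)) (proj₁ (in-K u∈)) (proj₂ (in-K p∈)) (proj₂ (in-K q∈)) (proj₂ (in-K u∈))
                (adj-K p∈ q∈ p≢q) (adj-K p∈ u∈ (u≢p ∘ ≡.sym)) (adj-K q∈ u∈ (u≢q ∘ ≡.sym))
            ; p∈ = here refl ; q∈ = there (here refl) ; ⊆T = p∈ ⊙ q∈ ⊙ u∈ ⊙ ⊆[] }
        all-in : ∀ {z} → z ∈ H → z ∈ K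
        all-in = outside K (here refl) (there (here refl)) a≢b (proj₁ ∘ in-K) N-K cover
        cl : ∀ {u v} → u ∈ W → v ∈ W → u ≢ v → A u v ≡ true
        cl {u} {v} u∈ v∈ u≢v with u ≟ x | v ≟ x
        ... | yes refl | yes refl = ⊥-elim (u≢v refl)
        ... | yes refl | no ne = proj₂ (in-K (all-in (∈-H v∈ ne)))
        ... | no ne | yes refl = flipA (proj₂ (in-K (all-in (∈-H u∈ ne))))
        ... | no ne | no ne′ = adj-K (all-in (∈-H u∈ ne)) (all-in (∈-H v∈ ne′)) u≢v
      ... | inj₁ (z , z∈ , xz , z∉) with find-arm {S = a ∷ b ∷ c ∷ ks} (proj₁ (in-K (here refl))) (true-adjTo {a ∷ b ∷ c ∷ ks} (there (here refl)) (adj-K (here refl) (there (here refl)) a≢b)) z∈ z∉ xz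
      ...   | record { y = y ; Z = Z ; arm = arm ; y∉ = y∉ ; Z-S = zS ; s = s ; s∈ = s∈ ; y~s = y~s } =
        rec smaller refl ((All.tabulate λ r e → y∉ (subst (_∈ K) (≡.sym e) r)) ∷ uK) (adj′ , λ { (here refl) → top arm , xy ; (there r) → in-K r })
        where
        K = a ∷ b ∷ c ∷ ks
        get : ∀ {t} → t ∈ K → t ≢ s → A y t ≡ true × Z ≡ []
        get {t} t∈ t≢s with third uK s t
        ... | u , u∈ , u≢s , u≢t with caseX {Z₁ = []} {[]} {[]} (triple (proj₁ (in-K s∈)) (proj₁ (in-K t∈)) (proj₁ (in-K u∈)) (proj₂ (in-K s∈)) (proj₂ (in-K t∈)) (proj₂ (in-K u∈))
                (adj-K s∈ t∈ (t≢s ∘ ≡.sym)) (adj-K s∈ u∈ (u≢s ∘ ≡.sym)) (adj-K t∈ u∈ (u≢t ∘ ≡.sym))) arm (y∉ ∘ sub) (NA-⊆ id sub zS) (here refl) y~s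
          where
          sub : ∀ {z} → z ∈ Tri s [] t [] u [] → z ∈ K
          sub = s∈ ⊙ t∈ ⊙ u∈ ⊙ ⊆[]
        ...   | alpha (_ , _ , _ , Z[] , _ , yt , _) = yt , Z[]
        ...   | beta₁ (_ , _ , () , _)
        ...   | beta₂ (_ , _ , () , _)
        ...   | beta₃ (_ , _ , () , _)
        yK : ∀ {t} → t ∈ K → A y t ≡ true
        yK {t} t∈ with t ≟ s
        ... | yes refl = y~s
        ... | no ne = proj₁ (get t∈ ne)
        Z[] : Z ≡ []
        Z[] with third uK s s
        ... | u , u∈ , ne , _ = proj₂ (get u∈ ne)
        xy : A x y ≡ true
        xy = ≡.trans (arm-hit arm) (cong (isTriv ∘ legT) Z[])
        adj′ : ∀ {u v} → u ∈ y ∷ K → v ∈ y ∷ K → u ≢ v → A u v ≡ true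
        adj′ (here refl) (here refl) ne = ⊥-elim (ne refl)
        adj′ (here refl) (there q) ne = yK q
        adj′ (there p) (here refl) ne = flipA (yK p)
        adj′ (there p) (there q) ne = adj-K p q ne
        yK⊆ : ∀ {u} → u ∈ y ∷ K → u ∈ H
        yK⊆ (here refl) = top arm
        yK⊆ (there q) = proj₁ (in-K q)
        fits : length (y ∷ K) ≤ length H
        fits = unique-length ((All.tabulate λ r e → y∉ (subst (_∈ K) (≡.sym e) r)) ∷ uK) (Unique-─ (x ∷ []) uW) yK⊆
          where
          open import Data.List.Relation.Binary.Permutation.Propositional.Properties using (↭-length)
          unique-length : ∀ {U L : List V} → Unique U → Unique L → (∀ {z} → z ∈ U → z ∈ L) → length U ≤ length L
          unique-length {U} {L} uU uL i = ℕₚ.≤-trans (ℕₚ.m≤n+m (length U) (length (L ─ U))) (ℕₚ.≤-reflexive (≡.sym (≡.trans (↭-length (split-↭ uL uU i)) (Listₚ.length-++ (L ─ U)))))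
        smaller : length H ∸ length (y ∷ K) < m
        smaller = subst (length H ∸ length (y ∷ K) <_) eq (ℕₚ.∸-monoʳ-< (ℕₚ.n<1+n (length K)) fits)

    -- The seven-vertex graph contains the configuration `k`, its mirror image `kb` with `r` in
    -- place of `p`, and `kc`, in which the two triangles exchange their roles. Any two vertices lie
    -- in one of them; the pair `p`, `r` needs `kc`.
    e7-shape : ∀ {t₁ t₂ t₃ q p r} → Seven t₁ t₂ t₃ q p r → Shape
    e7-shape {t₁} {t₂} {t₃} {q} {p} {r} e7 = go (search T₁)
      where
      open Seven e7
      T₁ = r ∷ Tri t₁ (q ∷ p ∷ []) t₂ [] t₃ []
      ip₁ = proj₁ (a₁ k)
      t₁q : A t₁ q ≡ true
      t₁q with ip₁
      ... | cons e _ _ _ = e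
      t₁p : A t₁ p ≡ false × t₁ ≢ p
      t₁p = ip-head ip₁ (here refl)
      qp : A q p ≡ true
      qp with ip₁
      ... | cons _ _ _ (cons e _ _ _) = e
      n₂ = proj₁ (proj₂ (j₁₂ k))
      n₃ = proj₁ (proj₂ (j₁₃ k))
      q₂ = n₂ (here refl) (here refl)
      q₃ = n₃ (here refl) (here refl)
      p₂ = n₂ (there (here refl)) (here refl)
      p₃ = n₃ (there (here refl)) (here refl)
      e₁₂ = proj₁ (j₁₂ k)
      e₁₃ = proj₁ (j₁₃ k)
      e₂₃ = proj₁ (j₂₃ k)
      xt₁ : A x t₁ ≡ false
      xt₁ = arm-hit (a₁ k)
      xq : A x q ≡ false
      xq = arm-hit (arm-suffix (t₁ ∷ []) refl (a₁ k))
      xp : A x p ≡ true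
      xp = arm-hit (arm-suffix (t₁ ∷ q ∷ []) refl (a₁ k))
      xt₂ : A x t₂ ≡ true
      xt₂ = arm-hit (a₂ k)
      t₁∈ = top (a₁ k)
      t₂∈ = top (a₂ k)
      t₃∈ = top (a₃ k)
      q∈ = arm-Z (a₁ k) (here refl)
      p∈ = arm-Z (a₁ k) (there (here refl))
      r≢ : ∀ {a b} → A r a ≡ false → A b a ≡ true → r ≢ b
      r≢ f e refl = absurdᵇ e f
      r≢t₁ : r ≢ t₁
      r≢t₁ = r≢ rt₂ e₁₂
      r≢t₂ : r ≢ t₂
      r≢t₂ = r≢ rt₁ (flipA e₁₂)
      r≢t₃ : r ≢ t₃
      r≢t₃ = r≢ rt₁ (flipA e₁₃)
      no[] : ∀ {X : List V} → NA X []
      no[] _ ()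
      pair : ∀ {a b c} → (A a c ≡ false × a ≢ c) → (A b c ≡ false × b ≢ c) → NA (a ∷ b ∷ []) (c ∷ [])
      pair f g (here refl) (here refl) = f
      pair f g (there (here refl)) (here refl) = g
      kb : Config t₁ t₂ t₃ (q ∷ r ∷ []) [] []
      kb = cfg (cons t₁q (λ { (here refl) → flipA rt₁ }) (λ { (here e) → r≢t₁ (≡.sym e) }) (cons (flipA rq) (λ ()) (λ ()) one) , (xt₁ , xq , xr) , t₁∈ ⊙ q∈ ⊙ r∈ ⊙ ⊆[]) (a₂ k) (a₃ k)
        (e₁₂ , pair q₂ (rt₂ , r≢t₂) , no[]) (e₁₃ , pair q₃ (rt₃ , r≢t₃) , no[]) (j₂₃ k)
      kc : Config q p r (t₁ ∷ t₂ ∷ []) [] []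
      kc = cfg (cons (flipA t₁q) (λ { (here refl) → proj₁ q₂ }) (λ { (here e) → proj₂ q₂ e }) (cons e₁₂ (λ ()) (λ ()) one) , (xq , xt₁ , xt₂) , q∈ ⊙ t₁∈ ⊙ t₂∈ ⊙ ⊆[])
        (one , xp , p∈ ⊙ ⊆[]) (one , xr , r∈ ⊙ ⊆[])
        (qp , pair t₁p (flipA (proj₁ p₂) , proj₂ p₂ ∘ ≡.sym) , no[]) (flipA rq , pair (flipA rt₁ , r≢t₁ ∘ ≡.sym) (flipA rt₂ , r≢t₂ ∘ ≡.sym) , no[]) (flipA rp , (λ ()) , no[])
      cover : ∀ {u v} → u ∈ T₁ → v ∈ T₁ → u ≢ v → CoverAt T₁ u v
      b⊆ : ∀ {z} → z ∈ Tri t₁ (q ∷ r ∷ []) t₂ [] t₃ [] → z ∈ T₁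
      b⊆ = there (here refl) ⊙ there (there (here refl)) ⊙ here refl ⊙ there (there (there (there (here refl)))) ⊙ there (there (there (there (there (here refl))))) ⊙ ⊆[]
      c⊆ : ∀ {z} → z ∈ Tri q (t₁ ∷ t₂ ∷ []) p [] r [] → z ∈ T₁
      c⊆ = there (there (here refl)) ⊙ there (here refl) ⊙ there (there (there (there (here refl)))) ⊙ there (there (there (here refl))) ⊙ here refl ⊙ ⊆[]
      ⊆b : ∀ {z} → z ∈ Tri t₁ (q ∷ p ∷ []) t₂ [] t₃ [] → z ≢ p → z ∈ Tri t₁ (q ∷ r ∷ []) t₂ [] t₃ []
      ⊆b (here e) _ = here e
      ⊆b (there (here e)) _ = there (here e)
      ⊆b (there (there (here e))) ne = ⊥-elim (ne e)
      ⊆b (there (there (there m))) _ = there (there (there m))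
      cover {u} {v} (there u∈) (there v∈) _ = record { k = k ; p∈ = u∈ ; q∈ = v∈ ; ⊆T = there }
      cover (here refl) (here refl) ne = ⊥-elim (ne refl)
      cover {v = v} (here refl) (there v∈) _ with v ≟ p
      ... | yes refl = record { k = kc ; p∈ = there (there (there (there (here refl)))) ; q∈ = there (there (there (here refl))) ; ⊆T = c⊆ }
      ... | no ne = record { k = kb ; p∈ = there (there (here refl)) ; q∈ = ⊆b v∈ ne ; ⊆T = b⊆ }
      cover {u = u} (there u∈) (here refl) _ with u ≟ p
      ... | yes refl = record { k = kc ; p∈ = there (there (there (here refl))) ; q∈ = there (there (there (there (here refl)))) ; ⊆T = c⊆ }
      ... | no ne = record { k = kb ; p∈ = ⊆b u∈ ne ; q∈ = there (there (here refl)) ; ⊆T = b⊆ }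
      T-H : ∀ {z} → z ∈ T₁ → z ∈ H
      T-H = r∈ ⊙ t₁∈ ⊙ q∈ ⊙ p∈ ⊙ t₂∈ ⊙ t₃∈ ⊙ ⊆[]
      -- A further arm would have to be a `Beta` for each configuration it meets. For `k` this makes
      -- `y` adjacent to `q` but not to `t₁`, and then `kc` demands adjacency to `t₁`. If only `r`
      -- is met, `kb` demands adjacency to `q`.
      contra : ArmTo T₁ → ⊥
      contra record { y = y ; Z = Z ; arm = arm ; y∉ = y∉ ; Z-S = zS ; s = s ; s∈ = s∈ ; y~s = y~s } = by (adjTo Ta y) refl
        where
        Ta = Tri t₁ (q ∷ p ∷ []) t₂ [] t₃ []
        from-a : ∀ {s} → s ∈ Ta → A y s ≡ true → A y q ≡ true × A y t₁ ≡ false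
        from-a m e with caseX k arm (y∉ ∘ there) (NA-⊆ id there zS) m e
        ... | beta₁ (_ , _ , refl , _ , _ , _ , yq , _ , y₁ , _) = yq , y₁
        ... | alpha (() , _)
        ... | beta₂ (_ , _ , () , _)
        ... | beta₃ (_ , _ , () , _)
        by : ∀ b → adjTo Ta y ≡ b → ⊥
        by true e with adjTo-true Ta y e
        ... | s′ , s′∈ , ys′ with from-a s′∈ ys′
        ...   | yq , y₁ with caseX kc arm (y∉ ∘ c⊆) (NA-⊆ id c⊆ zS) (here refl) yq
        ...     | beta₁ (_ , _ , refl , _ , _ , _ , yt₁ , _) = absurdᵇ yt₁ y₁
        ...     | alpha (() , _)
        ...     | beta₂ (_ , _ , () , _)
        ...     | beta₃ (_ , _ , () , _)
        by false e with caseX kb arm (y∉ ∘ b⊆) (NA-⊆ id b⊆ zS) (there (there (here refl))) yr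
          where
          yr : A y r ≡ true
          yr = case s∈ of λ { (here eq) → subst (λ v → A y v ≡ true) eq y~s ; (there m) → absurdᵇ y~s (adjTo-false Ta y e m) }
        ... | beta₁ (_ , _ , refl , _ , _ , _ , yq , _) = absurdᵇ yq (adjTo-false Ta y e (there (here refl)))
        ... | alpha (() , _)
        ... | beta₂ (_ , _ , () , _)
        ... | beta₃ (_ , _ , () , _)
      go : (Σ V λ c → c ∈ H × A x c ≡ true × c ∉ T₁) ⊎ (∀ {z} → z ∈ H → A x z ≡ true → z ∈ T₁) → Shape
      go (inj₁ (z , z∈ , xz , z∉)) = ⊥-elim (contra (find-arm {S = T₁} r∈ (true-adjTo {T₁} (there (there (here refl))) rq) z∈ z∉ xz))
      go (inj₂ N-T) = seven e7 (outside T₁ (here refl) (there (here refl)) r≢t₁ T-H N-T cover)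

    beta-seven : ∀ {t₁ t₂ t₃ Z₁ Z₂ Z₃ r Zr} → Config t₁ t₂ t₃ Z₁ Z₂ Z₃ → Arm r Zr → Beta t₁ t₂ t₃ Z₁ Z₂ Z₃ r Zr → Shape
    beta-seven k ar (q , p , refl , refl , refl , refl , rq , rp , r₁ , r₂ , r₃) =
      e7-shape record { k = k ; r∈ = top ar ; xr = arm-hit ar ; rq = rq ; rp = rp ; rt₁ = r₁ ; rt₂ = r₂ ; rt₃ = r₃ }

    -- A nonempty arm rules out `Alpha` and leaves at most one form of `Beta`, so either the
    -- seven-vertex graph is present or no further arm exists.
    long-shape : ∀ {t₁ t₂ t₃ z Z₁ Z₂ Z₃} → Config t₁ t₂ t₃ (z ∷ Z₁) Z₂ Z₃ → Shape
    long-shape {t₁} {t₂} {t₃} {z} {Z₁} {Z₂} {Z₃} k = go (search T₁)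
      where
      T₁ = Tri t₁ (z ∷ Z₁) t₂ Z₂ t₃ Z₃
      t₂∈ : t₂ ∈ T₁
      t₂∈ = ∈-2 {t₁} {z ∷ Z₁} (here refl)
      go : (Σ V λ c → c ∈ H × A x c ≡ true × c ∉ T₁) ⊎ (∀ {z} → z ∈ H → A x z ≡ true → z ∈ T₁) → Shape
      go (inj₂ N-T) = sk4 k (outside T₁ {t₁} {t₂} (here refl) t₂∈ (A-≢ (proj₁ (j₁₂ k))) (arm-H (a₁ k) ⊕ arm-H (a₂ k) ⊕ arm-H (a₃ k)) N-T
                          (λ p∈ q∈ _ → record { k = k ; p∈ = p∈ ; q∈ = q∈ ; ⊆T = id }))
      go (inj₁ (c , c∈ , xc , c∉)) with find-arm {S = T₁} (top (a₁ k)) (true-adjTo {T₁} t₂∈ (proj₁ (j₁₂ k))) c∈ c∉ xc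
      ... | record { arm = arm ; y∉ = y∉ ; Z-S = zS ; s∈ = s∈ ; y~s = y~s } with caseX k arm y∉ zS s∈ y~s
      ...   | alpha (() , _)
      ...   | beta₁ b = beta-seven k arm b
      ...   | beta₂ (_ , _ , _ , _ , () , _)
      ...   | beta₃ (_ , _ , _ , () , _)

    shape : 3 ≤ dg H x → Shape
    shape d3 with find-config d3
    ... | t₁ , t₂ , t₃ , _ ∷ _ , Z₂ , Z₃ , k = long-shape k
    ... | t₁ , t₂ , t₃ , [] , _ ∷ _ , Z₃ , k = long-shape (cfg-rot k)
    ... | t₁ , t₂ , t₃ , [] , [] , _ ∷ _ , k = long-shape (cfg-rot (cfg-rot k))
    ... | t₁ , t₂ , t₃ , [] , [] , [] , k = grow _ refl ((A-≢ e₁₂ ∷ A-≢ e₁₃ ∷ []) ∷ (A-≢ e₂₃ ∷ []) ∷ [] ∷ []) (adj-T , in-T)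
      where
      e₁₂ = proj₁ (j₁₂ k)
      e₁₃ = proj₁ (j₁₃ k)
      e₂₃ = proj₁ (j₂₃ k)
      adj-T : ∀ {u v} → u ∈ t₁ ∷ t₂ ∷ t₃ ∷ [] → v ∈ t₁ ∷ t₂ ∷ t₃ ∷ [] → u ≢ v → A u v ≡ true
      adj-T (here refl) (here refl) ne = ⊥-elim (ne refl)
      adj-T (here refl) (there (here refl)) ne = e₁₂
      adj-T (here refl) (there (there (here refl))) ne = e₁₃
      adj-T (there (here refl)) (here refl) ne = flipA e₁₂
      adj-T (there (here refl)) (there (here refl)) ne = ⊥-elim (ne refl)
      adj-T (there (here refl)) (there (there (here refl))) ne = e₂₃
      adj-T (there (there (here refl))) (here refl) ne = flipA e₁₃
      adj-T (there (there (here refl))) (there (here refl)) ne = flipA e₂₃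
      adj-T (there (there (here refl))) (there (there (here refl))) ne = ⊥-elim (ne refl)
      in-T : ∀ {z} → z ∈ t₁ ∷ t₂ ∷ t₃ ∷ [] → z ∈ H × A x z ≡ true
      in-T (here refl) = top (a₁ k) , arm-hit (a₁ k)
      in-T (there (here refl)) = top (a₂ k) , arm-hit (a₂ k)
      in-T (there (there (here refl))) = top (a₃ k) , arm-hit (a₃ k)

  -- Degrees and bad list assignments.

  dg-∷ : ∀ u X v → dg (u ∷ X) v ≡ bit (A v u) + dg X v
  dg-∷ u X v with A v u
  ... | true = refl
  ... | false = refl

  dg-++ : ∀ X Y v → dg (X ++ Y) v ≡ dg X v + dg Y v
  dg-++ X Y v = ≡.trans (cong length (Listₚ.filter-++ (T? ∘ A v) X Y)) (Listₚ.length-++ (filterᵇ (A v) X))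

  dg-↭ : ∀ {X Y} → X ↭ Y → ∀ v → dg X v ≡ dg Y v
  dg-↭ p v = ↭ₚ.↭-length (↭ₚ.filter-↭ (T? ∘ A v) p)

  dg-none : ∀ X v → (∀ {z} → z ∈ X → A v z ≡ false) → dg X v ≡ 0
  dg-none X v f = cong length (filterᵇ-none (A v) X f)

  dg-≤ : ∀ X v → dg X v ≤ length X
  dg-≤ X v = Listₚ.length-filter (T? ∘ A v) X

  dg-< : ∀ {X v} → v ∈ X → dg X v < length X
  dg-< {_ ∷ X} {v} (here refl) rewrite dg-∷ v X v | A-irr v = s≤s (dg-≤ X v)
  dg-< {u ∷ X} {v} (there p) rewrite dg-∷ u X v with A v u
  ... | true = s≤s (dg-< p)
  ... | false = ℕₚ.m≤n⇒m≤1+n (dg-< p)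

  unique-⊆ : ∀ {U L : List V} → Unique U → Unique L → (∀ {z} → z ∈ U → z ∈ L) → length U ≤ length L
  unique-⊆ {U} {L} uU uL i = ℕₚ.≤-trans (ℕₚ.m≤n+m (length U) (length (L ─ U)))
    (ℕₚ.≤-reflexive (≡.sym (≡.trans (↭ₚ.↭-length (split-↭ uL uU i)) (Listₚ.length-++ (L ─ U)))))

  pigeon : ∀ k (xs : List ℕ) → Unique xs → (∀ {a} → a ∈ xs → a < k) → length xs ≤ k
  pigeon zero [] u f = z≤n
  pigeon zero (a ∷ xs) u f = case f (here refl) of λ ()
  pigeon (suc k) xs u f = ℕₚ.≤-trans (split xs u id) (s≤s (pigeon k (rest xs) (Uniqueₚ.filter⁺ (T? ∘ lt) u) (λ a∈ → small (∈-filterᵇ⁻ lt {xs} a∈))))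
    where
    lt : ℕ → Bool
    lt a = a <ᵇ k
    rest : List ℕ → List ℕ
    rest = filterᵇ lt
    small : ∀ {a} → a ∈ xs × lt a ≡ true → a < k
    small {a} (_ , e) = ℕₚ.<ᵇ⇒< a k (subst T (≡.sym e) _)
    split : ∀ ys → Unique ys → (∀ {a} → a ∈ ys → a ∈ xs) → length ys ≤ suc (length (rest ys))
    split [] _ _ = z≤n
    split (a ∷ ys) (ne ∷ u) i with lt a in e
    ... | true = s≤s (split ys u (i ∘ there))
    ... | false = s≤s (ℕₚ.≤-reflexive (≡.sym (cong length (all-lt ys (λ {b} b∈ → below b (λ { refl → All.lookup ne b∈ (eqk a (i (here refl)) e) }) (f (i (there b∈))))))))
      where
      eqk : ∀ a → a ∈ xs → lt a ≡ false → a ≡ k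
      eqk a a∈ e = ℕₚ.≤-antisym (ℕₚ.≤-pred (f a∈)) (ℕₚ.≮⇒≥ (λ a<k → absurdᵇ (Tt (ℕₚ.<⇒<ᵇ a<k)) e))
      below : ∀ b → b ≢ k → b < suc k → lt b ≡ true
      below b ne (s≤s b≤k) with lt b in e′
      ... | true = refl
      ... | false = ⊥-elim (ne (ℕₚ.≤-antisym b≤k (ℕₚ.≮⇒≥ (λ b<k → absurdᵇ (Tt (ℕₚ.<⇒<ᵇ b<k)) e′))))
      all-lt : ∀ ys → (∀ {b} → b ∈ ys → lt b ≡ true) → rest ys ≡ ys
      all-lt [] _ = refl
      all-lt (b ∷ ys) g = ≡.trans (filterᵇ-true lt (g (here refl))) (cong (b ∷_) (all-lt ys (g ∘ there)))

  Proper : List V → (V → ℕ) → Set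
  Proper W φ = ∀ {u v} → u ∈ W → v ∈ W → A u v ≡ true → φ u ≢ φ v

  -- Bad lists are kept as data, not as a negated statement, so that those of two subgraphs can be
  -- glued.
  record Bad (f : V → ℕ) (W : List V) : Set where
    field
      L    : V → List ℕ
      uniq : ∀ {v} → v ∈ W → Unique (L v)
      len  : ∀ {v} → v ∈ W → length (L v) ≡ f v
      bad  : ∀ φ → (∀ {v} → v ∈ W → φ v ∈ L v) → Proper W φ → ⊥
  open Bad public

  bad-trivial : ∀ {f W v} → v ∈ W → f v ≡ 0 → Bad f W
  bad-trivial {f} {W} {v} v∈ e = record { L = upTo ∘ f ; uniq = λ {u} _ → Uniqueₚ.upTo⁺ (f u) ; len = λ {u} _ → Listₚ.length-upTo (f u)
    ; bad = λ φ c _ → case subst (λ k → φ v ∈ upTo k) e (c v∈) of λ () }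

  -- All lists are initial segments of one set of |W| - 1 colours, while a clique on `W` needs |W|
  -- of them.
  bad-clique : ∀ {f W v₀} → v₀ ∈ W → Unique W → (∀ {v} → v ∈ W → f v ≤ dg W v) → (∀ {u v} → u ∈ W → v ∈ W → u ≢ v → A u v ≡ true) → Bad f W
  bad-clique {f} {W} {v₀} v₀∈ uW f≤ cl = record { L = upTo ∘ f ; uniq = λ {u} _ → Uniqueₚ.upTo⁺ (f u) ; len = λ {u} _ → Listₚ.length-upTo (f u) ; bad = bd }
    where
    bd : ∀ φ → (∀ {v} → v ∈ W → φ v ∈ upTo (f v)) → Proper W φ → ⊥
    bd φ c pr = ℕₚ.<-irrefl refl (ℕₚ.<-≤-trans (ℕₚ.n<1+n (pred (length W))) (ℕₚ.≤-trans (ℕₚ.≤-reflexive (≡.trans sucpred (≡.sym (Listₚ.length-map φ W)))) (pigeon (pred (length W)) (map φ W) (um uW id) below)))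
      where
      sucpred : suc (pred (length W)) ≡ length W
      sucpred = ℕₚ.suc-pred (length W) {{>-nonZero (ℕₚ.≤-<-trans z≤n (dg-< v₀∈))}}
      below : ∀ {a} → a ∈ map φ W → a < pred (length W)
      below a∈ with ∈-map⁻ φ a∈
      ... | v , v∈ , refl = ℕₚ.<-≤-trans (∈-upTo⁻ (c v∈)) (ℕₚ.≤-trans (f≤ v∈) (ℕₚ.≤-pred (subst (dg W v <_) (≡.sym sucpred) (dg-< v∈))))
      um : ∀ {U} → Unique U → (∀ {z} → z ∈ U → z ∈ W) → Unique (map φ U)
      um [] i = []
      um {u ∷ U} (ne ∷ un) i = Allₚ.map⁺ (All.tabulate (λ {z} z∈ → pr (i (here refl)) (i (there z∈)) (cl (i (here refl)) (i (there z∈)) (All.lookup ne z∈)))) ∷ um un (i ∘ there)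

  -- Even and odd numbers keep the two palettes in `glue` disjoint; halving recovers the original
  -- colour from either.
  dbl dbl₁ : ℕ → ℕ
  dbl n = n + n
  dbl₁ n = suc (n + n)

  half-dbl : ∀ n → ⌊ dbl n /2⌋ ≡ n
  half-dbl n = ≡.sym (ℕₚ.n≡⌊n+n/2⌋ n)

  half-dbl₁ : ∀ n → ⌊ dbl₁ n /2⌋ ≡ n
  half-dbl₁ zero = refl
  half-dbl₁ (suc n) rewrite ℕₚ.+-suc n n = cong suc (half-dbl₁ n)

  dbl-inj : ∀ {a b} → dbl a ≡ dbl b → a ≡ b
  dbl-inj {a} {b} e = ≡.trans (≡.sym (half-dbl a)) (≡.trans (cong ⌊_/2⌋ e) (half-dbl b))

  dbl₁-inj : ∀ {a b} → dbl₁ a ≡ dbl₁ b → a ≡ b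
  dbl₁-inj e = dbl-inj (ℕₚ.suc-injective e)

  dbl≢dbl₁ : ∀ a b → dbl a ≢ dbl₁ b
  dbl≢dbl₁ zero b ()
  dbl≢dbl₁ (suc a) zero e rewrite ℕₚ.+-suc a a = case e of λ ()
  dbl≢dbl₁ (suc a) (suc b) e rewrite ℕₚ.+-suc a a | ℕₚ.+-suc b b = dbl≢dbl₁ a b (ℕₚ.suc-injective (ℕₚ.suc-injective e))

  -- Bad lists on the two sides of a cut vertex p use disjoint sets of colours, which are united at p.
  glue : ∀ {f f₁ f₂ W p X Y} → (∀ {v} → v ∈ W → v ∈ p ∷ X ++ Y) → (∀ {v} → v ∈ p ∷ X ++ Y → v ∈ W) → p ∉ X → p ∉ Y → (∀ {v} → v ∈ X → v ∉ Y) →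
    Bad f₁ (p ∷ X) → Bad f₂ (p ∷ Y) → (∀ {v} → v ∈ X → f v ≡ f₁ v) → (∀ {v} → v ∈ Y → f v ≡ f₂ v) → f p ≡ f₁ p + f₂ p → Bad f W
  glue {f} {f₁} {f₂} {W} {p} {X} {Y} W⊆ ⊆W p∉X p∉Y dis b₁ b₂ eX eY ep = record { L = LL ; uniq = uq ∘ W⊆ ; len = ln ∘ W⊆ ; bad = bd }
    where
    L₁ = L b₁
    L₂ = L b₂
    LL : V → List ℕ
    LL v = if does (v ≟ p) then map dbl (L₁ v) ++ map dbl₁ (L₂ v) else (if ∈ᵇ X v then map dbl (L₁ v) else map dbl₁ (L₂ v))
    LLp : LL p ≡ map dbl (L₁ p) ++ map dbl₁ (L₂ p)
    LLp with p ≟ p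
    ... | yes _ = refl
    ... | no ne = ⊥-elim (ne refl)
    LLX : ∀ {v} → v ∈ X → LL v ≡ map dbl (L₁ v)
    LLX {v} v∈ with v ≟ p
    ... | yes refl = ⊥-elim (p∉X v∈)
    ... | no _ rewrite true-∈ᵇ {X} v∈ = refl
    LLY : ∀ {v} → v ∈ Y → LL v ≡ map dbl₁ (L₂ v)
    LLY {v} v∈ with v ≟ p
    ... | yes refl = ⊥-elim (p∉Y v∈)
    ... | no _ rewrite false-∈ᵇ {X} {v} (λ v∈X → dis v∈X v∈) = refl
    data Pos (v : V) : Set where
      atp : v ≡ p → Pos v
      inX : v ∈ X → Pos v
      inY : v ∈ Y → Pos v
    pos : ∀ {v} → v ∈ p ∷ X ++ Y → Pos v
    pos (here e) = atp e
    pos (there q) with ∈-++⁻ X q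
    ... | inj₁ r = inX r
    ... | inj₂ r = inY r
    uq : ∀ {v} → v ∈ p ∷ X ++ Y → Unique (LL v)
    uq q with pos q
    ... | atp refl rewrite LLp = Uniqueₚ.++⁺ (Uniqueₚ.map⁺ dbl-inj (uniq b₁ (here refl))) (Uniqueₚ.map⁺ dbl₁-inj (uniq b₂ (here refl)))
            λ { (r , s) → case ∈-map⁻ dbl r of λ { (a , _ , refl) → case ∈-map⁻ dbl₁ s of λ { (b , _ , e) → dbl≢dbl₁ a b e } } }
    ... | inX r rewrite LLX r = Uniqueₚ.map⁺ dbl-inj (uniq b₁ (there r))
    ... | inY r rewrite LLY r = Uniqueₚ.map⁺ dbl₁-inj (uniq b₂ (there r))
    ln : ∀ {v} → v ∈ p ∷ X ++ Y → length (LL v) ≡ f v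
    ln {v} q with pos q
    ... | atp refl rewrite LLp = ≡.trans (Listₚ.length-++ (map dbl (L₁ p))) (≡.trans (cong₂ _+_ (≡.trans (Listₚ.length-map dbl (L₁ p)) (len b₁ (here refl))) (≡.trans (Listₚ.length-map dbl₁ (L₂ p)) (len b₂ (here refl)))) (≡.sym ep))
    ... | inX r rewrite LLX r = ≡.trans (Listₚ.length-map dbl (L₁ v)) (≡.trans (len b₁ (there r)) (≡.sym (eX r)))
    ... | inY r rewrite LLY r = ≡.trans (Listₚ.length-map dbl₁ (L₂ v)) (≡.trans (len b₂ (there r)) (≡.sym (eY r)))
    bd : ∀ φ → (∀ {v} → v ∈ W → φ v ∈ LL v) → Proper W φ → ⊥
    bd φ c pr with ∈-++⁻ (map dbl (L₁ p)) (subst (φ p ∈_) LLp (c (⊆W (here refl))))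
    ... | inj₁ q = bad b₁ (λ v → ⌊ φ v /2⌋) (λ v∈ → subst (_∈ L₁ _) (≡.sym (proj₂ (val v∈))) (proj₁ (proj₂ (pre v∈)))) pr′
      where
      mem : ∀ {v} → v ∈ p ∷ X → φ v ∈ map dbl (L₁ v)
      mem (here refl) = q
      mem (there r) = subst (_ ∈_) (LLX r) (c (⊆W (there (∈-++⁺ˡ r))))
      pre : ∀ {v} → v ∈ p ∷ X → Σ ℕ λ a → a ∈ L₁ v × φ v ≡ dbl a
      pre v∈ = ∈-map⁻ dbl (mem v∈)
      val : ∀ {v} (v∈ : v ∈ p ∷ X) → φ v ≡ dbl (proj₁ (pre v∈)) × ⌊ φ v /2⌋ ≡ proj₁ (pre v∈)
      val v∈ = proj₂ (proj₂ (pre v∈)) , ≡.trans (cong ⌊_/2⌋ (proj₂ (proj₂ (pre v∈)))) (half-dbl _)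
      up : ∀ {v} → v ∈ p ∷ X → v ∈ W
      up (here refl) = ⊆W (here refl)
      up (there r) = ⊆W (there (∈-++⁺ˡ r))
      pr′ : Proper (p ∷ X) (λ v → ⌊ φ v /2⌋)
      pr′ u∈ v∈ e eq = pr (up u∈) (up v∈) e (≡.trans (proj₁ (val u∈)) (≡.trans (cong dbl (≡.trans (≡.sym (proj₂ (val u∈))) (≡.trans eq (proj₂ (val v∈))))) (≡.sym (proj₁ (val v∈)))))
    ... | inj₂ q = bad b₂ (λ v → ⌊ φ v /2⌋) (λ v∈ → subst (_∈ L₂ _) (≡.sym (proj₂ (val v∈))) (proj₁ (proj₂ (pre v∈)))) pr′
      where
      mem : ∀ {v} → v ∈ p ∷ Y → φ v ∈ map dbl₁ (L₂ v)
      mem (here refl) = q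
      mem (there r) = subst (_ ∈_) (LLY r) (c (⊆W (there (∈-++⁺ʳ X r))))
      pre : ∀ {v} → v ∈ p ∷ Y → Σ ℕ λ a → a ∈ L₂ v × φ v ≡ dbl₁ a
      pre v∈ = ∈-map⁻ dbl₁ (mem v∈)
      val : ∀ {v} (v∈ : v ∈ p ∷ Y) → φ v ≡ dbl₁ (proj₁ (pre v∈)) × ⌊ φ v /2⌋ ≡ proj₁ (pre v∈)
      val v∈ = proj₂ (proj₂ (pre v∈)) , ≡.trans (cong ⌊_/2⌋ (proj₂ (proj₂ (pre v∈)))) (half-dbl₁ _)
      up : ∀ {v} → v ∈ p ∷ Y → v ∈ W
      up (here refl) = ⊆W (here refl)
      up (there r) = ⊆W (there (∈-++⁺ʳ X r))
      pr′ : Proper (p ∷ Y) (λ v → ⌊ φ v /2⌋)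
      pr′ u∈ v∈ e eq = pr (up u∈) (up v∈) e (≡.trans (proj₁ (val u∈)) (≡.trans (cong dbl₁ (≡.trans (≡.sym (proj₂ (val u∈))) (≡.trans eq (proj₂ (val v∈))))) (≡.sym (proj₁ (val v∈)))))

  -- x gets a single new colour, which is added to the lists of its neighbours.
  bad-cone : ∀ {f f′ W H x} → x ∈ W → x ∉ H → (∀ {v} → v ∈ W → v ≡ x ⊎ v ∈ H) → (∀ {v} → v ∈ H → v ∈ W) → Bad f′ H →
    f x ≡ 1 → (∀ {v} → v ∈ H → f v ≡ bit (A x v) + f′ v) → Bad f W
  bad-cone {f} {f′} {W} {H} {x} x∈ x∉ W⊆ H⊆ b fx fH = record { L = LL ; uniq = λ v∈ → uq (W⊆ v∈) ; len = λ v∈ → ln (W⊆ v∈) ; bad = bd }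
    where
    LL : V → List ℕ
    LL v = if does (v ≟ x) then 0 ∷ [] else (if A x v then 0 ∷ map suc (L b v) else map suc (L b v))
    LLx : LL x ≡ 0 ∷ []
    LLx with x ≟ x
    ... | yes _ = refl
    ... | no ne = ⊥-elim (ne refl)
    LLH : ∀ {v} → v ∈ H → LL v ≡ (if A x v then 0 ∷ map suc (L b v) else map suc (L b v))
    LLH {v} v∈ with v ≟ x
    ... | yes refl = ⊥-elim (x∉ v∈)
    ... | no _ = refl
    no-zero : ∀ {l : List ℕ} {a} → a ∈ map suc l → 0 ≢ a
    no-zero a∈ refl = case ∈-map⁻ suc a∈ of λ { (_ , _ , ()) }
    uq : ∀ {v} → v ≡ x ⊎ v ∈ H → Unique (LL v)
    uq (inj₁ refl) rewrite LLx = [] ∷ []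
    uq {v} (inj₂ v∈) rewrite LLH v∈ with A x v
    ... | true = All.tabulate no-zero ∷ Uniqueₚ.map⁺ ℕₚ.suc-injective (uniq b v∈)
    ... | false = Uniqueₚ.map⁺ ℕₚ.suc-injective (uniq b v∈)
    ln : ∀ {v} → v ≡ x ⊎ v ∈ H → length (LL v) ≡ f v
    ln (inj₁ refl) rewrite LLx = ≡.sym fx
    ln {v} (inj₂ v∈) rewrite LLH v∈ | fH v∈ with A x v
    ... | true = cong suc (≡.trans (Listₚ.length-map suc (L b v)) (len b v∈))
    ... | false = ≡.trans (Listₚ.length-map suc (L b v)) (len b v∈)
    bd : ∀ φ → (∀ {v} → v ∈ W → φ v ∈ LL v) → Proper W φ → ⊥
    bd φ c pr = bad b (pred ∘ φ) (λ v∈ → case ∈-map⁻ suc (mem v∈) of λ { (a , a∈ , e) → subst (_∈ L b _) (≡.sym (cong pred e)) a∈ })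
        λ u∈ v∈ e eq → pr (H⊆ u∈) (H⊆ v∈) e (pred-inj (mem u∈) (mem v∈) eq)
      where
      φx : φ x ≡ 0
      φx = case subst (φ x ∈_) LLx (c x∈) of λ { (here e) → e }
      mem : ∀ {v} → v ∈ H → φ v ∈ map suc (L b v)
      mem {v} v∈ with A x v in e | subst (φ v ∈_) (LLH v∈) (c (H⊆ v∈))
      ... | false | q = q
      ... | true | there q = q
      ... | true | here e₀ = ⊥-elim (pr x∈ (H⊆ v∈) e (≡.trans φx (≡.sym e₀)))
      pred-inj : ∀ {a b} {l l′ : List ℕ} → a ∈ map suc l → b ∈ map suc l′ → pred a ≡ pred b → a ≡ b
      pred-inj p q e = case ∈-map⁻ suc p of λ { (_ , _ , refl) → case ∈-map⁻ suc q of λ { (_ , _ , refl) → cong suc e } }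

  bad-upTo : ∀ {f W} → (∀ φ → (∀ {v} → v ∈ W → φ v < f v) → Proper W φ → ⊥) → Bad f W
  bad-upTo {f} bd = record { L = upTo ∘ f ; uniq = λ {u} _ → Uniqueₚ.upTo⁺ (f u) ; len = λ {u} _ → Listₚ.length-upTo (f u) ; bad = λ φ c pr → bd φ (∈-upTo⁻ ∘ c) pr }

  distinct₄ : ∀ {a b c d k} → a < k → b < k → c < k → d < k → a ≢ b → a ≢ c → a ≢ d → b ≢ c → b ≢ d → c ≢ d → 4 ≤ k
  distinct₄ {a} {b} {c} {d} {k} la lb lc ld ab ac ad bc bd cd = pigeon k (a ∷ b ∷ c ∷ d ∷ []) ((ab ∷ ac ∷ ad ∷ []) ∷ (bc ∷ bd ∷ []) ∷ (cd ∷ []) ∷ [] ∷ [])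
    λ { (here refl) → la ; (there (here refl)) → lb ; (there (there (here refl))) → lc ; (there (there (there (here refl)))) → ld }

  -- Along a path properly coloured with 0 and 1 the colours alternate.
  R : Sign → ℕ → ℕ → Set
  R Sign.+ a b = a ≡ b
  R Sign.- a b = a ≢ b

  bit-third : ∀ {a b c} → a < 2 → b < 2 → c < 2 → a ≢ b → b ≢ c → a ≡ c
  bit-third {zero} {zero} _ _ _ ab bc = ⊥-elim (ab refl)
  bit-third {zero} {suc zero} {zero} _ _ _ _ _ = refl
  bit-third {zero} {suc zero} {suc zero} _ _ _ _ bc = ⊥-elim (bc refl)
  bit-third {suc zero} {zero} {zero} _ _ _ _ bc = ⊥-elim (bc refl)
  bit-third {suc zero} {zero} {suc zero} _ _ _ _ _ = refl
  bit-third {suc zero} {suc zero} _ _ _ ab _ = ⊥-elim (ab refl)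
  bit-third {suc (suc _)} (s≤s (s≤s ()))
  bit-third {_} {suc (suc _)} _ (s≤s (s≤s ()))
  bit-third {_} {_} {suc (suc _)} _ _ (s≤s (s≤s ()))

  R-step : ∀ s {a b c} → a < 2 → b < 2 → c < 2 → R s a b → b ≢ c → R (s Sign.* Sign.-) a c
  R-step Sign.+ la lb lc refl ne = ne
  R-step Sign.- la lb lc ab ne = bit-third la lb lc ab ne

  R-det : ∀ s {a b c} → a < 2 → b < 2 → c < 2 → R s a c → R s b c → a ≡ b
  R-det Sign.+ _ _ _ refl refl = refl
  R-det Sign.- la lb lc ac bc = bit-third la lc lb ac (bc ∘ ≡.sym)

  -- `s` is the parity of the number of steps taken since the colour `a`. The last step goes from
  -- the neighbour of `x` on the path to `x`.
  chain : ∀ {x φ} s {a} z zs → a < 2 → (∀ {v} → v ∈ x ∷ z ∷ zs → φ v < 2) → Proper (x ∷ z ∷ zs) φ → IP z zs → (Σ V λ e → A x e ≡ true × Hit (λ v → does (v ≟ e)) z zs) → R s a (φ z) → R (psign s zs) a (φ x)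
  chain s z [] la lt pr ip (e , xe , ht) r with z ≟ e
  ... | yes refl = R-step s la (lt (there (here refl))) (lt (here refl)) r (pr (there (here refl)) (here refl) (flipA xe))
  chain s z (z′ ∷ zs) la lt pr (cons e _ _ ip) (end , xe , (_ , ht)) r =
    chain (s Sign.* Sign.-) z′ zs la (lt ∘ skip) (λ u∈ v∈ → pr (skip u∈) (skip v∈)) ip (end , xe , ht)
      (R-step s la (lt (there (here refl))) (lt (there (there (here refl)))) r (pr (there (here refl)) (there (there (here refl))) e))
    where
    skip : ∀ {v} → v ∈ _ ∷ z′ ∷ zs → v ∈ _ ∷ z ∷ z′ ∷ zs
    skip (here p) = here p
    skip (there p) = there (there p)

  psign-neg : ∀ {X : Set} s (zs : List X) → psign (s Sign.* Sign.-) zs ≡ psign s zs Sign.* Sign.-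
  psign-neg s [] = refl
  psign-neg s (_ ∷ zs) = psign-neg (s Sign.* Sign.-) zs

  hit-to-end : ∀ {g} z zs → Hit g z zs → Unique (z ∷ zs) → Σ V λ e → e ∈ z ∷ zs × g e ≡ true × Hit (λ v → does (v ≟ e)) z zs
  hit-to-end z [] ht u with z ≟ z in eq
  ... | yes _ = z , here refl , ht , cong does eq
  ... | no ne = ⊥-elim (ne refl)
  hit-to-end z (z′ ∷ zs) (_ , ht) (ne ∷ u) with hit-to-end z′ zs ht u
  ... | e , e∈ , ge , h′ with z ≟ e in eq
  ...   | yes refl = ⊥-elim (All.lookup ne e∈ refl)
  ...   | no _ = e , there e∈ , ge , cong does eq , h′

  -- Degrees in edge lists, and the product of coefficients at a common vertex.

  degE-row : ∀ u X {es v} → Unique X → u ≢ v → v ∈ X → degE (star u (filterᵇ (A u) X) ++ es) v ≡ bit (A u v) + degE es v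
  degE-off : ∀ u X {es v} → u ≢ v → v ∉ X → degE (star u (filterᵇ (A u) X) ++ es) v ≡ degE es v
  degE-off u [] ne v∉ = refl
  degE-off u (z ∷ X) {es} {v} ne v∉ with A u z
  ... | false = degE-off u X ne (v∉ ∘ there)
  ... | true = ≡.trans (bump-≢ _ ne) (≡.trans (bump-≢ {u = z} {v} _ (λ { refl → v∉ (here refl) })) (degE-off u X ne (v∉ ∘ there)))
  degE-row u (z ∷ X) {es} {v} (zX ∷ un) ne (here refl) with A u z
  ... | false = degE-off u X ne (λ q → All.lookup zX q refl)
  ... | true = ≡.trans (bump-≢ _ ne) (≡.trans (bump-≡ z _) (cong suc (degE-off u X ne (λ q → All.lookup zX q refl))))
  degE-row u (z ∷ X) {es} {v} (zX ∷ un) ne (there q) with A u z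
  ... | false = degE-row u X un ne q
  ... | true = ≡.trans (bump-≢ _ ne) (≡.trans (bump-≢ {u = z} {v} _ (λ { refl → All.lookup zX q refl })) (degE-row u X un ne q))

  degE-dg : ∀ {U v} → Unique U → v ∈ U → degE (E U) v ≡ dg U v
  degE-dg {u ∷ U} {v} (uU ∷ un) (here refl) = ≡.trans (degE-star (filterᵇ (A u) U) (λ q → All.lookup uU (proj₁ (∈-filterᵇ⁻ (A u) q)) refl))
    (≡.trans (cong (dg U u +_) (degE-fresh (fresh-in (λ q → All.lookup uU q refl) (edges-in U)))) (≡.trans (ℕₚ.+-identityʳ _) (≡.sym (≡.trans (dg-∷ u U u) (cong (λ b → bit b + dg U u) (A-irr u))))))
  degE-dg {u ∷ U} {v} (uU ∷ un) (there q) = ≡.trans (degE-row u U un (All.lookup uU q) q)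
    (≡.trans (cong₂ (λ b k → bit b + k) (A-sym u v) (degE-dg un q)) (≡.sym (dg-∷ u U v)))

  degE-++ : ∀ (es fs : List (SEdge (n G))) v → degE (es ++ fs) v ≡ degE es v + degE fs v
  degE-++ [] fs v = refl
  degE-++ (ed a b s ∷ es) fs v rewrite degE-++ es fs v = ≡.trans (cong (bump a v) (bump-+ b)) (bump-+′ a _ _)
    where
    bump-+′ : ∀ a k l → bump a v (k + l) ≡ bump a v k + l
    bump-+′ a k l with a ≟ v
    ... | yes _ = refl
    ... | no _ = refl
    bump-+ : ∀ b → bump b v (degE es v + degE fs v) ≡ bump b v (degE es v) + degE fs v
    bump-+ b = bump-+′ b _ _

  Mon : Set
  Mon = V → ℕ

  -- Where `m` is positive only the factors of `es` can raise an exponent, and there are too few of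
  -- them.
  vanish₂ : ∀ (es fs : List (SEdge (n G))) {w} (m : Mon) → (∀ v → 0 < m v → Fresh v fs) → (∀ v k → k < m v → w v k ≡ 0ℤ) → length es < sumF m → c (es ++ fs) w ≡ 0ℤ
  vanish₂ [] fs {w} m fr low p = let v , q = sumF-pos m p in c-zero-fresh fs v (fr v q) (low v 0 q)
  vanish₂ (ed a b s ∷ es) fs {w} m fr low p = sum-zero s (go a) (go b)
    where
    low′ : ∀ u v k → k < dec u m v → sh u w v k ≡ 0ℤ
    low′ u v k q with u ≟ v
    ... | yes refl = low v (suc k) (aux (m v) q)
      where aux : ∀ j → k < pred j → suc k < j
            aux (suc j) r = s≤s r
    ... | no _ = low v k q
    fr′ : ∀ u v → 0 < dec u m v → Fresh v fs
    fr′ u v q with u ≟ v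
    ... | yes refl = fr v (ℕₚ.<-≤-trans q ℕₚ.pred[n]≤n)
    ... | no _ = fr v q
    go : ∀ u → c (es ++ fs) (sh u w) ≡ 0ℤ
    go u = vanish₂ es fs (dec u m) (fr′ u) (low′ u) (ℕₚ.≤-pred (ℕₚ.≤-trans p (sumF-dec-≤ m u)))

  sumF-zero : ∀ {N} (m : Fin N → ℕ) → sumF m ≡ 0 → ∀ v → m v ≡ 0
  sumF-zero m e zero = ℕₚ.m+n≡0⇒m≡0 (m zero) e
  sumF-zero m e (suc v) = sumF-zero (m ∘ suc) (ℕₚ.m+n≡0⇒n≡0 (m zero) e) v

  -- For edge sets meeting only in x, homogeneity singles out one term of the Cauchy product.
  c-product : ∀ x (es fs : List (SEdge (n G))) (m₁ m₂ : Mon) → length es ≡ sumF m₁ → (∀ v → 0 < m₁ v → v ≢ x → Fresh v fs) →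
    All (λ e → (src e ≡ x ⊎ m₂ (src e) ≡ 0) × (tgt e ≡ x ⊎ m₂ (tgt e) ≡ 0)) es → c (es ++ fs) (δ (λ v → m₁ v + m₂ v)) ≡ c es (δ m₁) ℤ.* c fs (δ m₂)
  c-product x [] fs m₁ m₂ eq fr ends = ≡.trans (c-cong fs (λ v k → cong (λ q → δ₁ (q + m₂ v) k) (m0 v))) (≡.sym (≡.trans (cong (ℤ._* c fs (δ m₂)) (prodF-one _ (λ v → cong (λ q → δ₁ q 0) (m0 v)))) (ℤₚ.*-identityˡ _)))
    where
    m0 : ∀ v → m₁ v ≡ 0
    m0 = sumF-zero m₁ (≡.sym eq)
  c-product x (ed a b s ∷ es) fs m₁ m₂ eq fr ((pa , pb) ∷ ends) = ≡.trans (cong₂ (λ p q → p ℤ.+ sg s ℤ.* q) (go a pa) (go b pb))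
      (≡.sym (≡.trans (ℤₚ.*-distribʳ-+ (c fs (δ m₂)) (c es (sh a (δ m₁))) _) (cong (λ q → c es (sh a (δ m₁)) ℤ.* c fs (δ m₂) ℤ.+ q) (ℤₚ.*-assoc (sg s) (c es (sh b (δ m₁))) (c fs (δ m₂))))))
    where
    m = λ v → m₁ v + m₂ v
    go : ∀ u → u ≡ x ⊎ m₂ u ≡ 0 → c (es ++ fs) (sh u (δ m)) ≡ c es (sh u (δ m₁)) ℤ.* c fs (δ m₂)
    go u pu with m₁ u in e
    ... | suc j = ≡.trans (c-δ-suc (es ++ fs) u m (cong (_+ m₂ u) e)) (≡.trans (c-cong (es ++ fs) (λ v k → cong (λ q → δ₁ q k) (split v)))
          (≡.trans (c-product x es fs (dec u m₁) m₂ (ℕₚ.suc-injective (≡.trans eq (≡.sym (sumF-dec m₁ u e)))) fr′ ends) (cong (ℤ._* c fs (δ m₂)) (≡.sym (c-δ-suc es u m₁ e)))))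
      where
      split : ∀ v → dec u m v ≡ dec u m₁ v + m₂ v
      split v with u ≟ v
      ... | yes refl rewrite e = refl
      ... | no _ = refl
      fr′ : ∀ v → 0 < dec u m₁ v → v ≢ x → Fresh v fs
      fr′ v q with u ≟ v
      ... | yes refl = fr v (ℕₚ.<-≤-trans q ℕₚ.pred[n]≤n)
      ... | no _ = fr v q
    ... | zero = ≡.trans (zeroL pu) (≡.sym (≡.trans (cong (ℤ._* c fs (δ m₂)) (c-δ-zero es u m₁ e)) (ℤₚ.*-zeroˡ (c fs (δ m₂)))))
      where
      low : ∀ v k → k < m₁ v → sh u (δ m) v k ≡ 0ℤ
      low v k q with u ≟ v
      ... | yes refl = ⊥-elim (ℕₚ.n≮0 (subst (k <_) e q))
      ... | no _ = δ₁-≢ {m v} {k} (λ eq′ → ℕₚ.<-irrefl (≡.sym eq′) (ℕₚ.<-≤-trans q (ℕₚ.m≤m+n (m₁ v) (m₂ v))))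
      zeroL : u ≡ x ⊎ m₂ u ≡ 0 → c (es ++ fs) (sh u (δ m)) ≡ 0ℤ
      zeroL (inj₂ m₂0) = c-δ-zero (es ++ fs) u m (cong₂ _+_ e m₂0)
      -- Taking `x` once more than `m₁ x` uses up a factor of `es`. The remaining exponents of `m₁`
      -- belong to vertices that `fs` does not touch, and `es` is then too short for them.
      zeroL (inj₁ u≡x) = vanish₂ es fs m₁ (λ v q → fr v q (λ v≡x → ℕₚ.n≮0 (subst (0 <_) (≡.trans (cong m₁ (≡.trans v≡x (≡.sym u≡x))) e) q))) low (ℕₚ.≤-reflexive eq)

  c-degree : ∀ (es : List (SEdge (n G))) m → c es (δ m) ≢ 0ℤ → length es ≡ sumF m
  c-degree es m ne = ℕₚ.≤-antisym (ℕₚ.≮⇒≥ (ne ∘ c-below es m)) (ℕₚ.≮⇒≥ (ne ∘ c-vanish es m (λ v k q → δ₁-≢ {m v} {k} (λ e → ℕₚ.<-irrefl (≡.sym e) q))))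

  zero-h : V → ℕ
  zero-h _ = 0

  E-++ : ∀ X Y → NA X Y → E (X ++ Y) ≡ E X ++ E Y
  E-++ [] Y na = refl
  E-++ (x ∷ X) Y na = ≡.trans (cong₂ _++_ (cong (star x) (≡.trans (Listₚ.filter-++ (T? ∘ A x) X Y) (≡.trans (cong (filterᵇ (A x) X ++_) (filterᵇ-none (A x) Y (λ y∈ → proj₁ (na (here refl) y∈)))) (Listₚ.++-identityʳ _))))
      (E-++ X Y (na ∘ there))) (≡.sym (Listₚ.++-assoc (star x (filterᵇ (A x) X)) (E X) (E Y)))

  wedge-edges : ∀ x X Y → NA X Y → E (x ∷ X ++ Y) ↭ E (x ∷ X) ++ E (x ∷ Y)
  wedge-edges x X Y na = ↭-trans (↭-reflexive (cong₂ _++_ (≡.trans (cong (star x) (Listₚ.filter-++ (T? ∘ A x) X Y)) (Listₚ.map-++ _ (filterᵇ (A x) X) (filterᵇ (A x) Y))) (E-++ X Y na)))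
    (↭-trans (↭-reflexive (Listₚ.++-assoc a b (E X ++ E Y))) (↭-trans (↭ₚ.++⁺ˡ a (↭ₚ.shifts b (E X))) (↭-reflexive (≡.sym (Listₚ.++-assoc a (E X) (b ++ E Y))))))
    where
    a = star x (filterᵇ (A x) X)
    b = star x (filterᵇ (A x) Y)

  -- Two Alon–Tarsi orientations glued at x give indegree at least 2 at x.
  wedge-AT : ∀ {x X Y} → NA X Y → x ∉ X → x ∉ Y → ATe zero-h (x ∷ X) (E (x ∷ X)) → ATe zero-h (x ∷ Y) (E (x ∷ Y)) → ATe (h x) (x ∷ X ++ Y) (E (x ∷ X ++ Y))
  wedge-AT {x} {X} {Y} na x∉X x∉Y (m₁ , b₁ , ne₁) (m₂ , b₂ , ne₂) = ATe-≃ {h = h x} {x ∷ X ++ Y} (↭⇒≃ (↭-sym (wedge-edges x X Y na)))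
    (m , bnd , λ z → ne (≡.trans (≡.sym prod) z))
    where
    m : Mon
    m v = m₁ v + m₂ v
    e₁ = E (x ∷ X)
    e₂ = E (x ∷ Y)
    off₁ : ∀ {v} → v ∉ x ∷ X → m₁ v ≡ 0
    off₁ v∉ = fresh-exp {es = e₁} m₁ (fresh-in v∉ (edges-in (x ∷ X))) ne₁
    off₂ : ∀ {v} → v ∉ x ∷ Y → m₂ v ≡ 0
    off₂ v∉ = fresh-exp {es = e₂} m₂ (fresh-in v∉ (edges-in (x ∷ Y))) ne₂
    X∉ : ∀ {v} → v ∈ X → v ∉ x ∷ Y
    X∉ v∈ (here refl) = x∉X v∈
    X∉ v∈ (there q) = NA-ne na v∈ q refl
    Y∉ : ∀ {v} → v ∈ Y → v ∉ x ∷ X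
    Y∉ v∈ (here refl) = x∉Y v∈
    Y∉ v∈ (there q) = NA-ne na q v∈ refl
    end : ∀ {v} → v ∈ x ∷ X → v ≡ x ⊎ m₂ v ≡ 0
    end (here e) = inj₁ e
    end (there q) = inj₂ (off₂ (X∉ q))
    prod : c (e₁ ++ e₂) (δ m) ≡ c e₁ (δ m₁) ℤ.* c e₂ (δ m₂)
    prod = c-product x e₁ e₂ m₁ m₂ (c-degree e₁ m₁ ne₁)
      (λ v q v≢x → fresh-in (λ { (here e) → v≢x e ; (there r) → ℕₚ.<-irrefl (≡.sym (off₁ (Y∉ r))) q }) (edges-in (x ∷ Y)))
      (All.map (λ { (p , q) → end p , end q }) (edges-in (x ∷ X)))
    ne : c e₁ (δ m₁) ℤ.* c e₂ (δ m₂) ≢ 0ℤ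
    ne z with ℤₚ.i*j≡0⇒i≡0∨j≡0 (c e₁ (δ m₁)) z
    ... | inj₁ p = ne₁ p
    ... | inj₂ p = ne₂ p
    bnd : ∀ {v} → v ∈ x ∷ X ++ Y → m v + h x v < degE (e₁ ++ e₂) v
    bnd {v} p rewrite degE-++ e₁ e₂ v with p
    ... | here refl rewrite h-same x | ℕₚ.+-comm (m₁ x + m₂ x) 1 =
          ℕₚ.≤-trans (ℕₚ.≤-reflexive (cong suc (≡.sym (ℕₚ.+-suc (m₁ x) (m₂ x)))))
            (ℕₚ.+-mono-≤ (subst (_< degE e₁ x) (ℕₚ.+-identityʳ (m₁ x)) (b₁ (here refl))) (subst (_< degE e₂ x) (ℕₚ.+-identityʳ (m₂ x)) (b₂ (here refl))))
    ... | there q with ∈-++⁻ X q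
    ...   | inj₁ r rewrite h-other {x} {v} (λ { refl → x∉X r }) | off₂ (X∉ r) | ℕₚ.+-identityʳ (m₁ v) = ℕₚ.≤-trans (b₁ (there r)) (ℕₚ.m≤m+n (degE e₁ v) (degE e₂ v))
    ...   | inj₂ r rewrite h-other {x} {v} (λ { refl → x∉Y r }) | off₁ (Y∉ r) = ℕₚ.≤-trans (b₂ (there r)) (ℕₚ.m≤n+m (degE e₂ v) (degE e₁ v))

  -- Components and cut vertices.

  walk-trans : ∀ {W u v w} → Walk W u v → Walk W v w → Walk W u w
  walk-trans (stop _) q = q
  walk-trans (step u∈ e p) q = step u∈ e (walk-trans p q)

  walk-end : ∀ {W u v} → Walk W u v → v ∈ W
  walk-end (stop p) = p
  walk-end (step _ _ p) = walk-end p

  walk-sym : ∀ {W u v} → Walk W u v → Walk W v u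
  walk-sym (stop p) = stop p
  walk-sym (step u∈ e p) = walk-trans (walk-sym p) (step (walk-start p) (flipA e) (stop u∈))

  record Parts (U : List V) : Set where
    field
      {C D}   : List V
      {c₀ d₀} : V
      perm    : U ↭ C ++ D
      c₀∈     : c₀ ∈ C
      d₀∈     : d₀ ∈ D
      apart   : NA C D

  component : ∀ {U a} → Unique U → a ∈ U → Conn U ⊎ Parts U
  component {U} {a} uU a∈ = go (length (U ─ (a ∷ []))) (a ∷ []) (U ─ (a ∷ [])) refl (here refl)
      (↭-trans (split-↭ uU ([] ∷ []) (λ { (here refl) → a∈ })) (↭ₚ.++-comm (U ─ (a ∷ [])) (a ∷ []))) (λ { (here refl) → stop a∈ })
    where
    go : ∀ k C D → length D ≡ k → a ∈ C → U ↭ C ++ D → (∀ {c} → c ∈ C → Walk U a c) → Conn U ⊎ Parts U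
    go k C [] eq a∈C p w = inj₁ λ u∈ v∈ → walk-trans (walk-sym (w (inC u∈))) (w (inC v∈))
      where
      inC : ∀ {z} → z ∈ U → z ∈ C
      inC z∈ = subst (_ ∈_) (Listₚ.++-identityʳ C) (↭ₚ.∈-resp-↭ p z∈)
    go (suc k) C (d ∷ D) eq a∈C p w with firstIn (adjTo C) (d ∷ D)
    ... | none f = inj₂ record { C = C ; D = d ∷ D ; perm = p ; c₀∈ = a∈C ; d₀∈ = here refl
            ; apart = λ c∈ d∈ → flipA (adjTo-false C _ (f d∈) c∈) , λ { refl → disj c∈ d∈ } }
      where
      disj : ∀ {z} → z ∈ C → z ∉ d ∷ D
      disj = sep C (unique-↭ p uU)
        where
        sep : ∀ C → Unique (C ++ d ∷ D) → ∀ {z} → z ∈ C → z ∉ d ∷ D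
        sep (_ ∷ C) (ne ∷ u) (here refl) q = All.lookup ne (∈-++⁺ʳ C q) refl
        sep (_ ∷ C) (ne ∷ u) (there r) q = sep C u r q
    ... | some M r T eq′ e _ = go k (r ∷ C) (M ++ T) len′ (there a∈C) p′ w′
      where
      len′ : length (M ++ T) ≡ k
      len′ = ℕₚ.suc-injective (≡.trans (≡.sym (↭ₚ.↭-length (↭ₚ.shift r M T))) (≡.trans (cong length (≡.sym eq′)) eq))
      p′ : U ↭ (r ∷ C) ++ M ++ T
      p′ = ↭-trans (subst (λ l → U ↭ C ++ l) eq′ p) (↭-trans (↭ₚ.++⁺ˡ C (↭ₚ.shift r M T)) (↭ₚ.shift r C (M ++ T)))
      near = adjTo-true C r e
      r∈ : r ∈ U
      r∈ = ↭ₚ.∈-resp-↭ (↭-sym p′) (here refl)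
      w′ : ∀ {c} → c ∈ r ∷ C → Walk U a c
      w′ (here refl) = walk-trans (w (proj₁ (proj₂ near))) (step (walk-end (w (proj₁ (proj₂ near)))) (flipA (proj₂ (proj₂ near))) (stop r∈))
      w′ (there q) = w q

  connected? : ∀ {U} → Unique U → Conn U ⊎ Parts U
  connected? {[]} u = inj₁ λ ()
  connected? {a ∷ U} u = component u (here refl)

  record Cut (W : List V) (p : V) : Set where
    field
      {C D}   : List V
      {c₀ d₀} : V
      perm    : W ↭ p ∷ C ++ D
      c₀∈     : c₀ ∈ C
      d₀∈     : d₀ ∈ D
      apart   : NA C D

  cut-swap : ∀ {W p} → Cut W p → Cut W p
  cut-swap record { C = C ; D = D ; perm = perm ; c₀∈ = c₀∈ ; d₀∈ = d₀∈ ; apart = apart } =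
    record { perm = ↭-trans perm (prep _ (↭ₚ.++-comm C D)) ; c₀∈ = d₀∈ ; d₀∈ = c₀∈ ; apart = NA-sym apart }

  cut? : ∀ {W p} → Unique W → p ∈ W → Conn (W ─ (p ∷ [])) ⊎ Cut W p
  cut? {W} {p} uW p∈ with connected? (Unique-─ {W} (p ∷ []) uW)
  ... | inj₁ co = inj₁ co
  ... | inj₂ record { C = C ; D = D ; perm = perm ; c₀∈ = c₀∈ ; d₀∈ = d₀∈ ; apart = apart } = inj₂ record
        { perm = ↭-trans (split-↭ uW ([] ∷ []) (λ { (here refl) → p∈ })) (↭-trans (↭ₚ.++-comm (W ─ (p ∷ [])) (p ∷ [])) (prep p perm)) ; c₀∈ = c₀∈ ; d₀∈ = d₀∈ ; apart = apart }

  cuts? : ∀ {W} → Unique W → (∀ {p} → p ∈ W → Conn (W ─ (p ∷ []))) ⊎ (Σ V λ p → p ∈ W × Cut W p)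
  cuts? {W} uW = go W id
    where
    go : ∀ X → (∀ {p} → p ∈ X → p ∈ W) → (∀ {p} → p ∈ X → Conn (W ─ (p ∷ []))) ⊎ (Σ V λ p → p ∈ W × Cut W p)
    go [] i = inj₁ λ ()
    go (q ∷ X) i with cut? uW (i (here refl))
    ... | inj₂ k = inj₂ (q , i (here refl) , k)
    ... | inj₁ co with go X (i ∘ there)
    ...   | inj₂ k = inj₂ k
    ...   | inj₁ f = inj₁ λ { (here refl) → co ; (there r) → f r }

  module CutFacts {W p} (uW : Unique W) (con : Conn W) (k : Cut W p) where
    open Cut k public

    uPCD : Unique (p ∷ C ++ D)
    uPCD = unique-↭ perm uW
    p∉C : p ∉ C
    p∉C q = unique-head uPCD (∈-++⁺ˡ q)
    p∉D : p ∉ D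
    p∉D q = unique-head uPCD (∈-++⁺ʳ C q)
    uC : ∀ C → Unique (C ++ D) → Unique C
    uC [] u = []
    uC (a ∷ C) (ne ∷ u) = All.tabulate (λ q → All.lookup ne (∈-++⁺ˡ q)) ∷ uC C u
    uD : ∀ C → Unique (C ++ D) → Unique D
    uD [] u = u
    uD (_ ∷ C) (_ ∷ u) = uD C u
    uPC : Unique (p ∷ C)
    uPC = All.tabulate (λ { q refl → p∉C q }) ∷ uC C (unique-tail uPCD)
    uPD : Unique (p ∷ D)
    uPD = All.tabulate (λ { q refl → p∉D q }) ∷ uD C (unique-tail uPCD)
    to : ∀ {z} → z ∈ W → z ∈ p ∷ C ++ D
    to = ↭ₚ.∈-resp-↭ perm
    from : ∀ {z} → z ∈ p ∷ C ++ D → z ∈ W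
    from = ↭ₚ.∈-resp-↭ (↭-sym perm)
    inC : ∀ {z} → z ∈ p ∷ C → z ∈ W
    inC (here e) = from (here e)
    inC (there q) = from (there (∈-++⁺ˡ q))
    inD : ∀ {z} → z ∈ p ∷ D → z ∈ W
    inD (here e) = from (here e)
    inD (there q) = from (there (∈-++⁺ʳ C q))
    lenW : length W ≡ suc (length C + length D)
    lenW = ≡.trans (↭ₚ.↭-length perm) (cong suc (Listₚ.length-++ C))
    smallC : length (p ∷ C) < length W
    smallC rewrite lenW = s≤s (ℕₚ.m<m+n (length C) (pos d₀∈))
      where pos : ∀ {z} {L : List V} → z ∈ L → 0 < length L
            pos (here _) = s≤s z≤n
            pos (there _) = s≤s z≤n
    conC : Conn (p ∷ C)
    conC u∈ v∈ = walk-trans (toP u∈) (walk-sym (toP v∈))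
      where
      lift : ∀ {u} → u ∈ C → Walk W u p → Walk (p ∷ C) u p
      lift u∈ (stop _) = stop (here refl)
      lift u∈ (step {w = w} _ e wk) with to (walk-start wk)
      ... | here refl = step (there u∈) e (stop (here refl))
      ... | there q with ∈-++⁻ C q
      ...   | inj₁ r = step (there u∈) e (lift r wk)
      ...   | inj₂ r = absurdᵇ e (proj₁ (apart u∈ r))
      toP : ∀ {u} → u ∈ p ∷ C → Walk (p ∷ C) u p
      toP (here refl) = stop (here refl)
      toP (there q) = lift q (con (inC (there q)) (from (here refl)))
    dgC : ∀ {v} → v ∈ C → dg W v ≡ dg (p ∷ C) v
    dgC {v} v∈ = ≡.trans (dg-↭ perm v) (≡.trans (dg-++ (p ∷ C) D v) (≡.trans (cong (dg (p ∷ C) v +_) (dg-none D v (λ d∈ → proj₁ (apart v∈ d∈)))) (ℕₚ.+-identityʳ _)))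
    dgD : ∀ {v} → v ∈ D → dg W v ≡ dg (p ∷ D) v
    dgD {v} v∈ = ≡.trans (dg-↭ perm v) (≡.trans (dg-∷ p (C ++ D) v) (≡.trans (cong (bit (A v p) +_) (≡.trans (dg-++ C D v) (cong (_+ dg D v) (dg-none C v (λ c∈ → flipA (proj₁ (apart c∈ v∈))))))) (≡.sym (dg-∷ p D v))))
    dgP : dg W p ≡ dg (p ∷ C) p + dg (p ∷ D) p
    dgP = ≡.trans (dg-↭ perm p) (≡.trans (dg-++ (p ∷ C) D p) (cong (dg (p ∷ C) p +_) (≡.sym (≡.trans (dg-∷ p D p) (cong (λ b → bit b + dg D p) (A-irr p))))))
    disCD : ∀ {v} → v ∈ C → v ∉ D
    disCD c∈ d∈ = NA-ne apart c∈ d∈ refl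
    glueCut : ∀ {f f₁ f₂} → Bad f₁ (p ∷ C) → Bad f₂ (p ∷ D) → (∀ {v} → v ∈ C → f v ≡ f₁ v) → (∀ {v} → v ∈ D → f v ≡ f₂ v) → f p ≡ f₁ p + f₂ p → Bad f W
    glueCut = glue to from p∉C p∉D disCD

  -- Bad lists for the three shapes.

  skR : LegT → LegT → Rows 4
  skR l₂ l₃ = (true ∷ true ∷ isTriv l₂ ∷ []) , (true ∷ isTriv l₃ ∷ []) , (false ∷ []) , [] , tt

  -- K₄ without the edge between `t₁` and `x`, with the paths from `t₂` and `t₃` to `x` of arbitrary
  -- length: a theta graph with hubs `t₂` and `t₃`.
  skP : Vec LegT 2 → Bool
  skP (l₂ ∷ l₃ ∷ []) = okᵇ ((legE 0F l₂ 3F ++ legE 1F l₃ 3F ++ []) ++ smallE (skR l₂ l₃)) (1 ∷ 2 ∷ 1 ∷ 1 ∷ [])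

  sk-ok : ∀ ls → T (skP ls)
  sk-ok = allLs-sound skP tt

  NonAT-mono : ∀ {h₁ h₂ W} → (∀ {v} → v ∈ W → h₁ v ≤ h₂ v) → NonAT h₁ W → NonAT h₂ W
  NonAT-mono {h₁} {h₂} le na (m , b , ne) = na (m , (λ {v} v∈ → ℕₚ.≤-<-trans (ℕₚ.+-monoʳ-≤ (m v) (le v∈)) (b v∈)) , ne)

  small-dg : ∀ {k} (vs : Vec V k) rs → Unique (Vec.toList vs) → Facts vs rs → ∀ i → dg (Vec.toList vs) (lookup vs i) ≡ degE (smallE rs) i
  small-dg vs rs u f i = ≡.trans (≡.sym (degE-dg u (lookup-∈ vs i))) (≡.trans (cong (λ l → degE l (lookup vs i)) (small-edges vs rs f)) (degE-ι (lookup vs) (lookup-inj vs u) (smallE rs) i))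

  module Core₇ {W : List V} {x : V} (S : Setting W x) where

    open Core₆ S public

    fX : V → ℕ
    fX v = dg W v ∸ h x v

    W↭ : ∀ {T₁} → Unique T₁ → (∀ {z} → z ∈ T₁ → z ∈ H) → (∀ {z} → z ∈ H → z ∈ T₁) → W ↭ x ∷ T₁
    W↭ {T₁} u T⊆ ⊆T = ↭-set uW (All.tabulate (λ q e → H-≢ (T⊆ q) (≡.sym e)) ∷ u)
      (λ {v} v∈ → case v ≟ x of λ { (yes e) → here e ; (no ne) → there (⊆T (∈-H v∈ ne)) }) (λ { (here refl) → x∈W ; (there q) → H⊆W (T⊆ q) })

    fH : ∀ {v k} → v ∈ H → dg W v ≤ k → fX v ≤ k
    fH {v} v∈ le rewrite h-other {x} {v} (H-≢ v∈) = le

    path-dg : ∀ {u} Z → IP u Z → Hit (A x) u Z → dg (x ∷ u ∷ Z) u ≡ 1 × (∀ {z} → z ∈ Z → dg (x ∷ u ∷ Z) z ≡ 2)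
    path-dg {u} [] ip xu rewrite dg-∷ x (u ∷ []) u | dg-∷ u [] u | A-irr u | flipA {x} {u} xu = refl , λ ()
    path-dg {u} (v ∷ Z) (cons e f u∉ ip) (xu , ht) with path-dg Z ip ht
    ... | d₁ , d₂ = du , dz
      where
      du : dg (x ∷ u ∷ v ∷ Z) u ≡ 1
      du rewrite dg-∷ x (u ∷ v ∷ Z) u | dg-∷ u (v ∷ Z) u | dg-∷ v Z u | A-irr u | flipA {x} {u} xu | e = cong suc (dg-none Z u f)
      ins : ∀ z → dg (x ∷ u ∷ v ∷ Z) z ≡ bit (A z u) + dg (x ∷ v ∷ Z) z
      ins z rewrite dg-∷ x (u ∷ v ∷ Z) z | dg-∷ u (v ∷ Z) z | dg-∷ x (v ∷ Z) z = aux (bit (A z x)) (bit (A z u)) (dg (v ∷ Z) z)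
        where
        aux : ∀ a b d → a + (b + d) ≡ b + (a + d)
        aux a b d = ≡.trans (≡.sym (ℕₚ.+-assoc a b d)) (≡.trans (cong (_+ d) (ℕₚ.+-comm a b)) (ℕₚ.+-assoc b a d))
      dz : ∀ {z} → z ∈ v ∷ Z → dg (x ∷ u ∷ v ∷ Z) z ≡ 2
      dz (here refl) = ≡.trans (ins v) (cong₂ (λ b d → bit b + d) (flipA e) d₁)
      dz {z} (there q) = ≡.trans (ins z) (cong₂ (λ b d → bit b + d) (flipA (f q)) (d₂ q))

    hit-dg : ∀ u Z → Hit (A x) u Z → dg (u ∷ Z) x ≡ 1
    hit-dg u [] e rewrite dg-∷ u [] x | e = refl
    hit-dg u (v ∷ Z) (e , ht) rewrite dg-∷ u (v ∷ Z) x | e = hit-dg v Z ht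

    module Sk4 {t₁ t₂ t₃ Z₁ Z₂ Z₃} (k : Config t₁ t₂ t₃ Z₁ Z₂ Z₃) (all-in : ∀ {v} → v ∈ H → v ∈ Tri t₁ Z₁ t₂ Z₂ t₃ Z₃) where

      T₁ = Tri t₁ Z₁ t₂ Z₂ t₃ Z₃
      uT : Unique T₁
      uT = Uniqueₚ.++⁺ (ip-unique (proj₁ (a₁ k))) (Uniqueₚ.++⁺ (ip-unique (proj₁ (a₂ k))) (ip-unique (proj₁ (a₃ k))) (λ { (p , q) → join-disj (j₂₃ k) p q }))
            (λ { (p , q) → case ∈-++⁻ (t₂ ∷ Z₂) q of λ { (inj₁ q) → join-disj (j₁₂ k) p q ; (inj₂ q) → join-disj (j₁₃ k) p q } })
      T-H : ∀ {z} → z ∈ T₁ → z ∈ H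
      T-H = arm-H (a₁ k) ⊕ arm-H (a₂ k) ⊕ arm-H (a₃ k)
      perm : W ↭ x ∷ T₁
      perm = W↭ uT T-H all-in

    split-dg : ∀ t₁ Z₁ t₂ Z₂ t₃ Z₃ v → dg (x ∷ Tri t₁ Z₁ t₂ Z₂ t₃ Z₃) v ≡ dg (x ∷ t₁ ∷ Z₁) v + (dg (t₂ ∷ Z₂) v + dg (t₃ ∷ Z₃) v)
    split-dg t₁ Z₁ t₂ Z₂ t₃ Z₃ v = ≡.trans (dg-++ (x ∷ t₁ ∷ Z₁) ((t₂ ∷ Z₂) ++ t₃ ∷ Z₃) v) (cong (dg (x ∷ t₁ ∷ Z₁) v +_) (dg-++ (t₂ ∷ Z₂) (t₃ ∷ Z₃) v))

    first-dg : ∀ {t₁ t₂ t₃ Z₁ Z₂ Z₃} → Config t₁ t₂ t₃ Z₁ Z₂ Z₃ → (∀ {v} → v ∈ H → v ∈ Tri t₁ Z₁ t₂ Z₂ t₃ Z₃) → fX t₁ ≤ 3 × (∀ {z} → z ∈ Z₁ → fX z ≤ 2)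
    first-dg {t₁} {t₂} {t₃} {Z₁} {Z₂} {Z₃} k all-in = fH (top (a₁ k)) (ℕₚ.≤-reflexive dt) , λ z∈ → fH (arm-Z (a₁ k) z∈) (ℕₚ.≤-reflexive (dz z∈))
      where
      open Sk4 k all-in using (perm)
      pd = path-dg Z₁ (proj₁ (a₁ k)) (proj₁ (proj₂ (a₁ k)))
      arm-one : ∀ {t Z} → Join t₁ Z₁ t Z → dg (t ∷ Z) t₁ ≡ 1
      arm-one {t} {Z} (e , _ , g) rewrite dg-∷ t Z t₁ | e = cong suc (dg-none Z t₁ (λ q → proj₁ (g (here refl) q)))
      dt : dg W t₁ ≡ 3
      dt = ≡.trans (dg-↭ perm t₁) (≡.trans (split-dg t₁ Z₁ t₂ Z₂ t₃ Z₃ t₁) (cong₂ _+_ (proj₁ pd) (cong₂ _+_ (arm-one (j₁₂ k)) (arm-one (j₁₃ k)))))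
      dz : ∀ {z} → z ∈ Z₁ → dg W z ≡ 2
      dz {z} z∈ = ≡.trans (dg-↭ perm z) (≡.trans (split-dg t₁ Z₁ t₂ Z₂ t₃ Z₃ z) (cong₂ _+_ (proj₂ pd z∈)
        (cong₂ _+_ (dg-none (t₂ ∷ Z₂) z (λ q → proj₁ (proj₁ (proj₂ (j₁₂ k)) z∈ q))) (dg-none (t₃ ∷ Z₃) z (λ q → proj₁ (proj₁ (proj₂ (j₁₃ k)) z∈ q))))))

    -- With initial segments as lists, `x` and the interiors of the arms use the colours 0 and 1,
    -- and the triangle 0, 1 and 2. Colours alternate along an arm, and the arms have equal parity
    -- by `sk4-signs`, so all three forbid the same colour at the triangle, which is left with two.
    bad-sk4 : ∀ {t₁ t₂ t₃ Z₁ Z₂ Z₃} → Config t₁ t₂ t₃ Z₁ Z₂ Z₃ → (∀ {v} → v ∈ H → v ∈ Tri t₁ Z₁ t₂ Z₂ t₃ Z₃) → Bad fX W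
    bad-sk4 {t₁} {t₂} {t₃} {Z₁} {Z₂} {Z₃} k all-in = bad-upTo bd
      where
      open Sk4 k all-in using (perm)
      k₂ = cfg-rot k
      k₃ = cfg-rot k₂
      in₂′ : ∀ {v} → v ∈ H → v ∈ Tri t₂ Z₂ t₃ Z₃ t₁ Z₁
      in₂′ = tri-rot {t₂} {Z₂} {t₃} {Z₃} {t₁} {Z₁} ∘ tri-rot {t₃} {Z₃} {t₁} {Z₁} {t₂} {Z₂} ∘ all-in
      in₃′ : ∀ {v} → v ∈ H → v ∈ Tri t₃ Z₃ t₁ Z₁ t₂ Z₂
      in₃′ = tri-rot {t₃} {Z₃} {t₁} {Z₁} {t₂} {Z₂} ∘ all-in
      f₁ = first-dg k all-in
      f₂ = first-dg k₂ in₂′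
      f₃ = first-dg k₃ in₃′
      fx : fX x ≤ 2
      fx rewrite h-same x | dg-↭ perm x | split-dg t₁ Z₁ t₂ Z₂ t₃ Z₃ x | dg-∷ x (t₁ ∷ Z₁) x | A-irr x | hit-dg t₁ Z₁ (proj₁ (proj₂ (a₁ k))) | hit-dg t₂ Z₂ (proj₁ (proj₂ (a₂ k))) | hit-dg t₃ Z₃ (proj₁ (proj₂ (a₃ k))) = ℕₚ.≤-refl
      bd : ∀ φ → (∀ {v} → v ∈ W → φ v < fX v) → Proper W φ → ⊥
      -- The forbidden colour and the colours of the triangle would be four different numbers below
      -- 3.
      bd φ lt pr = ℕₚ.<-irrefl refl (distinct₄ (ℕₚ.<-≤-trans (proj₁ (proj₂ d₁)) (ℕₚ.n≤1+n 2)) (tlt (a₁ k) (proj₁ f₁)) (tlt (a₂ k) (proj₁ f₂)) (tlt (a₃ k) (proj₁ f₃))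
           (proj₁ (proj₂ (proj₂ d₁)) ∘ ≡.sym) (λ e → proj₁ (proj₂ (proj₂ d₂)) (≡.trans (≡.sym e) c₁₂)) (λ e → proj₁ (proj₂ (proj₂ d₃)) (≡.trans (≡.sym e) (≡.trans c₁₂ c₂₃)))
           (pr′ (a₁ k) (a₂ k) (proj₁ (j₁₂ k))) (pr′ (a₁ k) (a₃ k) (proj₁ (j₁₃ k))) (pr′ (a₂ k) (a₃ k) (proj₁ (j₂₃ k))))
        where
        tlt : ∀ {t Z} → Arm t Z → fX t ≤ 3 → φ t < 3
        tlt a le = ℕₚ.<-≤-trans (lt (H⊆W (top a))) le
        pr′ : ∀ {s Z t Z′} → Arm s Z → Arm t Z′ → A s t ≡ true → φ s ≢ φ t
        pr′ a b e = pr (H⊆W (top a)) (H⊆W (top b)) e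
        xlt : φ x < 2
        xlt = ℕₚ.<-≤-trans (lt x∈W) fx
        -- the colour forbidden at t by its arm
        forb : ∀ {t} Z → Arm t Z → (∀ {z} → z ∈ Z → fX z ≤ 2) → Σ ℕ λ d → d < 2 × φ t ≢ d × R (sgnT (legT Z) Sign.* Sign.-) d (φ x)
        forb [] a le = φ x , xlt , pr (H⊆W (top a)) x∈W (flipA (arm-hit a)) , refl
        forb {t} (z ∷ zs) a@(cons e _ _ ip , (_ , ht) , i) le = φ z , zlt (here refl) , pr (H⊆W (top a)) (H⊆W (i (there (here refl)))) e ,
            subst (λ s → R s (φ z) (φ x)) (psign-neg Sign.- zs) (chain {x} Sign.+ z zs (zlt (here refl)) (λ { (here refl) → xlt ; (there q) → zlt q }) (λ u∈ v∈ → pr (inW u∈) (inW v∈)) ip end refl)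
          where
          zlt : ∀ {v} → v ∈ z ∷ zs → φ v < 2
          zlt q = ℕₚ.<-≤-trans (lt (H⊆W (i (there q)))) (le q)
          inW : ∀ {v} → v ∈ x ∷ z ∷ zs → v ∈ W
          inW (here refl) = x∈W
          inW (there q) = H⊆W (i (there q))
          end : Σ V λ e → A x e ≡ true × Hit (λ v → does (v ≟ e)) z zs
          end with hit-to-end z zs ht (ip-unique ip)
          ... | e , _ , xe , h′ = e , xe , h′
        d₁ = forb Z₁ (a₁ k) (proj₂ f₁)
        d₂ = forb Z₂ (a₂ k) (proj₂ f₂)
        d₃ = forb Z₃ (a₃ k) (proj₂ f₃)
        c₁₂ : proj₁ d₁ ≡ proj₁ d₂
        c₁₂ = R-det (sgnT (legT Z₂) Sign.* Sign.-) (proj₁ (proj₂ d₁)) (proj₁ (proj₂ d₂)) xlt (subst (λ s → R (s Sign.* Sign.-) (proj₁ d₁) (φ x)) (sk4-signs k) (proj₂ (proj₂ (proj₂ d₁)))) (proj₂ (proj₂ (proj₂ d₂)))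
        c₂₃ : proj₁ d₂ ≡ proj₁ d₃
        c₂₃ = R-det (sgnT (legT Z₃) Sign.* Sign.-) (proj₁ (proj₂ d₂)) (proj₁ (proj₂ d₃)) xlt (subst (λ s → R (s Sign.* Sign.-) (proj₁ d₂) (φ x)) (sk4-signs k₂) (proj₂ (proj₂ (proj₂ d₂)))) (proj₂ (proj₂ (proj₂ d₃)))

    module SevenFacts {t₁ t₂ t₃ q p r} (e7 : Seven t₁ t₂ t₃ q p r) where
      open Seven e7 public
      ip₁ = proj₁ (a₁ k)
      t₁q : A t₁ q ≡ true
      t₁q with ip₁
      ... | cons e _ _ _ = e
      qp : A q p ≡ true
      qp with ip₁
      ... | cons _ _ _ (cons e _ _ _) = e
      t₁p : A t₁ p ≡ false × t₁ ≢ p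
      t₁p = ip-head ip₁ (here refl)
      n₂ = proj₁ (proj₂ (j₁₂ k))
      n₃ = proj₁ (proj₂ (j₁₃ k))
      q₂ = n₂ (here refl) (here refl)
      q₃ = n₃ (here refl) (here refl)
      p₂ = n₂ (there (here refl)) (here refl)
      p₃ = n₃ (there (here refl)) (here refl)
      e₁₂ = proj₁ (j₁₂ k)
      e₁₃ = proj₁ (j₁₃ k)
      e₂₃ = proj₁ (j₂₃ k)
      aq : Arm q (p ∷ [])
      aq = arm-suffix (t₁ ∷ []) refl (a₁ k)
      ap : Arm p []
      ap = arm-suffix (t₁ ∷ q ∷ []) refl (a₁ k)
      r≢ : ∀ {a b} → A r a ≡ false → A b a ≡ true → r ≢ b
      r≢ f e refl = absurdᵇ e f
      vs : Vec V 7
      vs = x ∷ r ∷ t₁ ∷ q ∷ p ∷ t₂ ∷ t₃ ∷ []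
      rows : Rows 7
      rows = (true ∷ false ∷ false ∷ true ∷ true ∷ true ∷ []) , (false ∷ true ∷ true ∷ false ∷ false ∷ []) , (true ∷ false ∷ true ∷ true ∷ []) ,
             (true ∷ false ∷ false ∷ []) , (false ∷ false ∷ []) , (true ∷ []) , [] , tt
      facts : Facts vs rows
      facts = (xr , arm-hit (a₁ k) , arm-hit aq , arm-hit ap , arm-hit (a₂ k) , arm-hit (a₃ k) , tt) , (rt₁ , rq , rp , rt₂ , rt₃ , tt) , (t₁q , proj₁ t₁p , e₁₂ , e₁₃ , tt) ,
              (qp , proj₁ q₂ , proj₁ q₃ , tt) , (proj₁ p₂ , proj₁ p₃ , tt) , (e₂₃ , tt) , tt , tt
      uT : Unique (r ∷ Tri t₁ (q ∷ p ∷ []) t₂ [] t₃ [])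
      uT = (r≢ rt₂ e₁₂ ∷ A-≢ rq ∷ A-≢ rp ∷ r≢ rt₁ (flipA e₁₂) ∷ r≢ rt₁ (flipA e₁₃) ∷ []) ∷ (A-≢ t₁q ∷ proj₂ t₁p ∷ A-≢ e₁₂ ∷ A-≢ e₁₃ ∷ []) ∷
           (A-≢ qp ∷ proj₂ q₂ ∷ proj₂ q₃ ∷ []) ∷ (proj₂ p₂ ∷ proj₂ p₃ ∷ []) ∷ (A-≢ e₂₃ ∷ []) ∷ [] ∷ []
      T-H : ∀ {z} → z ∈ r ∷ Tri t₁ (q ∷ p ∷ []) t₂ [] t₃ [] → z ∈ H
      T-H = r∈ ⊙ arm-H (a₁ k) (here refl) ⊙ arm-H (a₁ k) (there (here refl)) ⊙ arm-H (a₁ k) (there (there (here refl))) ⊙ top (a₂ k) ⊙ top (a₃ k) ⊙ ⊆[]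

    -- The graph is the Moser spindle, which is not 3-colourable, and all lists are subsets of {0,
    -- 1, 2}. Two triangles on the edge between `p` and `r` force `q` to have the colour of `x`;
    -- likewise for `t₁`; but `q` and `t₁` are adjacent.
    bad-seven : ∀ {t₁ t₂ t₃ q p r} → Seven t₁ t₂ t₃ q p r → (∀ {v} → v ∈ H → v ∈ r ∷ Tri t₁ (q ∷ p ∷ []) t₂ [] t₃ []) → Bad fX W
    bad-seven {t₁} {t₂} {t₃} {q} {p} {r} e7 all-in = bad-upTo bd
      where
      open SevenFacts e7
      perm : W ↭ Vec.toList vs
      perm = W↭ uT T-H all-in
      uV : Unique (Vec.toList vs)
      uV = unique-↭ perm uW
      dgs : ∀ i → dg W (lookup vs i) ≡ degE (smallE rows) i
      dgs i = ≡.trans (dg-↭ perm (lookup vs i)) (small-dg vs rows uV facts i)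
      bd : ∀ φ → (∀ {v} → v ∈ W → φ v < fX v) → Proper W φ → ⊥
      bd φ lt pr = pr (inW 3F) (inW 2F) (flipA t₁q) (≡.trans (sameColour 3F 4F 1F xp xr qp (flipA rq) (flipA rp)) (≡.sym (sameColour 2F 5F 6F xt₂ xt₃ e₁₂ e₁₃ e₂₃)))
        where
        inW : ∀ i → lookup vs i ∈ W
        inW i = ↭ₚ.∈-resp-↭ (↭-sym perm) (lookup-∈ vs i)
        xp = arm-hit ap
        xt₂ = arm-hit (a₂ k)
        xt₃ = arm-hit (a₃ k)
        l3 : ∀ i → φ (lookup vs i) < 3
        l3 0F = ℕₚ.<-≤-trans (lt x∈W) (ℕₚ.≤-reflexive (cong₂ _∸_ (dgs 0F) (h-same x)))
        l3 (suc i) = ℕₚ.<-≤-trans (lt (inW (suc i))) (fH (T-H (lookup-∈ (r ∷ t₁ ∷ q ∷ p ∷ t₂ ∷ t₃ ∷ []) i)) (ℕₚ.≤-reflexive (≡.trans (dgs (suc i)) (three i))))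
          where
          three : ∀ i → degE (smallE rows) (suc i) ≡ 3
          three 0F = refl
          three 1F = refl
          three 2F = refl
          three 3F = refl
          three 4F = refl
          three 5F = refl
        sameColour : ∀ i j l → A x (lookup vs j) ≡ true → A x (lookup vs l) ≡ true → A (lookup vs i) (lookup vs j) ≡ true → A (lookup vs i) (lookup vs l) ≡ true → A (lookup vs j) (lookup vs l) ≡ true → φ (lookup vs i) ≡ φ x
        sameColour i j l xj xl ij il jl with φ (lookup vs i) ℕₚ.≟ φ x
        ... | yes e = e
        ... | no ne = ⊥-elim (ℕₚ.<-irrefl refl (distinct₄ (l3 i) (l3 0F) (l3 j) (l3 l) ne (pr (inW i) (inW j) ij) (pr (inW i) (inW l) il) (pr x∈W (inW j) xj) (pr x∈W (inW l) xl) (pr (inW j) (inW l) jl)))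

    bad-core : 3 ≤ dg H x → Bad fX W
    bad-core d3 with shape d3
    ... | clique cl = bad-clique x∈W uW (λ {v} _ → ℕₚ.m∸n≤m (dg W v) (h x v)) cl
    ... | sk4 k i = bad-sk4 k i
    ... | seven e i = bad-seven e i

    -- With the weaker degree condition only cliques survive: the other shapes contain a theta graph.
    module Degree (na₀ : NonAT zero-h W) where

      kill₀ : ∀ {U u₀} → Unique U → u₀ ∈ U → (∀ {v} → v ∈ U → v ∈ W) → ATe zero-h U (E U) → ⊥
      kill₀ uU u₀∈ i = NonAT-sub con uW uU u₀∈ i (λ _ _ → refl) na₀

      theta₀ : ∀ {t₁ t₂ t₃ Z₂ Z₃} → t₁ ∈ H → Arm t₂ Z₂ → Arm t₃ Z₃ → A t₂ t₁ ≡ true → A t₃ t₁ ≡ true → Join t₂ Z₂ t₃ Z₃ → A x t₁ ≡ false → NA Z₂ (t₁ ∷ []) → NA Z₃ (t₁ ∷ []) → ⊥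
      theta₀ {t₁} {t₂} {t₃} {Z₂} {Z₃} t₁∈ b₂ b₃ e₂ e₃ j xt n₂ n₃ = kill₀ (build-unique (toBuild bld) uV) (build-⊇ (toBuild bld) (here refl))
          (H⊆W ∘ arm-Z b₂ ⊕ H⊆W ∘ arm-Z b₃ ⊕ H⊆W (top b₂) ⊙ H⊆W (top b₃) ⊙ H⊆W t₁∈ ⊙ x∈W ⊙ ⊆[])
          (build-AT (toBuild bld) uV (small-AT vs (skR (legT Z₂) (legT Z₃)) (legE 0F (legT Z₂) 3F ++ legE 1F (legT Z₃) 3F ++ []) (1 ∷ 2 ∷ 1 ∷ 1 ∷ []) uV
            ((proj₁ j , e₂ , flipA (arm-hit b₂) , tt) , (e₃ , flipA (arm-hit b₃) , tt) , (flipA xt , tt) , tt , tt) (λ _ → z≤n) (sk-ok (legT Z₂ ∷ legT Z₃ ∷ []))))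
        where
        vs : Vec V 4
        vs = t₂ ∷ t₃ ∷ t₁ ∷ x ∷ []
        uV : Unique (Vec.toList vs)
        uV = (A-≢ (proj₁ j) ∷ A-≢ e₂ ∷ H-≢ (top b₂) ∷ []) ∷ (A-≢ e₃ ∷ H-≢ (top b₃) ∷ []) ∷ (H-≢ t₁∈ ∷ []) ∷ [] ∷ []
        bld : Bld zero-h vs (Z₂ ++ Z₃ ++ Vec.toList vs) (legE 0F (legT Z₂) 3F ++ legE 1F (legT Z₃) 3F ++ [])
        bld = leg 0F Z₂ 3F (H-≢ (top b₂)) (arm-leg b₂) (off-++ (join-NA j) (off-src (off-∷ (join-NAₜ j) (off-∷ n₂ (off-tgt off-[]))))) (λ _ → refl)
             (leg 1F Z₃ 3F (H-≢ (top b₃)) (arm-leg b₃) (off-∷ (join-NAₜ (join-sym j)) (off-src (off-∷ n₃ (off-tgt off-[])))) (λ _ → refl) base)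

      bad-degree : 3 ≤ dg H x → Bad (dg W) W
      bad-degree d3 with shape d3
      ... | clique cl = bad-clique x∈W uW (λ _ → ℕₚ.≤-refl) cl
      ... | sk4 k _ = ⊥-elim (theta₀ (top (a₁ k)) (a₂ k) (a₃ k) (flipA (proj₁ (j₁₂ k))) (flipA (proj₁ (j₁₃ k))) (j₂₃ k) (arm-hit (a₁ k)) (join-NAₜ (join-sym (j₁₂ k))) (join-NAₜ (join-sym (j₁₃ k))))
      ... | seven e7 _ = ⊥-elim (theta₀ (top aq) ap (one , xr , λ { (here refl) → r∈ }) (flipA qp) rq (flipA rp , (λ ()) , λ _ ()) (arm-hit aq) (λ ()) (λ ()))
        where open SevenFacts e7

  -- The degree version: lists of size d(v) at every vertex.

  dg-─ : ∀ {W x} → Unique W → x ∈ W → ∀ v → dg W v ≡ bit (A v x) + dg (W ─ (x ∷ [])) v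
  dg-─ {W} {x} uW x∈ v = ≡.trans (dg-↭ (↭-trans (split-↭ uW ([] ∷ []) (λ { (here refl) → x∈ })) (↭ₚ.++-comm (W ─ (x ∷ [])) (x ∷ []))) v) (dg-∷ x (W ─ (x ∷ [])) v)

  dg-self : ∀ {W x} → Unique W → x ∈ W → dg (W ─ (x ∷ [])) x ≡ dg W x
  dg-self {W} {x} uW x∈ = ≡.sym (≡.trans (dg-─ uW x∈ x) (cong (λ b → bit b + dg (W ─ (x ∷ [])) x) (A-irr x)))

  -- The cycle contracts to two parallel edges, both negative because its length is even. In (x_a -
  -- x_x)(x_x - x_a) the monomial x_a x_x has coefficient 2.
  even-cycle : ∀ {x a y ys} → x ≢ a → A x a ≡ true → Leg a (y ∷ ys) x → psign Sign.- ys ≡ Sign.- → Σ (List V) λ U → Unique U × x ∈ U × (∀ {z} → z ∈ U → z ∈ x ∷ a ∷ y ∷ ys) × ATe zero-h U (E U)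
  even-cycle {x} {a} {y} {ys} x≢a xa lg s = (y ∷ ys) ++ x ∷ a ∷ [] , build-unique (toBuild bld) u , build-⊇ (toBuild bld) (here refl) ,
      (λ z∈ → case ∈-++⁻ (y ∷ ys) z∈ of λ { (inj₁ q) → there (there q) ; (inj₂ (here e)) → here e ; (inj₂ (there (here e))) → there (here e) }) ,
      build-AT (toBuild bld) u (subst (λ t → ATe zero-h (x ∷ a ∷ []) (ed a x t ∷ E (x ∷ a ∷ []))) (≡.sym s)
        (subst (λ l → ATe zero-h (x ∷ a ∷ []) (ed a x Sign.- ∷ l)) (≡.sym (small-edges vs rows ((xa , tt) , tt , tt)))
          (ATe-ι (lookup vs) (lookup-inj vs u) (ed 1F 0F Sign.- ∷ smallE rows) (1 ∷ 1 ∷ []) (λ { 0F → ℕₚ.≤-refl ; 1F → ℕₚ.≤-refl }) (λ ()))))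
    where
    vs : Vec V 2
    vs = x ∷ a ∷ []
    rows : Rows 2
    rows = (true ∷ []) , [] , tt
    u : Unique (x ∷ a ∷ [])
    u = (x≢a ∷ []) ∷ [] ∷ []
    bld : Bld zero-h vs ((y ∷ ys) ++ x ∷ a ∷ []) (ed 1F 0F (psign Sign.- ys) ∷ [])
    bld = leg 1F (y ∷ ys) 0F (x≢a ∘ ≡.sym) lg (off-tgt (off-src off-[])) (λ _ → refl) base

  -- At a vertex of degree 0 the list is empty, and a vertex of degree 1 leaves only a K₂, since
  -- there is no cut vertex. Otherwise an induced cycle passes through `x`; it is odd by
  -- `even-cycle`, and at most the colours 0 and 1 are available on it.
  low-degree : ∀ {W x} → Unique W → x ∈ W → Conn W → (∀ {p} → p ∈ W → Conn (W ─ (p ∷ []))) → NonAT zero-h W → (∀ {v} → v ∈ W → dg W v ≤ 2) → Bad (dg W) W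
  low-degree {W} {x} uW x∈ con noCut na le2 = go (filterᵇ (A x) W) refl
    where
    go : ∀ ns → filterᵇ (A x) W ≡ ns → Bad (dg W) W
    go [] eq = bad-trivial x∈ (cong length eq)
    go (a ∷ []) eq = bad-upTo bd
      where
      nb : ∀ {z} → z ∈ W → A x z ≡ true → z ≡ a
      nb {z} z∈ e with subst (z ∈_) eq (in-filter z∈ e)
        where
        in-filter : ∀ {L z} → z ∈ L → A x z ≡ true → z ∈ filterᵇ (A x) L
        in-filter {_ ∷ L} (here refl) e rewrite filterᵇ-true (A x) {xs = L} e = here refl
        in-filter {y ∷ L} (there q) e with A x y
        ... | true = there (in-filter q e)
        ... | false = in-filter q e
      ... | here e′ = e′
      a∈ : a ∈ W × A x a ≡ true
      a∈ = ∈-filterᵇ⁻ (A x) {W} (subst (a ∈_) (≡.sym eq) (here refl))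
      only : ∀ {z} → z ∈ W → z ≡ x ⊎ z ≡ a
      only {z} z∈ with z ≟ x | z ≟ a
      ... | yes e | _ = inj₁ e
      ... | _ | yes e = inj₂ e
      ... | no z≢x | no z≢a with crossing (λ v → does (v ≟ x)) (noCut (proj₁ a∈) (∈-─⁺ x∈ λ { (here e) → A-≢ (proj₂ a∈) e }) (∈-─⁺ z∈ λ { (here e) → z≢a e })) xx zx
        where
        xx : does (x ≟ x) ≡ true
        xx with x ≟ x
        ... | yes _ = refl
        ... | no ne = ⊥-elim (ne refl)
        zx : does (z ≟ x) ≡ false
        zx with z ≟ x
        ... | yes e = ⊥-elim (z≢x e)
        ... | no _ = refl
      ...   | u , v , u∈ , v∈ , ux , _ , uv with u ≟ x
      ...     | yes refl = ⊥-elim (proj₂ (∈-─⁻ {W} {a ∷ []} v∈) (here (nb (proj₁ (∈-─⁻ {W} {a ∷ []} v∈)) uv)))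
      len2 : length W ≤ 2
      len2 = unique-⊆ {W} {x ∷ a ∷ []} uW ((A-≢ (proj₂ a∈) ∷ []) ∷ [] ∷ []) (λ z∈ → case only z∈ of λ { (inj₁ e) → here e ; (inj₂ e) → there (here e) })
      bd : ∀ φ → (∀ {v} → v ∈ W → φ v < dg W v) → Proper W φ → ⊥
      bd φ lt pr = pr x∈ (proj₁ a∈) (proj₂ a∈) (≡.trans (z0 x∈) (≡.sym (z0 (proj₁ a∈))))
        where
        z0 : ∀ {v} → v ∈ W → φ v ≡ 0
        z0 v∈ = ℕₚ.n<1⇒n≡0 (ℕₚ.<-≤-trans (lt v∈) (ℕₚ.≤-pred (ℕₚ.<-≤-trans (dg-< v∈) len2)))
    go (a ∷ b ∷ ns) eq with hit-walk g (noCut x∈ (∈-─⁺ (proj₁ a∈) λ { (here e) → A-≢ (proj₂ a∈) (≡.sym e) }) (∈-─⁺ (proj₁ b∈) λ { (here e) → A-≢ (proj₂ b∈) (≡.sym e) })) gb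
      where
      a∈ : a ∈ W × A x a ≡ true
      a∈ = ∈-filterᵇ⁻ (A x) {W} (subst (a ∈_) (≡.sym eq) (here refl))
      b∈ : b ∈ W × A x b ≡ true
      b∈ = ∈-filterᵇ⁻ (A x) {W} (subst (b ∈_) (≡.sym eq) (there (here refl)))
      g : V → Bool
      g z = A x z ∧ not (does (z ≟ a))
      b≢a : b ≢ a
      b≢a e = unique-head (subst Unique eq (Uniqueₚ.filter⁺ (T? ∘ A x) uW)) (here (≡.sym e))
      gb : g b ≡ true
      gb rewrite proj₂ b∈ with b ≟ a
      ... | yes e = ⊥-elim (b≢a e)
      ... | no _ = refl
    ... | [] , ip , ht , i = ⊥-elim (no-a ht)
      where
      no-a : A x a ∧ not (does (a ≟ a)) ≡ true → ⊥
      no-a e with A x a | a ≟ a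
      no-a () | false | _
      no-a () | true | yes _
      ... | true | no ne = ne refl
    ... | y ∷ ys , ip@(cons ay _ _ ipy) , (_ , ht) , i = fin (psign Sign.- ys) refl
      where
      inW : ∀ {z} → z ∈ a ∷ y ∷ ys → z ∈ W
      inW q = proj₁ (∈-─⁻ {W} {x ∷ []} (i q))
      x∉ : x ∉ a ∷ y ∷ ys
      x∉ q = proj₂ (∈-─⁻ {W} {x ∷ []} (i q)) (here refl)
      xa : A x a ≡ true
      xa = proj₂ (∈-filterᵇ⁻ (A x) {W} (subst (a ∈_) (≡.sym eq) (here refl)))
      ht′ : Hit (A x) y ys
      ht′ = hit-cong y ys (λ {z} z∈ → aux z (λ { refl → unique-head (ip-unique ip) z∈ })) ht
        where
        aux : ∀ z → z ≢ a → A x z ∧ not (does (z ≟ a)) ≡ A x z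
        aux z ne with A x z | z ≟ a
        ... | false | _ = refl
        ... | true | yes e = ⊥-elim (ne e)
        ... | true | no _ = refl
      fin : ∀ s → psign Sign.- ys ≡ s → Bad (dg W) W
      fin Sign.- s = let U , uU , x∈U , U⊆ , at = even-cycle (A-≢ xa) xa (ip , ht′ , x∉) s in
        ⊥-elim (NonAT-sub con uW uU x∈U (λ z∈ → case U⊆ z∈ of λ { (here refl) → x∈ ; (there q) → inW q }) (λ _ _ → refl) na at)
      fin Sign.+ s = bad-upTo λ φ lt pr →
        let l2 : ∀ {v} → v ∈ W → φ v < 2
            l2 v∈ = ℕₚ.<-≤-trans (lt v∈) (le2 v∈)
            in′ : ∀ {v} → v ∈ x ∷ y ∷ ys → v ∈ W
            in′ = λ { (here refl) → x∈ ; (there q) → inW (there q) }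
            e , _ , xe , h′ = hit-to-end y ys ht′ (ip-unique ipy)
        in pr (inW (here refl)) x∈ (flipA xa) (subst (λ t → R t (φ a) (φ x)) s
             (chain {x} Sign.- y ys (l2 (inW (here refl))) (λ q → l2 (in′ q)) (λ u∈ v∈ → pr (in′ u∈) (in′ v∈)) ipy (e , xe , h′) (pr (inW (here refl)) (inW (there (here refl))) ay)))

  high? : ∀ W → (Σ V λ x → x ∈ W × 3 ≤ dg W x) ⊎ (∀ {v} → v ∈ W → dg W v ≤ 2)
  high? W with firstIn (λ v → 3 ≤ᵇ dg W v) W
  ... | some M x _ eq e _ = inj₁ (x , subst (x ∈_) (≡.sym eq) (∈-++⁺ʳ M (here refl)) , ℕₚ.≤ᵇ⇒≤ 3 (dg W x) (subst T (≡.sym e) _))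
  ... | none f = inj₂ λ {v} v∈ → ℕₚ.≤-pred (ℕₚ.≰⇒> λ le → absurdᵇ (Tt (ℕₚ.≤⇒≤ᵇ le)) (f v∈))

  -- Induction over cut vertices, at which the degrees add up. Without a cut vertex, any vertex of
  -- degree at least 3 can serve as `x` in the classification, because the bound with `h x` is
  -- stronger than the one assumed.
  degree-bad : ∀ k {W x} → length W ≡ k → Unique W → x ∈ W → Conn W → NonAT zero-h W → Bad (dg W) W
  degree-bad = <-rec _ step′
    where
    step′ : ∀ k → (∀ {k′} → k′ < k → ∀ {W x} → length W ≡ k′ → Unique W → x ∈ W → Conn W → NonAT zero-h W → Bad (dg W) W) →
      ∀ {W x} → length W ≡ k → Unique W → x ∈ W → Conn W → NonAT zero-h W → Bad (dg W) W
    step′ k rec {W} {x₀} refl uW x₀∈ con na with cuts? uW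
    ... | inj₂ (p , p∈ , cut) = C.glueCut
          (rec C.smallC refl C.uPC (here refl) C.conC (NonAT-sub con uW C.uPC (here refl) C.inC (λ _ _ → refl) na))
          (rec C′.smallC refl C.uPD (here refl) C′.conC (NonAT-sub con uW C.uPD (here refl) C.inD (λ _ _ → refl) na)) C.dgC C.dgD C.dgP
      where
      module C = CutFacts uW con cut
      module C′ = CutFacts uW con (cut-swap cut)
    ... | inj₁ noCut with high? W
    ...   | inj₂ le2 = low-degree uW x₀∈ con noCut na le2
    ...   | inj₁ (x , x∈ , d3) = Core₇.Degree.bad-degree S na (subst (3 ≤_) (≡.sym (dg-self uW x∈)) d3)
      where
      S : Setting W x
      S = record { uW = uW ; x∈W = x∈ ; con = con ; noCut = noCut ; na = NonAT-mono {zero-h} {h x} (λ _ → z≤n) na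
                 ; d2 = ℕₚ.≤-trans (ℕₚ.n≤1+n 2) (subst (3 ≤_) (≡.sym (dg-self uW x∈)) d3) }

  -- Bad lists for the pair, by induction over cut vertices.

  NonAT-zero : ∀ {x W} → x ∉ W → NonAT (h x) W → NonAT zero-h W
  NonAT-zero {x} x∉ = NonAT-mono {h x} {zero-h} (λ v∈ → ℕₚ.≤-reflexive (h-other (λ { refl → x∉ v∈ })))

  -- Used to ask whether a side of the cut vertex `x` is AT without deciding it.
  ¬¬-em : ∀ {X : Set} → ¬ ¬ (X ⊎ ¬ X)
  ¬¬-em k = k (inj₂ (k ∘ inj₁))

  PairBad : List V → V → Set
  PairBad W x = Bad (λ v → dg W v ∸ h x v) W

  module Pair {W x} (uW : Unique W) (x∈ : x ∈ W) (con : Conn W) (na : NonAT (h x) W)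
    (rec : ∀ {U} → length U < length W → Unique U → x ∈ U → Conn U → NonAT (h x) U → ¬ ¬ PairBad U x) where

    sub : ∀ {U} → Unique U → x ∈ U → (∀ {v} → v ∈ U → v ∈ W) → NonAT (h x) U
    sub uU x∈U i = NonAT-sub con uW uU x∈U i (λ _ v∉ → h-other (λ { refl → v∉ x∈U })) na

    x∷H : W ↭ x ∷ (W ─ (x ∷ []))
    x∷H = ↭-trans (split-↭ uW ([] ∷ []) (λ { (here refl) → x∈ })) (↭ₚ.++-comm (W ─ (x ∷ [])) (x ∷ []))

    naH : 2 ≤ dg W x → NonAT (h x) (W ─ (x ∷ []))
    naH d2 = NonAT-tail (λ q → proj₂ (∈-─⁻ {W} {x ∷ []} q) (here refl)) (≡.subst₂ _<_ (≡.sym (h-same x)) (≡.sym (dg-self uW x∈)) d2) (NonAT-↭ {h x} x∷H na)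

    ≡ᵇ-self : ∀ (v : V) → does (v ≟ v) ≡ true
    ≡ᵇ-self v with v ≟ v
    ... | yes _ = refl
    ... | no ne = ⊥-elim (ne refl)

    pos : ∀ {X z} → z ∈ X → z ≢ x → Conn (x ∷ X) → 0 < dg (x ∷ X) x
    pos {X} {z} z∈ z≢x co with crossing (λ v → does (v ≟ x)) (co (here refl) (there z∈)) (≡ᵇ-self x) zx
      where
      zx : does (z ≟ x) ≡ false
      zx with z ≟ x
      ... | yes e = ⊥-elim (z≢x e)
      ... | no _ = refl
    ... | u , v , u∈ , v∈ , ux , _ , uv with u ≟ x
    ...   | yes refl = dg-pos v∈ uv

    -- By `wedge-AT` one side is not AT even without the extra condition at `x`. That side takes
    -- lists of size `dg`, the other one bad lists for the pair. The sizes at `x` add up to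
    -- `dg W x ∸ 1`, where truncated subtraction is harmless as each side contains a neighbour of
    -- `x`.
    x-cut : Cut W x → ¬ ¬ PairBad W x
    x-cut cut ¬b = ¬¬-em λ
        { (inj₂ nC) → rec C′.smallC C.uPD (here refl) C′.conC (sub C.uPD (here refl) C.inD) λ bD → ¬b (C.glueCut (degree-bad _ refl C.uPC (here refl) C.conC nC) bD
             (λ {v} v∈ → cong₂ _∸_ (C.dgC v∈) (h-other {x} {v} (λ { refl → C.p∉C v∈ }))) (λ {v} v∈ → cong (_∸ h x v) (C.dgD v∈))
             (≡.trans (cong (_∸ h x x) C.dgP) (ℕₚ.+-∸-assoc (dg (x ∷ C.C) x) (one≤ (pos C.d₀∈ (λ { refl → C.p∉D C.d₀∈ }) C′.conC)))))
        ; (inj₁ atC) → rec C.smallC C.uPC (here refl) C.conC (sub C.uPC (here refl) C.inC) λ bC → ¬b (C.glueCut bC (degree-bad _ refl C.uPD (here refl) C′.conC (nD atC))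
             (λ {v} v∈ → cong (_∸ h x v) (C.dgC v∈)) (λ {v} v∈ → cong₂ _∸_ (C.dgD v∈) (h-other {x} {v} (λ { refl → C.p∉D v∈ })))
             (≡.trans (cong (_∸ h x x) C.dgP) (∸-left (dg (x ∷ C.C) x) (dg (x ∷ C.D) x) (one≤ (pos C.c₀∈ (λ { refl → C.p∉C C.c₀∈ }) C.conC))))) }
      where
      module C = CutFacts uW con cut
      module C′ = CutFacts uW con (cut-swap cut)
      nD : ATe zero-h (x ∷ C.C) (E (x ∷ C.C)) → NonAT zero-h (x ∷ C.D)
      nD atC atD = NonAT-↭ {h x} C.perm na (wedge-AT C.apart C.p∉C C.p∉D atC atD)
      one≤ : ∀ {m} → 0 < m → h x x ≤ m
      one≤ p = subst (_≤ _) (≡.sym (h-same x)) p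
      ∸-left : ∀ m l → h x x ≤ m → (m + l) ∸ h x x ≡ (m ∸ h x x) + l
      ∸-left m l le = ≡.trans (cong (_∸ h x x) (ℕₚ.+-comm m l)) (≡.trans (ℕₚ.+-∸-assoc l le) (ℕₚ.+-comm l _))

    -- The side without `x` lies in `W` minus `x`, which is connected and not AT, so the degree
    -- version applies to it. Only the side of `x` keeps the shortened list.
    side-cut : ∀ {p} (cut : Cut W p) → p ≢ x → x ∈ Cut.C cut → 2 ≤ dg W x → Conn (W ─ (x ∷ [])) → ¬ ¬ PairBad W x
    side-cut {p} cut p≢x x∈C d2 conH ¬b = rec C.smallC C.uPC (there x∈C) C.conC (sub C.uPC (there x∈C) C.inC) λ bC → ¬b (C.glueCut bC
        (degree-bad _ refl C.uPD (here refl) C′.conC nD)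
        (λ {v} v∈ → cong (_∸ h x v) (C.dgC v∈)) (λ {v} v∈ → cong₂ _∸_ (C.dgD v∈) (h-other {x} {v} (λ { refl → C.disCD x∈C v∈ })))
        (≡.trans (cong₂ _∸_ C.dgP hp) (≡.sym (cong (λ k → (dg (p ∷ C.C) p ∸ k) + dg (p ∷ C.D) p) hp))))
      where
      module C = CutFacts uW con cut
      module C′ = CutFacts uW con (cut-swap cut)
      hp : h x p ≡ 0
      hp = h-other p≢x
      x∉D : x ∉ p ∷ C.D
      x∉D (here e) = p≢x (≡.sym e)
      x∉D (there q) = C.disCD x∈C q
      nD : NonAT zero-h (p ∷ C.D)
      nD = NonAT-zero x∉D (NonAT-sub conH (Unique-─ (x ∷ []) uW) C.uPD (here refl) (λ v∈ → ∈-─⁺ (C.inD v∈) λ { (here refl) → x∉D v∈ })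
             (λ v∈ _ → h-other (λ { refl → proj₂ (∈-─⁻ {W} {x ∷ []} v∈) (here refl) })) (naH d2))

    -- The list of `x` has a single colour, which costs each neighbour one colour and leaves the
    -- rest with exactly its own degrees.
    cone : dg W x ≡ 2 → Conn (W ─ (x ∷ [])) → PairBad W x
    cone d2 conH = bad-cone x∈ x∉H (λ {v} v∈ → case v ≟ x of λ { (yes e) → inj₁ e ; (no ne) → inj₂ (∈-─⁺ v∈ λ { (here e) → ne e }) }) (λ v∈ → proj₁ (∈-─⁻ {W} {x ∷ []} v∈))
        (degree-bad _ refl (Unique-─ (x ∷ []) uW) (proj₁ (proj₂ someN)) conH (NonAT-zero x∉H (naH (ℕₚ.≤-reflexive (≡.sym d2)))))
        (cong₂ _∸_ d2 (h-same x))
        (λ {v} v∈ → ≡.trans (cong₂ _∸_ (dg-─ uW x∈ v) (h-other {x} {v} (λ { refl → x∉H v∈ }))) (cong (λ b → bit b + dg (W ─ (x ∷ [])) v) (A-sym v x)))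
      where
      x∉H : x ∉ W ─ (x ∷ [])
      x∉H q = proj₂ (∈-─⁻ {W} {x ∷ []} q) (here refl)
      someN : Σ V λ a → a ∈ W ─ (x ∷ []) × A x a ≡ true
      someN = adj-of (W ─ (x ∷ [])) (subst (0 <_) (≡.sym (≡.trans (dg-self uW x∈) d2)) (s≤s z≤n))
        where
        adj-of : ∀ X → 0 < dg X x → Σ V λ a → a ∈ X × A x a ≡ true
        adj-of (a ∷ X) p with A x a in e
        ... | true = a , here refl , e
        ... | false = let b , q , r = adj-of X p in b , there q , r

    pair-step : ¬ ¬ PairBad W x
    pair-step ¬b with 2 ℕₚ.≤? dg W x
    -- The list of `x` is empty; for degree 0 this is the effect of truncated subtraction.
    ... | no lo = ¬b (bad-trivial x∈ (≡.trans (cong (dg W x ∸_) (h-same x)) (ℕₚ.m≤n⇒m∸n≡0 (ℕₚ.≤-pred (ℕₚ.≰⇒> lo)))))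
    ... | yes d2 with cut? uW x∈
    ...   | inj₂ cut = x-cut cut ¬b
    ...   | inj₁ conH with cuts? uW
    ...     | inj₂ (p , _ , cut) = at (p ≟ x) cut
      where
      at : Dec (p ≡ x) → Cut W p → ⊥
      at (yes refl) cut = x-cut cut ¬b
      at (no p≢x) cut with CutFacts.to uW con cut x∈
      ... | here e = p≢x (≡.sym e)
      ... | there q with ∈-++⁻ (Cut.C cut) q
      ...   | inj₁ r = side-cut cut p≢x r d2 conH ¬b
      ...   | inj₂ r = side-cut (cut-swap cut) p≢x r d2 conH ¬b
    ...     | inj₁ noCut with 3 ℕₚ.≤? dg W x
    ...       | yes d3 = ¬b (Core₇.bad-core record { uW = uW ; x∈W = x∈ ; con = con ; noCut = noCut ; na = na ; d2 = subst (2 ≤_) (≡.sym (dg-self uW x∈)) d2 } (subst (3 ≤_) (≡.sym (dg-self uW x∈)) d3))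
    ...       | no lo = ¬b (cone (ℕₚ.≤-antisym (ℕₚ.≤-pred (ℕₚ.≰⇒> lo)) d2) conH)

  pair-bad : ∀ k {W x} → length W ≡ k → Unique W → x ∈ W → Conn W → NonAT (h x) W → ¬ ¬ PairBad W x
  pair-bad = <-rec _ λ { k rec refl uW x∈ con na → Pair.pair-step uW x∈ con na (λ lt → rec lt refl) }

  -- AT pairs are paintable.

  sumF-≤ : ∀ {N} {f g : Fin N → ℕ} → (∀ v → f v ≤ g v) → sumF f ≤ sumF g
  sumF-≤ {zero} le = z≤n
  sumF-≤ {suc N} le = ℕₚ.+-mono-≤ (le zero) (sumF-≤ (le ∘ suc))

  sumF-< : ∀ {N} {f g : Fin N → ℕ} v → (∀ u → f u ≤ g u) → f v < g v → sumF f < sumF g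
  sumF-< zero le lt = ℕₚ.+-mono-<-≤ lt (sumF-≤ (le ∘ suc))
  sumF-< (suc v) le lt = ℕₚ.+-mono-≤-< (le zero) (sumF-< v (le ∘ suc) lt)

  c-cong-off : ∀ (es : List (SEdge (n G))) {w w′} → (∀ v → (∀ k → w v k ≡ w′ v k) ⊎ (Fresh v es × w v 0 ≡ w′ v 0)) → c es w ≡ c es w′
  c-cong-off [] e = prodF-cong λ v → case e v of λ { (inj₁ f) → f 0 ; (inj₂ (_ , q)) → q }
  c-cong-off (ed a b s ∷ es) {w} {w′} e = cong₂ (λ p q → p ℤ.+ sg s ℤ.* q) (go a (λ { (inj₁ ()) ; (inj₂ r) → proj₁ r }) ) (go b λ { (inj₁ ()) ; (inj₂ r) → proj₂ r })
    where
    go : ∀ u → (∀ {v} → ⊥ ⊎ (a ≢ v × b ≢ v) → u ≢ v) → c es (sh u w) ≡ c es (sh u w′)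
    go u ne = c-cong-off es λ v → case e v of λ
      { (inj₁ f) → inj₁ λ k → f _
      ; (inj₂ (r ∷ fr , q)) → inj₂ (fr , ≡.trans (cong (w v) (bump-≢ 0 (ne (inj₂ r)))) (≡.trans q (cong (w′ v) (≡.sym (bump-≢ 0 (ne (inj₂ r))))))) }

  -- Constant weight 1 means substituting 1 for the variable. Doing so at both ends of an edge
  -- annihilates the factor x_u - x_v.
  ones-edge : ∀ (es : List (SEdge (n G))) {w u v} → ed u v Sign.- ∈ es → (∀ k → w u k ≡ 1ℤ) → (∀ k → w v k ≡ 1ℤ) → c es w ≡ 0ℤ
  ones-edge (ed a b s ∷ es) {w} (here refl) wu wv = ≡.trans (cong₂ (λ p q → p ℤ.+ -1ℤ ℤ.* q) (c-cong es (flat a wu)) (c-cong es (flat b wv))) (cancel (c es w))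
    where
    flat : ∀ z → (∀ k → w z k ≡ 1ℤ) → sh z w ≗₂ w
    flat z e v k with z ≟ v
    ... | yes refl = ≡.trans (e (suc k)) (≡.sym (e k))
    ... | no _ = refl
    cancel : ∀ p → p ℤ.+ -1ℤ ℤ.* p ≡ 0ℤ
    cancel = solve-∀
  ones-edge (ed a b s ∷ es) (there q) wu wv = sum-zero s (ones-edge es q (λ k → wu _) (λ k → wv _)) (ones-edge es q (λ k → wu _) (λ k → wv _))

  edge-mem : ∀ {U u v} → u ∈ U → v ∈ U → A u v ≡ true → ed u v Sign.- ∈ E U ⊎ ed v u Sign.- ∈ E U
  edge-mem {z ∷ U} (here refl) (here refl) e = ⊥-elim (A-≢ e refl)
  edge-mem {z ∷ U} (here refl) (there q) e = inj₁ (∈-++⁺ˡ (∈-map⁺ _ (∈-filter⁺ (T? ∘ A z) q (tT e))))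
  edge-mem {z ∷ U} (there p) (here refl) e = inj₂ (∈-++⁺ˡ (∈-map⁺ _ (∈-filter⁺ (T? ∘ A z) p (tT (flipA e)))))
  edge-mem {z ∷ U} (there p) (there q) e = case edge-mem p q e of λ { (inj₁ r) → inj₁ (∈-++⁺ʳ (star z (filterᵇ (A z) U)) r) ; (inj₂ r) → inj₂ (∈-++⁺ʳ (star z (filterᵇ (A z) U)) r) }

  E-split : ∀ X Y → Σ (List (SEdge (n G))) λ fs → E (X ++ Y) ≡ fs ++ E Y
  E-split [] Y = [] , refl
  E-split (x ∷ X) Y = let fs , eq = E-split X Y in star x (filterᵇ (A x) (X ++ Y)) ++ fs , ≡.trans (cong (star x (filterᵇ (A x) (X ++ Y)) ++_) eq) (≡.sym (Listₚ.++-assoc (star x (filterᵇ (A x) (X ++ Y))) fs (E Y)))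

  -- Expanding the factors of `fs` one after another, some choice of variables keeps the value
  -- nonzero; `j` counts how often `v` is chosen. Such a shift preserves vanishing from a bound on.
  peel : ∀ (fs : List (SEdge (n G))) {es w} → c (fs ++ es) w ≢ 0ℤ → Σ (Wt (n G)) λ w′ → c es w′ ≢ 0ℤ × (∀ v → Σ ℕ λ j → ∀ k → w′ v k ≡ w v (j + k))
  peel [] {w = w} ne = w , ne , λ v → 0 , λ k → refl
  peel (ed a b s ∷ fs) {es} {w} ne = case edge-≢0 a b s (fs ++ es) w ne of λ { (inj₁ p) → go a p ; (inj₂ p) → go b p }
    where
    go : ∀ u → c (fs ++ es) (sh u w) ≢ 0ℤ → Σ (Wt (n G)) λ w′ → c es w′ ≢ 0ℤ × (∀ v → Σ ℕ λ j → ∀ k → w′ v k ≡ w v (j + k))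
    go u p with peel fs p
    ... | w′ , ne′ , sh′ = w′ , ne′ , λ v → shift v (sh′ v)
      where
      shift : ∀ v → (Σ ℕ λ j → ∀ k → w′ v k ≡ sh u w v (j + k)) → Σ ℕ λ j → ∀ k → w′ v k ≡ w v (j + k)
      shift v (j , e) with u ≟ v
      ... | yes _ = suc j , e
      ... | no _ = j , e

  lst : (V → Bool) → List V
  lst W = filterᵇ W (allFin (n G))

  lst-∈ : ∀ {W v} → W v ≡ true → v ∈ lst W
  lst-∈ {W} {v} e = ∈-filter⁺ (T? ∘ W) (∈-allFin v) (tT e)

  ∈-lst : ∀ {W v} → v ∈ lst W → W v ≡ true
  ∈-lst {W} q = proj₂ (∈-filterᵇ⁻ W {allFin (n G)} q)

  lst-unique : ∀ W → Unique (lst W)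
  lst-unique W = Uniqueₚ.filter⁺ (T? ∘ W) (Uniqueₚ.allFin⁺ (n G))

  fresh-lst : ∀ {W v} → W v ≡ false → Fresh v (E (lst W))
  fresh-lst {W} e = fresh-in (λ q → absurdᵇ (∈-lst {W} q) e) (edges-in (lst W))

  ge lt : ℕ → ℕ → ℤ
  ge m k = if m ≤ᵇ k then 1ℤ else 0ℤ
  lt m k = if m ≤ᵇ k then 0ℤ else 1ℤ

  ge-δ : ∀ m k → k ≤ m → ge m k ≡ δ₁ m k
  ge-δ m k le with m ℕₚ.≟ k
  ... | yes refl rewrite Tt (ℕₚ.≤⇒≤ᵇ (ℕₚ.≤-refl {m})) | ≡ᵇ-refl m = refl
  ... | no ne with m ≤ᵇ k in e
  ...   | true = ⊥-elim (ne (ℕₚ.≤-antisym (ℕₚ.≤ᵇ⇒≤ m k (tT e)) le))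
  ...   | false rewrite ≡ᵇ-≢ m k ne = refl

  ge-lt : ∀ m k → ge m k ≡ 1ℤ ℤ.* 1ℤ ℤ.+ -1ℤ ℤ.* lt m k
  ge-lt m k with m ≤ᵇ k
  ... | true = refl
  ... | false = refl

  lt-bound : ∀ m k → m ≤ k → lt m k ≡ 0ℤ
  lt-bound m k le rewrite Tt (ℕₚ.≤⇒≤ᵇ le) = refl

  -- The invariant of the game: `W` is the set of uncoloured vertices, and `f` counts the tokens
  -- they still have.
  ATf : (V → Bool) → (V → ℕ) → Set
  ATf W f = Σ Mon λ m → (∀ v → W v ≡ true → m v < f v) × c (E (lst W)) (δ m) ≢ 0ℤ

  -- Weights at the vertices of S whose exponent is as large as f allows are first replaced by
  -- "≥ f v ∸ 1", which by homogeneity changes nothing, and then split as 1 minus "< f v ∸ 1".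
  module PaintStep (W : V → Bool) (f : V → ℕ) (at : ATf W f) (S : V → Bool) (S⊆W : ∀ v → S v ≡ true → W v ≡ true) where

    m = proj₁ at
    m< = proj₁ (proj₂ at)
    ne₀ = proj₂ (proj₂ at)
    es = E (lst W)

    f⁻ : V → ℕ
    f⁻ v = if S v then f v ∸ 1 else f v

    -- A finished vertex either carries weight 1 and is going to be painted, or its weight vanishes
    -- from the bound of the next round on. A tight vertex still has to be split into these two
    -- possibilities.
    Fin₁ Tight : Wt (n G) → V → Set
    Fin₁ w v = (S v ≡ true × (∀ k → w v k ≡ 1ℤ)) ⊎ (W v ≡ true → ∀ k → f⁻ v ≤ k → w v k ≡ 0ℤ)
    Tight w v = S v ≡ true × (∀ k → w v k ≡ ge (f v ∸ 1) k)

    -- For `v` in `S`, only `m v ≡ f v ∸ 1` violates the bound of the next round; every other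
    -- exponent already satisfies it.
    w₀ : Wt (n G)
    w₀ v = if S v ∧ (suc (m v) ≡ᵇ f v) then ge (m v) else δ₁ (m v)

    w₀-≡ : c es w₀ ≡ c es (δ m)
    w₀-≡ = c-hom es m agree (ℕₚ.≤-reflexive (c-degree es m ne₀))
      where
      agree : ∀ v k → k ≤ m v → w₀ v k ≡ δ m v k
      agree v k le with S v ∧ (suc (m v) ≡ᵇ f v)
      ... | true = ge-δ (m v) k le
      ... | false = refl

    start : ∀ v → Fin₁ w₀ v ⊎ Tight w₀ v
    start v with S v in s
    ... | false = inj₁ (inj₂ λ wv k le → δ₁-≢ {m v} {k} (λ e → ℕₚ.<-irrefl e (ℕₚ.<-≤-trans (m< v wv) le)))
    ... | true with suc (m v) ≡ᵇ f v in e
    ...   | true = inj₂ (refl , λ k → cong (λ q → ge q k) (cong (_∸ 1) (ℕₚ.≡ᵇ⇒≡ (suc (m v)) (f v) (tT e))))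
    ...   | false = inj₁ (inj₂ λ wv k le → δ₁-≢ {m v} {k} (λ eq → ℕₚ.<-irrefl eq (ℕₚ.<-≤-trans (below (m< v wv)) le)))
      where
      below : m v < f v → m v < f v ∸ 1
      below p with f v
      ... | suc j = ℕₚ.≤∧≢⇒< (ℕₚ.≤-pred p) (λ { refl → absurdᵇ (≡ᵇ-refl (suc j)) e })

    resolve : ∀ vs w → c es w ≢ 0ℤ → (∀ v → Fin₁ w v ⊎ Tight w v) →
      Σ (Wt (n G)) λ w′ → c es w′ ≢ 0ℤ × (∀ {v} → v ∈ vs → Fin₁ w′ v) × (∀ v → Fin₁ w v → Fin₁ w′ v)
    resolve [] w ne st = w , ne , (λ ()) , λ v p → p
    resolve (v ∷ vs) w ne st with st v
    ... | inj₁ fv = let w′ , ne′ , at′ , keep = resolve vs w ne st in w′ , ne′ , (λ { (here refl) → keep v fv ; (there q) → at′ q }) , keep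
    ... | inj₂ (sv , tv) = case pick of λ { (inj₁ p) → cont (λ _ → 1ℤ) p (inj₁ (sv , λ k → cong (λ q → q k) (upd-same w v _))) ; (inj₂ p) → cont (lt (f v ∸ 1)) p (inj₂ λ _ k le → ≡.trans (cong (λ q → q k) (upd-same w v _)) (lt-bound (f v ∸ 1) k (subst (λ b → (if b then f v ∸ 1 else f v) ≤ k) sv le))) }
      where
      off : ∀ g → ∀ u → v ≢ u → ∀ k → w u k ≡ upd w v g u k
      off g u q k = cong (λ z → z k) (≡.sym (upd-other w v g q))
      w₁ = upd w v (λ _ → 1ℤ)
      w₂ = upd w v (lt (f v ∸ 1))
      pick : c es w₁ ≢ 0ℤ ⊎ c es w₂ ≢ 0ℤ
      pick with c es w₁ ℤₚ.≟ 0ℤ | c es w₂ ℤₚ.≟ 0ℤ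
      ... | no p | _ = inj₁ p
      ... | _ | no p = inj₂ p
      ... | yes p | yes q = ⊥-elim (ne (≡.trans (c-lin es 1ℤ -1ℤ v {w} {w₁} {w₂} (off _) (off _)
              (λ k → ≡.trans (tv k) (≡.trans (ge-lt (f v ∸ 1) k) (≡.sym (cong₂ (λ a b → 1ℤ ℤ.* a k ℤ.+ -1ℤ ℤ.* b k) (upd-same w v (λ _ → 1ℤ)) (upd-same w v (lt (f v ∸ 1))))))))
              (cong₂ (λ a b → 1ℤ ℤ.* a ℤ.+ -1ℤ ℤ.* b) p q)))
      cont : ∀ g → c es (upd w v g) ≢ 0ℤ → Fin₁ (upd w v g) v → Σ (Wt (n G)) λ w′ → c es w′ ≢ 0ℤ × (∀ {u} → u ∈ v ∷ vs → Fin₁ w′ u) × (∀ u → Fin₁ w u → Fin₁ w′ u)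
      cont g ne₁ fv with resolve vs (upd w v g) ne₁ st′
        where
        st′ : ∀ u → Fin₁ (upd w v g) u ⊎ Tight (upd w v g) u
        st′ u with v ≟ u
        ... | yes refl = inj₁ (moved fv)
          where
          moved : Fin₁ (upd w v g) v → (S v ≡ true × (∀ k → g k ≡ 1ℤ)) ⊎ (W v ≡ true → ∀ k → f⁻ v ≤ k → g k ≡ 0ℤ)
          moved (inj₁ (a , b)) = inj₁ (a , λ k → ≡.trans (cong (λ q → q k) (≡.sym (upd-same w v g))) (b k))
          moved (inj₂ b) = inj₂ λ wv k le → ≡.trans (cong (λ q → q k) (≡.sym (upd-same w v g))) (b wv k le)
        ... | no _ = st u
      ... | w′ , ne′ , at′ , keep = w′ , ne′ , (λ { (here refl) → keep v fv ; (there q) → at′ q }) , λ u fu → keep u (up u fu)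
        where
        up : ∀ u → Fin₁ w u → Fin₁ (upd w v g) u
        up u fu with v ≟ u
        ... | no _ = fu
        ... | yes refl = moved fv
          where
          moved : Fin₁ (upd w v g) v → (S v ≡ true × (∀ k → g k ≡ 1ℤ)) ⊎ (W v ≡ true → ∀ k → f⁻ v ≤ k → g k ≡ 0ℤ)
          moved (inj₁ (a , b)) = inj₁ (a , λ k → ≡.trans (cong (λ q → q k) (≡.sym (upd-same w v g))) (b k))
          moved (inj₂ b) = inj₂ λ wv k le → ≡.trans (cong (λ q → q k) (≡.sym (upd-same w v g))) (b wv k le)

    resolved = resolve (allFin (n G)) w₀ (λ z → ne₀ (≡.trans (≡.sym w₀-≡) z)) start
    w₁ = proj₁ resolved
    ne₁ = proj₁ (proj₂ resolved)

    fin : ∀ v → Fin₁ w₁ v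
    fin v = proj₁ (proj₂ (proj₂ resolved)) (∈-allFin v)

    I : V → Bool
    I v = case fin v of λ { (inj₁ _) → true ; (inj₂ _) → false }

    I-true : ∀ v → I v ≡ true → S v ≡ true × (∀ k → w₁ v k ≡ 1ℤ)
    I-true v e with fin v
    ... | inj₁ p = p

    I-false : ∀ v → I v ≡ false → W v ≡ true → ∀ k → f⁻ v ≤ k → w₁ v k ≡ 0ℤ
    I-false v e with fin v
    ... | inj₂ p = p

    -- An edge inside `I` would have weight 1 at both ends and make the value vanish.
    I-indep : ∀ u v → I u ≡ true → I v ≡ true → A u v ≡ false
    I-indep u v iu iv with A u v in e
    ... | false = refl
    ... | true = ⊥-elim (case edge-mem {lst W} (lst-∈ (S⊆W u (proj₁ (I-true u iu)))) (lst-∈ (S⊆W v (proj₁ (I-true v iv)))) e of λ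
            { (inj₁ q) → ne₁ (ones-edge es q (proj₂ (I-true u iu)) (proj₂ (I-true v iv))) ; (inj₂ q) → ne₁ (ones-edge es q (proj₂ (I-true v iv)) (proj₂ (I-true u iu))) })

    W′ : V → Bool
    W′ v = W v ∧ not (I v)

    f′ : V → ℕ
    f′ v = if S v ∧ not (I v) then f v ∸ 1 else f v

    W′-true : ∀ {v} → W′ v ≡ true → W v ≡ true × I v ≡ false
    W′-true {v} e with W v | I v
    ... | true | false = refl , refl

    true-W′ : ∀ {v} → W v ≡ true → I v ≡ false → W′ v ≡ true
    true-W′ {v} a b rewrite a | b = refl

    f′-≡ : ∀ {v} → I v ≡ false → f′ v ≡ f⁻ v
    f′-≡ {v} e rewrite e with S v
    ... | true = refl
    ... | false = refl

    perm : lst W ↭ lst I ++ lst W′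
    perm = ↭-set (lst-unique W) (Uniqueₚ.++⁺ (lst-unique I) (lst-unique W′) (λ { (p , q) → absurdᵇ (∈-lst {I} p) (proj₂ (W′-true (∈-lst {W′} q))) }))
      (λ {v} v∈ → sort v (∈-lst {W} v∈) (I v) refl)
      (λ {v} v∈ → case ∈-++⁻ (lst I) v∈ of λ { (inj₁ q) → lst-∈ (S⊆W v (proj₁ (I-true v (∈-lst {I} q)))) ; (inj₂ q) → lst-∈ (proj₁ (W′-true (∈-lst {W′} q))) })
      where
      sort : ∀ v → W v ≡ true → ∀ b → I v ≡ b → v ∈ lst I ++ lst W′
      sort v wv true e = ∈-++⁺ˡ (lst-∈ e)
      sort v wv false e = ∈-++⁺ʳ (lst I) (lst-∈ {W′} (true-W′ wv e))

    -- The factors at painted vertices are expanded away by `peel`. The weights that remain vanish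
    -- from the new bounds on, so `monomial` finds an exponent sequence for the rest of the graph.
    next : ATf W′ f′
    next with E-split (lst I) (lst W′)
    ... | fs , eq with peel fs {E (lst W′)} {w₁} ne₂
      where
      eqv = edgesL-↭ A A-sym perm
      ne₂ : c (fs ++ E (lst W′)) w₁ ≢ 0ℤ
      ne₂ z = ne₁ (≡.trans (c-eq eqv w₁) (≡.trans (cong (sg (sign eqv) ℤ.*_) (≡.trans (cong (λ l → c l w₁) eq) z)) (ℤₚ.*-zeroʳ (sg (sign eqv)))))
    ...   | w₂ , ne₂ , shf with monomial (E (lst W′)) F w₃ bound (λ z → ne₂ (≡.trans (c-cong-off (E (lst W′)) same₃) z))
      where
      -- Outside `W′` no factor is left, so the weight may be cut down to exponent 0, and 1 is a
      -- valid bound there.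
      F : V → ℕ
      F v = if W′ v then f′ v else 1
      w₃ : Wt (n G)
      w₃ v k = if W′ v then w₂ v k else (if k ≡ᵇ 0 then w₂ v k else 0ℤ)
      same₃ : ∀ v → (∀ k → w₂ v k ≡ w₃ v k) ⊎ (Fresh v (E (lst W′)) × w₂ v 0 ≡ w₃ v 0)
      same₃ v with W′ v in e
      ... | true = inj₁ λ k → refl
      ... | false = inj₂ (fresh-lst {W′} e , refl)
      bound : ∀ v k → F v ≤ k → w₃ v k ≡ 0ℤ
      bound v k le with W′ v in e
      ... | true = let j , q = shf v in ≡.trans (q k) (I-false v (proj₂ (W′-true e)) (proj₁ (W′-true e)) (j + k) (ℕₚ.≤-trans (subst (_≤ k) (f′-≡ (proj₂ (W′-true e))) le) (ℕₚ.m≤n+m k j)))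
      bound v (suc k) le | false = refl
    ...     | m′ , m′< , ne′ = m′ , (λ v e → subst (λ b → m′ v < (if b then f′ v else 1)) e (m′< v)) , ne′

  -- Induction on the total number of tokens: each vertex of the nonempty set `S` is either painted
  -- or pays a token.
  paintable : ∀ k W f → sumF (λ v → if W v then f v else 0) ≡ k → ATf W f → Paintable G W f
  paintable = <-rec _ step′
    where
    step′ : ∀ k → (∀ {k′} → k′ < k → ∀ W f → sumF (λ v → if W v then f v else 0) ≡ k′ → ATf W f → Paintable G W f) →
      ∀ W f → sumF (λ v → if W v then f v else 0) ≡ k → ATf W f → Paintable G W f
    step′ k rec W f refl at = move (λ v wv → ℕₚ.≤-trans (s≤s z≤n) (proj₁ (proj₂ at) v wv)) λ S S⊆W (v , sv) →
      let open PaintStep W f at S S⊆W in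
      I , (λ u e → proj₁ (I-true u e)) , I-indep , rec (sumF-< v (less W f at S S⊆W) (strict W f at S S⊆W v sv)) W′ f′ refl next
      where
      less : ∀ W f at S S⊆W u → (if PaintStep.W′ W f at S S⊆W u then PaintStep.f′ W f at S S⊆W u else 0) ≤ (if W u then f u else 0)
      less W f at S S⊆W u with W u | PaintStep.I W f at S S⊆W u | S u
      ... | false | _ | _ = z≤n
      ... | true | true | _ = z≤n
      ... | true | false | true = ℕₚ.m∸n≤m (f u) 1
      ... | true | false | false = ℕₚ.≤-refl
      strict : ∀ W f at S S⊆W u → S u ≡ true → (if PaintStep.W′ W f at S S⊆W u then PaintStep.f′ W f at S S⊆W u else 0) < (if W u then f u else 0)
      strict W f at S S⊆W u su with proj₁ (proj₂ at) u (S⊆W u su)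
      ... | p rewrite S⊆W u su | su with PaintStep.I W f at S S⊆W u
      ...   | true = ℕₚ.≤-trans (s≤s z≤n) p
      ...   | false = ℕₚ.∸-monoʳ-< {f u} {1} {0} (s≤s z≤n) (ℕₚ.≤-trans (s≤s z≤n) p)

  -- Paintable pairs are choosable.

  rm : ℕ → List ℕ → List ℕ
  rm a = filterᵇ (λ b → not (b ≡ᵇ a))

  rm-∈ : ∀ {a b l} → b ∈ rm a l → b ∈ l × b ≢ a
  rm-∈ {a} {b} {l} q with ∈-filterᵇ⁻ (λ b → not (b ≡ᵇ a)) {l} q
  ... | m , e = m , λ { refl → bad-eq (≡ᵇ-refl b) e }
    where
    bad-eq : ∀ {x} → x ≡ true → not x ≡ true → ⊥
    bad-eq refl ()

  rm-≤ : ∀ a l → length (rm a l) ≤ length l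
  rm-≤ a l = Listₚ.length-filter (T? ∘ (λ b → not (b ≡ᵇ a))) l

  rm-< : ∀ {a l} → a ∈ l → length (rm a l) < length l
  rm-< {a} {b ∷ l} (here refl) rewrite ≡ᵇ-refl a = s≤s (rm-≤ a l)
  rm-< {a} {b ∷ l} (there q) with b ≡ᵇ a
  ... | true = s≤s (rm-≤ a l)
  ... | false = s≤s (rm-< q)

  rm-∉ : ∀ a l → a ∉ l → rm a l ≡ l
  rm-∉ a [] _ = refl
  rm-∉ a (b ∷ l) a∉ rewrite ≡ᵇ-≢ b a (λ e → a∉ (here (≡.sym e))) = cong (b ∷_) (rm-∉ a l (a∉ ∘ there))

  -- A colour occurs at most once in a list, so deleting it costs no more than the token paid by a
  -- vertex that was offered but not painted.
  rm-unique : ∀ a l → Unique l → length l ≤ suc (length (rm a l))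
  rm-unique a [] _ = z≤n
  rm-unique a (b ∷ l) (ne ∷ u) with b ℕₚ.≟ a
  ... | yes refl rewrite ≡ᵇ-refl a | rm-∉ a l (λ q → All.lookup ne q refl) = ℕₚ.≤-refl
  ... | no b≢a rewrite ≡ᵇ-≢ b a b≢a = s≤s (rm-unique a l u)

  memᵇ : ℕ → List ℕ → Bool
  memᵇ a l = length (rm a l) <ᵇ length l

  memᵇ-true : ∀ {a l} → memᵇ a l ≡ true → a ∈ l
  memᵇ-true {a} {l} e = go l (ℕₚ.<ᵇ⇒< _ _ (tT e))
    where
    go : ∀ l → length (rm a l) < length l → a ∈ l
    go (b ∷ l) p with b ℕₚ.≟ a
    ... | yes refl = here refl
    ... | no ne rewrite ≡ᵇ-≢ b a ne = there (go l (ℕₚ.≤-pred p))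

  true-memᵇ : ∀ {a l} → a ∈ l → memᵇ a l ≡ true
  true-memᵇ q = Tt (ℕₚ.<⇒<ᵇ (rm-< q))

  search-true : ∀ (W : V → Bool) → (Σ V λ v → W v ≡ true) ⊎ (∀ v → W v ≡ false)
  search-true W with firstIn W (allFin (n G))
  ... | some _ v _ _ e _ = inj₁ (v , e)
  ... | none f = inj₂ λ v → f (∈-allFin v)

  -- The painter's answers to the sets of vertices having a given colour in their lists form a colouring.
  choose : ∀ k W f (L : V → List ℕ) → sumF (λ v → if W v then length (L v) else 0) ≡ k → (∀ v → Unique (L v)) → (∀ v → W v ≡ true → f v ≤ length (L v)) → Paintable G W f →
    Σ (V → ℕ) λ φ → (∀ v → W v ≡ true → φ v ∈ L v) × (∀ u v → W u ≡ true → W v ≡ true → A u v ≡ true → φ u ≢ φ v)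
  choose = <-rec _ step′
    where
    Goal : (V → Bool) → (V → List ℕ) → Set
    Goal W L = Σ (V → ℕ) λ φ → (∀ v → W v ≡ true → φ v ∈ L v) × (∀ u v → W u ≡ true → W v ≡ true → A u v ≡ true → φ u ≢ φ v)
    step′ : ∀ k → (∀ {k′} → k′ < k → ∀ W f (L : V → List ℕ) → sumF (λ v → if W v then length (L v) else 0) ≡ k′ → (∀ v → Unique (L v)) → (∀ v → W v ≡ true → f v ≤ length (L v)) → Paintable G W f → Goal W L) →
      ∀ W f (L : V → List ℕ) → sumF (λ v → if W v then length (L v) else 0) ≡ k → (∀ v → Unique (L v)) → (∀ v → W v ≡ true → f v ≤ length (L v)) → Paintable G W f → Goal W L
    step′ k rec W f L refl uL le (empty e) = (λ _ → 0) , (λ v wv → absurdᵇ wv (e v)) , λ u v wu → absurdᵇ wu (e u)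
    step′ k rec W f L refl uL le (move f1 g) with search-true W
    ... | inj₂ e = (λ _ → 0) , (λ v wv → absurdᵇ wv (e v)) , λ u v wu → absurdᵇ wu (e u)
    ... | inj₁ (v₀ , wv₀) = from (L v₀) refl
      where
      from : ∀ l → L v₀ ≡ l → Goal W L
      from [] eq = ⊥-elim (ℕₚ.n≮0 (ℕₚ.≤-trans (f1 v₀ wv₀) (ℕₚ.≤-trans (le v₀ wv₀) (ℕₚ.≤-reflexive (cong length eq)))))
      from (a ∷ l) eq with g S S⊆ (v₀ , S₀)
        where
        S : V → Bool
        S v = W v ∧ memᵇ a (L v)
        S⊆ : ∀ v → S v ≡ true → W v ≡ true
        S⊆ v e = ∧-left e
        S₀ : S v₀ ≡ true
        S₀ rewrite wv₀ = true-memᵇ {a} {L v₀} (subst (a ∈_) (≡.sym eq) (here refl))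
      ... | I , I⊆S , ind , P with rec (sumF-< v₀ less strict) (λ v → W v ∧ not (I v)) _ L′ refl (λ v → Uniqueₚ.filter⁺ _ (uL v)) le′ P
        where
        L′ : V → List ℕ
        L′ v = rm a (L v)
        less : ∀ u → (if W u ∧ not (I u) then length (L′ u) else 0) ≤ (if W u then length (L u) else 0)
        less u with W u | I u
        ... | false | _ = z≤n
        ... | true | true = z≤n
        ... | true | false = rm-≤ a (L u)
        a∈₀ : a ∈ L v₀
        a∈₀ = subst (a ∈_) (≡.sym eq) (here refl)
        strict : (if W v₀ ∧ not (I v₀) then length (L′ v₀) else 0) < (if W v₀ then length (L v₀) else 0)
        strict rewrite wv₀ with I v₀
        ... | true = ℕₚ.≤-trans (s≤s z≤n) (rm-< a∈₀)
        ... | false = rm-< a∈₀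
        le′ : ∀ v → W v ∧ not (I v) ≡ true → (if (W v ∧ memᵇ a (L v)) ∧ not (I v) then f v ∸ 1 else f v) ≤ length (L′ v)
        le′ v e with W v in wv | I v | memᵇ a (L v) in ma
        ... | true | false | true = ℕₚ.≤-trans (ℕₚ.∸-monoˡ-≤ 1 (ℕₚ.≤-trans (le v wv) (rm-unique a (L v) (uL v)))) ℕₚ.≤-refl
        ... | true | false | false = ℕₚ.≤-trans (le v wv) (ℕₚ.≤-reflexive (cong length (≡.sym (rm-∉ a (L v) (λ q → absurdᵇ (true-memᵇ {a} {L v} q) ma)))))
      ...   | φ′ , φ∈ , φp = φ , mem , prop
        where
        φ : V → ℕ
        φ v = if I v then a else φ′ v
        w′ : ∀ {v} → W v ≡ true → I v ≡ false → W v ∧ not (I v) ≡ true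
        w′ p q rewrite p | q = refl
        mem : ∀ v → W v ≡ true → φ v ∈ L v
        mem v wv with I v in iv
        ... | true = memᵇ-true (second (I⊆S v iv))
          where
          second : W v ∧ memᵇ a (L v) ≡ true → memᵇ a (L v) ≡ true
          second e rewrite wv = e
        ... | false = proj₁ (rm-∈ {a} {l = L v} (φ∈ v (w′ wv iv)))
        prop : ∀ u v → W u ≡ true → W v ≡ true → A u v ≡ true → φ u ≢ φ v
        prop u v wu wv e with I u in iu | I v in iv
        ... | true | true = λ _ → absurdᵇ e (ind u v iu iv)
        ... | true | false = λ eq → proj₂ (rm-∈ {a} {l = L v} (φ∈ v (w′ wv iv))) (≡.sym eq)
        ... | false | true = λ eq → proj₂ (rm-∈ {a} {l = L u} (φ∈ u (w′ wu iu))) eq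
        ... | false | false = φp u v (w′ wu iu) (w′ wv iv) e

  -- Passage between coefficients and orientations, and the conclusion.

  length-filterᵇ : ∀ {X : Set} (p : X → Bool) xs → length (filterᵇ p xs) ≡ sum (map (λ i → if p i then 1 else 0) xs)
  length-filterᵇ p [] = refl
  length-filterᵇ p (y ∷ xs) with p y
  ... | true = cong suc (length-filterᵇ p xs)
  ... | false = length-filterᵇ p xs

  lst-all : lst (λ _ → true) ≡ allFin (n G)
  lst-all = Listₚ.filter-all _ (All.tabulate λ _ → tt)

  orientation-coef : ∀ {D} → IsOrientation G D → c (E (allFin (n G))) (δ (outdeg D)) ≢ 0ℤ → IsAT D
  orientation-coef {D} (cover , once) ne eq = ne (≡.trans (c-eq iso _) (≡.trans (cong (λ q → sg (sign iso) ℤ.* q) (≡.trans (alon-tarsi D) (ℤₚ.i≡j⇒i-j≡0 (cong ℤ.+_ eq)))) (ℤₚ.*-zeroʳ (sg (sign iso)))))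
    where iso = Orient.edges-rows A D cover once

  coef-orientation : ∀ {D} → IsOrientation G D → IsAT D → c (E (allFin (n G))) (δ (outdeg D)) ≢ 0ℤ
  coef-orientation {D} (cover , once) at z = sg-≢0 (sign iso) (λ q → at (ℤₚ.+-injective (ℤₚ.i-j≡0⇒i≡j (ℤ.+ EE D) (ℤ.+ EO D) (≡.trans (≡.sym (alon-tarsi D)) q)))) (≡.trans (≡.sym (c-eq iso _)) z)
    where iso = Orient.edges-rows A D cover once

  AT⇒paintable : ∀ {x} → PairAT G x → PairPaintable G x
  AT⇒paintable {x} (D , ori , at , bound) = paintable _ (λ _ → true) _ refl
    (outdeg D , (λ v _ → ℕₚ.m+n≤o⇒m≤o∸n _ (subst (_≤ deg G v) (ℕₚ.+-comm (outdeg D v + h x v) 1) (bound v)))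
              , subst (λ W → c (E W) (δ (outdeg D)) ≢ 0ℤ) (≡.sym lst-all) (coef-orientation ori at))

  paintable⇒choosable : ∀ {x} → PairPaintable G x → PairChoosable G x
  paintable⇒choosable P L uniq len with choose _ (λ _ → true) _ L refl uniq (λ v _ → ℕₚ.≤-reflexive (≡.sym (len v))) P
  ... | φ , φ∈ , proper = φ , (λ v → φ∈ v refl) , λ u v → proper u v refl refl

  -- A monomial with nonzero coefficient is the outdegree sequence of an orientation by `realise`,
  -- and by `alon-tarsi` its coefficient being nonzero makes that orientation AT.
  nonAT : ∀ {x} → ¬ PairAT G x → NonAT (h x) (allFin (n G))
  nonAT {x} na (m , b , ne) with realise A A-sym A-irr m ne
  ... | D , ori , out = na (D , ori , orientation-coef ori (λ z → ne (≡.trans (c-cong (E (allFin (n G))) (λ v k → cong (λ q → δ₁ q k) (≡.sym (out v)))) z)) , bound)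
    where
    bound : ∀ v → outdeg D v + h x v + 1 ≤ deg G v
    bound v rewrite out v | ℕₚ.+-comm (m v + h x v) 1 =
      subst (m v + h x v <_) (≡.trans (degE-dg (Uniqueₚ.allFin⁺ (n G)) (∈-allFin v)) (length-filterᵇ (A v) (allFin (n G)))) (b (∈-allFin v))

  reach-walk : ∀ {u v} → Reach G u v → Walk (allFin (n G)) u v
  reach-walk here = stop (∈-allFin _)
  reach-walk (step e r) = Walk.step (∈-allFin _) e (reach-walk r)

  nonAT⇒not-choosable : Connected G → ∀ {x} → ¬ PairAT G x → ¬ PairChoosable G x
  nonAT⇒not-choosable con {x} na ch = pair-bad _ refl (Uniqueₚ.allFin⁺ (n G)) (∈-allFin x) (λ {u} {v} _ _ → reach-walk (con u v)) (nonAT na)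
    λ b → let φ , φ∈ , proper = ch (L b) (λ v → uniq b (∈-allFin v)) (λ v → ≡.trans (len b (∈-allFin v)) (cong (_∸ h x v) (length-filterᵇ (A v) (allFin (n G))))) in
      bad b φ (λ _ → φ∈ _) (λ _ _ → proper _ _)

theorem11 : (G : Graph) → Connected G → (x : Fin (n G)) →
    ((¬ PairChoosable G x) ⇔ (¬ PairAT G x)) × ((¬ PairPaintable G x) ⇔ (¬ PairAT G x))
theorem11 G con x =
    -- As AT implies paintable and paintable implies choosable, both equivalences share the single
    -- converse `¬AT⇒¬C`.
    mk⇔ (λ ¬choosable → ¬choosable ∘ P⇒C ∘ AT⇒P) ¬AT⇒¬C
  , mk⇔ (λ ¬paintable → ¬paintable ∘ AT⇒P) (λ ¬at → ¬AT⇒¬C ¬at ∘ P⇒C)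
  where
  AT⇒P = OnGraph.AT⇒paintable G {x}
  P⇒C = OnGraph.paintable⇒choosable G {x}
  ¬AT⇒¬C = OnGraph.nonAT⇒not-choosable G con {x}
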